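{- Let $c$ be a standard Coxeter element of $W$. Then, as polynomials in the variables $(x_s)_{s\in S},y,z$, $$\mathbf F(\underline x,y,z)=\mathbf I(\underline x+1,y,z),$$ where $\underline x+1$ means each $x_s$ is replaced by $x_s+1$, and $$\mathbf I(\underline x,y,z)=\sum_{\substack{\alpha,\beta\in NC(W,c)\\ \alpha\ll\beta}}\Big(\prod_{s\in S\setminus\mathrm{supp}(\beta)}x_s\Big)y^{\mathrm{rk}(\alpha)}z^{\mathrm{rk}(\beta)-\mathrm{rk}(\alpha)},\quad \mathbf F(\underline x,y,z)=\sum_{F\in\Upsilon(W,c)}\Big(\prod_{\delta\in F\cap(-\Delta)}x_{s_\delta}\Big)\Big(\frac yz\Big)^{\mathrm{sqr}(F)}z^{\#(F\cap\Pi)},$$ with $s_\delta\in S$ the simple reflection such that $r(s_\delta)=-\delta$.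
   Context: Let $W$ be a finite real reflection group with simple system of reflections $S$, $n=|S|$, set of reflections $T$, Coxeter length $\ell$. For $t\in T$, $r(t)$ is its positive root; $\Pi=\{r(t):t\in T\}$, $\Delta=\{r(s):s\in S\}$, $r^{ -1}:\Pi\to T$ the inverse bijection. $\mathrm{supp}(w)$ is the set of simple reflections in a reduced expression of $w$. Absolute length $\ell_T(w)$: minimal number of reflections with product $w$; $\mathrm{rk}=\ell_T$; absolute order $v\le w$ iff $\ell_T(w)=\ell_T(v)+\ell_T(v^{ -1}w)$; $v\lessdot w$ means $v\le w$ and $\ell_T(v)=\ell_T(w)-1$. Write $v\sqsubset\!\cdot\, w$ if $v\lessdot w$ and $\ell(v)<\ell(w)$, and $\ll$ for the reflexive-transitive closure of "$v\lessdot w$ and $\ell(w)<\ell(v)$". A standard Coxeter element is a product of all elements of $S$, each once; $NC(W,c)=\{w:w\le c\}$. Cluster complex (Reading): $\Phi_{\ge-1}=(-\Delta)\cup\Pi$; for $s\in S$, $\sigma_s$ fixes $(-\Delta)\setminus\{ -r(s)\}$ and maps $\alpha\mapsto s(\alpha)$ on $\Pi\cup\{ -r(s)\}$; $\|_c$ is the unique family of symmetric relations on $\Phi_{\ge-1}$, indexed by standard Coxeter elements, with: $\alpha\|_c\beta$ for $\alpha,\beta\in-\Delta$; for $\alpha\in-\Delta,\beta\in\Pi$, $\alpha\|_c\beta$ iff the simple reflection $s$ with $r(s)=-\alpha$ is not in $\mathrm{supp}(r^{ -1}(\beta))$; if $\ell(sc)<\ell(c)$, $s\in S$, then $\alpha\|_c\beta\iff\sigma_s(\alpha)\|_{scs}\sigma_s(\beta)$.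 $\Upsilon(W,c)$ is the flag complex on $\Phi_{\ge-1}$ defined by $\|_c$ (faces: pairwise related subsets, including $\emptyset$); $\Upsilon^+(W,c)$ its restriction to $\Pi$. Statistic $\mathrm{sqr}$: for $F\in\Upsilon^+(W,c)$ there exists an indexing $F=\{r(t_1),\dots,r(t_k)\}$ with $t_1\cdots t_k\le c$; set $\mathrm{sqr}(F)=\#\{0\le i<k: t_1\cdots t_i\sqsubset\!\cdot\, t_1\cdots t_{i+1}\}$ (this does not depend on the choice of such indexing); for $F\in\Upsilon(W,c)$ set $\mathrm{sqr}(F)=\mathrm{sqr}(F\cap\Pi)$. -}

module Defs where

open import Level using (0ℓ)
open import Data.Nat using (ℕ; zero; suc; _+_; _∸_; _≤_; _<_)
open import Data.Nat.Properties using () renaming (_≟_ to _≟ℕ_; _<?_ to _<?ℕ_)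
open import Data.Fin using (Fin) renaming (_≟_ to _≟F_)
open import Data.List using (List; []; _∷_; [_]; map; foldr; length; _++_; concatMap; allFin; filterᵇ)
open import Data.List.Membership.Propositional using (_∈_)
open import Data.List.Relation.Unary.All using (All)
open import Data.List.Relation.Unary.Unique.Propositional using (Unique)
open import Data.List.Relation.Binary.Permutation.Propositional using (_↭_)
open import Data.Bool using (Bool; true; false; _∧_; not; if_then_else_)
open import Data.Maybe using (Maybe; just; nothing)
open import Data.Product using (Σ; ∃; ∃₂; _×_; _,_)
open import Relation.Binary.PropositionalEquality using (_≡_; _≢_)
open import Relation.Binary.Definitions using (DecidableEquality)
open import Relation.Nullary using (¬_; Dec; yes; no)
open import Relation.Nullary.Decidable using (⌊_⌋)
open import Relation.Binary.Construct.Closure.ReflexiveTransitive using (Star)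
open import Algebra.Bundles using (Group; CommutativeRing)
open import Function.Bundles using (_⇔_)

mpow : {A : Set} → (A → A → A) → A → A → ℕ → A
mpow _∙_ u x zero    = u
mpow _∙_ u x (suc k) = x ∙ mpow _∙_ u x k

sublists : {A : Set} → List A → List (List A)
sublists []       = [ [] ]
sublists (a ∷ as) = map (a ∷_) (sublists as) ++ sublists as

insertEverywhere : {A : Set} → A → List A → List (List A)
insertEverywhere x []       = [ x ∷ [] ]
insertEverywhere x (y ∷ ys) = (x ∷ y ∷ ys) ∷ map (y ∷_) (insertEverywhere x ys)

orderings : {A : Set} → List A → List (List A)
orderings []       = [ [] ]
orderings (x ∷ xs) = concatMap (insertEverywhere x) (orderings xs)

allᵇ : {A : Set} → (A → Bool) → List A → Bool
allᵇ p []       = true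
allᵇ p (x ∷ xs) = p x ∧ allᵇ p xs

findᵇ : {A : Set} → (A → Bool) → List A → Maybe A
findᵇ p []       = nothing
findᵇ p (x ∷ xs) = if p x then just x else findᵇ p xs

-- A finite Coxeter system (W,S), S = {s 0, …, s (n-1)}.
-- W is a finite group (with propositional equality), and (W,S) satisfies
-- the defining universal property of the Coxeter presentation
--   < S | (s_i s_j)^{m_ij} = 1 >,  m_ij = order of s_i s_j in W.

record FiniteCoxeterSystem : Set₁ where
  infixl 7 _·_
  field
    W         : Set
    _·_       : W → W → W
    e         : W
    _⁻¹       : W → W
    assoc     : ∀ x y z → (x · y) · z ≡ x · (y · z)
    identityˡ : ∀ x → e · x ≡ x
    identityʳ : ∀ x → x · e ≡ x
    inverseˡ  : ∀ x → (x ⁻¹) · x ≡ e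
    inverseʳ  : ∀ x → x · (x ⁻¹) ≡ e
    _≟_       : DecidableEquality W
    elems          : List W
    elems-complete : ∀ w → w ∈ elems
    elems-unique   : Unique elems
    n            : ℕ
    s            : Fin n → W
    s-involution : ∀ i → s i · s i ≡ e
    s-nontrivial : ∀ i → s i ≢ e
    s-injective  : ∀ i j → s i ≡ s j → i ≡ j
    generated    : ∀ w → ∃ λ (ws : List (Fin n)) → foldr (λ i v → s i · v) e ws ≡ w
    presentation :
      (G : Group 0ℓ 0ℓ) (f : Fin n → Group.Carrier G) →
      (∀ i j k → mpow _·_ e (s i · s j) k ≡ e →
                 Group._≈_ G (mpow (Group._∙_ G) (Group.ε G) (Group._∙_ G (f i) (f j)) k) (Group.ε G)) →
      ∃ λ (φ : W → Group.Carrier G) →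
        (∀ x y → Group._≈_ G (φ (x · y)) (Group._∙_ G (φ x) (φ y))) ×
        (∀ i → Group._≈_ G (φ (s i)) (f i))

module Cox (C : FiniteCoxeterSystem) where
  open FiniteCoxeterSystem C public

  prodS : List (Fin n) → W
  prodS = foldr (λ i v → s i · v) e

  prodW : List W → W
  prodW = foldr _·_ e

  IsLength : W → ℕ → Set
  IsLength w k = (∃ λ ws → length ws ≡ k × prodS ws ≡ w)
               × (∀ ws → prodS ws ≡ w → k ≤ length ws)

  IsReflection : W → Set
  IsReflection t = ∃₂ λ (w : W) (i : Fin n) → t ≡ w · s i · w ⁻¹

  IsAbsLength : W → ℕ → Set
  IsAbsLength w k = (∃ λ ts → All IsReflection ts × length ts ≡ k × prodW ts ≡ w)
                  × (∀ ts → All IsReflection ts → prodW ts ≡ w → k ≤ length ts)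

  IsStdCoxeter : W → Set
  IsStdCoxeter c = ∃ λ ws → ws ↭ allFin n × prodS ws ≡ c

  -- Φ_{≥-1}: neg i stands for -r(s i) ∈ -Δ, pos t for r(t) ∈ Π (t ∈ T)
  data Root : Set where
    neg : Fin n → Root
    pos : W → Root

  Φ≥-1 : List W → List Root
  Φ≥-1 Tl = map neg (allFin n) ++ map pos Tl

  σ : Fin n → Root → Root
  σ i (neg j) with j ≟F i
  ... | yes _ = pos (s i)
  ... | no  _ = neg j
  σ i (pos t) with t ≟ s i
  ... | yes _ = neg i
  ... | no  _ = pos (s i · t · s i)

  negPart : List Root → List (Fin n)
  negPart []            = []
  negPart (neg i ∷ rs) = i ∷ negPart rs
  negPart (pos _ ∷ rs) = negPart rs

  posPart : List Root → List W
  posPart []            = []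
  posPart (neg _ ∷ rs) = posPart rs
  posPart (pos t ∷ rs) = t ∷ posPart rs

  module WithLengths (ℓ ℓT : W → ℕ) where

    InSupp : W → Fin n → Set
    InSupp w i = ∃ λ ws → length ws ≡ ℓ w × prodS ws ≡ w × i ∈ ws

    absLe : W → W → Bool
    absLe v w = ⌊ ℓT w ≟ℕ (ℓT v + ℓT ((v ⁻¹) · w)) ⌋

    cov : W → W → Bool
    cov v w = absLe v w ∧ ⌊ ℓT w ≟ℕ suc (ℓT v) ⌋

    sqcov : W → W → Bool
    sqcov v w = cov v w ∧ ⌊ ℓ v <?ℕ ℓ w ⌋

    DownStep : W → W → Set
    DownStep v w = cov v w ≡ true × ℓ w < ℓ v

    _≪_ : W → W → Set
    _≪_ = Star DownStep

    NC : W → List W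
    NC c = filterᵇ (λ w → absLe w c) elems

    -- Reading's compatibility relations ∥_c, as a Bool-valued family indexed by c
    record IsClusterFamily (Tl : List W) (compat : W → Root → Root → Bool) : Set where
      field
        symm   : ∀ c → IsStdCoxeter c → ∀ α β → α ∈ Φ≥-1 Tl → β ∈ Φ≥-1 Tl →
                 compat c α β ≡ compat c β α
        negneg : ∀ c → IsStdCoxeter c → ∀ i j → compat c (neg i) (neg j) ≡ true
        negpos : ∀ c → IsStdCoxeter c → ∀ i t → t ∈ Tl →
                 (compat c (neg i) (pos t) ≡ true ⇔ (¬ InSupp t i))
        rot    : ∀ c → IsStdCoxeter c → ∀ i → ℓ (s i · c) < ℓ c →
                 ∀ α β → α ∈ Φ≥-1 Tl → β ∈ Φ≥-1 Tl →
                 compat c α β ≡ compat (s i · c · s i) (σ i α) (σ i β)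

    module Complex (Tl : List W) (compat : W → Root → Root → Bool) (c : W) where

      pairwise : List Root → Bool
      pairwise []       = true
      pairwise (a ∷ as) = allᵇ (compat c a) as ∧ pairwise as

      faces : List (List Root)
      faces = filterᵇ pairwise (sublists (Φ≥-1 Tl))

      countSq : W → List W → ℕ
      countSq acc []       = 0
      countSq acc (t ∷ ts) = (if sqcov acc (acc · t) then 1 else 0) + countSq (acc · t) ts

      sqr : List Root → ℕ
      sqr F with findᵇ (λ ts → absLe (prodW ts) c) (orderings (posPart F))
      ... | just ts = countSq e ts
      ... | nothing = 0

      module Poly (R : CommutativeRing 0ℓ 0ℓ) where
        open CommutativeRing R using (Carrier; 0#; 1#) renaming (_+_ to _+R_; _*_ to _*R_)

        sumL : {A : Set} → (A → Carrier) → List A → Carrier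
        sumL f = foldr (λ a acc → f a +R acc) 0#

        prodL : {A : Set} → (A → Carrier) → List A → Carrier
        prodL f = foldr (λ a acc → f a *R acc) 1#

        pow : Carrier → ℕ → Carrier
        pow = mpow _*R_ 1#

        Ipoly : (supp? : ∀ w i → Dec (InSupp w i)) → (≪? : ∀ α β → Dec (α ≪ β)) →
                (Fin n → Carrier) → Carrier → Carrier → Carrier
        Ipoly supp? ≪? x y z =
          sumL (λ α → sumL (λ β →
                  prodL x (filterᵇ (λ i → not ⌊ supp? β i ⌋) (allFin n))
                  *R pow y (ℓT α) *R pow z (ℓT β ∸ ℓT α))
                (filterᵇ (λ β → ⌊ ≪? α β ⌋) (NC c)))
               (NC c)

        -- (y/z)^{sqr F} z^{#(F∩Π)} written as y^{sqr F} z^{#(F∩Π) - sqr F}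
        Fpoly : (Fin n → Carrier) → Carrier → Carrier → Carrier
        Fpoly x y z =
          sumL (λ F → prodL x (negPart F) *R pow y (sqr F)
                        *R pow z (length (posPart F) ∸ sqr F))
               faces

module Submission where

-- η x t records whether ℓ (x t) < ℓ x.  For a Coxeter word r ∷ ws everything is reduced to the word
-- ws ++ [ r ] by conjugation with s r, and every reflection becomes the head letter of some rotated word;
-- positivity of an integral form of the geometric representation shows that this happens before the
-- rotation returns.  By this induction
--   * two positive roots t, u are compatible iff one of t u, u t is ≼ c, and t, u commute or one of them
--     inverts the other (Fall);
--   * a positive face has an ordering U ++ D along which the lengths of the partial products first go up,
--     then down, and (prodW U , prodW (U ++ D)) is a pair α ≪ β ≼ c;
--   * each such pair arises from exactly one face, for which sqr, size and support are ℓT α, ℓT β and supp β.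
-- The negative simple roots compatible with the face are those outside supp β, and summing over their
-- subsets turns each x into x + 1.

open import Defs
open import Level using (0ℓ)
open import Algebra.Bundles using (Group; CommutativeRing)
open import Data.Bool using (Bool; true; false; _∧_; _xor_; not; if_then_else_; T)
open import Data.Bool.Properties using (∧-assoc; not-involutive; xor-assoc; xor-same; xor-identityʳ)
open import Data.Empty using (⊥; ⊥-elim)
open import Data.Fin using (Fin; toℕ) renaming (_≟_ to _≟F_)
open import Data.Integer using (ℤ; 0ℤ; 1ℤ)
open import Data.List using (List; []; _∷_; _++_; map; foldr; length; allFin; filterᵇ; reverse; concatMap; initLast; _∷ʳ′_)
open import Data.List.Membership.Propositional using (_∈_; _∉_)
open import Data.List.Membership.Propositional.Properties.WithK using (unique∧set⇒bag)
open import Data.List.Relation.Binary.BagAndSetEquality using (∼bag⇒↭)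
open import Data.List.Relation.Binary.Permutation.Propositional using (_↭_; ↭-sym; ↭-trans; ↭-refl; ↭-prep)
open import Data.List.Relation.Binary.Sublist.Propositional using ([]; _∷_; _∷ʳ_; from∈) renaming (_⊆_ to _⊑_; ⊆-refl to ⊑-refl)
open import Data.List.Relation.Unary.All as All using (All; []; _∷_)
open import Data.List.Relation.Unary.AllPairs as AllPairs using (AllPairs; []; _∷_)
open import Data.List.Relation.Unary.Any as Any using (Any; here; there)
open import Data.List.Relation.Unary.Unique.Propositional using (Unique)
open import Data.Maybe using (Maybe; just; nothing)
open import Data.Nat using (ℕ; zero; suc; _+_; _∸_; _*_; _≤_; _<_; z≤n; s≤s; _≡ᵇ_) renaming (_≟_ to _≟ℕ_; _<?_ to _<?ℕ_)
open import Data.Product using (Σ; ∃; ∃₂; _×_; _,_; proj₁; proj₂)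
open import Data.Sum using (_⊎_; inj₁; inj₂; [_,_]′)
open import Data.Unit using (⊤; tt)
open import Data.Vec using (Vec; lookup; replicate) renaming (_[_]≔_ to _[_↦_])
open import Function using (_∘_; id; case_of_)
open import Function.Bundles using (_⇔_; mk⇔; Equivalence)
open import Relation.Binary.Construct.Closure.ReflexiveTransitive using (ε; _◅_)
open import Relation.Binary.PropositionalEquality
open import Relation.Nullary using (¬_; Dec; yes; no)
open import Relation.Nullary.Decidable using (⌊_⌋; _×-dec_; ¬?; map′)
import Data.Fin as F
import Data.Fin.Properties as Fₚ
import Data.Integer as ℤ
import Data.Integer.Properties as ℤₚ
import Data.Integer.Solver as ℤSolver
import Data.List.Membership.Propositional as ∈
import Data.List.Membership.Propositional.Properties as ∈ₚ
import Data.List.Properties as Listₚ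
import Data.List.Relation.Binary.Permutation.Propositional as Perm
import Data.List.Relation.Binary.Permutation.Propositional.Properties as ↭ₚ
import Data.List.Relation.Binary.Sublist.Propositional.Properties as ⊑ₚ
import Data.List.Relation.Unary.All.Properties as Allₚ
import Data.List.Relation.Unary.AllPairs.Properties as AllPairsₚ
import Data.List.Relation.Unary.Any.Properties as Anyₚ
import Data.List.Relation.Unary.Unique.Propositional.Properties as Uniqueₚ
import Data.Nat as ℕ
import Data.Nat.DivMod as ℕDM
import Data.Nat.Properties as ℕₚ
import Data.Vec.Properties as Vecₚ
import Relation.Binary.Definitions as Tri
import Relation.Binary.Reasoning.Setoid as SetoidReasoning

-- The obstacle is that conjugation by `s r` preserves the absolute order but not the length. As
-- `s r` changes the sign of a single positive root, a step from `x` to `x · t` can change direction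
-- only if `t` or `conj x t` is `s r`. A step of the second kind is left multiplication by `s r` and
-- puts `x` below `c′ = prodS ws`; a step of the first kind puts the conjugate of `x` below `c′`.
-- Either way an element of the parabolic subgroup without `r` appears and the statement for `ws`
-- takes over. `Turning`, `FinalStep` and `Insertion` isolate these exceptional steps; all others
-- pass through the rotation unchanged. Rotation does not shorten the word, so each induction holds
-- on to one reflection, below `α` or in the face, and recurses on its `Hit`. The existence of a
-- `Hit` is the only place where a linear representation enters.

module Theory
  (C : FiniteCoxeterSystem)
  (ℓ : FiniteCoxeterSystem.W C → ℕ) (ℓ-spec : ∀ w → Cox.IsLength C w (ℓ w))
  (ℓT : FiniteCoxeterSystem.W C → ℕ) (ℓT-spec : ∀ w → Cox.IsAbsLength C w (ℓT w))
  where

  open Cox C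
  open WithLengths ℓ ℓT

  -- Deciding identities in groups with involutions

  data Expr : Set where
    #_ !_ : ℕ → Expr
    𝟙 : Expr
    _⊙_ : Expr → Expr → Expr
    inv : Expr → Expr

  infixl 7 _⊙_
  infix 9 #_ !_

  data Letter : Set where
    fwd bwd invol : ℕ → Letter

  Involution : Set
  Involution = Σ W λ t → t · t ≡ e

  at : List W → ℕ → W
  at []       _       = e
  at (x ∷ _)  zero    = x
  at (_ ∷ xs) (suc k) = at xs k

  atI : List Involution → ℕ → Involution
  atI []       _       = e , identityˡ e
  atI (x ∷ _)  zero    = x
  atI (_ ∷ xs) (suc k) = atI xs k

  cancels : Letter → Letter → Bool
  cancels (fwd k)   (bwd m)   = k ≡ᵇ m
  cancels (bwd k)   (fwd m)   = k ≡ᵇ m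
  cancels (invol k) (invol m) = k ≡ᵇ m
  cancels _ _ = false

  push : Letter → List Letter → List Letter
  push a []       = a ∷ []
  push a (b ∷ bs) = if cancels a b then bs else a ∷ b ∷ bs

  -- The Boolean asks for the inverse of the expression, and the list argument is the word already
  -- standing to its right. Letters are pushed one at a time onto a reduced word, so flattening onto
  -- `[]` gives the normal form in the free product of infinite cyclic groups and groups of order
  -- two; an identity that holds there is settled by `refl`.
  flatten : Expr → Bool → List Letter → List Letter
  flatten (# k)   false = push (fwd k)
  flatten (# k)   true  = push (bwd k)
  flatten (! k)   _     = push (invol k)
  flatten 𝟙       _     = id
  flatten (x ⊙ y) false = flatten x false ∘ flatten y false
  flatten (x ⊙ y) true  = flatten y true ∘ flatten x true
  flatten (inv x) b     = flatten x (not b)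

  cancelˡ : ∀ a x → a ⁻¹ · (a · x) ≡ x
  cancelˡ a x = trans (sym (assoc _ _ _)) (trans (cong (_· x) (inverseˡ a)) (identityˡ x))

  cancelˡ′ : ∀ a x → a · (a ⁻¹ · x) ≡ x
  cancelˡ′ a x = trans (sym (assoc _ _ _)) (trans (cong (_· x) (inverseʳ a)) (identityˡ x))

  ·-cancelˡ : ∀ a {x y} → a · x ≡ a · y → x ≡ y
  ·-cancelˡ a {x} {y} p = trans (sym (cancelˡ a x)) (trans (cong (a ⁻¹ ·_) p) (cancelˡ a y))

  ·-cancelʳ : ∀ a {x y} → x · a ≡ y · a → x ≡ y
  ·-cancelʳ a {x} {y} p = trans (strip x) (trans (cong (_· a ⁻¹) p) (sym (strip y)))
    where
    strip : ∀ z → z ≡ z · a · a ⁻¹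
    strip z = sym (trans (assoc _ _ _) (trans (cong (z ·_) (inverseʳ a)) (identityʳ z)))

  inverse-unique : ∀ {a b} → a · b ≡ e → b ≡ a ⁻¹
  inverse-unique {a} p = ·-cancelˡ a (trans p (sym (inverseʳ a)))

  ⁻¹-anti : ∀ a b → (a · b) ⁻¹ ≡ b ⁻¹ · a ⁻¹
  ⁻¹-anti a b = sym (inverse-unique
    (trans (assoc _ _ _) (trans (cong (a ·_) (cancelˡ′ b (a ⁻¹))) (inverseʳ a))))

  ⁻¹-involutive : ∀ a → (a ⁻¹) ⁻¹ ≡ a
  ⁻¹-involutive a = sym (inverse-unique (inverseˡ a))

  module GroupSolver (ρ : List W) (τ : List Involution) where

    ⟦_⟧ : Expr → W
    ⟦ # k ⟧   = at ρ k
    ⟦ ! k ⟧   = proj₁ (atI τ k)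
    ⟦ 𝟙 ⟧     = e
    ⟦ x ⊙ y ⟧ = ⟦ x ⟧ · ⟦ y ⟧
    ⟦ inv x ⟧ = ⟦ x ⟧ ⁻¹

    letter : Letter → W
    letter (fwd k)   = at ρ k
    letter (bwd k)   = at ρ k ⁻¹
    letter (invol k) = proj₁ (atI τ k)

    word : List Letter → W
    word = foldr (λ a x → letter a · x) e

    signed : Bool → W → W
    signed false x = x
    signed true  x = x ⁻¹

    cancels-sound : ∀ a b x → cancels a b ≡ true → x ≡ letter a · (letter b · x)
    cancels-sound (fwd k) (bwd m) x p
      rewrite ℕₚ.≡ᵇ⇒≡ k m (subst T (sym p) tt) = sym (cancelˡ′ _ x)
    cancels-sound (bwd k) (fwd m) x p
      rewrite ℕₚ.≡ᵇ⇒≡ k m (subst T (sym p) tt) = sym (cancelˡ _ x)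
    cancels-sound (invol k) (invol m) x p
      rewrite ℕₚ.≡ᵇ⇒≡ k m (subst T (sym p) tt) =
      sym (trans (sym (assoc _ _ _)) (trans (cong (_· x) (proj₂ (atI τ m))) (identityˡ x)))

    push-sound : ∀ a as → word (push a as) ≡ letter a · word as
    push-sound a [] = refl
    push-sound a (b ∷ bs) with cancels a b in eq
    ... | true  = cancels-sound a b (word bs) eq
    ... | false = refl

    flatten-sound : ∀ x b as → word (flatten x b as) ≡ signed b ⟦ x ⟧ · word as
    flatten-sound (# k) false as = push-sound _ as
    flatten-sound (# k) true  as = push-sound _ as
    flatten-sound (! k) false as = push-sound _ as
    flatten-sound (! k) true  as =
      trans (push-sound _ as) (cong (_· word as) (inverse-unique (proj₂ (atI τ k))))
    flatten-sound 𝟙 false as = sym (identityˡ _)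
    flatten-sound 𝟙 true  as =
      trans (sym (identityˡ _)) (cong (_· word as) (inverse-unique (identityˡ e)))
    flatten-sound (x ⊙ y) false as =
      trans (flatten-sound x false _)
        (trans (cong (⟦ x ⟧ ·_) (flatten-sound y false as)) (sym (assoc _ _ _)))
    flatten-sound (x ⊙ y) true as =
      trans (flatten-sound y true _)
        (trans (cong (⟦ y ⟧ ⁻¹ ·_) (flatten-sound x true as))
          (trans (sym (assoc _ _ _)) (cong (_· word as) (sym (⁻¹-anti _ _)))))
    flatten-sound (inv x) false as = flatten-sound x true as
    flatten-sound (inv x) true  as =
      trans (flatten-sound x false as) (cong (_· word as) (sym (⁻¹-involutive _)))

    prove : ∀ x y → flatten x false [] ≡ flatten y false [] → ⟦ x ⟧ ≡ ⟦ y ⟧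
    prove x y p = trans (sym (value x)) (trans (cong word p) (value y))
      where
      value : ∀ z → word (flatten z false []) ≡ ⟦ z ⟧
      value z = trans (flatten-sound z false []) (identityʳ _)

  group : ∀ ρ τ x y → flatten x false [] ≡ flatten y false [] →
          GroupSolver.⟦_⟧ ρ τ x ≡ GroupSolver.⟦_⟧ ρ τ y
  group ρ τ = GroupSolver.prove ρ τ

  -- Products of words, and actions of `W` given on generators

  s² : ∀ i → Involution
  s² i = s i , s-involution i

  prodS-++ : ∀ us vs → prodS (us ++ vs) ≡ prodS us · prodS vs
  prodS-++ []       vs = sym (identityˡ _)
  prodS-++ (i ∷ us) vs = trans (cong (s i ·_) (prodS-++ us vs)) (sym (assoc _ _ _))

  prodW-++ : ∀ us vs → prodW (us ++ vs) ≡ prodW us · prodW vs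
  prodW-++ []       vs = sym (identityˡ _)
  prodW-++ (t ∷ us) vs = trans (cong (t ·_) (prodW-++ us vs)) (sym (assoc _ _ _))

  -- Operators satisfying the relations of the presentation act through W.
  module WordAction
    (V : Set) (_~_ : V → V → Set)
    (~-refl : ∀ {v} → v ~ v) (~-sym : ∀ {v w} → v ~ w → w ~ v)
    (~-trans : ∀ {u v w} → u ~ v → v ~ w → u ~ w)
    (S : Fin n → V → V) (S-cong : ∀ i {v w} → v ~ w → S i v ~ S i w)
    (S² : ∀ i v → S i (S i v) ~ v)
    (relation : ∀ i j k → mpow _·_ e (s i · s j) k ≡ e →
                ∀ v → mpow (λ f g v → f (g v)) id (λ v → S i (S j v)) k v ~ v)
    where

    -- The presentation maps into groups, so each operator is packaged with an inverse. The relation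
    -- `~` replaces equality because vectors are later compared only at valid positions.
    record Auto : Set where
      field
        to from   : V → V
        to-cong   : ∀ {v w} → v ~ w → to v ~ to w
        from-cong : ∀ {v w} → v ~ w → from v ~ from w
        to-from   : ∀ v → to (from v) ~ v
        from-to   : ∀ v → from (to v) ~ v
    open Auto

    _∙_ : Auto → Auto → Auto
    f ∙ g = record
      { to = λ v → to f (to g v)
      ; from = λ v → from g (from f v)
      ; to-cong = λ p → to-cong f (to-cong g p)
      ; from-cong = λ p → from-cong g (from-cong f p)
      ; to-from = λ v → ~-trans (to-cong f (to-from g _)) (to-from f v)
      ; from-to = λ v → ~-trans (from-cong g (from-to f _)) (from-to g v) }

    idAuto : Auto
    idAuto = record { to = id ; from = id ; to-cong = id ; from-cong = id
                    ; to-from = λ _ → ~-refl ; from-to = λ _ → ~-refl }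

    flipAuto : Auto → Auto
    flipAuto f = record { to = from f ; from = to f ; to-cong = from-cong f ; from-cong = to-cong f
                        ; to-from = from-to f ; from-to = to-from f }

    AutoGroup : Group 0ℓ 0ℓ
    AutoGroup = record
      { Carrier = Auto
      ; _≈_ = λ f g → ∀ v → to f v ~ to g v
      ; _∙_ = _∙_
      ; ε = idAuto
      ; _⁻¹ = flipAuto
      ; isGroup = record
        { isMonoid = record
          { isSemigroup = record
            { isMagma = record
              { isEquivalence = record
                { refl = λ _ → ~-refl ; sym = λ p v → ~-sym (p v) ; trans = λ p q v → ~-trans (p v) (q v) }
              ; ∙-cong = λ {f} {f′} {g} {g′} p q v → ~-trans (to-cong f (q v)) (p (to g′ v)) }
            ; assoc = λ _ _ _ _ → ~-refl }
          ; identity = (λ _ _ → ~-refl) , (λ _ _ → ~-refl) }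
        ; inverse = (λ f → from-to f) , (λ f → to-from f)
        ; ⁻¹-cong = λ {f} {g} p v →
            ~-trans (~-sym (from-to g _))
              (from-cong g (~-trans (~-sym (p _)) (to-from f v))) } }

    gen : Fin n → Auto
    gen i = record { to = S i ; from = S i ; to-cong = S-cong i ; from-cong = S-cong i
                   ; to-from = S² i ; from-to = S² i }

    mpow-to : ∀ i j k v →
      to (mpow _∙_ idAuto (gen i ∙ gen j) k) v ≡ mpow (λ f g v → f (g v)) id (λ v → S i (S j v)) k v
    mpow-to i j zero    v = refl
    mpow-to i j (suc k) v = cong (λ w → S i (S j w)) (mpow-to i j k v)

    lift : ∃ λ (φ : W → Auto) → (∀ x y v → to (φ (x · y)) v ~ to (φ x) (to (φ y) v))
                              × (∀ i v → to (φ (s i)) v ~ S i v)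
    lift = presentation AutoGroup gen
      λ i j k p v → subst (_~ v) (sym (mpow-to i j k v)) (relation i j k p v)

    act : List (Fin n) → V → V
    act us v = foldr S v us

    act-lift : ∀ us v → to (proj₁ lift (prodS us)) v ~ act us v
    -- The universal property only provides multiplicativity; `φe` acts as the identity because it
    -- is idempotent and invertible.
    act-lift [] v = ~-trans (~-sym (from-to φe _))
      (~-trans (from-cong φe (~-trans (~-sym (proj₁ (proj₂ lift) e e v))
        (subst (λ x → to (proj₁ lift x) v ~ to φe v) (sym (identityˡ e)) ~-refl))) (from-to φe v))
      where φe = proj₁ lift e
    act-lift (i ∷ us) v = ~-trans (proj₁ (proj₂ lift) _ _ v)
      (~-trans (proj₂ (proj₂ lift) i _) (S-cong i (act-lift us v)))

    act-resp : ∀ us vs → prodS us ≡ prodS vs → ∀ v → act us v ~ act vs v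
    act-resp us vs p v = ~-trans (~-sym (act-lift us v))
      (subst (λ x → to (proj₁ lift x) v ~ act vs v) (sym p) (act-lift vs v))

  -- Signed reflections and the inversion cocycle

  infix 5 _≡ʷ_
  _≡ʷ_ : W → W → Bool
  x ≡ʷ y = ⌊ x ≟ y ⌋

  ≡ʷ-true : ∀ {x y} → x ≡ y → (x ≡ʷ y) ≡ true
  ≡ʷ-true {x} {y} p with x ≟ y
  ... | yes _ = refl
  ... | no ¬p = ⊥-elim (¬p p)

  ≡ʷ-false : ∀ {x y} → x ≢ y → (x ≡ʷ y) ≡ false
  ≡ʷ-false {x} {y} ¬p with x ≟ y
  ... | yes p = ⊥-elim (¬p p)
  ... | no _  = refl

  ≡ʷ-true⁻ : ∀ {x y} → (x ≡ʷ y) ≡ true → x ≡ y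
  ≡ʷ-true⁻ {x} {y} p with x ≟ y
  ... | yes q = q
  ... | no _  = case p of λ ()

  ≡ʷ-cong : ∀ {x y u v} → (x ≡ y → u ≡ v) → (u ≡ v → x ≡ y) → (x ≡ʷ y) ≡ (u ≡ʷ v)
  ≡ʷ-cong {x} {y} f g with x ≟ y
  ... | yes p = sym (≡ʷ-true (f p))
  ... | no ¬p = sym (≡ʷ-false (¬p ∘ g))

  conj : W → W → W
  conj x t = x · t · x ⁻¹

  infixr 6 _⊕_
  _⊕_ : Bool → Bool → Bool
  _⊕_ = _xor_

  -- The W-set of signed reflections: s i maps the root of t to that of s i t s i and
  -- changes its sign exactly when t = s i.
  flipS : Fin n → W × Bool → W × Bool
  flipS i (t , b) = s i · t · s i , (t ≡ʷ s i) ⊕ b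

  flips : List (Fin n) → W → Bool
  flips []       t = false
  flips (i ∷ us) t = (conj (prodS us) t ≡ʷ s i) ⊕ flips us t

  conj-e : ∀ t → conj e t ≡ t
  conj-e t = group (t ∷ []) [] (𝟙 ⊙ # 0 ⊙ inv 𝟙) (# 0) refl

  conj-s : ∀ i x t → s i · conj x t · s i ≡ conj (s i · x) t
  conj-s i x t = group (x ∷ t ∷ []) (s² i ∷ [])
    (! 0 ⊙ (# 0 ⊙ # 1 ⊙ inv (# 0)) ⊙ ! 0) (! 0 ⊙ # 0 ⊙ # 1 ⊙ inv (! 0 ⊙ # 0)) refl

  foldr-flipS : ∀ us t b → foldr flipS (t , b) us ≡ (conj (prodS us) t , flips us t ⊕ b)
  foldr-flipS [] t b = cong (_, b) (sym (conj-e t))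
  foldr-flipS (i ∷ us) t b rewrite foldr-flipS us t b =
    cong₂ _,_ (conj-s i (prodS us) t) (sym (xor-assoc (conj (prodS us) t ≡ʷ s i) (flips us t) b))

  -- The reflections met by (s_i s_j)^k are z^p s_j for p < 2k, where z = s_j s_i.
  hits₂ : W → W → W → ℕ → Bool
  hits₂ z y t zero    = false
  hits₂ z y t (suc p) = (t ≡ʷ mpow _·_ e z p · y) ⊕ hits₂ z y t p

  mpow-+ : ∀ z p q → mpow _·_ e z (p + q) ≡ mpow _·_ e z p · mpow _·_ e z q
  mpow-+ z zero    q = sym (identityˡ _)
  mpow-+ z (suc p) q = trans (cong (z ·_) (mpow-+ z p q)) (sym (assoc _ _ _))

  mpow-comm : ∀ z p → mpow _·_ e z p · z ≡ z · mpow _·_ e z p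
  mpow-comm z zero    = trans (identityˡ z) (sym (identityʳ z))
  mpow-comm z (suc p) = trans (assoc _ _ _) (cong (z ·_) (mpow-comm z p))

  hits₂-periodic : ∀ z y t k → mpow _·_ e z k ≡ e → ∀ p → hits₂ z y t (p + k) ≡ hits₂ z y t p ⊕ hits₂ z y t k
  hits₂-periodic z y t k z^k zero    = refl
  hits₂-periodic z y t k z^k (suc p) =
    trans (cong₂ _⊕_ (cong (λ x → t ≡ʷ x · y) (trans (mpow-+ z p k) (trans (cong (mpow _·_ e z p ·_) z^k) (identityʳ _))))
            (hits₂-periodic z y t k z^k p))
      (sym (xor-assoc (t ≡ʷ mpow _·_ e z p · y) (hits₂ z y t p) (hits₂ z y t k)))

  module DihedralFlips (i j : Fin n) where
    u z : W
    u = s i · s j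
    z = s j · s i

    uz : ∀ k → mpow _·_ e u k · mpow _·_ e z k ≡ e
    uz zero    = identityˡ e
    uz (suc k) = trans (cong (_· (z · mpow _·_ e z k)) (sym (mpow-comm u k)))
      (trans (group (mpow _·_ e u k ∷ mpow _·_ e z k ∷ []) (s² i ∷ s² j ∷ [])
               (# 0 ⊙ (! 0 ⊙ ! 1) ⊙ ((! 1 ⊙ ! 0) ⊙ # 1)) (# 0 ⊙ # 1) refl)
        (uz k))

    u⁻¹ : ∀ k → mpow _·_ e z k ≡ mpow _·_ e u k ⁻¹
    u⁻¹ k = inverse-unique (uz k)

    s-conj : ∀ k → s j · mpow _·_ e u k ≡ mpow _·_ e z k · s j
    s-conj zero    = trans (identityʳ _) (sym (identityˡ _))
    s-conj (suc k) = trans (group (mpow _·_ e u k ∷ []) (s² i ∷ s² j ∷ [])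
                             (! 1 ⊙ ((! 0 ⊙ ! 1) ⊙ # 0)) (! 1 ⊙ ! 0 ⊙ (! 1 ⊙ # 0)) refl)
      (trans (cong (s j · s i ·_) (s-conj k)) (sym (assoc _ _ _)))

    hit : ∀ k t y → (conj (mpow _·_ e u k) t ≡ʷ y) ≡ (t ≡ʷ mpow _·_ e z k · y · mpow _·_ e u k)
    hit k t y = ≡ʷ-cong
      (λ p → trans (group (U ∷ t ∷ []) [] (# 1) (inv (# 0) ⊙ (# 0 ⊙ # 1 ⊙ inv (# 0)) ⊙ # 0) refl)
               (trans (cong (λ x → U ⁻¹ · x · U) p) (cong (λ x → x · y · U) (sym (u⁻¹ k)))))
      (λ p → trans (cong (conj U) (trans p (cong (λ x → x · y · U) (u⁻¹ k))))
               (group (U ∷ y ∷ []) [] (# 0 ⊙ (inv (# 0) ⊙ # 1 ⊙ # 0) ⊙ inv (# 0)) (# 1) refl))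
      where U = mpow _·_ e u k

    double : ∀ k → mpow _·_ e z k · s j · mpow _·_ e u k ≡ mpow _·_ e z (k + k) · s j
    double k = trans (assoc _ _ _) (trans (cong (mpow _·_ e z k ·_) (s-conj k))
      (trans (sym (assoc _ _ _)) (cong (_· s j) (sym (mpow-+ z k k)))))

    -- After k factors, the letters `s j` and `s i` of the next one meet the reflections `z` to the
    -- power 2k times `s j` and `z` to the power 2k + 1 times `s j`: two consecutive new terms of
    -- `hits₂`.
    iterate : ∀ k t b → mpow (λ f g v → f (g v)) id (λ v → flipS i (flipS j v)) k (t , b)
                      ≡ (conj (mpow _·_ e u k) t , hits₂ z (s j) t (k + k) ⊕ b)
    iterate zero    t b = cong (_, b) (sym (conj-e t))
    iterate (suc k) t b rewrite iterate k t b | ℕₚ.+-suc k k = cong₂ _,_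
      (group (U ∷ t ∷ []) (s² i ∷ s² j ∷ [])
         (! 0 ⊙ (! 1 ⊙ (# 0 ⊙ # 1 ⊙ inv (# 0)) ⊙ ! 1) ⊙ ! 0)
         ((! 0 ⊙ ! 1) ⊙ # 0 ⊙ # 1 ⊙ inv ((! 0 ⊙ ! 1) ⊙ # 0)) refl)
      (trans (cong₂ _⊕_ outer (cong (_⊕ (hits₂ z (s j) t (k + k) ⊕ b)) (trans (hit k t (s j)) (cong (t ≡ʷ_) (double k)))))
        (sym (trans (xor-assoc (t ≡ʷ z · Z · s j) ((t ≡ʷ Z · s j) ⊕ hits₂ z (s j) t (k + k)) b)
          (cong ((t ≡ʷ z · Z · s j) ⊕_) (xor-assoc (t ≡ʷ Z · s j) _ b)))))
      where
      U = mpow _·_ e u k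
      Z = mpow _·_ e z (k + k)
      outer : (s j · conj U t · s j ≡ʷ s i) ≡ (t ≡ʷ z · Z · s j)
      outer = trans (≡ʷ-cong
        (λ p → trans (group (conj U t ∷ []) (s² j ∷ []) (# 0) (! 0 ⊙ (! 0 ⊙ # 0 ⊙ ! 0) ⊙ ! 0) refl) (cong (λ x → s j · x · s j) p))
        (λ p → trans (cong (λ x → s j · x · s j) p) (group [] (s² i ∷ s² j ∷ []) (! 1 ⊙ (! 1 ⊙ ! 0 ⊙ ! 1) ⊙ ! 1) (! 0) refl)))
        (trans (hit k t (s j · s i · s j)) (cong (t ≡ʷ_)
          (trans (group (mpow _·_ e z k ∷ U ∷ []) (s² i ∷ s² j ∷ []) (# 0 ⊙ (! 1 ⊙ ! 0 ⊙ ! 1) ⊙ # 1) (# 0 ⊙ (! 1 ⊙ ! 0) ⊙ (! 1 ⊙ # 1)) refl)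
            (trans (cong₂ _·_ (mpow-comm z k) (s-conj k))
              (trans (group (z ∷ mpow _·_ e z k ∷ []) (s² j ∷ []) (# 0 ⊙ # 1 ⊙ (# 1 ⊙ ! 0)) (# 0 ⊙ (# 1 ⊙ # 1) ⊙ ! 0) refl)
                (cong (λ x → z · x · s j) (sym (mpow-+ z k k))))))))

    -- When the k-th power of `z` is trivial, the second k reflections met repeat the first k, so
    -- every sign is changed an even number of times.
    relation : ∀ k → mpow _·_ e u k ≡ e → ∀ v →
               mpow (λ f g v → f (g v)) id (λ v → flipS i (flipS j v)) k v ≡ v
    relation k u^k (t , b) = trans (iterate k t b) (cong₂ _,_
      (trans (cong (λ x → conj x t) u^k) (conj-e t))
      (cong (_⊕ b) (trans (hits₂-periodic z (s j) t k (trans (sym (identityˡ _)) (trans (cong (_· mpow _·_ e z k) (sym u^k)) (uz k))) k)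
        (xor-same (hits₂ z (s j) t k)))))

  flipS² : ∀ i v → flipS i (flipS i v) ≡ v
  flipS² i (t , b) = cong₂ _,_
    (group (t ∷ []) (s² i ∷ []) (! 0 ⊙ (! 0 ⊙ # 0 ⊙ ! 0) ⊙ ! 0) (# 0) refl)
    (trans (cong (_⊕ ((t ≡ʷ s i) ⊕ b)) (≡ʷ-cong
        (λ p → trans (group (t ∷ []) (s² i ∷ []) (# 0) (! 0 ⊙ (! 0 ⊙ # 0 ⊙ ! 0) ⊙ ! 0) refl)
          (trans (cong (λ x → s i · x · s i) p) (group [] (s² i ∷ []) (! 0 ⊙ ! 0 ⊙ ! 0) (! 0) refl)))
        (λ p → trans (cong (λ x → s i · x · s i) p) (group [] (s² i ∷ []) (! 0 ⊙ ! 0 ⊙ ! 0) (! 0) refl))))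
      (trans (sym (xor-assoc (t ≡ʷ s i) _ b)) (cong (_⊕ b) (xor-same (t ≡ʷ s i)))))

  module SignAction = WordAction (W × Bool) _≡_ refl sym trans flipS (λ i → cong (flipS i)) flipS² DihedralFlips.relation

  flips-resp : ∀ us vs → prodS us ≡ prodS vs → ∀ t → flips us t ≡ flips vs t
  flips-resp us vs p t = trans (sym (snd us)) (trans (cong proj₂ (SignAction.act-resp us vs p (t , false))) (snd vs))
    where
    snd : ∀ us → proj₂ (foldr flipS (t , false) us) ≡ flips us t
    snd us = trans (cong proj₂ (foldr-flipS us t false)) (xor-identityʳ _)

  -- η x t records whether x sends the positive root of t to a negative root.
  η : W → W → Bool
  η x t = flips (proj₁ (generated x)) t

  η-word : ∀ us t → η (prodS us) t ≡ flips us t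
  η-word us t = flips-resp (proj₁ (generated (prodS us))) us (proj₂ (generated (prodS us))) t

  η-· : ∀ x y t → η (x · y) t ≡ η x (conj y t) ⊕ η y t
  η-· x y t = trans (flips-resp (proj₁ (generated (x · y))) (us ++ vs) (trans (proj₂ (generated (x · y)))
      (trans (sym (cong₂ _·_ (proj₂ (generated x)) (proj₂ (generated y)))) (sym (prodS-++ us vs)))) t)
    (trans (split us) (cong (λ w → flips us (conj w t) ⊕ flips vs t) (proj₂ (generated y))))
    where
    us = proj₁ (generated x)
    vs = proj₁ (generated y)
    split : ∀ us → flips (us ++ vs) t ≡ flips us (conj (prodS vs) t) ⊕ flips vs t
    split [] = refl
    split (i ∷ us) = trans (cong₂ _⊕_ (cong (_≡ʷ s i) (trans (cong (λ w → conj w t) (prodS-++ us vs))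
        (group (prodS us ∷ prodS vs ∷ t ∷ []) [] (# 0 ⊙ # 1 ⊙ # 2 ⊙ inv (# 0 ⊙ # 1)) (# 0 ⊙ (# 1 ⊙ # 2 ⊙ inv (# 1)) ⊙ inv (# 0)) refl)))
        (split us))
      (sym (xor-assoc (conj (prodS us) (conj (prodS vs) t) ≡ʷ s i) _ _))

  η-e : ∀ t → η e t ≡ false
  η-e t = η-word [] t

  η-s : ∀ i t → η (s i) t ≡ (t ≡ʷ s i)
  η-s i t = trans (cong (λ x → η x t) (sym (identityʳ (s i))))
    (trans (η-word (i ∷ []) t) (trans (xor-identityʳ _) (cong (_≡ʷ s i) (conj-e t))))

  conj-· : ∀ x y t → conj (x · y) t ≡ conj x (conj y t)
  conj-· x y t = group (x ∷ y ∷ t ∷ []) []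
    (# 0 ⊙ # 1 ⊙ # 2 ⊙ inv (# 0 ⊙ # 1)) (# 0 ⊙ (# 1 ⊙ # 2 ⊙ inv (# 1)) ⊙ inv (# 0)) refl

  conj-inv : ∀ x t → conj (x ⁻¹) (conj x t) ≡ t
  conj-inv x t = group (x ∷ t ∷ []) []
    (inv (# 0) ⊙ (# 0 ⊙ # 1 ⊙ inv (# 0)) ⊙ inv (inv (# 0))) (# 1) refl

  conj-inv′ : ∀ x t → conj x (conj (x ⁻¹) t) ≡ t
  conj-inv′ x t = group (x ∷ t ∷ []) []
    (# 0 ⊙ (inv (# 0) ⊙ # 1 ⊙ inv (inv (# 0))) ⊙ inv (# 0)) (# 1) refl

  conj-homo : ∀ x y z → conj x (y · z) ≡ conj x y · conj x z
  conj-homo x y z = group (x ∷ y ∷ z ∷ []) []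
    (# 0 ⊙ (# 1 ⊙ # 2) ⊙ inv (# 0)) (# 0 ⊙ # 1 ⊙ inv (# 0) ⊙ (# 0 ⊙ # 2 ⊙ inv (# 0))) refl

  conj-fix : ∀ x e′ → e′ ≡ e → conj x e′ ≡ e
  conj-fix x _ refl = group (x ∷ []) [] (# 0 ⊙ 𝟙 ⊙ inv (# 0)) 𝟙 refl

  conj-s² : ∀ r t → conj (s r) (conj (s r) t) ≡ t
  conj-s² r t = group (t ∷ []) (s² r ∷ [])
    (! 0 ⊙ (! 0 ⊙ # 0 ⊙ inv (! 0)) ⊙ inv (! 0)) (# 0) refl

  conj-injective : ∀ x {y z} → conj x y ≡ conj x z → y ≡ z
  conj-injective x {y} {z} p = trans (sym (conj-inv x y)) (trans (cong (conj (x ⁻¹)) p) (conj-inv x z))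

  e⁻¹ : e ⁻¹ ≡ e
  e⁻¹ = sym (inverse-unique (identityˡ e))

  s⁻¹ : ∀ i → s i ⁻¹ ≡ s i
  s⁻¹ i = sym (inverse-unique (s-involution i))

  refl-s : ∀ i → IsReflection (s i)
  refl-s i = e , i , group [] (s² i ∷ []) (! 0) (𝟙 ⊙ ! 0 ⊙ inv 𝟙) refl

  refl-conj : ∀ x {t} → IsReflection t → IsReflection (conj x t)
  refl-conj x (w , i , refl) = x · w , i , sym (conj-· x w (s i))

  refl-invol : ∀ {t} → IsReflection t → t · t ≡ e
  refl-invol (w , i , refl) = group (w ∷ []) (s² i ∷ [])
    (# 0 ⊙ ! 0 ⊙ inv (# 0) ⊙ (# 0 ⊙ ! 0 ⊙ inv (# 0))) 𝟙 refl

  invol² : ∀ {t} → IsReflection t → Involution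
  invol² {t} tR = t , refl-invol tR

  refl-⁻¹ : ∀ {t} → IsReflection t → t ⁻¹ ≡ t
  refl-⁻¹ tR = sym (inverse-unique (refl-invol tR))

  refl≢e : ∀ {t} → IsReflection t → t ≢ e
  refl≢e (w , i , refl) p = s-nontrivial i (conj-injective w (trans p (sym (conj-fix w e refl))))

  η-⁻¹ : ∀ x t → η (x ⁻¹) (conj x t) ≡ η x t
  η-⁻¹ x t = xor-eq (trans (sym (η-· (x ⁻¹) x t)) (trans (cong (λ y → η y t) (inverseˡ x)) (η-e t)))
    where
    xor-eq : ∀ {a b} → a ⊕ b ≡ false → a ≡ b
    xor-eq {false} {false} _ = refl
    xor-eq {true}  {true}  _ = refl

  -- Along `w · s i · w ⁻¹` the signs contributed by `w` and by `w ⁻¹` cancel, and the middle letter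
  -- contributes exactly one change.
  η-self : ∀ {t} → IsReflection t → η t t ≡ true
  η-self (w , i , refl) = trans (η-· (w · s i) (w ⁻¹) t)
    (trans (cong₂ _⊕_ (cong (η (w · s i)) (conj-inv w (s i))) (η-⁻¹ w (s i)))
      (trans (cong (_⊕ η w (s i)) (trans (η-· w (s i) (s i))
          (cong₂ _⊕_ (cong (η w) (group [] (s² i ∷ []) (! 0 ⊙ ! 0 ⊙ inv (! 0)) (! 0) refl)) (trans (η-s i (s i)) (≡ʷ-true refl)))))
        (flip-back (η w (s i)))))
    where
    t = conj w (s i)
    flip-back : ∀ b → (b ⊕ true) ⊕ b ≡ true
    flip-back false = refl
    flip-back true  = refl

  η-·t : ∀ x {t} → IsReflection t → η (x · t) t ≡ not (η x t)
  η-·t x {t} tR = trans (η-· x t t) (trans (cong₂ _⊕_ (cong (η x) (group [] (invol² tR ∷ []) (! 0 ⊙ ! 0 ⊙ inv (! 0)) (! 0) refl)) (η-self tR))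
    (flip-true (η x t)))
    where
    flip-true : ∀ b → b ⊕ true ≡ not b
    flip-true false = refl
    flip-true true  = refl

  η-up : ∀ {x t} → IsReflection t → η x t ≡ false → η (x · t) t ≡ true
  η-up tR p = trans (η-·t _ tR) (cong not p)

  η-down : ∀ {x t} → IsReflection t → η x t ≡ true → η (x · t) t ≡ false
  η-down tR p = trans (η-·t _ tR) (cong not p)

  -- Strong exchange and parabolic subgroups

  data _⋖_ : List (Fin n) → List (Fin n) → Set where
    drop : ∀ {i us} → us ⋖ (i ∷ us)
    keep : ∀ {i us vs} → us ⋖ vs → (i ∷ us) ⋖ (i ∷ vs)

  ⋖-length : ∀ {us vs} → us ⋖ vs → length vs ≡ suc (length us)
  ⋖-length drop     = refl
  ⋖-length (keep p) = cong suc (⋖-length p)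

  ⋖-All : ∀ {J : Fin n → Set} {us vs} → us ⋖ vs → All J vs → All J us
  ⋖-All drop     (_ ∷ ps) = ps
  ⋖-All (keep p) (q ∷ ps) = q ∷ ⋖-All p ps

  -- The strong exchange condition. The leftmost letter that `t` meets is deleted: the letters after
  -- it conjugate `t` to this letter, so right multiplication by `t` removes it.
  exchange : ∀ us t → flips us t ≡ true → ∃ λ vs → vs ⋖ us × prodS us · t ≡ prodS vs
  exchange (i ∷ us) t p with conj (prodS us) t ≟ s i | flips us t in eq
  ... | yes q | false = us , drop , trans (cong (λ x → x · prodS us · t) (sym q))
          (trans (group (prodS us ∷ t ∷ []) [] (# 0 ⊙ # 1 ⊙ inv (# 0) ⊙ # 0 ⊙ # 1) (# 0 ⊙ # 1 ⊙ # 1) refl)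
            (trans (cong (λ x → prodS us · t · x) t≡) (trans (assoc _ _ _) (trans (cong (prodS us ·_) tt≡) (identityʳ _)))))
    where
    t≡ : t ≡ conj (prodS us ⁻¹) (s i)
    t≡ = trans (sym (conj-inv (prodS us) t)) (cong (conj (prodS us ⁻¹)) q)
    tt≡ : t · conj (prodS us ⁻¹) (s i) ≡ e
    tt≡ = trans (cong (_· conj (prodS us ⁻¹) (s i)) t≡) (refl-invol (refl-conj _ (refl-s i)))
  ... | yes q | true  = case p of λ ()
  ... | no _  | true with exchange us t eq
  ...   | vs , v⋖u , q = i ∷ vs , keep v⋖u , trans (assoc _ _ _) (cong (s i ·_) q)

  exchangeʷ : ∀ us {x} t → prodS us ≡ x → η x t ≡ true → ∃ λ vs → vs ⋖ us × x · t ≡ prodS vs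
  exchangeʷ us t refl p = exchange us t (trans (sym (η-word us t)) p)

  reducedWord : ∀ w → ∃ λ us → length us ≡ ℓ w × prodS us ≡ w
  reducedWord w = proj₁ (ℓ-spec w)

  ℓ-≤ : ∀ us {w} → prodS us ≡ w → ℓ w ≤ length us
  ℓ-≤ us p = proj₂ (ℓ-spec _) us p

  η-true⇒ℓ : ∀ {x t} → η x t ≡ true → ℓ (x · t) < ℓ x
  η-true⇒ℓ {x} {t} p with reducedWord x
  ... | us , len , eq with exchangeʷ us t eq p
  ...   | vs , v⋖u , q = ℕₚ.≤-trans (s≤s (ℓ-≤ vs (sym q))) (ℕₚ.≤-reflexive (trans (sym (⋖-length v⋖u)) len))

  tt-cancel : ∀ x {t} → IsReflection t → x · t · t ≡ x
  tt-cancel x tR = group (x ∷ []) (invol² tR ∷ []) (# 0 ⊙ ! 0 ⊙ ! 0) (# 0) refl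

  η-false⇒ℓ : ∀ {x t} → IsReflection t → η x t ≡ false → ℓ x < ℓ (x · t)
  η-false⇒ℓ {x} {t} tR p = subst (λ y → ℓ y < ℓ (x · t)) (tt-cancel x tR) (η-true⇒ℓ (η-up tR p))

  ℓ⇒η-true : ∀ {x t} → IsReflection t → ℓ (x · t) < ℓ x → η x t ≡ true
  ℓ⇒η-true {x} {t} tR lt with η x t in eq
  ... | true  = refl
  ... | false = ⊥-elim (ℕₚ.<-asym lt (η-false⇒ℓ tR eq))

  Par : (Fin n → Set) → W → Set
  Par J x = ∃ λ us → All J us × prodS us ≡ x

  par-e : ∀ {J} → Par J e
  par-e = [] , [] , refl

  par-s : ∀ {J i} → J i → Par J (s i)
  par-s p = _ ∷ [] , p ∷ [] , identityʳ _

  par-· : ∀ {J x y} → Par J x → Par J y → Par J (x · y)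
  par-· (us , p , refl) (vs , q , refl) = us ++ vs , Allₚ.++⁺ p q , prodS-++ us vs

  par-⁻¹ : ∀ {J x} → Par J x → Par J (x ⁻¹)
  par-⁻¹ {J} (us , p , refl) = go us p
    where
    go : ∀ us → All J us → Par J (prodS us ⁻¹)
    go []       _        = subst (Par J) (sym e⁻¹) par-e
    go (i ∷ us) (q ∷ qs) = subst (Par J)
      (group (prodS us ∷ []) (s² i ∷ []) (inv (# 0) ⊙ ! 0) (inv (! 0 ⊙ # 0)) refl)
      (par-· (go us qs) (par-s q))

  par-conj : ∀ {J x y} → Par J x → Par J y → Par J (conj x y)
  par-conj p q = par-· (par-· p q) (par-⁻¹ p)

  par-cancelˡ : ∀ {J x y} → Par J x → Par J (x · y) → Par J y
  par-cancelˡ {J} {x} {y} p q = subst (Par J) (cancelˡ x y) (par-· (par-⁻¹ p) q)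

  par-cancelʳ : ∀ {J x y} → Par J y → Par J (x · y) → Par J x
  par-cancelʳ {J} {x} {y} p q = subst (Par J)
    (group (x ∷ y ∷ []) [] (# 0 ⊙ # 1 ⊙ inv (# 1)) (# 0) refl) (par-· q (par-⁻¹ p))

  -- Exchange writes `x · t` with some of the letters of `x`, and `t` is a quotient of two elements
  -- of the subgroup.
  par-exchange : ∀ {J x t} → Par J x → η x t ≡ true → Par J t
  par-exchange {J} {x} {t} px@(us , p , q) h with exchangeʷ us t q h
  ... | vs , v⋖u , r = par-cancelˡ px (vs , ⋖-All v⋖u p , sym r)

  par-η-false : ∀ {J x t} → Par J x → ¬ Par J t → η x t ≡ false
  par-η-false {x = x} {t} px ¬pt with η x t in eq
  ... | false = refl
  ... | true  = ⊥-elim (¬pt (par-exchange px eq))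

  prodS-∷ʳ : ∀ us i → prodS (us ++ i ∷ []) ≡ prodS us · s i
  prodS-∷ʳ us i = trans (prodS-++ us (i ∷ [])) (cong (prodS us ·_) (identityʳ _))

  length-∷ʳ : ∀ {A : Set} (xs : List A) x → length (xs ++ x ∷ []) ≡ suc (length xs)
  length-∷ʳ xs x = trans (Listₚ.length-++ xs) (ℕₚ.+-comm _ 1)

  -- The last letter of a word is a descent unless the word before it can be exchanged against it,
  -- and then a word shorter by two in the same letters has the same product.
  descent : ∀ {J x} → Par J x → x ≢ e → ∃ λ i → J i × η x (s i) ≡ true
  descent {J} {x} (us , p , q) x≢e = go (length us) us ℕₚ.≤-refl p q
    where
    go : ∀ k us → length us ≤ k → All J us → prodS us ≡ x → ∃ λ i → J i × η x (s i) ≡ true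
    go k us le p q with initLast us
    go k .[] le p q | [] = ⊥-elim (x≢e (sym q))
    go zero .(vs ++ i ∷ []) le p q | vs ∷ʳ′ i with () ← subst (_≤ 0) (length-∷ʳ vs i) le
    go (suc k) .(vs ++ i ∷ []) le p q | vs ∷ʳ′ i with η (prodS vs) (s i) in eq
    ... | false = i , All.head (Allₚ.++⁻ʳ vs p) ,
          trans (cong (λ y → η y (s i)) (trans (sym q) (prodS-∷ʳ vs i))) (η-up (refl-s i) eq)
    ... | true with exchangeʷ vs (s i) refl eq
    ...   | ws , w⋖v , r = go k ws
            (ℕₚ.≤-trans (ℕₚ.n≤1+n _) (ℕₚ.≤-trans (ℕₚ.≤-reflexive (sym (⋖-length w⋖v))) (ℕₚ.≤-pred (subst (_≤ suc k) (length-∷ʳ vs i) le))))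
            (⋖-All w⋖v (Allₚ.++⁻ˡ vs p)) (trans (sym r) (trans (sym (prodS-∷ʳ vs i)) q))

  par-s⁻ : ∀ {J i} → Par J (s i) → J i
  par-s⁻ {J} {i} p with descent p (s-nontrivial i)
  ... | j , q , h = subst J (s-injective j i (≡ʷ-true⁻ (trans (sym (η-s i (s j))) h))) q

  Without : Fin n → W → Set
  Without r = Par (_≢ r)

  ¬without-s : ∀ {r} → ¬ Without r (s r)
  ¬without-s p = par-s⁻ p refl

  without-≢ : ∀ {r x} → Without r x → x ≢ s r
  without-≢ {r} p q = ¬without-s (subst (Without r) q p)

  -- Compute the sign of `s r` under one element written as `s r · x` and as `x′ · s r`. The second
  -- form inverts `s r`, since `x′` avoids `r`; the first does so only if conjugation by `x` fixes
  -- `s r`.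
  without-commute : ∀ {r x} → Without r x → Without r (conj (s r) x) → conj (s r) x ≡ x
  without-commute {r} {x} p q = trans (cong (λ y → y · x · s r ⁻¹) (sym (≡ʷ-true⁻ fixed)))
    (group (x ∷ []) (s² r ∷ []) (# 0 ⊙ ! 0 ⊙ inv (# 0) ⊙ # 0 ⊙ inv (! 0)) (# 0) refl)
    where
    x′ = conj (s r) x
    fixed : (conj x (s r) ≡ʷ s r) ≡ true
    fixed = trans (sym (xor-identityʳ _))
      (trans (cong₂ _⊕_ (sym (η-s r _)) (sym (par-η-false p ¬without-s)))
        (trans (sym (η-· (s r) x (s r)))
          (trans (cong (λ y → η y (s r)) (group (x ∷ []) (s² r ∷ []) (! 0 ⊙ # 0) (! 0 ⊙ # 0 ⊙ inv (! 0) ⊙ ! 0) refl))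
            (η-up (refl-s r) (par-η-false q ¬without-s)))))

  η-s·-without : ∀ {r x t} → Without r x → Without r t → η (s r · x) t ≡ η x t
  η-s·-without {r} {x} {t} p q = trans (η-· (s r) x t)
    (cong (_⊕ η x t) (trans (η-s r _) (≡ʷ-false (without-≢ (par-conj p q)))))

  -- The source of the case distinctions under rotation: each of the two outer factors `s r` affects
  -- a single root, and if both corrections occur they cancel.
  η-conj-s : ∀ r x t → η (conj (s r) x) (conj (s r) t) ≡ ((conj x t ≡ʷ s r) ⊕ η x t) ⊕ (t ≡ʷ s r)
  η-conj-s r x t = trans (η-· (s r · x) (s r ⁻¹) _)
    (cong₂ _⊕_ (trans (cong (η (s r · x)) (conj-inv (s r) t)) (trans (η-· (s r) x t) (cong (_⊕ η x t) (η-s r _))))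
      (trans (η-⁻¹ (s r) t) (η-s r t)))

  η-conj-s-same : ∀ {r x t} → conj x t ≢ s r → t ≢ s r → η (conj (s r) x) (conj (s r) t) ≡ η x t
  η-conj-s-same {r} {x} {t} p q = trans (η-conj-s r x t)
    (trans (cong₂ _⊕_ (cong (_⊕ η x t) (≡ʷ-false p)) (≡ʷ-false q)) (xor-identityʳ _))

  -- Absolute length and absolute order

  Reflections : List W → Set
  Reflections = All IsReflection

  ℓT-≤ : ∀ {ts w} → Reflections ts → prodW ts ≡ w → ℓT w ≤ length ts
  ℓT-≤ {ts} {w} R p = proj₂ (ℓT-spec w) ts R p

  ℓT-word : ∀ w → ∃ λ ts → Reflections ts × length ts ≡ ℓT w × prodW ts ≡ w
  ℓT-word w = proj₁ (ℓT-spec w)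

  ℓT-e : ℓT e ≡ 0
  ℓT-e = ℕₚ.n≤0⇒n≡0 (ℓT-≤ [] refl)

  ℓT-0 : ∀ {w} → ℓT w ≡ 0 → w ≡ e
  ℓT-0 {w} p with ℓT-word w
  ... | []     , _ , _ , q = sym q
  ... | _ ∷ _  , _ , q , _ = case trans q p of λ ()

  ℓT-sub : ∀ x y → ℓT (x · y) ≤ ℓT x + ℓT y
  ℓT-sub x y with ℓT-word x | ℓT-word y
  ... | us , R , p , refl | vs , S , q , refl =
    ℕₚ.≤-trans (ℓT-≤ (Allₚ.++⁺ R S) (prodW-++ us vs)) (ℕₚ.≤-reflexive (trans (Listₚ.length-++ us) (cong₂ _+_ p q)))

  prodW-conj : ∀ x ts → prodW (map (conj x) ts) ≡ conj x (prodW ts)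
  prodW-conj x []       = sym (conj-fix x e refl)
  prodW-conj x (t ∷ ts) = trans (cong (conj x t ·_) (prodW-conj x ts)) (sym (conj-homo x t _))

  refls-conj : ∀ x {ts} → Reflections ts → Reflections (map (conj x) ts)
  refls-conj x R = Allₚ.map⁺ (All.map (refl-conj x) R)

  ℓT-conj : ∀ x w → ℓT (conj x w) ≡ ℓT w
  ℓT-conj x w = ℕₚ.≤-antisym (le x w) (subst (λ v → ℓT v ≤ ℓT (conj x w)) (conj-inv x w) (le (x ⁻¹) (conj x w)))
    where
    le : ∀ x w → ℓT (conj x w) ≤ ℓT w
    le x w with ℓT-word w
    ... | ts , R , p , refl = ℕₚ.≤-trans (ℓT-≤ (refls-conj x R) (prodW-conj x ts))
            (ℕₚ.≤-reflexive (trans (Listₚ.length-map _ ts) p))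

  ℓT-refl : ∀ {t} → IsReflection t → ℓT t ≡ 1
  ℓT-refl {t} tR with ℓT t in eq | ℓT-≤ {t ∷ []} {t} (tR ∷ []) (identityʳ t)
  ... | zero  | _       = ⊥-elim (refl≢e tR (ℓT-0 eq))
  ... | suc .0 | s≤s z≤n = refl

  -- The product form of `x ≼ x · y`, in which brackets can be moved without inverses.
  Additive : W → W → Set
  Additive x y = ℓT (x · y) ≡ ℓT x + ℓT y

  additive : ∀ {x y} → ℓT x + ℓT y ≤ ℓT (x · y) → Additive x y
  additive p = ℕₚ.≤-antisym (ℓT-sub _ _) p

  additive-assocʳ : ∀ {x y z} → Additive (x · y) z → Additive x y → Additive x (y · z) × Additive y z
  additive-assocʳ {x} {y} {z} p q = trans total (cong (ℓT x +_) (sym yz)) , yz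
    where
    total : ℓT (x · (y · z)) ≡ ℓT x + (ℓT y + ℓT z)
    total = trans (cong ℓT (sym (assoc x y z))) (trans p (trans (cong (_+ ℓT z) q) (ℕₚ.+-assoc (ℓT x) _ _)))
    yz : Additive y z
    yz = additive (ℕₚ.+-cancelˡ-≤ (ℓT x) _ _ (ℕₚ.≤-trans (ℕₚ.≤-reflexive (sym total)) (ℓT-sub x (y · z))))

  additive-assocˡ : ∀ {x y z} → Additive x (y · z) → Additive y z → Additive (x · y) z × Additive x y
  additive-assocˡ {x} {y} {z} p q = trans total (cong (_+ ℓT z) (sym xy)) , xy
    where
    total : ℓT (x · y · z) ≡ (ℓT x + ℓT y) + ℓT z
    total = trans (cong ℓT (assoc x y z)) (trans p (trans (cong (ℓT x +_) q) (sym (ℕₚ.+-assoc (ℓT x) _ _))))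
    xy : Additive x y
    xy = additive (ℕₚ.+-cancelʳ-≤ (ℓT z) _ _ (ℕₚ.≤-trans (ℕₚ.≤-reflexive (sym total)) (ℓT-sub (x · y) z)))

  additive-conj : ∀ g {x y} → Additive x y → Additive (conj g x) (conj g y)
  additive-conj g {x} {y} p = trans (cong ℓT (sym (conj-homo g x y)))
    (trans (ℓT-conj g _) (trans p (cong₂ _+_ (sym (ℓT-conj g x)) (sym (ℓT-conj g y)))))

  additive-swapʳ : ∀ {x y} → Additive x y → Additive y (conj (y ⁻¹) x)
  additive-swapʳ {x} {y} p = trans (cong ℓT (group (x ∷ y ∷ []) [] (# 1 ⊙ (inv (# 1) ⊙ # 0 ⊙ inv (inv (# 1)))) (# 0 ⊙ # 1) refl))
    (trans p (trans (ℕₚ.+-comm (ℓT x) _) (cong (ℓT y +_) (sym (ℓT-conj (y ⁻¹) x)))))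

  infix 4 _≼_
  _≼_ : W → W → Set
  v ≼ w = ℓT w ≡ ℓT v + ℓT (v ⁻¹ · w)

  ≼-dec : ∀ v w → Dec (v ≼ w)
  ≼-dec v w = ℓT w ≟ℕ _

  ≼-additive : ∀ {v w} → v ≼ w → Additive v (v ⁻¹ · w)
  ≼-additive {v} {w} p = trans (cong ℓT (cancelˡ′ v w)) p

  additive-≼ : ∀ {v u} → Additive v u → v ≼ v · u
  additive-≼ {v} {u} p = trans p (cong (λ x → ℓT v + ℓT x) (sym (cancelˡ v u)))

  additive-≼ʳ : ∀ {v u} → Additive v u → u ≼ v · u
  additive-≼ʳ {v} {u} p = subst (u ≼_)
    (group (v ∷ u ∷ []) [] (# 1 ⊙ (inv (# 1) ⊙ # 0 ⊙ inv (inv (# 1)))) (# 0 ⊙ # 1) refl)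
    (additive-≼ (additive-swapʳ p))

  ≼-refl : ∀ {v} → v ≼ v
  ≼-refl {v} = sym (trans (cong (ℓT v +_) (trans (cong ℓT (inverseˡ v)) ℓT-e)) (ℕₚ.+-identityʳ _))

  e≼ : ∀ w → e ≼ w
  e≼ w = trans (cong ℓT (sym (trans (cong (_· w) e⁻¹) (identityˡ w)))) (cong (_+ ℓT (e ⁻¹ · w)) (sym ℓT-e))

  ≼-quotient : ∀ {a b c} → a ≼ b → b ≼ c → a ≼ c × (a ⁻¹ · b) ≼ (a ⁻¹ · c)
  ≼-quotient {a} {b} {c} p q =
      subst (a ≼_) c≡ (additive-≼ (proj₁ both))
    , subst ((a ⁻¹ · b) ≼_) (group (a ∷ b ∷ c ∷ []) [] (inv (# 0) ⊙ # 1 ⊙ (inv (# 1) ⊙ # 2)) (inv (# 0) ⊙ # 2) refl)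
        (additive-≼ (proj₂ both))
    where
    both : Additive a ((a ⁻¹ · b) · (b ⁻¹ · c)) × Additive (a ⁻¹ · b) (b ⁻¹ · c)
    both = additive-assocʳ (subst (λ x → Additive x (b ⁻¹ · c)) (sym (cancelˡ′ a b)) (≼-additive q)) (≼-additive p)
    c≡ : a · ((a ⁻¹ · b) · (b ⁻¹ · c)) ≡ c
    c≡ = group (a ∷ b ∷ c ∷ []) [] (# 0 ⊙ (inv (# 0) ⊙ # 1 ⊙ (inv (# 1) ⊙ # 2))) (# 2) refl

  ≼-trans : ∀ {a b c} → a ≼ b → b ≼ c → a ≼ c
  ≼-trans p q = proj₁ (≼-quotient p q)

  ≼-conj : ∀ g {a b} → a ≼ b → conj g a ≼ conj g b
  ≼-conj g {a} {b} p = subst (conj g a ≼_)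
    (group (g ∷ a ∷ b ∷ []) [] (# 0 ⊙ # 1 ⊙ inv (# 0) ⊙ (# 0 ⊙ (inv (# 1) ⊙ # 2) ⊙ inv (# 0))) (# 0 ⊙ # 2 ⊙ inv (# 0)) refl)
    (additive-≼ (additive-conj g (≼-additive p)))

  ≼-conj⁻ : ∀ r {a b} → conj (s r) a ≼ conj (s r) b → a ≼ b
  ≼-conj⁻ r p = subst₂ _≼_ (conj-s² r _) (conj-s² r _) (≼-conj (s r) p)

  ≼-cancelʳ : ∀ {a b y} → Additive a y → Additive b y → a · y ≼ b · y → a ≼ b
  ≼-cancelʳ {a} {b} {y} p q le = ℕₚ.+-cancelʳ-≡ (ℓT y) _ _ (trans (sym q) (trans le
    (trans (cong₂ _+_ p (trans (cong ℓT (group (a ∷ b ∷ y ∷ []) []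
        (inv (# 0 ⊙ # 2) ⊙ (# 1 ⊙ # 2)) (inv (# 2) ⊙ (inv (# 0) ⊙ # 1) ⊙ inv (inv (# 2))) refl)) (ℓT-conj (y ⁻¹) _)))
      (trans (ℕₚ.+-assoc (ℓT a) _ _) (trans (cong (ℓT a +_) (ℕₚ.+-comm (ℓT y) _)) (sym (ℕₚ.+-assoc (ℓT a) _ _)))))))

  ≼-mulˡ : ∀ {t a b} → Additive t b → a ≼ b → Additive t a × t · a ≼ t · b
  ≼-mulˡ {t} {a} {b} p q = proj₂ both , subst (t · a ≼_) (trans (assoc _ _ _) (cong (t ·_) (cancelˡ′ a b))) (additive-≼ (proj₁ both))
    where
    both : Additive (t · a) (a ⁻¹ · b) × Additive t a
    both = additive-assocˡ (subst (Additive t) (sym (cancelˡ′ a b)) p) (≼-additive q)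

  Reduced : List W → Set
  Reduced ts = Reflections ts × ℓT (prodW ts) ≡ length ts

  reduced-[] : Reduced []
  reduced-[] = [] , ℓT-e

  reduced-∷ : ∀ {t ts} → IsReflection t → Reduced ts → Additive t (prodW ts) → Reduced (t ∷ ts)
  reduced-∷ tR (R , p) q = tR ∷ R , trans q (cong₂ _+_ (ℓT-refl tR) p)

  reduced-∷⁻ : ∀ {t ts} → Reduced (t ∷ ts) → IsReflection t × Reduced ts × Additive t (prodW ts)
  reduced-∷⁻ {t} {ts} (tR ∷ R , p) = tR , (R , ts≡) , trans p (sym (cong₂ _+_ (ℓT-refl tR) ts≡))
    where
    ts≡ : ℓT (prodW ts) ≡ length ts
    ts≡ = ℕₚ.≤-antisym (ℓT-≤ R refl) (ℕₚ.≤-pred (ℕₚ.≤-trans (ℕₚ.≤-reflexive (sym p))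
      (ℕₚ.≤-trans (ℓT-sub t _) (ℕₚ.≤-reflexive (cong (_+ ℓT (prodW ts)) (ℓT-refl tR))))))

  reduced-++⁻ : ∀ us {vs} → Reduced (us ++ vs) → Reduced us × Reduced vs × Additive (prodW us) (prodW vs)
  reduced-++⁻ [] {vs} R = reduced-[] , R , trans (cong ℓT (identityˡ _)) (cong (_+ ℓT (prodW vs)) (sym ℓT-e))
  reduced-++⁻ (t ∷ us) {vs} R with reduced-∷⁻ R
  ... | tR , R′ , p with reduced-++⁻ us R′
  ...   | U , V , q with additive-assocˡ (subst (Additive t) (prodW-++ us vs) p) q
  ...     | a , b = reduced-∷ tR U b , V , a

  reduced-++ : ∀ {us vs} → Reduced us → Reduced vs → Additive (prodW us) (prodW vs) → Reduced (us ++ vs)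
  reduced-++ {us} {vs} (R , p) (S , q) a = Allₚ.++⁺ R S ,
    trans (cong ℓT (prodW-++ us vs)) (trans a (trans (cong₂ _+_ p q) (sym (Listₚ.length-++ us))))

  reduced-⊑ : ∀ {us ts} → us ⊑ ts → Reduced ts → Reduced us × prodW us ≼ prodW ts
  reduced-⊑ [] R = R , ≼-refl
  reduced-⊑ (t ∷ʳ p) R with reduced-∷⁻ R
  ... | tR , R′ , a with reduced-⊑ p R′
  ...   | U , le = U , ≼-trans le (additive-≼ʳ a)
  reduced-⊑ (refl ∷ p) R with reduced-∷⁻ R
  ... | tR , R′ , a with reduced-⊑ p R′
  ...   | U , le with ≼-mulˡ a le
  ...     | b , le′ = reduced-∷ tR U b , le′

  reducedFactors : ∀ w → ∃ λ ts → Reduced ts × prodW ts ≡ w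
  reducedFactors w with ℓT-word w
  ... | ts , R , p , q = ts , (R , trans (cong ℓT q) (sym p)) , q

  reduced-cong : ∀ {us vs} → Reflections vs → prodW us ≡ prodW vs → length us ≡ length vs → Reduced us → Reduced vs
  reduced-cong R p q (_ , h) = R , trans (cong ℓT (sym p)) (trans h q)

  reduced-conj : ∀ x {ts} → Reduced ts → Reduced (map (conj x) ts)
  reduced-conj x {ts} (R , p) = refls-conj x R ,
    trans (cong ℓT (prodW-conj x ts)) (trans (ℓT-conj x _) (trans p (sym (Listₚ.length-map _ ts))))

  factor-≼ : ∀ {ts t} → Reduced ts → t ∈ ts → t ≼ prodW ts
  factor-≼ {ts} {t} R m = subst (_≼ prodW ts) (identityʳ t) (proj₂ (reduced-⊑ (from∈ m) R))

  -- Rising and falling factorizations into reflections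

  prodW-∷ʳ : ∀ ts t → prodW (ts ++ t ∷ []) ≡ prodW ts · t
  prodW-∷ʳ ts t = trans (prodW-++ ts (t ∷ [])) (cong (prodW ts ·_) (identityʳ t))

  -- Length goes up (b = false) or down (b = true) at each step of the path x, x t₁, x t₁ t₂, …
  Steps : Bool → W → List W → Set
  Steps b x []       = ⊤
  Steps b x (t ∷ ts) = η x t ≡ b × Steps b (x · t) ts

  Up Down : W → List W → Set
  Up   = Steps false
  Down = Steps true

  steps-++ : ∀ {b x} ts {us} → Steps b x ts → Steps b (x · prodW ts) us → Steps b x (ts ++ us)
  steps-++ {b} [] {us} _ q = subst (λ y → Steps b y us) (identityʳ _) q
  steps-++ {b} {x} (t ∷ ts) {us} (p , ps) q = p , steps-++ ts ps (subst (λ y → Steps b y us) (sym (assoc _ _ _)) q)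

  steps-++⁻ : ∀ {b x} ts {us} → Steps b x (ts ++ us) → Steps b x ts × Steps b (x · prodW ts) us
  steps-++⁻ {b} [] {us} q = tt , subst (λ y → Steps b y us) (sym (identityʳ _)) q
  steps-++⁻ {b} {x} (t ∷ ts) {us} (p , q) with steps-++⁻ ts q
  ... | ps , q′ = (p , ps) , subst (λ y → Steps b y us) (assoc _ _ _) q′

  -- Distinct reflections are deleted at different letters. Deleting the left letter first leaves
  -- the part of the word to its right unchanged, so the other reflection can still be exchanged
  -- there; which of the two letters stands further left decides the order of `u` and `t`.
  exchange₂ : ∀ us u t → flips us u ≡ true → flips us t ≡ true → u ≢ t →
              (∃ λ vs → suc (suc (length vs)) ≡ length us × prodS vs ≡ prodS us · u · t) ⊎
              (∃ λ vs → suc (suc (length vs)) ≡ length us × prodS vs ≡ prodS us · t · u)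
  exchange₂ (i ∷ us) u t p q u≢t
    with conj (prodS us) u ≟ s i | flips us u in eu | conj (prodS us) t ≟ s i | flips us t in et
  ... | yes a | _     | yes b | _    = ⊥-elim (u≢t (conj-injective (prodS us) (trans a (sym b))))
  ... | yes a | true  | no b  | _    = case p of λ ()
  ... | yes a | false | no b  | false = case q of λ ()
  ... | yes a | false | no b  | true with exchange us t et
  ...   | vs , v⋖u , h = inj₁ (vs , cong suc (sym (⋖-length v⋖u)) , trans (sym h) (cong (_· t) (headDeletion us u a)))
    where
    headDeletion : ∀ us u → conj (prodS us) u ≡ s i → prodS us ≡ s i · prodS us · u
    headDeletion us u a = sym (trans (assoc _ _ _) (trans (cong (s i ·_)
      (trans (group (prodS us ∷ u ∷ []) [] (# 0 ⊙ # 1) (# 0 ⊙ # 1 ⊙ inv (# 0) ⊙ # 0) refl) (cong (_· prodS us) a)))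
      (group (prodS us ∷ []) (s² i ∷ []) (! 0 ⊙ (! 0 ⊙ # 0)) (# 0) refl)))
  exchange₂ (i ∷ us) u t p q u≢t | no a | false | _ | _ = case p of λ ()
  exchange₂ (i ∷ us) u t p q u≢t | no a | true | yes b | true = case q of λ ()
  exchange₂ (i ∷ us) u t p q u≢t | no a | true | no b | false = case q of λ ()
  exchange₂ (i ∷ us) u t p q u≢t | no a | true | yes b | false with exchange us u eu
  ... | vs , v⋖u , h = inj₂ (vs , cong suc (sym (⋖-length v⋖u)) , trans (sym h) (cong (_· u) headDeletion))
    where
    headDeletion : prodS us ≡ s i · prodS us · t
    headDeletion = sym (trans (assoc _ _ _) (trans (cong (s i ·_)
      (trans (group (prodS us ∷ t ∷ []) [] (# 0 ⊙ # 1) (# 0 ⊙ # 1 ⊙ inv (# 0) ⊙ # 0) refl) (cong (_· prodS us) b)))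
      (group (prodS us ∷ []) (s² i ∷ []) (! 0 ⊙ (! 0 ⊙ # 0)) (# 0) refl)))
  exchange₂ (i ∷ us) u t p q u≢t | no a | true | no b | true with exchange₂ us u t eu et u≢t
  ... | inj₁ (vs , l , h) = inj₁ (i ∷ vs , cong suc l , trans (cong (s i ·_) h) (group (prodS us ∷ u ∷ t ∷ []) (s² i ∷ []) (! 0 ⊙ (# 0 ⊙ # 1 ⊙ # 2)) (! 0 ⊙ # 0 ⊙ # 1 ⊙ # 2) refl))
  ... | inj₂ (vs , l , h) = inj₂ (i ∷ vs , cong suc l , trans (cong (s i ·_) h) (group (prodS us ∷ u ∷ t ∷ []) (s² i ∷ []) (! 0 ⊙ (# 0 ⊙ # 2 ⊙ # 1)) (! 0 ⊙ # 0 ⊙ # 2 ⊙ # 1) refl))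

  peak : ∀ {x u t} → η x u ≡ true → η x t ≡ true → u ≢ t → ℓ (x · u · t) < ℓ x ⊎ ℓ (x · t · u) < ℓ x
  peak {x} {u} {t} p q u≢t with reducedWord x
  ... | us , len , refl with exchange₂ us u t (trans (sym (η-word us u)) p) (trans (sym (η-word us t)) q) u≢t
  ...   | inj₁ (vs , l , h) = inj₁ (ℕₚ.≤-trans (s≤s (ℓ-≤ vs h)) (ℕₚ.≤-trans (ℕₚ.n≤1+n _) (ℕₚ.≤-reflexive (trans l len))))
  ...   | inj₂ (vs , l , h) = inj₂ (ℕₚ.≤-trans (s≤s (ℓ-≤ vs h)) (ℕₚ.≤-trans (ℕₚ.n≤1+n _) (ℕₚ.≤-reflexive (trans l len))))

  -- Replacing a peak x u⁻¹ < x > x t by a lower middle element is a Hurwitz move on the two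
  -- reflections, so it preserves the subgroup they generate.
  record UpFactors (ts : List W) : Set₁ where
    field
      factors  : List W
      reduced  : Reduced factors
      product  : prodW factors ≡ prodW ts
      size     : length factors ≡ length ts
      ascends  : Up e factors
      transfer : ∀ {J} → All (Par J) factors → All (Par J) ts

  -- Induction on the number of factors, and inside it on a bound for the length at a peak.
  -- Appending a factor that falls creates a peak; a Hurwitz move lowers its middle element, the
  -- initial part is sorted again, and the new last factor is appended under a smaller bound.
  -- `transfer` survives because conjugation recovers the old pair of factors from the new one.
  upFactors : ∀ ts → Reduced ts → UpFactors ts
  upFactors ts = go (length ts) ts refl
    where
    open UpFactors
    go : ∀ k ts → length ts ≡ k → Reduced ts → UpFactors ts
    lower : ∀ k b us t → length us ≡ k → Reduced (us ++ t ∷ []) → Up e us → ℓ (prodW us) ≤ b → UpFactors (us ++ t ∷ [])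

    lowerPeak : ∀ k b vs u t → length (vs ++ u ∷ []) ≡ k → Reduced ((vs ++ u ∷ []) ++ t ∷ []) → Up e (vs ++ u ∷ []) →
                ℓ (prodW (vs ++ u ∷ [])) ≤ b → η (prodW (vs ++ u ∷ [])) t ≡ true → UpFactors ((vs ++ u ∷ []) ++ t ∷ [])
    replace : ∀ k b vs x u t v z → length (vs ++ u ∷ []) ≡ k → Reduced ((vs ++ u ∷ []) ++ t ∷ []) →
              x ≡ prodW vs · u → IsReflection v → IsReflection z → v · z ≡ u · t →
              (∀ {J} → Par J v → Par J z → Par J u × Par J t) →
              ℓ (prodW vs · v) ≤ b → UpFactors ((vs ++ u ∷ []) ++ t ∷ [])
    replace k b vs x u t v z len R refl vR zR vz≡ut back le = record
      { factors = factors last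
      ; reduced = reduced last
      ; product = trans (product last) (trans (prodW-∷ʳ (factors mid) z) (trans (cong (_· z) (product mid)) same))
      ; size = trans (size last) (trans (length-∷ʳ (factors mid) z) (trans (cong suc (size mid))
          (trans (cong suc (trans (length-∷ʳ vs v) (sym (length-∷ʳ vs u)))) (sym (length-∷ʳ (vs ++ u ∷ []) t)))))
      ; ascends = ascends last
      ; transfer = λ {J} ps →
          let qs = transfer last {J} ps
              rs = transfer mid {J} (Allₚ.++⁻ˡ (factors mid) qs)
              uv = back (All.head (Allₚ.++⁻ʳ vs rs)) (All.head (Allₚ.++⁻ʳ (factors mid) qs))
          in Allₚ.++⁺ (Allₚ.++⁺ (Allₚ.++⁻ˡ vs rs) (proj₁ uv ∷ [])) (proj₂ uv ∷ [])
      }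
      where
      same : prodW (vs ++ v ∷ []) · z ≡ prodW ((vs ++ u ∷ []) ++ t ∷ [])
      same = trans (cong (_· z) (prodW-∷ʳ vs v)) (trans (assoc _ _ _) (trans (cong (prodW vs ·_) vz≡ut)
        (trans (sym (assoc _ _ _)) (trans (cong (_· t) (sym (prodW-∷ʳ vs u))) (sym (prodW-∷ʳ (vs ++ u ∷ []) t))))))
      R-vs : Reflections vs
      R-vs = proj₁ (proj₁ (reduced-++⁻ vs (proj₁ (reduced-++⁻ (vs ++ u ∷ []) R))))
      R-new : Reduced ((vs ++ v ∷ []) ++ z ∷ [])
      R-new = reduced-cong (Allₚ.++⁺ (Allₚ.++⁺ R-vs (vR ∷ [])) (zR ∷ []))
        (sym (trans (prodW-∷ʳ (vs ++ v ∷ []) z) same))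
        (trans (length-∷ʳ (vs ++ u ∷ []) t) (trans (cong suc (trans (length-∷ʳ vs u) (sym (length-∷ʳ vs v)))) (sym (length-∷ʳ (vs ++ v ∷ []) z)))) R
      len-mid : length (vs ++ v ∷ []) ≡ k
      len-mid = trans (length-∷ʳ vs v) (trans (sym (length-∷ʳ vs u)) len)
      mid : UpFactors (vs ++ v ∷ [])
      mid = go k (vs ++ v ∷ []) len-mid (proj₁ (reduced-++⁻ (vs ++ v ∷ []) R-new))
      last : UpFactors (factors mid ++ z ∷ [])
      last = lower k b (factors mid) z (trans (size mid) len-mid)
        (reduced-cong (Allₚ.++⁺ (proj₁ (reduced mid)) (zR ∷ []))
          (trans (prodW-∷ʳ (vs ++ v ∷ []) z) (trans (cong (_· z) (sym (product mid))) (sym (prodW-∷ʳ (factors mid) z))))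
          (trans (length-∷ʳ (vs ++ v ∷ []) z) (trans (cong suc (sym (size mid))) (sym (length-∷ʳ (factors mid) z)))) R-new)
        (ascends mid) (ℕₚ.≤-trans (ℕₚ.≤-reflexive (cong ℓ (trans (product mid) (prodW-∷ʳ vs v)))) le)

    lower k b us t len R up le with η (prodW us) t in eq
    ... | false = record { factors = us ++ t ∷ [] ; reduced = R ; product = refl ; size = refl
                         ; ascends = steps-++ us up (subst (λ y → η y t ≡ false) (sym (identityˡ _)) eq , tt)
                         ; transfer = id }
    ... | true with initLast us
    ...   | [] = case trans (sym eq) (η-e t) of λ ()
    ...   | vs ∷ʳ′ u = lowerPeak k b vs u t len R up le eq

    lowerPeak k zero vs u t len R up le eq with () ← ℕₚ.≤-trans (η-true⇒ℓ eq) le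
    -- `peak` selects one of two Hurwitz moves: the new middle element is `x · u · t` or
    -- `x · t · u`, whichever is known to be shorter than `x`.
    lowerPeak k (suc b) vs u t len R up le eq = [ left , right ]′ (peak ηxu eq u≢t)
      where
      x = prodW (vs ++ u ∷ [])
      uR : IsReflection u
      uR = All.head (Allₚ.++⁻ʳ vs (proj₁ (proj₁ (reduced-++⁻ (vs ++ u ∷ []) R))))
      tR : IsReflection t
      tR = All.head (Allₚ.++⁻ʳ (vs ++ u ∷ []) (proj₁ R))
      ηxu : η x u ≡ true
      ηxu = trans (cong (λ y → η y u) (prodW-∷ʳ vs u)) (η-up uR
        (subst (λ y → η y u ≡ false) (identityˡ _) (proj₁ (proj₂ (steps-++⁻ vs up)))))
      u≢t : u ≢ t
      u≢t u≡t = ℕₚ.m+1+n≰m (length vs) {1} (subst (_≤ length vs)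
        (trans (proj₂ R) (trans (length-∷ʳ (vs ++ u ∷ []) t) (trans (cong suc (length-∷ʳ vs u)) (sym (ℕₚ.+-comm (length vs) 2)))))
        (ℓT-≤ (Allₚ.++⁻ˡ vs (Allₚ.++⁻ˡ (vs ++ u ∷ []) (proj₁ R)))
          (sym (trans (prodW-∷ʳ (vs ++ u ∷ []) t) (trans (cong₂ _·_ (prodW-∷ʳ vs u) (sym u≡t)) (tt-cancel _ uR))))))
      tut≡ : t · conj t u ≡ u · t
      tut≡ = trans (cong (λ y → t · (t · u · y)) (refl-⁻¹ tR))
        (group (u ∷ []) (invol² tR ∷ []) (! 0 ⊙ (! 0 ⊙ # 0 ⊙ ! 0)) (# 0 ⊙ ! 0) refl)
      mid₁ : prodW vs · t ≡ x · u · t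
      mid₁ = sym (trans (cong (λ y → y · u · t) (prodW-∷ʳ vs u)) (cong (_· t) (tt-cancel _ uR)))
      mid₂ : prodW vs · conj u t ≡ x · t · u
      mid₂ = trans (cong (λ y → prodW vs · (u · t · y)) (refl-⁻¹ uR))
        (trans (group (prodW vs ∷ u ∷ t ∷ []) [] (# 0 ⊙ (# 1 ⊙ # 2 ⊙ # 1)) (# 0 ⊙ # 1 ⊙ # 2 ⊙ # 1) refl)
          (cong (λ y → y · t · u) (sym (prodW-∷ʳ vs u))))
      left : ℓ (x · u · t) < ℓ x → UpFactors ((vs ++ u ∷ []) ++ t ∷ [])
      left lt = replace k b vs x u t t (conj t u) len R (prodW-∷ʳ vs u) tR (refl-conj t uR) tut≡
        (λ {J} pt pz → subst (Par J) (conj-inv t u) (par-conj (par-⁻¹ pt) pz) , pt)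
        (ℕₚ.≤-pred (ℕₚ.≤-trans (s≤s (ℕₚ.≤-reflexive (cong ℓ mid₁))) (ℕₚ.≤-trans lt le)))
      right : ℓ (x · t · u) < ℓ x → UpFactors ((vs ++ u ∷ []) ++ t ∷ [])
      right lt = replace k b vs x u t (conj u t) u len R (prodW-∷ʳ vs u) (refl-conj u tR) uR
        (group (u ∷ t ∷ []) [] (# 0 ⊙ # 1 ⊙ inv (# 0) ⊙ # 0) (# 0 ⊙ # 1) refl)
        (λ {J} pv pu → pu , subst (Par J) (conj-inv u t) (par-conj (par-⁻¹ pu) pv))
        (ℕₚ.≤-pred (ℕₚ.≤-trans (s≤s (ℕₚ.≤-reflexive (cong ℓ mid₂))) (ℕₚ.≤-trans lt le)))

    go k ts len R with initLast ts
    go k .[] len R | [] = record { factors = [] ; reduced = R ; product = refl ; size = refl ; ascends = tt ; transfer = id }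
    go zero .(us ++ t ∷ []) len R | us ∷ʳ′ t with () ← trans (sym (length-∷ʳ us t)) len
    go (suc k) .(us ++ t ∷ []) len R | us ∷ʳ′ t = record
      { factors = factors last ; reduced = reduced last
      ; product = trans (product last) (trans (prodW-∷ʳ (factors init) t) (trans (cong (_· t) (product init)) (sym (prodW-∷ʳ us t))))
      ; size = trans (size last) (trans (length-∷ʳ (factors init) t) (trans (cong suc (size init)) (sym (length-∷ʳ us t))))
      ; ascends = ascends last
      ; transfer = λ ps → let qs = transfer last ps in
          Allₚ.++⁺ (transfer init (Allₚ.++⁻ˡ (factors init) qs)) (Allₚ.++⁻ʳ (factors init) qs) }
      where
      len-us : length us ≡ k
      len-us = ℕₚ.suc-injective (trans (sym (length-∷ʳ us t)) len)
      init : UpFactors us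
      init = go k us len-us (proj₁ (reduced-++⁻ us R))
      last : UpFactors (factors init ++ t ∷ [])
      last = lower k (ℓ (prodW (factors init))) (factors init) t (trans (size init) len-us)
        (reduced-cong (Allₚ.++⁺ (proj₁ (reduced init)) (Allₚ.++⁻ʳ us (proj₁ R)))
          (trans (prodW-∷ʳ us t) (trans (cong (_· t) (sym (product init))) (sym (prodW-∷ʳ (factors init) t))))
          (trans (length-∷ʳ us t) (trans (cong suc (sym (size init))) (sym (length-∷ʳ (factors init) t)))) R)
        (ascends init) ℕₚ.≤-refl

  ⋖⇒⊑ : ∀ {us vs ws} → us ⋖ vs → vs ⊑ ws → us ⊑ ws
  ⋖⇒⊑ p        (w ∷ʳ q)   = w ∷ʳ ⋖⇒⊑ p q
  ⋖⇒⊑ drop     (refl ∷ q) = _ ∷ʳ q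
  ⋖⇒⊑ (keep p) (refl ∷ q) = refl ∷ ⋖⇒⊑ p q

  -- Walk down the rising path from its end: each factor is an inversion of the element reached, and
  -- exchange deletes one letter for it.
  subword : ∀ {us} y ρ → Reflections us → Up y us → prodS ρ ≡ y · prodW us →
            ∃ λ σ → σ ⊑ ρ × length ρ ≡ length us + length σ × prodS σ ≡ y
  subword {[]} y ρ [] _ p = ρ , ⊑-refl , refl , trans p (identityʳ y)
  subword {u ∷ us} y ρ (uR ∷ R) (q , up) p with subword (y · u) ρ R up (trans p (sym (assoc _ _ _)))
  ... | σ , σ⊑ρ , len , h with exchangeʷ σ u h (η-up uR q)
  ...   | τ , τ⋖σ , k = τ , ⋖⇒⊑ τ⋖σ σ⊑ρ ,
          trans len (trans (cong (length us +_) (⋖-length τ⋖σ)) (ℕₚ.+-suc _ _)) , trans (sym k) (tt-cancel y uR)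

  up-par : ∀ {J us} y → Reflections us → Up y us → Par J (y · prodW us) → Par J y × All (Par J) us
  up-par {us = []} y _ _ p = subst (Par _) (identityʳ y) p , []
  up-par {J} {u ∷ us} y (uR ∷ R) (q , up) p with up-par (y · u) R up (subst (Par J) (sym (assoc _ _ _)) p)
  ... | pyu , ps with par-exchange pyu (η-up uR q)
  ...   | pu = par-cancelʳ pu pyu , pu ∷ ps

  -- In a rising factorization each factor is an inversion of the partial product that it completes,
  -- so `par-exchange` keeps it in the subgroup; `transfer` carries this back to an arbitrary
  -- shortest factorization.
  parabolic : ∀ {J ts} → Reduced ts → Par J (prodW ts) → All (Par J) ts
  parabolic {J} {ts} R p = transfer (proj₂ (up-par e (proj₁ reduced) ascends
    (subst (Par J) (trans (sym product) (sym (identityˡ _))) p)))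
    where open UpFactors (upFactors ts R)

  par-prodW : ∀ {J ts} → All (Par J) ts → Par J (prodW ts)
  par-prodW []       = par-e
  par-prodW (p ∷ ps) = par-· p (par-prodW ps)

  par-≼ : ∀ {J v w} → v ≼ w → Par J w → Par J v
  par-≼ {J} {v} {w} le p with reducedFactors v | reducedFactors (v ⁻¹ · w)
  ... | ts , R , refl | us , S , q = par-prodW (Allₚ.++⁻ˡ ts (parabolic {J} {ts ++ us}
    (reduced-++ R S (subst (Additive (prodW ts)) (sym q) (≼-additive le)))
    (subst (Par J) (sym (trans (prodW-++ ts us) (trans (cong (prodW ts ·_) q) (cancelˡ′ _ w)))) p)))

  -- Words with distinct letters

  AllPairs-⊑ : ∀ {A : Set} {R : A → A → Set} {us vs : List A} → us ⊑ vs → AllPairs R vs → AllPairs R us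
  AllPairs-⊑ []         _        = []
  AllPairs-⊑ (_ ∷ʳ p)   (_ ∷ u)  = AllPairs-⊑ p u
  AllPairs-⊑ (refl ∷ p) (q ∷ u)  = ⊑ₚ.All-resp-⊆ p q ∷ AllPairs-⊑ p u

  unique-head : ∀ {A : Set} {x : A} {xs} → Unique (x ∷ xs) → All (_≢ x) xs
  unique-head (p ∷ _) = All.map (λ q eq → q (sym eq)) p

  without-word : ∀ {r ws} → All (_≢ r) ws → Without r (prodS ws)
  without-word p = _ , p , refl

  unique-product : ∀ {σ} → Unique σ → prodS σ ≡ e → σ ≡ []
  unique-product {[]}    _ _ = refl
  unique-product {r ∷ σ} u p = ⊥-elim (¬without-s
    (subst (Without r) (sym (trans (sym (⁻¹-involutive _)) (cong _⁻¹ (sym (inverse-unique p)))))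
      (par-⁻¹ (without-word (unique-head u)))))

  -- A rising shortest factorization deletes one letter per factor. What remains is a word with
  -- distinct letters and product `e`, hence empty, so there are as many factors as letters.
  ℓT-prodS : ∀ {ws} → Unique ws → ℓT (prodS ws) ≡ length ws
  ℓT-prodS {ws} u with reducedFactors (prodS ws)
  ... | ts , R , p with upFactors ts R
  ...   | up with subword e ws (proj₁ (UpFactors.reduced up)) (UpFactors.ascends up)
                     (sym (trans (identityˡ _) (trans (UpFactors.product up) p)))
  ...     | σ , σ⊑ws , len , h rewrite unique-product (AllPairs-⊑ σ⊑ws u) h =
            trans (cong ℓT (sym p)) (trans (proj₂ R) (trans (sym (UpFactors.size up)) (trans (sym (ℕₚ.+-identityʳ _)) (sym len))))

  AllPairs-↭ : ∀ {A : Set} {R : A → A → Set} → (∀ {x y} → R x y → R y x) →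
               ∀ {xs ys} → xs ↭ ys → AllPairs R xs → AllPairs R ys
  AllPairs-↭ _ Perm.refl h = h
  AllPairs-↭ sm (Perm.prep x p) (q ∷ h) = ↭ₚ.All-resp-↭ p q ∷ AllPairs-↭ sm p h
  AllPairs-↭ sm (Perm.swap x y p) ((xy ∷ qx) ∷ qy ∷ h) =
    (sm xy ∷ ↭ₚ.All-resp-↭ p qy) ∷ ↭ₚ.All-resp-↭ p qx ∷ AllPairs-↭ sm p h
  AllPairs-↭ sm (Perm.trans p q) h = AllPairs-↭ sm q (AllPairs-↭ sm p h)

  rotate : ∀ {r ws} → Unique (r ∷ ws) → Unique {A = Fin n} (ws ++ r ∷ [])
  rotate {r} {ws} u = AllPairs-↭ ≢-sym (↭ₚ.∷↭∷ʳ r ws) u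

  deletions : ∀ {σ ρ} → σ ⊑ ρ → ∃ λ ts → Reflections ts × length ρ ≡ length σ + length ts × prodS ρ ≡ prodS σ · prodW ts
  deletions [] = [] , [] , refl , sym (identityʳ e)
  deletions {σ} {i ∷ ρ} (i ∷ʳ p) with deletions p
  ... | ts , R , len , h = conj (prodS σ ⁻¹) (s i) ∷ ts , refl-conj _ (refl-s i) ∷ R ,
    trans (cong suc len) (sym (ℕₚ.+-suc _ _)) ,
    trans (cong (s i ·_) h) (group (prodS σ ∷ s i ∷ prodW ts ∷ []) []
      (# 1 ⊙ (# 0 ⊙ # 2)) (# 0 ⊙ (inv (# 0) ⊙ # 1 ⊙ inv (inv (# 0)) ⊙ # 2)) refl)
  deletions {i ∷ σ} {i ∷ ρ} (refl ∷ p) with deletions p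
  ... | ts , R , len , h = ts , R , cong suc len , trans (cong (s i ·_) h) (sym (assoc _ _ _))

  ℓT-deletions : ∀ {σ ρ} → σ ⊑ ρ → prodS σ ≡ e → length σ + ℓT (prodS ρ) ≤ length ρ
  ℓT-deletions {σ} {ρ} p h with deletions p
  ... | ts , R , len , q = ℕₚ.≤-trans (ℕₚ.+-monoʳ-≤ (length σ)
    (ℓT-≤ R (sym (trans q (trans (cong (_· prodW ts) h) (identityˡ _)))))) (ℕₚ.≤-reflexive (sym len))

  ⊑-split : ∀ {A : Set} {σ : List A} us {x vs} → σ ⊑ (us ++ x ∷ vs) →
            σ ⊑ (us ++ vs) ⊎ ∃₂ λ σ₁ σ₂ → σ ≡ σ₁ ++ x ∷ σ₂ × σ₁ ⊑ us × σ₂ ⊑ vs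
  ⊑-split [] (_ ∷ʳ p)   = inj₁ p
  ⊑-split [] (refl ∷ p) = inj₂ ([] , _ , refl , [] , p)
  ⊑-split (u ∷ us) (_ ∷ʳ p) with ⊑-split us p
  ... | inj₁ q = inj₁ (u ∷ʳ q)
  ... | inj₂ (σ₁ , σ₂ , h , q₁ , q₂) = inj₂ (σ₁ , σ₂ , h , u ∷ʳ q₁ , q₂)
  ⊑-split (u ∷ us) (refl ∷ p) with ⊑-split us p
  ... | inj₁ q = inj₁ (refl ∷ q)
  ... | inj₂ (σ₁ , σ₂ , refl , q₁ , q₂) = inj₂ (u ∷ σ₁ , σ₂ , refl , refl ∷ q₁ , q₂)

  -- In a shortest factorization of a word with a single letter r, that letter must be deleted:
  -- s r is not a product of other letters.
  ℓT-single : ∀ {r ρ τ} → All (_≢ r) ρ → All (_≢ r) τ → suc (ℓT (prodS (ρ ++ τ))) ≤ ℓT (prodS (ρ ++ r ∷ τ))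
  ℓT-single {r} {ρ} {τ} ρ≢r τ≢r with reducedFactors (prodS (ρ ++ r ∷ τ))
  ... | ts , R , ts≡ with upFactors ts R
  ...   | up with subword e (ρ ++ r ∷ τ) (proj₁ (UpFactors.reduced up)) (UpFactors.ascends up)
                  (sym (trans (identityˡ _) (trans (UpFactors.product up) ts≡)))
  ...     | σ , σ⊑ , len , h with ⊑-split ρ σ⊑
  ...       | inj₂ (σ₁ , σ₂ , refl , q₁ , q₂) = ⊥-elim (¬without-s (subst (Without r) s≡
                (par-· (par-⁻¹ (without-word (⊑ₚ.All-resp-⊆ q₁ ρ≢r))) (par-⁻¹ (without-word (⊑ₚ.All-resp-⊆ q₂ τ≢r))))))
    where
    s≡ : prodS σ₁ ⁻¹ · prodS σ₂ ⁻¹ ≡ s r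
    s≡ = trans (cong (_· prodS σ₂ ⁻¹) (trans (sym (identityʳ _)) (cong (prodS σ₁ ⁻¹ ·_) (trans (sym h) (prodS-++ σ₁ _)))))
      (group (prodS σ₁ ∷ prodS σ₂ ∷ []) (s² r ∷ []) (inv (# 0) ⊙ (# 0 ⊙ (! 0 ⊙ # 1)) ⊙ inv (# 1)) (! 0) refl)
  ...       | inj₁ q = ℕₚ.+-cancelˡ-≤ (length σ) _ _ (begin
    length σ + suc (ℓT (prodS (ρ ++ τ)))     ≡⟨ ℕₚ.+-suc _ _ ⟩
    suc (length σ + ℓT (prodS (ρ ++ τ)))     ≤⟨ s≤s (ℓT-deletions q h) ⟩
    suc (length (ρ ++ τ))                    ≡⟨ sym (Listₚ.length-++-sucʳ ρ r τ) ⟩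
    length (ρ ++ r ∷ τ)                      ≡⟨ len ⟩
    length (UpFactors.factors up) + length σ ≡⟨ ℕₚ.+-comm _ (length σ) ⟩
    length σ + length (UpFactors.factors up) ≡⟨ cong (length σ +_) (trans (UpFactors.size up) (trans (sym (proj₂ R)) (cong ℓT ts≡))) ⟩
    length σ + ℓT (prodS (ρ ++ r ∷ τ))       ∎)
    where open ℕₚ.≤-Reasoning

  -- Stripping and rotating the head letter of a Coxeter word

  module Head (r : Fin n) (ws : List (Fin n)) (uniq : Unique (r ∷ ws)) where

    c c′ : W
    c  = prodS (r ∷ ws)
    c′ = prodS ws

    uniq′ : Unique ws
    uniq′ = AllPairs.tail uniq

    others : All (_≢ r) ws
    others = unique-head uniq

    c′-without : Without r c′
    c′-without = without-word others

    ℓT-c : ℓT c ≡ suc (ℓT c′)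
    ℓT-c = trans (ℓT-prodS uniq) (cong suc (sym (ℓT-prodS uniq′)))

    additive-c : Additive (s r) c′
    additive-c = trans ℓT-c (cong (_+ ℓT c′) (sym (ℓT-refl (refl-s r))))

    c′≼c : c′ ≼ c
    c′≼c = additive-≼ʳ additive-c

    s≼c : s r ≼ c
    s≼c = additive-≼ additive-c

    s·c : s r · c ≡ c′
    s·c = group (c′ ∷ []) (s² r ∷ []) (! 0 ⊙ (! 0 ⊙ # 0)) (# 0) refl

    ≼c′⇒≼c : ∀ {w} → w ≼ c′ → w ≼ c
    ≼c′⇒≼c p = ≼-trans p c′≼c

    ≼c′⇒without : ∀ {w} → w ≼ c′ → Without r w
    ≼c′⇒without p = par-≼ p c′-without

    -- With a word for `w ⁻¹` that avoids `r`, the element `w ⁻¹ · c` is given by a word containing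
    -- `r` once. By `ℓT-single`, removing this letter lowers the absolute length by at least one,
    -- which leaves no slack in the triangle inequality for `c′`.
    without⇒≼c′ : ∀ {w} → w ≼ c → Without r w → w ≼ c′
    without⇒≼c′ {w} le pw with par-⁻¹ pw
    ... | ρ , ρ≢r , ρ≡ = ℕₚ.≤-antisym (subst (_≤ ℓT w + ℓT (w ⁻¹ · c′)) (cong ℓT (cancelˡ′ w c′)) (ℓT-sub w _)) (ℕₚ.≤-pred bound)
      where
      short : suc (ℓT (w ⁻¹ · c′)) ≤ ℓT (w ⁻¹ · c)
      short = subst₂ (λ x y → suc (ℓT x) ≤ ℓT y) (trans (prodS-++ ρ ws) (cong (_· c′) ρ≡))
        (trans (prodS-++ ρ (r ∷ ws)) (cong (_· c) ρ≡)) (ℓT-single ρ≢r others)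
      bound : suc (ℓT w + ℓT (w ⁻¹ · c′)) ≤ suc (ℓT c′)
      bound = subst₂ _≤_ (ℕₚ.+-suc _ _) (trans (sym le) ℓT-c) (ℕₚ.+-monoʳ-≤ (ℓT w) short)

    strip : ∀ {α} → s r ≼ α → α ≼ c → s r · α ≼ c′
    strip {α} p q = subst₂ _≼_ (cong (_· α) (s⁻¹ r)) (trans (cong (_· c) (s⁻¹ r)) s·c) (proj₂ (≼-quotient p q))

    additive-s : ∀ {α} → α ≼ c′ → Additive (s r) α
    additive-s p = proj₁ (≼-mulˡ additive-c p)

    s·≼c : ∀ {α} → α ≼ c′ → s r · α ≼ c
    s·≼c p = proj₂ (≼-mulˡ additive-c p)

    c* : W
    c* = prodS (ws ++ r ∷ [])

    c*≡c′s : c* ≡ c′ · s r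
    c*≡c′s = prodS-∷ʳ ws r

    c*≡ : c* ≡ conj (s r) c
    c*≡ = trans c*≡c′s (group (c′ ∷ []) (s² r ∷ []) (# 0 ⊙ ! 0) (! 0 ⊙ (! 0 ⊙ # 0) ⊙ inv (! 0)) refl)

    ≼-rot : ∀ {w} → w ≼ c → conj (s r) w ≼ c*
    ≼-rot {w} p = subst (conj (s r) w ≼_) (sym c*≡) (≼-conj (s r) p)

    ≼-rot⁻ : ∀ {w} → conj (s r) w ≼ c* → w ≼ c
    ≼-rot⁻ {w} p = ≼-conj⁻ r (subst (conj (s r) w ≼_) c*≡ p)

    conj-·s : ∀ x → conj (s r) (x · s r) ≡ conj (s r) x · s r
    conj-·s x = group (x ∷ []) (s² r ∷ []) (! 0 ⊙ (# 0 ⊙ ! 0) ⊙ inv (! 0)) (! 0 ⊙ # 0 ⊙ inv (! 0) ⊙ ! 0) refl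

    conj-ss : conj (s r) (s r) ≡ s r
    conj-ss = group [] (s² r ∷ []) (! 0 ⊙ ! 0 ⊙ inv (! 0)) (! 0) refl

    additive-c′s : Additive c′ (s r)
    additive-c′s = trans (cong ℓT (trans (sym c*≡c′s) c*≡)) (trans (ℓT-conj (s r) c) (trans additive-c (ℕₚ.+-comm (ℓT (s r)) _)))

    -- Conjugation by `s r` turns the hypothesis into a comparison of `conj (s r) α · s r` with
    -- `c* = c′ · s r`, where the common last factor cancels.
    conj≼c′ : ∀ {α} → Additive α (s r) → α · s r ≼ c → conj (s r) α ≼ c′
    conj≼c′ {α} a p = ≼-cancelʳ (subst (Additive (conj (s r) α)) conj-ss (additive-conj (s r) a)) additive-c′s
      (subst₂ _≼_ (conj-·s α) c*≡c′s (≼-rot p))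

    ·s≼c : ∀ {α} → conj (s r) α ≼ c′ → Additive α (s r) × α · s r ≼ c
    ·s≼c {α} p = subst₂ Additive (conj-s² r α) conj-ss (additive-conj (s r) α*s) ,
      ≼-rot⁻ (subst₂ _≼_ (sym (conj-·s α)) (sym c*≡c′s) α*s≼)
      where
      α* = conj (s r) α
      sα*≡ : conj (s r) (s r · α*) ≡ α* · s r
      sα*≡ = group (α* ∷ []) (s² r ∷ []) (! 0 ⊙ (! 0 ⊙ # 0) ⊙ inv (! 0)) (# 0 ⊙ ! 0) refl
      α*s : Additive α* (s r)
      α*s = trans (cong ℓT (sym sα*≡)) (trans (ℓT-conj (s r) _) (trans (additive-s p) (ℕₚ.+-comm (ℓT (s r)) _)))
      α*s≼ : α* · s r ≼ c′ · s r
      α*s≼ = subst₂ _≼_ sα*≡ (trans (sym c*≡) c*≡c′s) (≼-conj (s r) (s·≼c p))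

    -- The step is left multiplication by `s r`, and stripping the head letter from
    -- `x · t = s r · x` leaves `x`.
    crossing : ∀ {x t} → conj x t ≡ s r → Additive x t → IsReflection t → x · t ≼ c → x ≼ c′
    crossing {x} {t} p a tR le = subst (_≼ c′) (group (x ∷ []) (s² r ∷ []) (! 0 ⊙ (! 0 ⊙ # 0)) (# 0) refl)
      (strip (additive-≼ (trans (cong ℓT (sym xt≡)) (trans a (trans (ℕₚ.+-comm (ℓT x) _)
          (cong (_+ ℓT x) (trans (ℓT-refl tR) (sym (ℓT-refl (refl-s r)))))))))
        (subst (_≼ c) xt≡ le))
      where
      xt≡ : x · t ≡ s r · x
      xt≡ = trans (group (x ∷ t ∷ []) [] (# 0 ⊙ # 1) (# 0 ⊙ # 1 ⊙ inv (# 0) ⊙ # 0) refl) (cong (_· x) p)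

  -- An integral form of the geometric representation

  -- Solution of the discrete wave equation on 0 < a < m with w₀ = 0 and w₁ = f: the row k is the
  -- k-th Chebyshev polynomial in the adjacency operator of a path, applied to f. F extends f
  -- antisymmetrically about m.
  module Wave (m : ℕ) (f : ℕ → ℤ) where

    F : ℕ → ℤ
    F b with ℕₚ.<-cmp b m
    ... | Tri.tri< _ _ _ = f b
    ... | Tri.tri≈ _ _ _ = 0ℤ
    ... | Tri.tri> _ _ _ = ℤ.- f (m + m ∸ b)

    F-below : ∀ {b} → b < m → F b ≡ f b
    F-below {b} lt with ℕₚ.<-cmp b m
    ... | Tri.tri< _ _ _ = refl
    ... | Tri.tri≈ ¬p _ _ = ⊥-elim (¬p lt)
    ... | Tri.tri> ¬p _ _ = ⊥-elim (¬p lt)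

    F-anti : ∀ a b → a + b ≡ m + m → F a ≡ ℤ.- F b
    F-anti a b p with ℕₚ.<-cmp a m | ℕₚ.<-cmp b m
    ... | Tri.tri< _ _ _ | Tri.tri> _ _ _ = trans (cong f (sym (trans (cong (_∸ b) (sym p)) (ℕₚ.m+n∸n≡m a b)))) (sym (ℤₚ.neg-involutive _))
    ... | Tri.tri> _ _ _ | Tri.tri< _ _ _ = cong (λ x → ℤ.- f x) (trans (cong (_∸ a) (trans (sym p) (ℕₚ.+-comm a b))) (ℕₚ.m+n∸n≡m b a))
    ... | Tri.tri≈ _ _ _ | Tri.tri≈ _ _ _ = refl
    ... | Tri.tri< lt _ _ | Tri.tri< lt′ _ _ = ⊥-elim (ℕₚ.<-irrefl p (ℕₚ.+-mono-< lt lt′))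
    ... | Tri.tri< lt _ _ | Tri.tri≈ _ q _ = ⊥-elim (ℕₚ.<-irrefl p (ℕₚ.+-mono-<-≤ lt (ℕₚ.≤-reflexive q)))
    ... | Tri.tri≈ _ q _ | Tri.tri< lt _ _ = ⊥-elim (ℕₚ.<-irrefl p (ℕₚ.+-mono-≤-< (ℕₚ.≤-reflexive q) lt))
    ... | Tri.tri> _ _ gt | Tri.tri> _ _ gt′ = ⊥-elim (ℕₚ.<-irrefl (sym p) (ℕₚ.+-mono-< gt gt′))
    ... | Tri.tri> _ _ gt | Tri.tri≈ _ q _ = ⊥-elim (ℕₚ.<-irrefl (sym p) (ℕₚ.+-mono-<-≤ gt (ℕₚ.≤-reflexive (sym q))))
    ... | Tri.tri≈ _ q _ | Tri.tri> _ _ gt = ⊥-elim (ℕₚ.<-irrefl (sym p) (ℕₚ.+-mono-≤-< (ℕₚ.≤-reflexive (sym q)) gt))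

    F-above : (∀ b → 0 < b → b < m → 0ℤ ℤ.≤ f b) → ∀ {b} → m ≤ b → b < m + m → F b ℤ.≤ 0ℤ
    F-above f≥0 {b} le lt with ℕₚ.<-cmp b m
    ... | Tri.tri< b<m _ _ = ⊥-elim (ℕₚ.<⇒≱ b<m le)
    ... | Tri.tri≈ _ _ _ = ℤₚ.≤-refl
    ... | Tri.tri> _ _ gt = ℤₚ.neg-mono-≤ (f≥0 _ (ℕₚ.m<n⇒0<n∸m lt)
      (ℕₚ.+-cancelʳ-< b _ _ (subst (_< m + b) (sym (ℕₚ.m∸n+n≡m (ℕₚ.<⇒≤ lt))) (ℕₚ.+-monoʳ-< m gt))))

    -- Unfolded along the diagonal, `G k a` is the sum of `F` over k + a - 1, k + a - 3, and so on
    -- down to |k - a| + 1: d'Alembert's formula in discrete form. Symmetry in k and a is visible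
    -- from it.
    G : ℕ → ℕ → ℤ
    G zero    a       = 0ℤ
    G (suc k) zero    = 0ℤ
    G (suc k) (suc a) = G k a ℤ.+ F (suc (k + a))

    G-zero : ∀ k → G k 0 ≡ 0ℤ
    G-zero zero    = refl
    G-zero (suc k) = refl

    G-one : ∀ a → G 1 (suc a) ≡ F (suc a)
    G-one a = ℤₚ.+-identityˡ _

    G-wave : ∀ k a → G (suc (suc k)) (suc a) ≡ (G (suc k) (suc (suc a)) ℤ.+ G (suc k) a) ℤ.- G k (suc a)
    G-wave k a = trans (cong (λ j → G (suc k) a ℤ.+ F (suc j)) (sym (ℕₚ.+-suc k a)))
      (solve 3 (λ x y z → x :+ y := ((z :+ y) :+ x) :- z) refl (G (suc k) a) (F (suc (k + suc a))) (G k (suc a)))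
      where open ℤSolver.+-*-Solver

    G-comm : ∀ k a → G k a ≡ G a k
    G-comm zero    a       = sym (G-zero a)
    G-comm (suc k) zero    = refl
    G-comm (suc k) (suc a) = cong₂ ℤ._+_ (G-comm k a) (cong (F ∘ suc) (ℕₚ.+-comm k a))

    G-anti : ∀ k a b → a + b ≡ m + m → k + a ≤ m + m → k + b ≤ m + m → G k a ≡ ℤ.- G k b
    G-anti zero a b _ _ _ = refl
    G-anti (suc zero) zero b p _ lb = ⊥-elim (ℕₚ.<-irrefl p lb)
    G-anti (suc zero) (suc a) zero p la _ = ⊥-elim (ℕₚ.<-irrefl (trans (sym (ℕₚ.+-identityʳ _)) p) la)
    G-anti (suc zero) (suc a) (suc b) p _ _ = trans (G-one a) (trans (F-anti (suc a) (suc b) p) (cong ℤ.-_ (sym (G-one b))))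
    G-anti (suc (suc k)) zero b p _ lb = ⊥-elim (ℕₚ.<-irrefl p (ℕₚ.≤-trans (s≤s (ℕₚ.m≤n+m b (suc k))) lb))
    G-anti (suc (suc k)) (suc a) zero p la _ = ⊥-elim (ℕₚ.<-irrefl (trans (sym (ℕₚ.+-identityʳ _)) p) (ℕₚ.≤-trans (s≤s (ℕₚ.m≤n+m (suc a) (suc k))) la))
    G-anti (suc (suc k)) (suc a) (suc b) p la lb = trans (G-wave k a)
      (trans (cong₂ ℤ._-_ (cong₂ ℤ._+_
          (G-anti (suc k) (suc (suc a)) b (trans (cong suc (sym (ℕₚ.+-suc a b))) p) (subst (_≤ m + m) (cong suc (sym (ℕₚ.+-suc k (suc a)))) la)
            (ℕₚ.≤-trans (ℕₚ.≤-trans (ℕₚ.n≤1+n _) (ℕₚ.≤-reflexive (cong suc (sym (ℕₚ.+-suc k b))))) (ℕₚ.<⇒≤ lb)))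
          (G-anti (suc k) a (suc (suc b)) (trans (ℕₚ.+-suc a (suc b)) p)
            (ℕₚ.≤-trans (ℕₚ.≤-trans (ℕₚ.n≤1+n _) (ℕₚ.≤-reflexive (cong suc (sym (ℕₚ.+-suc k a))))) (ℕₚ.<⇒≤ la))
            (subst (_≤ m + m) (cong suc (sym (ℕₚ.+-suc k (suc b)))) lb)))
          (G-anti k (suc a) (suc b) p (ℕₚ.<⇒≤ (ℕₚ.<⇒≤ la)) (ℕₚ.<⇒≤ (ℕₚ.<⇒≤ lb))))
        (trans (solve 3 (λ x y z → (:- x :+ :- y) :- :- z := :- ((y :+ x) :- z)) refl (G (suc k) b) (G (suc k) (suc (suc b))) (G k (suc b)))
          (cong ℤ.-_ (sym (G-wave k b)))))
      where open ℤSolver.+-*-Solver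

    G-edge : ∀ k → k ≤ m → G k m ≡ 0ℤ
    G-edge k le = self-neg (G k m) (G-anti k m m refl (ℕₚ.+-monoˡ-≤ m le) (ℕₚ.+-monoˡ-≤ m le))
      where
      self-neg : ∀ x → x ≡ ℤ.- x → x ≡ 0ℤ
      self-neg (ℤ.+ zero) _ = refl
      self-neg (ℤ.+ suc _) ()
      self-neg (ℤ.-[1+ _ ]) ()

    -- While k + a is at most m, only nonnegative values of `F` are summed. Beyond that, each
    -- diagonal step adds a value of `F` that is at most 0 and finally reaches an edge, where `G`
    -- vanishes; hence the earlier values are nonnegative.
    G-≥0 : (∀ b → 0 < b → b < m → 0ℤ ℤ.≤ f b) → ∀ k a → k ≤ m → a ≤ m → 0ℤ ℤ.≤ G k a
    G-≥0 f≥0 k a k≤m a≤m = [ small k a , large (m ∸ k) k a (ℕₚ.m+[n∸m]≡n k≤m) a≤m ]′ (ℕₚ.≤-total (k + a) m)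
      where
      small : ∀ k a → k + a ≤ m → 0ℤ ℤ.≤ G k a
      small zero    a       _  = ℤₚ.≤-refl
      small (suc k) zero    _  = ℤₚ.≤-refl
      small (suc k) (suc a) le = ℤₚ.+-mono-≤ (small k a (ℕₚ.≤-trans (ℕₚ.+-mono-≤ (ℕₚ.n≤1+n k) (ℕₚ.n≤1+n a)) le))
        (subst (0ℤ ℤ.≤_) (sym (F-below lt)) (f≥0 _ (s≤s z≤n) lt))
        where lt = subst (_≤ m) (cong suc (ℕₚ.+-suc k a)) le
      large : ∀ j k a → k + j ≡ m → a ≤ m → m ≤ k + a → 0ℤ ℤ.≤ G k a
      large zero k a p a≤m le = ℤₚ.≤-reflexive (sym (trans (cong (λ x → G x a) (trans (sym (ℕₚ.+-identityʳ k)) p)) (trans (G-comm m a) (G-edge a a≤m))))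
      large (suc j) k a p a≤m le with ℕₚ.m≤n⇒m<n∨m≡n a≤m
      ... | inj₂ refl = ℤₚ.≤-reflexive (sym (G-edge k (ℕₚ.m+n≤o⇒m≤o k (ℕₚ.≤-reflexive p))))
      ... | inj₁ a<m = ℤₚ.≤-trans (large j (suc k) (suc a) (trans (sym (ℕₚ.+-suc k j)) p) a<m (ℕₚ.≤-trans le (ℕₚ.+-mono-≤ (ℕₚ.n≤1+n k) (ℕₚ.n≤1+n a))))
            (ℤₚ.≤-trans (ℤₚ.+-monoʳ-≤ (G k a) (F-above f≥0 (ℕₚ.m≤n⇒m≤1+n le)
                (ℕₚ.≤-trans (ℕₚ.≤-reflexive (cong suc (sym (ℕₚ.+-suc k a)))) (ℕₚ.+-mono-≤ k<m a<m))))
              (ℤₚ.≤-reflexive (ℤₚ.+-identityʳ _)))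
        where k<m = subst (suc k ≤_) p (subst (_≤ k + suc j) (ℕₚ.+-comm k 1) (ℕₚ.+-monoʳ-≤ k (s≤s z≤n)))

  least : ∀ {P : ℕ → Set} → (∀ k → Dec (P k)) → ∀ k → P k → ∃ λ m → P m × (∀ j → j < m → ¬ P j)
  least {P} P? k pk with P? 0
  ... | yes p0 = 0 , p0 , λ _ ()
  least {P} P? zero pk | no ¬p0 = ⊥-elim (¬p0 pk)
  least {P} P? (suc k) pk | no ¬p0 with least (P? ∘ suc) k pk
  ... | m , pm , min = suc m , pm , λ { zero _ → ¬p0 ; (suc j) (s≤s lt) → min j lt }

  finiteOrder : ∀ z → ∃ λ k → mpow _·_ e z (suc k) ≡ e
  finiteOrder z with Fₚ.pigeonhole (ℕₚ.n<1+n (length elems)) (λ i → Any.index (elems-complete (mpow _·_ e z (toℕ i))))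
  ... | i , j , i<j , eq = toℕ j ∸ suc (toℕ i) , ·-cancelʳ (mpow _·_ e z (toℕ i))
    (trans (sym (mpow-+ z (suc (toℕ j ∸ suc (toℕ i))) (toℕ i)))
      (trans (cong (mpow _·_ e z) (trans (sym (ℕₚ.+-suc _ (toℕ i))) (ℕₚ.m∸n+n≡m i<j)))
        (trans (sym same) (sym (identityˡ _)))))
    where
    same : mpow _·_ e z (toℕ i) ≡ mpow _·_ e z (toℕ j)
    same = trans (Anyₚ.lookup-index (elems-complete (mpow _·_ e z (toℕ i))))
      (trans (cong (Data.List.lookup elems) eq) (sym (Anyₚ.lookup-index (elems-complete (mpow _·_ e z (toℕ j))))))

  mpow-* : ∀ z q m → mpow _·_ e z m ≡ e → mpow _·_ e z (q * m) ≡ e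
  mpow-* z zero    m p = refl
  mpow-* z (suc q) m p = trans (mpow-+ z m (q * m)) (trans (cong₂ _·_ p (mpow-* z q m p)) (identityˡ e))

  abstract
    leastOrder : ∀ z → ∃ λ k → mpow _·_ e z (suc k) ≡ e × (∀ j → j < k → mpow _·_ e z (suc j) ≢ e)
    leastOrder z = least (λ k → mpow _·_ e z (suc k) ≟ e) (proj₁ (finiteOrder z)) (proj₂ (finiteOrder z))

    order : W → ℕ
    order z = suc (proj₁ (leastOrder z))

    order-power : ∀ z → mpow _·_ e z (order z) ≡ e
    order-power z = proj₁ (proj₂ (leastOrder z))

    order≥2 : ∀ {z} → z ≢ e → 2 ≤ order z
    order≥2 {z} z≢e = go (leastOrder z)
      where
      go : (o : ∃ λ k → mpow _·_ e z (suc k) ≡ e × (∀ j → j < k → mpow _·_ e z (suc j) ≢ e)) → 2 ≤ suc (proj₁ o)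
      go (zero  , p , _) = ⊥-elim (z≢e (trans (sym (identityʳ z)) p))
      go (suc _ , _ , _) = s≤s (s≤s z≤n)

    order-divides : ∀ z k → mpow _·_ e z k ≡ e → ∃ λ q → k ≡ q * order z
    order-divides z k p = go (k ℕ.% order z) (k ℕ./ order z) (ℕDM.m≡m%n+[m/n]*n k (order z)) (ℕDM.m%n<n k (order z))
      where
      go : ∀ j q → k ≡ j + q * order z → j < order z → ∃ λ q → k ≡ q * order z
      go zero    q h _        = q , h
      go (suc j) q h (s≤s lt) = ⊥-elim (proj₂ (proj₂ (leastOrder z)) j lt
        (trans (sym (identityʳ _)) (trans (cong (mpow _·_ e z (suc j) ·_) (sym (mpow-* z q (order z) (order-power z))))
          (trans (sym (mpow-+ z (suc j) _)) (trans (cong (mpow _·_ e z) (sym h)) p)))))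

  -- W acts on integer functions v i d, where d records a position 0 < d_p < m_p on a path for each
  -- pair p of simple reflections: s i negates v i and adds, for each j ≠ i, the sum of v j over the
  -- neighbours of d along the path of {i,j}. The path with m-1 vertices stands in for 2cos(π/m):
  -- its Chebyshev operators below the m-th are nonnegative and the m-th vanishes.
  pairIndex : Fin n → Fin n → Fin (n * n)
  pairIndex i j with toℕ i <?ℕ toℕ j
  ... | yes _ = F.combine i j
  ... | no _  = F.combine j i

  pairIndex-comm : ∀ i j → pairIndex i j ≡ pairIndex j i
  pairIndex-comm i j with toℕ i <?ℕ toℕ j | toℕ j <?ℕ toℕ i
  ... | yes p | yes q = ⊥-elim (ℕₚ.<-asym p q)
  ... | yes _ | no _  = refl
  ... | no _  | yes _ = refl
  ... | no p  | no q  with Fₚ.toℕ-injective (ℕₚ.≤-antisym (ℕₚ.≮⇒≥ q) (ℕₚ.≮⇒≥ p))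
  ...   | refl = refl

  pairOrder : Fin n × Fin n → ℕ
  pairOrder (i , j) with i ≟F j
  -- The diagonal index has no order to record; the value 2 leaves the single position 1, so that
  -- valid positions exist.
  ... | yes _ = 2
  ... | no _  = order (s i · s j)

  pathLength : Fin (n * n) → ℕ
  pathLength p = pairOrder (F.remQuot n p)

  s·s≢e : ∀ {i j} → i ≢ j → s i · s j ≢ e
  s·s≢e {i} {j} i≢j p = i≢j (s-injective i j (trans (sym (⁻¹-involutive (s i))) (trans (cong _⁻¹ (sym (inverse-unique p))) (s⁻¹ j))))

  pairOrder≥2 : ∀ ij → 2 ≤ pairOrder ij
  pairOrder≥2 (i , j) with i ≟F j
  ... | yes _  = ℕₚ.≤-refl
  ... | no i≢j = order≥2 (s·s≢e i≢j)

  pathLength≥2 : ∀ p → 2 ≤ pathLength p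
  pathLength≥2 p = pairOrder≥2 (F.remQuot n p)

  pairOrder-≢ : ∀ {i j} → i ≢ j → pairOrder (i , j) ≡ order (s i · s j)
  pairOrder-≢ {i} {j} i≢j with i ≟F j
  ... | yes p = ⊥-elim (i≢j p)
  ... | no _  = refl

  pathLength-combine : ∀ {i j} → i ≢ j → pathLength (F.combine i j) ≡ order (s i · s j)
  pathLength-combine {i} {j} i≢j = trans (cong pairOrder (Fₚ.remQuot-combine i j)) (pairOrder-≢ i≢j)

  mpow-swap : ∀ i j k → mpow _·_ e (s i · s j) k ≡ e → mpow _·_ e (s j · s i) k ≡ e
  mpow-swap i j k p = trans (DihedralFlips.u⁻¹ i j k) (trans (cong _⁻¹ p) e⁻¹)

  pathLength-divides : ∀ {i j} → i ≢ j → ∀ k → mpow _·_ e (s i · s j) k ≡ e → ∃ λ q → k ≡ q * pathLength (pairIndex i j)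
  pathLength-divides {i} {j} i≢j k p with toℕ i <?ℕ toℕ j
  ... | yes _ = subst (λ m → ∃ λ q → k ≡ q * m) (sym (pathLength-combine i≢j)) (order-divides _ k p)
  ... | no _  = subst (λ m → ∃ λ q → k ≡ q * m) (sym (pathLength-combine (≢-sym i≢j))) (order-divides _ k (mpow-swap i j k p))

  pathLength-power : ∀ {i j} → i ≢ j → mpow _·_ e (s i · s j) (pathLength (pairIndex i j)) ≡ e
  pathLength-power {i} {j} i≢j with toℕ i <?ℕ toℕ j
  ... | yes _ = trans (cong (mpow _·_ e (s i · s j)) (pathLength-combine i≢j)) (order-power _)
  ... | no _  = trans (cong (mpow _·_ e (s i · s j)) (pathLength-combine (≢-sym i≢j))) (mpow-swap j i (order (s j · s i)) (order-power _))

  Position : Set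
  Position = Vec ℕ (n * n)

  InRange : Fin (n * n) → ℕ → Set
  InRange p b = 0 < b × b < pathLength p

  inRange? : ∀ p b → Dec (InRange p b)
  inRange? p b = (0 <?ℕ b) ×-dec (b <?ℕ pathLength p)

  Valid : Position → Set
  Valid d = ∀ p → InRange p (lookup d p)

  valid-update : ∀ d {p b} → Valid d → InRange p b → Valid (d [ p ↦ b ])
  valid-update d {p} {b} vd h q with q ≟F p
  ... | yes refl = subst (InRange p) (sym (Vecₚ.lookup∘updateAt p d)) h
  ... | no q≢p   = subst (InRange q) (sym (Vecₚ.lookup∘updateAt′ q p q≢p d)) (vd q)

  A : Set
  A = Position → ℤ

  infix 4 _≈ᴬ_
  _≈ᴬ_ : A → A → Set
  f ≈ᴬ g = ∀ d → Valid d → f d ≡ g d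

  0ᴬ : A
  0ᴬ _ = 0ℤ

  infixl 6 _+ᴬ_
  _+ᴬ_ : A → A → A
  (f +ᴬ g) d = f d ℤ.+ g d

  -ᴬ_ : A → A
  (-ᴬ f) d = ℤ.- f d

  ≥0ᴬ : A → Set
  ≥0ᴬ f = ∀ d → Valid d → 0ℤ ℤ.≤ f d

  truncated : Fin (n * n) → A → Position → ℕ → ℤ
  truncated p f d b with inRange? p b
  ... | yes _ = f (d [ p ↦ b ])
  ... | no _  = 0ℤ

  neighbours : Fin (n * n) → A → A
  neighbours p f d = truncated p f d (suc (lookup d p)) ℤ.+ truncated p f d (ℕ.pred (lookup d p))

  truncated-in : ∀ {p b} f d → InRange p b → truncated p f d b ≡ f (d [ p ↦ b ])
  truncated-in {p} {b} f d h with inRange? p b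
  ... | yes _ = refl
  ... | no ¬h = ⊥-elim (¬h h)

  truncated-out : ∀ {p b} f d → ¬ InRange p b → truncated p f d b ≡ 0ℤ
  truncated-out {p} {b} f d ¬h with inRange? p b
  ... | yes h = ⊥-elim (¬h h)
  ... | no _  = refl

  truncated-cong : ∀ p {f g} d b → Valid d → f ≈ᴬ g → truncated p f d b ≡ truncated p g d b
  truncated-cong p d b vd h with inRange? p b
  ... | yes r = h _ (valid-update d vd r)
  ... | no _  = refl

  truncated-+ : ∀ p f g d b → truncated p (f +ᴬ g) d b ≡ truncated p f d b ℤ.+ truncated p g d b
  truncated-+ p f g d b with inRange? p b
  ... | yes _ = refl
  ... | no _  = refl

  truncated-neg : ∀ p f d b → truncated p (-ᴬ f) d b ≡ ℤ.- truncated p f d b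
  truncated-neg p f d b with inRange? p b
  ... | yes _ = refl
  ... | no _  = refl

  truncated-0 : ∀ p d b → truncated p 0ᴬ d b ≡ 0ℤ
  truncated-0 p d b with inRange? p b
  ... | yes _ = refl
  ... | no _  = refl

  +-interchange : ∀ a b c d → (a ℤ.+ b) ℤ.+ (c ℤ.+ d) ≡ (a ℤ.+ c) ℤ.+ (b ℤ.+ d)
  +-interchange = solve 4 (λ a b c d → (a :+ b) :+ (c :+ d) := (a :+ c) :+ (b :+ d)) refl
    where open ℤSolver.+-*-Solver

  neighbours-cong : ∀ p {f g} → f ≈ᴬ g → neighbours p f ≈ᴬ neighbours p g
  neighbours-cong p h d vd = cong₂ ℤ._+_ (truncated-cong p d (suc (lookup d p)) vd h) (truncated-cong p d (ℕ.pred (lookup d p)) vd h)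

  neighbours-+ : ∀ p f g d → neighbours p (f +ᴬ g) d ≡ neighbours p f d ℤ.+ neighbours p g d
  neighbours-+ p f g d = trans (cong₂ ℤ._+_ (truncated-+ p f g d (suc (lookup d p))) (truncated-+ p f g d (ℕ.pred (lookup d p)))) 
    (+-interchange (truncated p f d (suc (lookup d p))) (truncated p g d (suc (lookup d p))) (truncated p f d (ℕ.pred (lookup d p))) (truncated p g d (ℕ.pred (lookup d p))))

  neighbours-neg : ∀ p f d → neighbours p (-ᴬ f) d ≡ ℤ.- neighbours p f d
  neighbours-neg p f d = trans (cong₂ ℤ._+_ (truncated-neg p f d (suc (lookup d p))) (truncated-neg p f d (ℕ.pred (lookup d p))))
    (sym (ℤₚ.neg-distrib-+ (truncated p f d (suc (lookup d p))) (truncated p f d (ℕ.pred (lookup d p)))))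

  neighbours-0 : ∀ p d → neighbours p 0ᴬ d ≡ 0ℤ
  neighbours-0 p d = cong₂ ℤ._+_ (truncated-0 p d (suc (lookup d p))) (truncated-0 p d (ℕ.pred (lookup d p)))

  -- With all other coordinates of the position frozen, the recurrence is the wave equation on the
  -- path of `p`. So `w k` is a value of `G`, and its vanishing at `m` and its sign are read off
  -- from `G`.
  module Chebyshev (p : Fin (n * n)) (w : ℕ → A) (w₀ : w 0 ≈ᴬ 0ᴬ)
    (step : ∀ k → w (suc (suc k)) ≈ᴬ neighbours p (w (suc k)) +ᴬ (-ᴬ w k)) where

    m : ℕ
    m = pathLength p

    module At (d : Position) (vd : Valid d) where
      open Wave m (λ b → w 1 (d [ p ↦ b ]))

      neighbour-value : ∀ k → suc k ≤ m → (∀ b → InRange p b → w (suc k) (d [ p ↦ b ]) ≡ G (suc k) b) → ∀ b → InRange p (suc b) →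
                        neighbours p (w (suc k)) (d [ p ↦ suc b ]) ≡ G (suc k) (suc (suc b)) ℤ.+ G (suc k) b
      neighbour-value k le row b h = cong₂ ℤ._+_
          (trans (cong (truncated p (w (suc k)) d′ ∘ suc) at≡) (above (ℕₚ.m≤n⇒m<n∨m≡n (proj₂ h))))
          (trans (cong (truncated p (w (suc k)) d′ ∘ ℕ.pred) at≡) (below b h))
        where
        d′ = d [ p ↦ suc b ]
        at≡ : lookup d′ p ≡ suc b
        at≡ = Vecₚ.lookup∘updateAt p d
        again : ∀ b′ → w (suc k) (d′ [ p ↦ b′ ]) ≡ w (suc k) (d [ p ↦ b′ ])
        again b′ = cong (w (suc k)) (Vecₚ.[]≔-idempotent d p)
        above : suc (suc b) < m ⊎ suc (suc b) ≡ m → truncated p (w (suc k)) d′ (suc (suc b)) ≡ G (suc k) (suc (suc b))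
        above (inj₁ lt) = trans (truncated-in {p} (w (suc k)) d′ (s≤s z≤n , lt)) (trans (again _) (row (suc (suc b)) (s≤s z≤n , lt)))
        above (inj₂ eq) = trans (truncated-out {p} (w (suc k)) d′ (λ r → ℕₚ.<-irrefl eq (proj₂ r)))
          (sym (trans (cong (G (suc k)) eq) (G-edge (suc k) le)))
        below : ∀ b → InRange p (suc b) → truncated p (w (suc k)) d′ b ≡ G (suc k) b
        below zero     _ = truncated-out {p} {0} (w (suc k)) d′ (λ r → ℕₚ.<-irrefl refl (proj₁ r))
        below (suc b′) r = trans (truncated-in {p} (w (suc k)) d′ r′) (trans (again _) (row (suc b′) r′))
          where r′ = s≤s z≤n , ℕₚ.<⇒≤ (proj₂ r)

      value : ∀ k → k ≤ m → ∀ b → InRange p b → w k (d [ p ↦ b ]) ≡ G k b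
      value zero          _  b h = w₀ _ (valid-update d vd h)
      value (suc zero)    _  (suc b) h = sym (trans (G-one b) (F-below (proj₂ h)))
      value (suc (suc k)) le (suc b) h = trans (step k _ (valid-update d vd h))
        (trans (cong₂ ℤ._-_ (neighbour-value k (ℕₚ.<⇒≤ le) (value (suc k) (ℕₚ.<⇒≤ le)) b h)
                            (value k (ℕₚ.≤-trans (ℕₚ.n≤1+n k) (ℕₚ.<⇒≤ le)) (suc b) h)) (sym (G-wave k b)))

      value-here : ∀ k → k ≤ m → w k d ≡ G k (lookup d p)
      value-here k le = trans (cong (w k) (sym (Vecₚ.[]≔-lookup d p))) (value k le _ (vd p))

    vanishes : w m ≈ᴬ 0ᴬ
    vanishes d vd = trans (value-here m ℕₚ.≤-refl) (trans (G-comm m _) (G-edge _ (ℕₚ.<⇒≤ (proj₂ (vd p)))))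
      where
      open At d vd
      open Wave m (λ b → w 1 (d [ p ↦ b ]))

    nonneg : ≥0ᴬ (w 1) → ∀ k → k ≤ m → ≥0ᴬ (w k)
    nonneg h k le d vd = subst (0ℤ ℤ.≤_) (sym (value-here k le))
      (G-≥0 (λ b lo hi → h _ (valid-update d vd (lo , hi))) k _ le (ℕₚ.<⇒≤ (proj₂ (vd p))))
      where
      open At d vd
      open Wave m (λ b → w 1 (d [ p ↦ b ]))

  ΣFin : (Fin n → ℤ) → ℤ
  ΣFin f = foldr (λ i a → f i ℤ.+ a) 0ℤ (allFin n)

  ΣFin-cong : ∀ {f g} → (∀ i → f i ≡ g i) → ΣFin f ≡ ΣFin g
  ΣFin-cong {f} {g} h = go (allFin n)
    where
    go : ∀ is → foldr (λ i a → f i ℤ.+ a) 0ℤ is ≡ foldr (λ i a → g i ℤ.+ a) 0ℤ is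
    go []       = refl
    go (i ∷ is) = cong₂ ℤ._+_ (h i) (go is)

  ΣFin-+ : ∀ f g → ΣFin (λ i → f i ℤ.+ g i) ≡ ΣFin f ℤ.+ ΣFin g
  ΣFin-+ f g = go (allFin n)
    where
    go : ∀ is → foldr (λ i a → (f i ℤ.+ g i) ℤ.+ a) 0ℤ is ≡ foldr (λ i a → f i ℤ.+ a) 0ℤ is ℤ.+ foldr (λ i a → g i ℤ.+ a) 0ℤ is
    go []       = refl
    go (i ∷ is) = trans (cong (λ a → (f i ℤ.+ g i) ℤ.+ a) (go is)) (+-interchange (f i) _ _ _)

  only : Fin n → (Fin n → ℤ) → Fin n → ℤ
  only j f i with i ≟F j
  ... | yes _ = f i
  ... | no _  = 0ℤ

  except : Fin n → (Fin n → ℤ) → Fin n → ℤ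
  except j f i with i ≟F j
  ... | yes _ = 0ℤ
  ... | no _  = f i

  only+except : ∀ j f i → f i ≡ only j f i ℤ.+ except j f i
  only+except j f i with i ≟F j
  ... | yes _ = sym (ℤₚ.+-identityʳ _)
  ... | no _  = sym (ℤₚ.+-identityˡ _)

  except-≢ : ∀ {j i} f → i ≢ j → except j f i ≡ f i
  except-≢ {j} {i} f i≢j with i ≟F j
  ... | yes p = ⊥-elim (i≢j p)
  ... | no _  = refl

  ΣFin-only : ∀ j f → ΣFin (only j f) ≡ f j
  ΣFin-only j f = go (allFin n) (Uniqueₚ.allFin⁺ n) (∈ₚ.∈-allFin j)
    where
    Σ′ = foldr (λ i a → only j f i ℤ.+ a) 0ℤ
    none : ∀ is → All (j ≢_) is → Σ′ is ≡ 0ℤ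
    none [] _ = refl
    none (i ∷ is) (p ∷ ps) with i ≟F j
    ... | yes q = ⊥-elim (p (sym q))
    ... | no _  = trans (ℤₚ.+-identityˡ _) (none is ps)
    go : ∀ is → Unique is → j ∈ is → Σ′ is ≡ f j
    go (i ∷ is) (u ∷ us) m with i ≟F j
    ... | yes refl = trans (cong (λ x → f j ℤ.+ x) (none is u)) (ℤₚ.+-identityʳ _)
    go (i ∷ is) (u ∷ us) (here p)  | no i≢j = ⊥-elim (i≢j (sym p))
    go (i ∷ is) (u ∷ us) (there m) | no i≢j = trans (ℤₚ.+-identityˡ _) (go is us m)

  ΣFin-split : ∀ j f → ΣFin f ≡ f j ℤ.+ ΣFin (except j f)
  ΣFin-split j f = trans (ΣFin-cong (only+except j f)) (trans (ΣFin-+ (only j f) (except j f)) (cong (ℤ._+ ΣFin (except j f)) (ΣFin-only j f)))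

  ΣFin-0 : ∀ {f} → (∀ i → f i ≡ 0ℤ) → ΣFin f ≡ 0ℤ
  ΣFin-0 h = trans (ΣFin-cong h) (zeros (allFin n))
    where
    zeros : ∀ (is : List (Fin n)) → foldr (λ _ a → 0ℤ ℤ.+ a) 0ℤ is ≡ 0ℤ
    zeros []       = refl
    zeros (_ ∷ is) = trans (ℤₚ.+-identityˡ _) (zeros is)

  V : Set
  V = Fin n → A

  infix 4 _≈ⱽ_
  _≈ⱽ_ : V → V → Set
  v ≈ⱽ w = ∀ i → v i ≈ᴬ w i

  infixl 6 _+ⱽ_
  _+ⱽ_ : V → V → V
  (v +ⱽ w) i = v i +ᴬ w i

  0ⱽ : V
  0ⱽ _ = 0ᴬ

  -ⱽ_ : V → V
  (-ⱽ v) i = -ᴬ v i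

  ≈ⱽ-trans : ∀ {u v w} → u ≈ⱽ v → v ≈ⱽ w → u ≈ⱽ w
  ≈ⱽ-trans p q i d vd = trans (p i d vd) (q i d vd)

  ≈ⱽ-sym : ∀ {u v} → u ≈ⱽ v → v ≈ⱽ u
  ≈ⱽ-sym p i d vd = sym (p i d vd)

  linked : Fin n → V → Position → Fin n → ℤ
  linked i v d = except i (λ l → neighbours (pairIndex i l) (v l) d)

  reflect : Fin n → V → V
  reflect i v j with j ≟F i
  ... | yes _ = λ d → ℤ.- v i d ℤ.+ ΣFin (linked i v d)
  ... | no _  = v j

  reflect-same : ∀ i v → reflect i v i ≡ (λ d → ℤ.- v i d ℤ.+ ΣFin (linked i v d))
  reflect-same i v with i ≟F i
  ... | yes _ = refl
  ... | no ¬p = ⊥-elim (¬p refl)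

  reflect-other : ∀ {i j} v → j ≢ i → reflect i v j ≡ v j
  reflect-other {i} {j} v j≢i with j ≟F i
  ... | yes p = ⊥-elim (j≢i p)
  ... | no _  = refl

  reflect-sameᵈ : ∀ i v d → reflect i v i d ≡ ℤ.- v i d ℤ.+ ΣFin (linked i v d)
  reflect-sameᵈ i v d = cong (λ f → f d) (reflect-same i v)

  reflect-otherᵈ : ∀ {i j} v d → j ≢ i → reflect i v j d ≡ v j d
  reflect-otherᵈ v d j≢i = cong (λ f → f d) (reflect-other v j≢i)

  linked-cong : ∀ i {v w} → (∀ j → j ≢ i → v j ≈ᴬ w j) → ∀ d → Valid d → ∀ l → linked i v d l ≡ linked i w d l
  linked-cong i h d vd l with l ≟F i
  ... | yes _  = refl
  ... | no l≢i = neighbours-cong (pairIndex i l) (h l l≢i) d vd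

  reflect-cong : ∀ i {v w} → v ≈ⱽ w → reflect i v ≈ⱽ reflect i w
  reflect-cong i {v} {w} h j d vd with j ≟F i
  ... | yes _ = cong₂ (λ a b → ℤ.- a ℤ.+ b) (h i d vd) (ΣFin-cong (linked-cong i (λ l _ → h l) d vd))
  ... | no _  = h j d vd

  reflect² : ∀ i v → reflect i (reflect i v) ≈ⱽ v
  reflect² i v j d vd with j ≟F i
  ... | no j≢i = reflect-otherᵈ v d j≢i
  ... | yes refl = trans (cong₂ (λ a b → ℤ.- a ℤ.+ b) (reflect-sameᵈ i v d)
      (ΣFin-cong (linked-cong i (λ l l≢i d′ _ → reflect-otherᵈ v d′ l≢i) d vd)))
    (solve 2 (λ a b → :- (:- a :+ b) :+ b := a) refl (v i d) (ΣFin (linked i v d)))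
    where open ℤSolver.+-*-Solver

  reflect-+ : ∀ i v w → reflect i (v +ⱽ w) ≈ⱽ reflect i v +ⱽ reflect i w
  reflect-+ i v w j d vd with j ≟F i
  ... | no _  = refl
  ... | yes _ = trans (cong (λ a → ℤ.- (v i d ℤ.+ w i d) ℤ.+ a) (trans (ΣFin-cong pointwise) (ΣFin-+ (linked i v d) (linked i w d))))
      (solve 4 (λ a b x y → :- (a :+ b) :+ (x :+ y) := (:- a :+ x) :+ (:- b :+ y)) refl (v i d) (w i d) (ΣFin (linked i v d)) (ΣFin (linked i w d)))
    where
    open ℤSolver.+-*-Solver
    pointwise : ∀ l → linked i (v +ⱽ w) d l ≡ linked i v d l ℤ.+ linked i w d l
    pointwise l with l ≟F i
    ... | yes _ = refl
    ... | no _  = neighbours-+ (pairIndex i l) (v l) (w l) d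

  reflect-0 : ∀ i → reflect i 0ⱽ ≈ⱽ 0ⱽ
  reflect-0 i j d vd with j ≟F i
  ... | no _  = refl
  ... | yes _ = trans (ℤₚ.+-identityˡ _) (ΣFin-0 zero-term)
    where
    zero-term : ∀ l → linked i 0ⱽ d l ≡ 0ℤ
    zero-term l with l ≟F i
    ... | yes _ = refl
    ... | no _  = neighbours-0 (pairIndex i l) d

  rest : Fin n → Fin n → V → Position → Fin n → ℤ
  rest i j v d = except j (linked i v d)

  linked-split : ∀ {i j} → i ≢ j → ∀ v d → ΣFin (linked i v d) ≡ neighbours (pairIndex i j) (v j) d ℤ.+ ΣFin (rest i j v d)
  linked-split {i} {j} i≢j v d = trans (ΣFin-split j (linked i v d))
    (cong (ℤ._+ ΣFin (rest i j v d)) (except-≢ (λ l → neighbours (pairIndex i l) (v l) d) (≢-sym i≢j)))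

  rest-cong : ∀ i j {v w} → (∀ l → l ≢ i → l ≢ j → v l ≈ᴬ w l) → ∀ d → Valid d → ΣFin (rest i j v d) ≡ ΣFin (rest i j w d)
  rest-cong i j {v} {w} h d vd = ΣFin-cong pointwise
    where
    pointwise : ∀ l → rest i j v d l ≡ rest i j w d l
    pointwise l with l ≟F j
    ... | yes _  = refl
    ... | no l≢j with l ≟F i
    ...   | yes _  = refl
    ...   | no l≢i = neighbours-cong (pairIndex i l) (h l l≢i l≢j) d vd

  -- Inhomogeneous recurrences y_{k+2} = c_k - y_k + X y_{k+1} with c alternating between Q and P.
  module Alternating (p : Fin (n * n)) where

    private m = pathLength p

    seq : A → A → A → A → ℕ → A
    seq Q P y₀ y₁ zero    = y₀
    seq Q P y₀ y₁ (suc k) = seq P Q y₁ (λ d → Q d ℤ.- y₀ d ℤ.+ neighbours p y₁ d) k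

    coef : A → A → ℕ → A
    coef Q P zero    = Q
    coef Q P (suc k) = coef P Q k

    seq-step : ∀ Q P y₀ y₁ k d → seq Q P y₀ y₁ (suc (suc k)) d
             ≡ coef Q P k d ℤ.- seq Q P y₀ y₁ k d ℤ.+ neighbours p (seq Q P y₀ y₁ (suc k)) d
    seq-step Q P y₀ y₁ zero    d = refl
    seq-step Q P y₀ y₁ (suc k) d = seq-step P Q y₁ _ k d

    -- In the difference of one sequence and the shifted other the inhomogeneous terms cancel. The
    -- difference starts with 0 and obeys the Chebyshev recurrence, whose m-th term vanishes.
    half-turn : ∀ Q P y₀ y₁ → seq Q P y₀ y₁ m ≈ᴬ seq P Q y₁ y₀ (suc m)
    half-turn Q P y₀ y₁ d vd = trans (solve 2 (λ a b → a := (a :- b) :+ b) refl (Y m d) (Z (suc m) d))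
        (trans (cong (ℤ._+ Z (suc m) d) (Chebyshev.vanishes p difference base step d vd)) (ℤₚ.+-identityˡ _))
      where
      open ℤSolver.+-*-Solver
      Y Z : ℕ → A
      Y = seq Q P y₀ y₁
      Z = seq P Q y₁ y₀
      difference : ℕ → A
      difference k = Y k +ᴬ (-ᴬ Z (suc k))
      base : difference 0 ≈ᴬ 0ᴬ
      base d _ = ℤₚ.+-inverseʳ (y₀ d)
      step : ∀ k → difference (suc (suc k)) ≈ᴬ neighbours p (difference (suc k)) +ᴬ (-ᴬ difference k)
      step k d _ = trans (cong₂ ℤ._-_ (seq-step Q P y₀ y₁ k d) (seq-step P Q y₁ y₀ (suc k) d))
        (trans (solve 5 (λ c a b x x′ → (c :- a :+ x) :- (c :- b :+ x′) := (x :+ :- x′) :+ :- (a :+ :- b)) refl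
                  (coef Q P k d) (Y k d) (Z (suc k) d) (neighbours p (Y (suc k)) d) (neighbours p (Z (suc (suc k))) d))
          (cong (ℤ._+ (ℤ.- difference k d)) (sym (trans (neighbours-+ p (Y (suc k)) (-ᴬ Z (suc (suc k))) d)
            (cong (λ a → neighbours p (Y (suc k)) d ℤ.+ a) (neighbours-neg p (Z (suc (suc k))) d))))))

    coef-even : ∀ Q P k → coef Q P (k + k) ≡ Q
    coef-even Q P zero    = refl
    coef-even Q P (suc k) = trans (cong (coef P Q) (ℕₚ.+-suc k k)) (coef-even Q P k)

    module _ (Q P y₀ y₁ : A) where

      private
        y z : ℕ → A
        y = seq Q P y₀ y₁
        z = seq P Q y₁ y₀

      -- The recurrence is reversible: once two consecutive terms of `y` agree with two consecutive
      -- terms of `z` in reverse order, `y` runs through `z` backwards down to its first two terms,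
      -- which are `y₁` and `y₀`.
      run : ∀ b a → (∀ Q P → coef Q P a ≡ coef P Q b) → y a ≈ᴬ z (suc (suc b)) → y (suc a) ≈ᴬ z (suc b) →
            y (suc b + a) ≈ᴬ y₀ × y (suc (suc b) + a) ≈ᴬ y₁
      run b a ab p₀ p₁ = finish b ab p₁ next
        where
        open ℤSolver.+-*-Solver
        next : y (suc (suc a)) ≈ᴬ z b
        next d vd = trans (seq-step Q P y₀ y₁ a d)
          (trans (cong₂ (λ s t → s ℤ.+ t) (cong₂ ℤ._-_ (cong (λ f → f d) (ab Q P)) (trans (p₀ d vd) (seq-step P Q y₁ y₀ b d)))
                   (neighbours-cong p p₁ d vd))
            (solve 3 (λ c x t → c :- (c :- x :+ t) :+ t := x) refl (coef P Q b d) (z b d) (neighbours p (z (suc b)) d)))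
        finish : ∀ b → (∀ Q P → coef Q P a ≡ coef P Q b) → y (suc a) ≈ᴬ z (suc b) → y (suc (suc a)) ≈ᴬ z b →
                 y (suc b + a) ≈ᴬ y₀ × y (suc (suc b) + a) ≈ᴬ y₁
        finish zero    _  p q = p , q
        finish (suc b) ab p q with run b (suc a) (λ Q P → ab P Q) p q
        ... | r₀ , r₁ = subst (λ k → y k ≈ᴬ y₀) (cong suc (ℕₚ.+-suc b a)) r₀ , subst (λ k → y k ≈ᴬ y₁) (cong (suc ∘ suc) (ℕₚ.+-suc b a)) r₁

    -- At `m` the sequence meets its mirror image, by `half-turn` for both assignments of the roles,
    -- and then runs back to its start.
    period : ∀ Q P y₀ y₁ → seq Q P y₀ y₁ (m + m) ≈ᴬ y₀ × seq Q P y₀ y₁ (suc (m + m)) ≈ᴬ y₁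
    period Q P y₀ y₁ = go m refl
      where
      go : ∀ k → m ≡ k → seq Q P y₀ y₁ (m + m) ≈ᴬ y₀ × seq Q P y₀ y₁ (suc (m + m)) ≈ᴬ y₁
      go zero    eq = case subst (2 ≤_) eq (pathLength≥2 p) of λ ()
      go (suc k) eq = subst (λ t → seq Q P y₀ y₁ (t + m) ≈ᴬ y₀ × seq Q P y₀ y₁ (suc t + m) ≈ᴬ y₁) (sym eq)
        (run Q P y₀ y₁ k m (λ Q P → cong (coef Q P) eq)
          (subst (λ t → seq Q P y₀ y₁ m ≈ᴬ seq P Q y₁ y₀ (suc t)) eq (half-turn Q P y₀ y₁))
          (λ d vd → sym (subst (λ t → seq P Q y₁ y₀ t ≈ᴬ seq Q P y₀ y₁ (suc m)) eq (half-turn P Q y₁ y₀) d vd)))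

  iter : (V → V) → ℕ → V → V
  iter f k = mpow (λ f g v → f (g v)) id f k

  module RankTwo {i j : Fin n} (i≢j : i ≢ j) where

    p : Fin (n * n)
    p = pairIndex i j

    open Alternating p

    T₂ : V → V
    T₂ v = reflect i (reflect j v)

    module _ (v : V) where
      private
        Q P : A
        Q d = ΣFin (rest j i v d)
        P d = ΣFin (rest i j v d)
        y : ℕ → A
        y = seq Q P (v j) (v i)

      -- Only the coordinates `i` and `j` move, so the contributions `Q` and `P` of the others are
      -- constant; the new values at `j` and at `i`, taken alternately, form one sequence, two terms
      -- for each application of `T₂`.
      iterates : ∀ k → (iter T₂ k v j ≈ᴬ y (k + k)) × (iter T₂ k v i ≈ᴬ y (suc (k + k))) ×
                       (∀ l → l ≢ i → l ≢ j → iter T₂ k v l ≈ᴬ v l)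
      iterates zero = (λ _ _ → refl) , (λ _ _ → refl) , λ _ _ _ _ _ → refl
      iterates (suc k) with iterates k
      ... | uj , ui , ul = jth , ith , λ l l≢i l≢j d vd → trans (reflect-otherᵈ (reflect j u) d l≢i) (trans (reflect-otherᵈ u d l≢j) (ul l l≢i l≢j d vd))
        where
        u u′ : V
        u = iter T₂ k v
        u′ = reflect j u
        open ℤSolver.+-*-Solver
        jth′ : u′ j ≈ᴬ y (suc (suc (k + k)))
        jth′ d vd = trans (reflect-sameᵈ j u d) (trans (cong₂ (λ a b → ℤ.- a ℤ.+ b) (uj d vd)
            (trans (linked-split (≢-sym i≢j) u d) (cong₂ ℤ._+_
              (trans (cong (λ q → neighbours q (u i) d) (pairIndex-comm j i)) (neighbours-cong p ui d vd))
              (rest-cong j i (λ l l≢j l≢i → ul l l≢i l≢j) d vd))))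
          (trans (solve 3 (λ a b c → :- a :+ (b :+ c) := c :- a :+ b) refl (y (k + k) d) (neighbours p (y (suc (k + k))) d) (Q d))
            (sym (trans (seq-step Q P (v j) (v i) (k + k) d)
              (cong (λ f → f d ℤ.- y (k + k) d ℤ.+ neighbours p (y (suc (k + k))) d) (coef-even Q P k))))))
        jth : T₂ u j ≈ᴬ y (suc k + suc k)
        jth d vd = trans (reflect-otherᵈ u′ d (≢-sym i≢j)) (trans (jth′ d vd) (cong (λ t → y (suc t) d) (sym (ℕₚ.+-suc k k))))
        ith : T₂ u i ≈ᴬ y (suc (suc k + suc k))
        ith d vd = trans (reflect-sameᵈ i u′ d) (trans (cong₂ (λ a b → ℤ.- a ℤ.+ b)
              (trans (reflect-otherᵈ u d i≢j) (ui d vd))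
            (trans (linked-split i≢j u′ d) (cong₂ ℤ._+_ (neighbours-cong p jth′ d vd)
              (rest-cong i j (λ l l≢i l≢j d′ vd′ → trans (reflect-otherᵈ u d′ l≢j) (ul l l≢i l≢j d′ vd′)) d vd))))
          (trans (solve 3 (λ a b c → :- a :+ (b :+ c) := c :- a :+ b) refl (y (suc (k + k)) d) (neighbours p (y (suc (suc (k + k)))) d) (P d))
            (trans (sym (trans (seq-step Q P (v j) (v i) (suc (k + k)) d)
              (cong (λ f → f d ℤ.- y (suc (k + k)) d ℤ.+ neighbours p (y (suc (suc (k + k)))) d) (coef-even P Q k))))
              (cong (λ t → y (suc (suc t)) d) (sym (ℕₚ.+-suc k k))))))

      T₂-period : iter T₂ (pathLength p) v ≈ⱽ v
      T₂-period l d vd with l ≟F i | l ≟F j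
      ... | yes refl | _ = trans (proj₁ (proj₂ (iterates (pathLength p))) d vd) (proj₂ (period Q P (v j) (v i)) d vd)
      ... | no _ | yes refl = trans (proj₁ (iterates (pathLength p)) d vd) (proj₁ (period Q P (v j) (v i)) d vd)
      ... | no l≢i | no l≢j = proj₂ (proj₂ (iterates (pathLength p))) l l≢i l≢j d vd

  iter-+ : ∀ f a b v → iter f (a + b) v ≡ iter f a (iter f b v)
  iter-+ f zero    b v = refl
  iter-+ f (suc a) b v = cong f (iter-+ f a b v)

  iter-fixed : ∀ f m → (∀ v → iter f m v ≈ⱽ v) → ∀ q v → iter f (q * m) v ≈ⱽ v
  iter-fixed f m h zero    v = λ _ _ _ → refl
  iter-fixed f m h (suc q) v = subst (_≈ⱽ v) (sym (iter-+ f m (q * m) v)) (≈ⱽ-trans (h _) (iter-fixed f m h q v))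

  reflect-relation : ∀ i j k → mpow _·_ e (s i · s j) k ≡ e → ∀ v → iter (λ v → reflect i (reflect j v)) k v ≈ⱽ v
  reflect-relation i j k p v with i ≟F j
  ... | yes refl = subst (λ t → iter (λ v → reflect i (reflect i v)) t v ≈ⱽ v) (ℕₚ.*-identityʳ k) (iter-fixed _ 1 (reflect² i) k v)
  ... | no i≢j with pathLength-divides i≢j k p
  ...   | q , refl = iter-fixed _ (pathLength (pairIndex i j)) (RankTwo.T₂-period i≢j) q v

  module RootAction = WordAction V _≈ⱽ_ (λ _ _ _ → refl) ≈ⱽ-sym ≈ⱽ-trans reflect reflect-cong reflect² reflect-relation
  open RootAction public using (act; act-resp)

  act-cong : ∀ us {v w} → v ≈ⱽ w → act us v ≈ⱽ act us w
  act-cong []       h = h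
  act-cong (i ∷ us) h = reflect-cong i (act-cong us h)

  act-+ : ∀ us v w → act us (v +ⱽ w) ≈ⱽ act us v +ⱽ act us w
  act-+ []       v w = λ _ _ _ → refl
  act-+ (i ∷ us) v w = ≈ⱽ-trans (reflect-cong i (act-+ us v w)) (reflect-+ i _ _)

  act-0 : ∀ us → act us 0ⱽ ≈ⱽ 0ⱽ
  act-0 []       = λ _ _ _ → refl
  act-0 (i ∷ us) = ≈ⱽ-trans (reflect-cong i (act-0 us)) (reflect-0 i)

  act-++ : ∀ us vs v → act (us ++ vs) v ≡ act us (act vs v)
  act-++ []       vs v = refl
  act-++ (i ∷ us) vs v = cong (reflect i) (act-++ us vs v)

  single : Fin n → A → V
  single i a j with j ≟F i
  ... | yes _ = a
  ... | no _  = 0ᴬ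

  single-same : ∀ i a → single i a i ≡ a
  single-same i a with i ≟F i
  ... | yes _ = refl
  ... | no ¬p = ⊥-elim (¬p refl)

  single-other : ∀ {i j} a → j ≢ i → single i a j ≡ 0ᴬ
  single-other {i} {j} a j≢i with j ≟F i
  ... | yes p = ⊥-elim (j≢i p)
  ... | no _  = refl

  ≥0ⱽ : V → Set
  ≥0ⱽ v = ∀ i → ≥0ᴬ (v i)

  ≥0ⱽ-resp : ∀ {v w} → v ≈ⱽ w → ≥0ⱽ v → ≥0ⱽ w
  ≥0ⱽ-resp h p i d vd = subst (0ℤ ℤ.≤_) (h i d vd) (p i d vd)

  ≥0ⱽ-+ : ∀ {v w} → ≥0ⱽ v → ≥0ⱽ w → ≥0ⱽ (v +ⱽ w)
  ≥0ⱽ-+ p q i d vd = ℤₚ.+-mono-≤ (p i d vd) (q i d vd)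

  single-≥0 : ∀ i {a} → ≥0ᴬ a → ≥0ⱽ (single i a)
  single-≥0 i h j d vd with j ≟F i
  ... | yes _ = h d vd
  ... | no _  = ℤₚ.≤-refl

  -- Positivity of roots

  ℓ-sub : ∀ x y → ℓ (x · y) ≤ ℓ x + ℓ y
  ℓ-sub x y with reducedWord x | reducedWord y
  ... | us , p , refl | vs , q , refl = ℕₚ.≤-trans (ℓ-≤ (us ++ vs) (prodS-++ us vs))
    (ℕₚ.≤-reflexive (trans (Listₚ.length-++ us) (cong₂ _+_ p q)))

  alternating : ℕ → Fin n → Fin n → W
  alternating zero    i j = e
  alternating (suc q) i j = alternating q j i · s i

  ℓ-alternating : ∀ q i j → ℓ (alternating q i j) ≤ q
  ℓ-alternating zero    i j = ℓ-≤ [] refl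
  ℓ-alternating (suc q) i j = ℕₚ.≤-trans (ℓ-sub _ _) (ℕₚ.≤-trans
    (ℕₚ.+-mono-≤ (ℓ-alternating q j i) (ℓ-≤ (i ∷ []) (identityʳ _))) (ℕₚ.≤-reflexive (ℕₚ.+-comm q 1)))

  alternating-swap : ∀ q i j → alternating q j i ≡ alternating q i j · mpow _·_ e (s i · s j) q
  alternating-swap zero    i j = sym (identityʳ e)
  alternating-swap (suc q) i j = sym (begin
    alternating q j i · s i · (u · U)       ≡⟨ cong (λ x → x · s i · (u · U)) (alternating-swap q i j) ⟩
    alternating q i j · U · s i · (u · U)   ≡⟨ cong (λ x → alternating q i j · U · s i · x) (sym (mpow-comm u q)) ⟩
    alternating q i j · U · s i · (U · u)   ≡⟨ group (alternating q i j ∷ U ∷ s i ∷ u ∷ []) [] (# 0 ⊙ # 1 ⊙ # 2 ⊙ (# 1 ⊙ # 3)) (# 0 ⊙ (# 1 ⊙ # 2) ⊙ # 1 ⊙ # 3) refl ⟩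
    alternating q i j · (U · s i) · U · u   ≡⟨ cong (λ x → alternating q i j · x · U · u) (sym (DihedralFlips.s-conj j i q)) ⟩
    alternating q i j · (s i · Z) · U · u   ≡⟨ cong (λ x → alternating q i j · (s i · x) · U · u) (DihedralFlips.u⁻¹ i j q) ⟩
    alternating q i j · (s i · U ⁻¹) · U · u ≡⟨ group (alternating q i j ∷ U ∷ []) (s² i ∷ s² j ∷ []) (# 0 ⊙ (! 0 ⊙ inv (# 1)) ⊙ # 1 ⊙ (! 0 ⊙ ! 1)) (# 0 ⊙ ! 1) refl ⟩
    alternating q i j · s j                 ∎)
    where
    open ≡-Reasoning
    u = s i · s j
    U = mpow _·_ e u q
    Z = mpow _·_ e (s j · s i) q

  single-step : ∀ {t t′} → t ≢ t′ → ∀ a b →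
    reflect t′ (single t a +ⱽ single t′ b) ≈ⱽ single t′ (neighbours (pairIndex t t′) a +ᴬ (-ᴬ b)) +ⱽ single t a
  single-step {t} {t′} t≢t′ a b l d vd = go (l ≟F t′)
    where
    open ℤSolver.+-*-Solver
    v = single t a +ⱽ single t′ b
    new = neighbours (pairIndex t t′) a +ᴬ (-ᴬ b)
    at-t : v t ≈ᴬ a
    at-t d _ = trans (cong₂ (λ f g → f d ℤ.+ g d) (single-same t a) (single-other b t≢t′)) (ℤₚ.+-identityʳ _)
    at-t′ : v t′ d ≡ b d
    at-t′ = trans (cong₂ (λ f g → f d ℤ.+ g d) (single-other a (≢-sym t≢t′)) (single-same t′ b)) (ℤₚ.+-identityˡ _)
    rest-0 : ∀ l → rest t′ t v d l ≡ 0ℤ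
    rest-0 l with l ≟F t
    ... | yes _ = refl
    ... | no l≢t with l ≟F t′
    ...   | yes _ = refl
    ...   | no l≢t′ = trans (neighbours-cong (pairIndex t′ l) {v l} {0ᴬ}
              (λ d _ → cong₂ (λ f g → f d ℤ.+ g d) (single-other a l≢t) (single-other b l≢t′)) d vd) (neighbours-0 (pairIndex t′ l) d)
    go : Dec (l ≡ t′) → reflect t′ v l d ≡ single t′ new l d ℤ.+ single t a l d
    go (yes refl) = trans (reflect-sameᵈ t′ v d) (trans (cong₂ (λ x y → ℤ.- x ℤ.+ y) at-t′ linked≡)
      (trans (ℤₚ.+-comm (ℤ.- b d) (neighbours (pairIndex t t′) a d))
        (sym (trans (cong₂ (λ f g → f d ℤ.+ g d) (single-same t′ new) (single-other a (≢-sym t≢t′))) (ℤₚ.+-identityʳ (new d))))))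
      where
      linked≡ : ΣFin (linked t′ v d) ≡ neighbours (pairIndex t t′) a d
      linked≡ = trans (linked-split (≢-sym t≢t′) v d) (trans
        (cong₂ ℤ._+_ (trans (cong (λ p → neighbours p (v t) d) (pairIndex-comm t′ t)) (neighbours-cong (pairIndex t t′) {v t} {a} at-t d vd)) (ΣFin-0 rest-0))
        (ℤₚ.+-identityʳ (neighbours (pairIndex t t′) a d)))
    go (no l≢t′) = trans (reflect-otherᵈ v d l≢t′)
      (trans (cong (λ g → single t a l d ℤ.+ g d) (single-other b l≢t′))
        (trans (ℤₚ.+-comm (single t a l d) 0ℤ) (sym (cong (λ g → g d ℤ.+ single t a l d) (single-other new l≢t′)))))

  chebyshev : Fin (n * n) → A → ℕ → A
  chebyshev p a zero          = 0ᴬ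
  chebyshev p a (suc zero)    = a
  chebyshev p a (suc (suc k)) = neighbours p (chebyshev p a (suc k)) +ᴬ (-ᴬ chebyshev p a k)

  -- Writing x = v d with d in the dihedral subgroup of a descent j and i, and v minimal in its
  -- coset, reduces positivity to v and to the Chebyshev operators.
  positive-root : ∀ k us i a → ℓ (prodS us) ≤ k → ≥0ᴬ a → η (prodS us) (s i) ≡ false → ≥0ⱽ (act us (single i a))

  module Strip (k : ℕ) (us : List (Fin n)) (i j : Fin n) (a : A) (le : ℓ (prodS us) ≤ suc k) (a≥0 : ≥0ᴬ a)
               (i≢j : i ≢ j) (up : η (prodS us) (s i) ≡ false) where

    x = prodS us
    p = pairIndex i j
    m = pathLength p

    w : ℕ → A
    w = chebyshev p a

    w≥0 : ∀ q → q ≤ m → ≥0ᴬ (w q)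
    w≥0 = Chebyshev.nonneg p w (λ _ _ → refl) (λ _ _ _ → refl) a≥0

    -- If the longest element of the dihedral subgroup stood at the right end of `x`, it could be
    -- written with last letter `s i`, and `s i` would be a descent of `x`, against `up`.
    not-all : ∀ v → x ≡ v · alternating m j i → ℓ v + m ≤ ℓ x → ⊥
    not-all v x≡ len = go m refl
      where
      go : ∀ m′ → m ≡ m′ → ⊥
      go zero     eq = case subst (2 ≤_) eq (pathLength≥2 p) of λ ()
      go (suc m′) eq = ℕₚ.<-irrefl refl (begin-strict
        ℓ x                               <⟨ η-false⇒ℓ (refl-s i) up ⟩
        ℓ (x · s i)                       ≡⟨ cong ℓ xsi ⟩
        ℓ (v · alternating m′ j i)        ≤⟨ ℓ-sub v _ ⟩
        ℓ v + ℓ (alternating m′ j i)      ≤⟨ ℕₚ.+-monoʳ-≤ (ℓ v) (ℓ-alternating m′ j i) ⟩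
        ℓ v + m′                          ≤⟨ ℕₚ.+-monoʳ-≤ (ℓ v) (ℕₚ.≤-trans (ℕₚ.n≤1+n m′) (ℕₚ.≤-reflexive (sym eq))) ⟩
        ℓ v + m                           ≤⟨ len ⟩
        ℓ x                               ∎)
        where
        open ℕₚ.≤-Reasoning
        xsi : x · s i ≡ v · alternating m′ j i
        xsi = trans (cong (_· s i) (trans x≡ (cong (v ·_) (trans (alternating-swap m i j)
            (trans (cong (alternating m i j ·_) (pathLength-power i≢j)) (trans (identityʳ _) (cong (λ q → alternating q i j) eq)))))))
          (group (v ∷ alternating m′ j i ∷ []) (s² i ∷ []) (# 0 ⊙ (# 1 ⊙ ! 0) ⊙ ! 0) (# 0 ⊙ # 1) refl)

    -- Letters `j` and `i` are moved alternately from the right end of `x` into the vector, which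
    -- stays a combination of the two simple roots with consecutive Chebyshev coefficients,
    -- nonnegative while the index is at most `m`. When neither letter is a descent any more, both
    -- summands fall under the induction hypothesis; `not-all` makes this happen before `m` letters
    -- are gone. `fuel` bounds the number of letters left.
    strip : ∀ fuel q vs t t′ → m ≤ fuel + q → q < m → pairIndex t t′ ≡ p → t ≢ t′ →
      x ≡ prodS vs · alternating q j i →
      s t′ · alternating q j i ≡ alternating (suc q) j i → s t · alternating q i j ≡ alternating (suc q) i j →
      act us (single i a) ≈ⱽ act vs (single t (w (suc q)) +ⱽ single t′ (w q)) →
      η (prodS vs) (s t′) ≡ true → ℓ (prodS vs) + q ≤ ℓ x → ≥0ⱽ (act us (single i a))
    strip zero q vs t t′ fuel q<m _ _ _ _ _ _ _ _ = ⊥-elim (ℕₚ.<⇒≱ q<m fuel)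
    strip (suc fuel) q vs t t′ fl q<m pt t≢t′ x≡ left₁ left₂ image down len with ℕₚ.m≤n⇒m<n∨m≡n q<m
    ... | inj₂ eq = ⊥-elim (not-all (prodS vs · s t′)
          (subst (λ q → x ≡ prodS vs · s t′ · alternating q j i) eq x≡′) (subst (λ q → ℓ (prodS vs · s t′) + q ≤ ℓ x) eq len′))
      where
      x≡′ : x ≡ prodS vs · s t′ · alternating (suc q) j i
      x≡′ = trans x≡ (trans (group (prodS vs ∷ alternating q j i ∷ []) (s² t′ ∷ []) (# 0 ⊙ # 1) (# 0 ⊙ ! 0 ⊙ (! 0 ⊙ # 1)) refl)
        (cong (prodS vs · s t′ ·_) left₁))
      len′ : ℓ (prodS vs · s t′) + suc q ≤ ℓ x
      len′ = ℕₚ.≤-trans (ℕₚ.≤-trans (ℕₚ.≤-reflexive (ℕₚ.+-suc _ q)) (ℕₚ.+-monoˡ-≤ q (η-true⇒ℓ down))) len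
    ... | inj₁ q′<m = next (η v′ (s t)) refl
      where
      vs′ = vs ++ t′ ∷ []
      v′ = prodS vs′
      v′≡ : v′ ≡ prodS vs · s t′
      v′≡ = prodS-∷ʳ vs t′
      x≡′ : x ≡ v′ · alternating (suc q) j i
      x≡′ = trans x≡ (trans (group (prodS vs ∷ alternating q j i ∷ []) (s² t′ ∷ []) (# 0 ⊙ # 1) (# 0 ⊙ ! 0 ⊙ (! 0 ⊙ # 1)) refl)
        (cong₂ _·_ (sym v′≡) left₁))
      len′ : ℓ v′ + suc q ≤ ℓ x
      len′ = ℕₚ.≤-trans (ℕₚ.≤-trans (ℕₚ.≤-reflexive (ℕₚ.+-suc _ q)) (ℕₚ.+-monoˡ-≤ q (subst (λ y → ℓ y < ℓ (prodS vs)) (sym v′≡) (η-true⇒ℓ down)))) len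
      image′ : act us (single i a) ≈ⱽ act vs′ (single t′ (w (suc (suc q))) +ⱽ single t (w (suc q)))
      image′ = ≈ⱽ-trans image (≈ⱽ-trans (act-cong vs (≈ⱽ-sym (reflect² t′ _)))
        (subst (λ f → act vs (reflect t′ (reflect t′ (single t (w (suc q)) +ⱽ single t′ (w q)))) ≈ⱽ f)
          (sym (act-++ vs (t′ ∷ []) _)) (act-cong vs (reflect-cong t′
            (subst (λ p → reflect t′ (single t (w (suc q)) +ⱽ single t′ (w q)) ≈ⱽ single t′ (neighbours p (w (suc q)) +ᴬ (-ᴬ w q)) +ⱽ single t (w (suc q)))
              pt (single-step t≢t′ (w (suc q)) (w q)))))))
      up′ : η v′ (s t′) ≡ false
      up′ = trans (cong (λ y → η y (s t′)) v′≡) (η-down (refl-s t′) down)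
      ℓv′ : ℓ v′ ≤ k
      ℓv′ = ℕₚ.≤-pred (ℕₚ.≤-trans (ℕₚ.≤-trans (s≤s (ℕₚ.m≤m+n _ q)) (ℕₚ.≤-trans (ℕₚ.≤-reflexive (sym (ℕₚ.+-suc _ q))) len′)) le)
      next : ∀ b → η v′ (s t) ≡ b → ≥0ⱽ (act us (single i a))
      next true down′ = strip fuel (suc q) vs′ t′ t (ℕₚ.≤-trans fl (ℕₚ.≤-reflexive (sym (ℕₚ.+-suc fuel q)))) q′<m
        (trans (pairIndex-comm t′ t) pt) (≢-sym t≢t′) x≡′
        (trans (sym (assoc _ _ _)) (cong (_· s j) left₂)) (trans (sym (assoc _ _ _)) (cong (_· s i) left₁))
        image′ down′ len′
      next false up″ = ≥0ⱽ-resp (≈ⱽ-sym (≈ⱽ-trans image′ (act-+ vs′ _ _)))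
        (≥0ⱽ-+ (positive-root k vs′ t′ _ ℓv′ (w≥0 _ q′<m) up′) (positive-root k vs′ t _ ℓv′ (w≥0 _ (ℕₚ.<⇒≤ q′<m)) up″))

  positive-root k us i a le a≥0 up with prodS us ≟ e
  ... | yes x≡e = ≥0ⱽ-resp (≈ⱽ-sym (act-resp us [] x≡e (single i a))) (single-≥0 i a≥0)
  ... | no x≢e with descent {λ _ → ⊤} (us , All.universal (λ _ → tt) us , refl) x≢e
  positive-root zero us i a le a≥0 up | no x≢e | j , _ , down = ⊥-elim (ℕₚ.n≮0 (ℕₚ.≤-trans (η-true⇒ℓ down) le))
  positive-root (suc k) us i a le a≥0 up | no x≢e | j , _ , down =
    Strip.strip k us i j a le a≥0 i≢j up (pathLength (pairIndex i j)) 0 us i j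
      (ℕₚ.≤-reflexive (sym (ℕₚ.+-identityʳ _))) (ℕₚ.<⇒≤ (pathLength≥2 (pairIndex i j))) refl i≢j (sym (identityʳ _))
      swap-e swap-e start down (ℕₚ.≤-reflexive (ℕₚ.+-identityʳ _))
    where
    i≢j : i ≢ j
    i≢j refl = case trans (sym up) down of λ ()
    swap-e : ∀ {y} → y · e ≡ e · y
    swap-e = trans (identityʳ _) (sym (identityˡ _))
    start : act us (single i a) ≈ⱽ act us (single i a +ⱽ single j 0ᴬ)
    start = act-cong us (λ l d vd → sym (trans (cong (λ z → single i a l d ℤ.+ z) (single-0 l d)) (ℤₚ.+-identityʳ (single i a l d))))
      where
      single-0 : ∀ l d → single j 0ᴬ l d ≡ 0ℤ
      single-0 l d with l ≟F j
      ... | yes _ = refl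
      ... | no _  = refl

  -- Every reflection is reached by rotation

  -- Hit ws t: rotating the word ws and conjugating t along, t eventually becomes the head letter.
  data Hit : List (Fin n) → W → Set where
    now   : ∀ {r ws t} → t ≡ s r → Hit (r ∷ ws) t
    later : ∀ {r ws t} → Hit (ws ++ r ∷ []) (conj (s r) t) → Hit (r ∷ ws) t

  Miss : List (Fin n) → W → Set
  Miss []       t = ⊤
  Miss (r ∷ ρ) t = t ≢ s r × Miss ρ (conj (s r) t)

  cycle : ∀ ρ τ t → Hit (ρ ++ τ) t ⊎ (Miss ρ t × (Hit (τ ++ ρ) (conj (prodS ρ ⁻¹) t) → Hit (ρ ++ τ) t))
  cycle [] τ t = inj₂ (tt , subst₂ Hit (Listₚ.++-identityʳ τ) (trans (cong (λ x → conj x t) e⁻¹) (conj-e t)))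
  cycle (r ∷ ρ) τ t with t ≟ s r
  ... | yes p = inj₁ (now p)
  ... | no ¬p with cycle ρ (τ ++ r ∷ []) (conj (s r) t)
  ...   | inj₁ h = inj₁ (later (subst (λ ws → Hit ws (conj (s r) t)) (sym (Listₚ.++-assoc ρ τ (r ∷ []))) h))
  ...   | inj₂ (miss , back) = inj₂ ((¬p , miss) , λ h → later (subst (λ ws → Hit ws (conj (s r) t)) (sym (Listₚ.++-assoc ρ τ (r ∷ [])))
            (back (subst₂ Hit (sym (Listₚ.++-assoc τ (r ∷ []) ρ))
              (group (prodS ρ ∷ t ∷ []) (s² r ∷ []) (inv (! 0 ⊙ # 0) ⊙ # 1 ⊙ inv (inv (! 0 ⊙ # 0)))
                (inv (# 0) ⊙ (! 0 ⊙ # 1 ⊙ inv (! 0)) ⊙ inv (inv (# 0))) refl) h))))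

  -- A letter turns a positive root negative only if it is the reflection in that root, which a miss
  -- excludes at every stage.
  miss-η : ∀ ρ y i → Miss ρ (conj y (s i)) → η y (s i) ≡ false → η (prodS ρ ⁻¹ · y) (s i) ≡ false
  miss-η [] y i _ p = trans (cong (λ x → η x (s i)) (trans (cong (_· y) e⁻¹) (identityˡ y))) p
  miss-η (r ∷ ρ) y i (≢r , miss) p = trans
    (cong (λ x → η x (s i)) (group (prodS ρ ∷ y ∷ []) (s² r ∷ []) (inv (! 0 ⊙ # 0) ⊙ # 1) (inv (# 0) ⊙ (! 0 ⊙ # 1)) refl))
    (miss-η ρ (s r · y) i (subst (Miss ρ) (sym (conj-· (s r) y (s i))) miss)
      (trans (η-· (s r) y (s i)) (cong₂ _⊕_ (trans (η-s r _) (≡ʷ-false ≢r)) p)))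

  -- Since `t` inverts its own root, it meets some letter `s i` of the word, and the inverse of the
  -- letters after it serves as `y`. If this `y` makes the simple root negative, `y · s i` is taken
  -- instead.
  reflection-par : ∀ {J t} → IsReflection t → Par J t → ∃₂ λ y i → Par J y × J i × t ≡ conj y (s i) × η y (s i) ≡ false
  reflection-par {J} {t} tR (us , ps , eq) with find us ps (trans (sym (η-word us t)) (trans (cong (λ x → η x t) eq) (η-self tR)))
    where
    find : ∀ us → All J us → flips us t ≡ true → ∃₂ λ y i → Par J y × J i × t ≡ conj y (s i)
    find (i ∷ us) (p ∷ ps) h with conj (prodS us) t ≟ s i | flips us t in f
    ... | yes q | _    = prodS us ⁻¹ , i , par-⁻¹ (us , ps , refl) , p , trans (sym (conj-inv (prodS us) t)) (cong (conj (prodS us ⁻¹)) q)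
    ... | no _  | true = find us ps f
  ... | y , i , py , ji , t≡ with η y (s i) in sign
  ...   | false = y , i , py , ji , t≡ , sign
  ...   | true  = y · s i , i , par-· py (par-s ji) , ji ,
          trans t≡ (group (y ∷ []) (s² i ∷ []) (# 0 ⊙ ! 0 ⊙ inv (# 0)) (# 0 ⊙ ! 0 ⊙ ! 0 ⊙ inv (# 0 ⊙ ! 0)) refl) , η-down (refl-s i) sign

  act-other : ∀ {us j} → All (_≢ j) us → ∀ v d → act us v j d ≡ v j d
  act-other []       v d = refl
  act-other {i ∷ us} (p ∷ ps) v d = trans (reflect-otherᵈ (act us v) d (≢-sym p)) (act-other ps v d)

  -- A letter changes only its own coordinate and occurs once, so no other letter can undo what it
  -- does.
  fixed-letters : ∀ us v → Unique us → act us v ≈ⱽ v → ∀ {j} → j ∈ us → reflect j v ≈ⱽ v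
  fixed-letters (i ∷ us) v uniq h = λ { (here refl) → head-fixed ; (there m) → fixed-letters us v (AllPairs.tail uniq) tail-fixed m }
    where
    tail-fixed : act us v ≈ⱽ v
    tail-fixed j d vd with j ≟F i
    ... | yes refl = act-other (unique-head uniq) v d
    ... | no j≢i   = trans (sym (reflect-otherᵈ (act us v) d j≢i)) (h j d vd)
    head-fixed : reflect i v ≈ⱽ v
    head-fixed = ≈ⱽ-trans (reflect-cong i (≈ⱽ-sym tail-fixed)) h

  act-fixed : ∀ us v → (∀ {j} → j ∈ us → reflect j v ≈ⱽ v) → act us v ≈ⱽ v
  act-fixed []       v h = λ _ _ _ → refl
  act-fixed (i ∷ us) v h = ≈ⱽ-trans (reflect-cong i (act-fixed us v (h ∘ there))) (h (here refl))

  act-zero⁻ : ∀ us v → act us v ≈ⱽ 0ⱽ → v ≈ⱽ 0ⱽ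
  act-zero⁻ []       v h = h
  act-zero⁻ (i ∷ us) v h = act-zero⁻ us v (≈ⱽ-trans (≈ⱽ-sym (reflect² i (act us v))) (≈ⱽ-trans (reflect-cong i h) (reflect-0 i)))

  act-neg : ∀ us v → act us (-ⱽ v) ≈ⱽ -ⱽ act us v
  act-neg us v i d vd = trans (solve 2 (λ a b → a := (a :+ b) :- b) refl (act us (-ⱽ v) i d) (act us v i d))
    (trans (cong (λ z → z ℤ.- act us v i d) (trans (sym (act-+ us (-ⱽ v) v i d vd))
        (trans (act-cong us {(-ⱽ v) +ⱽ v} {0ⱽ} (λ j d _ → ℤₚ.+-inverseˡ (v j d)) i d vd) (act-0 us i d vd))))
      (ℤₚ.+-identityˡ _))
    where open ℤSolver.+-*-Solver

  reflect-single : ∀ i a → reflect i (single i a) ≈ⱽ -ⱽ single i a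
  reflect-single i a j d vd = go (j ≟F i)
    where
    zero-term : ∀ l → linked i (single i a) d l ≡ 0ℤ
    zero-term l with l ≟F i
    ... | yes _ = refl
    ... | no l≢i = trans (cong (λ f → neighbours (pairIndex i l) f d) (single-other a l≢i)) (neighbours-0 (pairIndex i l) d)
    go : Dec (j ≡ i) → reflect i (single i a) j d ≡ ℤ.- single i a j d
    go (yes refl) = trans (reflect-sameᵈ i (single i a) d) (trans (cong (λ z → ℤ.- single i a i d ℤ.+ z) (ΣFin-0 zero-term)) (ℤₚ.+-identityʳ _))
    go (no j≢i)   = trans (reflect-otherᵈ (single i a) d j≢i) (trans (cong (λ f → f d) (single-other a j≢i)) (sym (cong (λ f → ℤ.- f d) (single-other a j≢i))))

  ℓ-bound : ∃ λ B → ∀ w → ℓ w ≤ B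
  ℓ-bound = foldr (λ w b → ℓ w ℕ.⊔ b) 0 elems , λ w → go (elems-complete w)
    where
    go : ∀ {w ws} → w ∈ ws → ℓ w ≤ foldr (λ w b → ℓ w ℕ.⊔ b) 0 ws
    go (here refl) = ℕₚ.m≤m⊔n _ _
    go (there m)   = ℕₚ.≤-trans (go m) (ℕₚ.m≤n⊔m _ _)

  longest : ∀ ws → ∃ λ xs → All (_∈ ws) xs × All (λ j → η (prodS xs) (s j) ≡ true) ws
  longest ws = climb (suc (proj₁ ℓ-bound)) [] [] (s≤s (ℕₚ.m≤m+n _ _))
    where
    search : ∀ x js → (∃ λ j → j ∈ js × η x (s j) ≡ false) ⊎ All (λ j → η x (s j) ≡ true) js
    search x [] = inj₂ []
    search x (j ∷ js) with η x (s j) in eq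
    ... | false = inj₁ (j , here refl , eq)
    ... | true with search x js
    ...   | inj₁ (i , m , p) = inj₁ (i , there m , p)
    ...   | inj₂ ps = inj₂ (eq ∷ ps)
    climb : ∀ fuel xs → All (_∈ ws) xs → proj₁ ℓ-bound < fuel + ℓ (prodS xs) → ∃ λ xs → All (_∈ ws) xs × All (λ j → η (prodS xs) (s j) ≡ true) ws
    climb zero xs ps lt = ⊥-elim (ℕₚ.<⇒≱ lt (proj₂ ℓ-bound _))
    climb (suc fuel) xs ps lt with search (prodS xs) ws
    ... | inj₂ done = xs , ps , done
    ... | inj₁ (j , m , up) = climb fuel (xs ++ j ∷ []) (Allₚ.++⁺ ps (m ∷ []))
          (ℕₚ.≤-trans lt (ℕₚ.≤-trans (ℕₚ.≤-reflexive (sym (ℕₚ.+-suc fuel _)))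
            (ℕₚ.+-monoʳ-≤ fuel (subst (λ y → ℓ (prodS xs) < ℓ y) (sym (prodS-∷ʳ xs j)) (η-false⇒ℓ (refl-s j) up)))))

  -- A nonnegative vector supported on ws and fixed by the letters of ws vanishes: the longest
  -- element makes it nonpositive.
  fixed-zero : ∀ ws v → ≥0ⱽ v → (∀ j → j ∉ ws → v j ≈ᴬ 0ᴬ) → (∀ {j} → j ∈ ws → reflect j v ≈ⱽ v) → v ≈ⱽ 0ⱽ
  fixed-zero ws v v≥0 support fixed j d vd = ℤₚ.≤-antisym
      (subst (ℤ._≤ 0ℤ) (trans (act-cong xs decompose j d vd) (act-fixed xs v (λ m → fixed (All.lookup xs⊆ m)) j d vd)) (parts (allFin n) j d vd))
      (v≥0 j d vd)
    where
    xs = proj₁ (longest ws)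
    xs⊆ : All (_∈ ws) xs
    xs⊆ = proj₁ (proj₂ (longest ws))
    sumOf : List (Fin n) → V
    sumOf = foldr (λ j u → single j (v j) +ⱽ u) 0ⱽ
    decompose : sumOf (allFin n) ≈ⱽ v
    decompose l d vd = trans (component (allFin n)) (ΣFin-only l (λ j → v j d))
      where
      component : ∀ js → sumOf js l d ≡ foldr (λ j a → only l (λ j → v j d) j ℤ.+ a) 0ℤ js
      component [] = refl
      component (j ∷ js) = cong₂ ℤ._+_ same (component js)
        where
        same : single j (v j) l d ≡ only l (λ j → v j d) j
        same with l ≟F j | j ≟F l
        ... | yes _ | yes _ = refl
        ... | no _  | no _  = refl
        ... | yes p | no q  = ⊥-elim (q (sym p))
        ... | no p  | yes q = ⊥-elim (p (sym q))
    part : ∀ j → Dec (j ∈ ws) → ∀ l d → Valid d → act xs (single j (v j)) l d ℤ.≤ 0ℤ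
    part j (no j∉) l d vd = ℤₚ.≤-reflexive (trans (act-cong xs zero-part l d vd) (act-0 xs l d vd))
      where
      zero-part : single j (v j) ≈ⱽ 0ⱽ
      zero-part l d vd with l ≟F j
      ... | yes _ = support j j∉ d vd
      ... | no _  = refl
    part j (yes j∈) l d vd = subst (ℤ._≤ 0ℤ) (ℤₚ.neg-involutive _) (ℤₚ.neg-mono-≤ (≥0ⱽ-resp negated
        (positive-root _ (xs ++ j ∷ []) j (v j) ℕₚ.≤-refl (v≥0 j)
          (trans (cong (λ y → η y (s j)) (prodS-∷ʳ xs j)) (η-down (refl-s j) (All.lookup (proj₂ (proj₂ (longest ws))) j∈)))) l d vd))
      where
      negated : act (xs ++ j ∷ []) (single j (v j)) ≈ⱽ -ⱽ act xs (single j (v j))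
      negated = ≈ⱽ-trans (subst (λ f → f ≈ⱽ act xs (reflect j (single j (v j)))) (sym (act-++ xs (j ∷ []) _)) (λ _ _ _ → refl))
        (≈ⱽ-trans (act-cong xs (reflect-single j (v j))) (act-neg xs _))
    parts : ∀ js l d → Valid d → act xs (sumOf js) l d ℤ.≤ 0ℤ
    parts []       l d vd = ℤₚ.≤-reflexive (act-0 xs l d vd)
    parts (j ∷ js) l d vd = subst (ℤ._≤ 0ℤ) (sym (act-+ xs _ _ l d vd)) (ℤₚ.+-mono-≤ (part j (Any.any? (j ≟F_) ws) l d vd) (parts js l d vd))

  prodS-reverse : ∀ us → prodS (reverse us) ≡ prodS us ⁻¹
  prodS-reverse [] = sym e⁻¹
  prodS-reverse (j ∷ us) = trans (cong prodS (Listₚ.unfold-reverse j us)) (trans (prodS-∷ʳ (reverse us) j)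
    (trans (cong (_· s j) (prodS-reverse us)) (group (prodS us ∷ []) (s² j ∷ []) (inv (# 0) ⊙ ! 0) (inv (! 0 ⊙ # 0)) refl)))

  -- If t were never hit, the sum of its positive roots over a period of c would be fixed by c, hence
  -- by every letter, contradicting fixed-zero.
  module Period (ws : List (Fin n)) (uniq : Unique ws) (yw : List (Fin n)) (yw⊆ : All (_∈ ws) yw) (i : Fin n) (i∈ : i ∈ ws) where

    c⁻¹ : W
    c⁻¹ = prodS ws ⁻¹

    cw : List (Fin n)
    cw = reverse ws

    words : ℕ → List (Fin n)
    words zero    = yw
    words (suc k) = cw ++ words k

    words-prod : ∀ k → prodS (words k) ≡ mpow _·_ e c⁻¹ k · prodS yw
    words-prod zero    = sym (identityˡ _)
    words-prod (suc k) = trans (prodS-++ cw (words k)) (trans (cong₂ _·_ (prodS-reverse ws) (words-prod k)) (sym (assoc _ _ _)))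

    words⊆ : ∀ k → All (_∈ ws) (words k)
    words⊆ zero    = yw⊆
    words⊆ (suc k) = Allₚ.++⁺ (All.tabulate (λ m → Anyₚ.reverse⁻ m)) (words⊆ k)

    one : A
    one _ = 1ℤ

    vec sums : ℕ → V
    vec k = act (words k) (single i one)
    sums zero    = 0ⱽ
    sums (suc k) = vec k +ⱽ sums k

    telescope : ∀ k → act cw (sums k) +ⱽ vec 0 ≈ⱽ sums k +ⱽ vec k
    telescope zero l d vd = cong (ℤ._+ vec 0 l d) (act-0 cw l d vd)
    telescope (suc k) l d vd = trans (cong (ℤ._+ vec 0 l d) (act-+ cw (vec k) (sums k) l d vd))
      (trans (ℤₚ.+-assoc (act cw (vec k) l d) (act cw (sums k) l d) (vec 0 l d)) (trans (cong₂ ℤ._+_ (cong (λ f → f l d) (sym (act-++ cw (words k) _))) (telescope k l d vd))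
        (solve 3 (λ a b c → a :+ (b :+ c) := (c :+ b) :+ a) refl (vec (suc k) l d) (sums k l d) (vec k l d))))
      where open ℤSolver.+-*-Solver

    h : ℕ
    h = proj₁ (finiteOrder c⁻¹)

    c-fixed : act cw (sums (suc h)) ≈ⱽ sums (suc h)
    c-fixed l d vd = ∙-cancelʳ (trans (telescope (suc h) l d vd) (cong (λ z → sums (suc h) l d ℤ.+ z)
        (act-resp (words (suc h)) yw (trans (words-prod (suc h)) (trans (cong (_· prodS yw) (proj₂ (finiteOrder c⁻¹))) (identityˡ _))) (single i one) l d vd)))
      where
      ∙-cancelʳ : ∀ {a b c} → a ℤ.+ c ≡ b ℤ.+ c → a ≡ b
      ∙-cancelʳ {a} {b} {c} p = trans (minus a c) (trans (cong (ℤ._- c) p) (sym (minus b c)))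
        where
        open ℤSolver.+-*-Solver
        minus : ∀ a c → a ≡ (a ℤ.+ c) ℤ.- c
        minus = solve 2 (λ a c → a := (a :+ c) :- c) refl

    sums-support : ∀ k j → j ∉ ws → sums k j ≈ᴬ 0ᴬ
    sums-support zero    j j∉ d vd = refl
    sums-support (suc k) j j∉ d vd = trans (cong₂ ℤ._+_
        (trans (act-other (All.map (λ { m refl → j∉ m }) (words⊆ k)) (single i one) d) (cong (λ f → f d) (single-other {i} {j} one (λ { refl → j∉ i∈ }))))
        (sums-support k j j∉ d vd)) refl

    sums-≥0 : ∀ k → (∀ q → q < k → η (prodS (words q)) (s i) ≡ false) → ≥0ⱽ (sums k)
    sums-≥0 zero    _  = λ _ _ _ → ℤₚ.≤-refl
    sums-≥0 (suc k) up = ≥0ⱽ-+ (positive-root _ (words k) i one ℕₚ.≤-refl (λ _ _ → ℤ.+≤+ z≤n) (up k ℕₚ.≤-refl))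
      (sums-≥0 k (λ q lt → up q (ℕₚ.m≤n⇒m≤1+n lt)))

    absurd : (∀ q → q < suc h → η (prodS (words q)) (s i) ≡ false) → ⊥
    -- The sum of nonnegative vectors vanishes, hence so does its last summand, hence so does the
    -- simple root: 1 would be 0 at any valid position, such as the one with all entries 1.
    absurd up = case trans (sym (cong (λ f → f d₁) (single-same i one))) (act-zero⁻ (words h) (single i one) vec-0 i d₁ valid₁) of λ ()
      where
      uniq-cw : Unique cw
      uniq-cw = AllPairs-↭ ≢-sym (↭-sym (↭ₚ.↭-reverse ws)) uniq
      total-0 : sums (suc h) ≈ⱽ 0ⱽ
      total-0 = fixed-zero ws (sums (suc h)) (sums-≥0 (suc h) up) (sums-support (suc h))
        (λ m → fixed-letters cw (sums (suc h)) uniq-cw c-fixed (Anyₚ.reverse⁺ m))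
      vec-0 : vec h ≈ⱽ 0ⱽ
      vec-0 l d vd = ℤₚ.≤-antisym (subst₂ ℤ._≤_ (ℤₚ.+-identityʳ _) (total-0 l d vd)
          (ℤₚ.+-monoʳ-≤ (vec h l d) (sums-≥0 h (λ q lt → up q (ℕₚ.m≤n⇒m≤1+n lt)) l d vd)))
        (positive-root _ (words h) i one ℕₚ.≤-refl (λ _ _ → ℤ.+≤+ z≤n) (up h ℕₚ.≤-refl) l d vd)
      d₁ : Position
      d₁ = replicate (n * n) 1
      valid₁ : Valid d₁
      valid₁ p = subst (InRange p) (sym (Vecₚ.lookup-replicate p 1)) (s≤s z≤n , pathLength≥2 p)

  -- Each full turn of the word conjugates by `prodS ws ⁻¹`. As long as `t` is missed, `miss-η`
  -- keeps its root positive, and `Period.absurd` excludes this for a whole period.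
  hit : ∀ {ws t} → Unique ws → IsReflection t → Par (_∈ ws) t → Hit ws t
  hit {ws} {t} uniq tR pt with reflection-par tR pt
  ... | _ , i , (yw , yw⊆ , refl) , i∈ , t≡ , up₀ with collect (suc h)
    where
    open Period ws uniq yw yw⊆ i i∈
    Y : ℕ → W
    Y k = prodS (words k)
    Y-suc : ∀ k → prodS ws ⁻¹ · Y k ≡ Y (suc k)
    Y-suc k = sym (trans (prodS-++ cw (words k)) (cong (_· Y k) (prodS-reverse ws)))
    state : ∀ k → Hit ws t ⊎ (η (Y k) (s i) ≡ false × (Hit ws (conj (Y k) (s i)) → Hit ws t))
    state zero = inj₂ (up₀ , subst (Hit ws) (sym t≡))
    state (suc k) with state k
    ... | inj₁ p = inj₁ p
    ... | inj₂ (up , back) with cycle ws [] (conj (Y k) (s i))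
    ...   | inj₁ p = inj₁ (back (subst (λ us → Hit us (conj (Y k) (s i))) (Listₚ.++-identityʳ ws) p))
    ...   | inj₂ (miss , back′) = inj₂ (trans (cong (λ y → η y (s i)) (sym (Y-suc k))) (miss-η ws (Y k) i miss up) ,
            λ p → back (subst (λ us → Hit us (conj (Y k) (s i))) (Listₚ.++-identityʳ ws) (back′ (subst (Hit ws)
              (trans (cong (λ y → conj y (s i)) (sym (Y-suc k))) (conj-· _ (Y k) (s i))) p))))
    collect : ∀ k → Hit ws t ⊎ (∀ q → q < k → η (Y q) (s i) ≡ false)
    collect zero = inj₂ (λ _ ())
    collect (suc k) with collect k | state k
    ... | inj₁ p  | _ = inj₁ p
    ... | inj₂ _  | inj₁ p = inj₁ p
    ... | inj₂ ps | inj₂ (up , _) = inj₂ below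
      where
      below : ∀ q → q < suc k → η (Y q) (s i) ≡ false
      below q (s≤s q≤k) with ℕₚ.m≤n⇒m<n∨m≡n q≤k
      ... | inj₁ lt   = ps q lt
      ... | inj₂ refl = up
  ...   | inj₁ p  = p
  ...   | inj₂ up = ⊥-elim (Period.absurd ws uniq yw yw⊆ i i∈ up)

  -- Parity, and reflections below a Coxeter element

  iterate-not² : ∀ k b → mpow (λ f g v → f (g v)) id (λ v → not (not v)) k b ≡ b
  iterate-not² zero    b = refl
  iterate-not² (suc k) b = trans (not-involutive _) (iterate-not² k b)

  module ParityAction = WordAction Bool _≡_ refl sym trans (λ _ → not) (λ _ → cong not)
    (λ _ → not-involutive) (λ _ _ k _ → iterate-not² k)

  odd : W → Bool
  odd w = foldr (λ _ → not) false (proj₁ (generated w))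

  odd-word : ∀ us → odd (prodS us) ≡ foldr (λ _ → not) false us
  odd-word us = ParityAction.act-resp (proj₁ (generated (prodS us))) us (proj₂ (generated (prodS us))) false

  odd-· : ∀ x y → odd (x · y) ≡ odd x ⊕ odd y
  odd-· x y = trans (cong odd (trans (sym (cong₂ _·_ (proj₂ (generated x)) (proj₂ (generated y)))) (sym (prodS-++ us vs))))
    (trans (odd-word (us ++ vs)) (split us))
    where
    us = proj₁ (generated x)
    vs = proj₁ (generated y)
    split : ∀ us → foldr (λ _ → not) false (us ++ vs) ≡ foldr (λ _ → not) false us ⊕ odd y
    split [] = refl
    split (_ ∷ us) = trans (cong not (split us)) (not-⊕ (foldr (λ _ → not) false us) (odd y))
      where
      not-⊕ : ∀ a b → not (a ⊕ b) ≡ not a ⊕ b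
      not-⊕ false b     = refl
      not-⊕ true  false = refl
      not-⊕ true  true  = refl

  odd-refl : ∀ {t} → IsReflection t → odd t ≡ true
  odd-refl (w , i , refl) = trans (odd-· (w · s i) (w ⁻¹)) (trans (cong (_⊕ odd (w ⁻¹)) (trans (odd-· w (s i))
      (cong (odd w ⊕_) (trans (cong odd (sym (identityʳ (s i)))) (odd-word (i ∷ []))))))
    (cancel (odd w) (odd (w ⁻¹)) (trans (sym (odd-· w (w ⁻¹))) (trans (cong odd (inverseʳ w)) (odd-word [])))))
    where
    cancel : ∀ a b → a ⊕ b ≡ false → (a ⊕ true) ⊕ b ≡ true
    cancel false false _ = refl
    cancel true  true  _ = refl

  -- Parity excludes absolute length 1 for the product of two reflections, and distinctness excludes
  -- 0.
  additive-refl : ∀ {t u} → IsReflection t → IsReflection u → t ≢ u → Additive t u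
  additive-refl {t} {u} tR uR t≢u = go (ℓT-word (t · u))
    where
    bound : ℓT (t · u) ≤ 2
    bound = ℕₚ.≤-trans (ℓT-sub t u) (ℕₚ.≤-reflexive (cong₂ _+_ (ℓT-refl tR) (ℓT-refl uR)))
    even : odd (t · u) ≡ false
    even = trans (odd-· t u) (cong₂ _⊕_ (odd-refl tR) (odd-refl uR))
    two : 2 ≡ ℓT t + ℓT u
    two = sym (cong₂ _+_ (ℓT-refl tR) (ℓT-refl uR))
    go : (∃ λ ts → Reflections ts × length ts ≡ ℓT (t · u) × prodW ts ≡ t · u) → Additive t u
    go ([] , _ , _ , p) = ⊥-elim (t≢u (trans (sym (⁻¹-involutive t)) (trans (cong _⁻¹ (sym (inverse-unique (sym p)))) (refl-⁻¹ uR))))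
    go (v ∷ [] , vR ∷ [] , _ , p) = case trans (sym (odd-refl vR)) (trans (cong odd (trans (sym (identityʳ v)) p)) even) of λ ()
    go (_ ∷ _ ∷ [] , _ , q , _) = trans (sym q) two
    go (_ ∷ _ ∷ _ ∷ _ , _ , q , _) = case ℕₚ.≤-trans (ℕₚ.≤-reflexive q) bound of λ { (s≤s (s≤s ())) }

  par-word : ∀ ws → Par (_∈ ws) (prodS ws)
  par-word ws = ws , All.tabulate id , refl

  hit-≼ : ∀ {ws t} → Unique ws → Hit ws t → t ≼ prodS ws
  hit-≼ uniq (now refl) = Head.s≼c _ _ uniq
  hit-≼ uniq (later h)  = Head.≼-rot⁻ _ _ uniq (hit-≼ (rotate uniq) h)

  -- The head letter lies below the Coxeter element of its word, and rotation preserves the order;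
  -- so a `Hit` suffices.
  refl-par-≼ : ∀ {ws t} → Unique ws → IsReflection t → Par (_∈ ws) t → t ≼ prodS ws
  refl-par-≼ uniq tR p = hit-≼ uniq (hit uniq tR p)

  ≼-hit : ∀ {ws t} → Unique ws → IsReflection t → t ≼ prodS ws → Hit ws t
  ≼-hit {ws} uniq tR le = hit uniq tR (par-≼ le (par-word ws))

  -- Descents are peeled off one by one. A descent of an element of a parabolic subgroup belongs to
  -- its letters, so meeting `r` refutes membership.
  without? : ∀ r x → Dec (Without r x)
  without? r x = go (ℓ x) x ℕₚ.≤-refl
    where
    go : ∀ k x → ℓ x ≤ k → Dec (Without r x)
    go k x le with x ≟ e
    ... | yes refl = yes par-e
    ... | no x≢e with descent {λ _ → ⊤} (proj₁ (generated x) , All.universal (λ _ → tt) _ , proj₂ (generated x)) x≢e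
    go zero x le | no _ | i , _ , down = ⊥-elim (ℕₚ.n≮0 (ℕₚ.≤-trans (η-true⇒ℓ down) le))
    go (suc k) x le | no _ | i , _ , down with i ≟F r
    ... | yes refl = no λ q → ¬without-s (par-exchange q down)
    ... | no i≢r = map′ (par-cancelʳ′) (λ q → par-· q (par-s i≢r)) (go k (x · s i) (ℕₚ.≤-pred (ℕₚ.≤-trans (η-true⇒ℓ down) le)))
      where
      par-cancelʳ′ : Without r (x · s i) → Without r x
      par-cancelʳ′ = par-cancelʳ (par-s i≢r)

  ≼-⁻¹ : ∀ {a b} → a ≼ b → a ⁻¹ ≼ b ⁻¹
  ≼-⁻¹ {a} {b} p = trans (ℓT-⁻¹ b) (trans p (cong₂ _+_ (sym (ℓT-⁻¹ a)) (trans (sym (ℓT-⁻¹ _)) (trans (sym (ℓT-conj a _))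
      (cong ℓT (group (a ∷ b ∷ []) [] (# 0 ⊙ inv (inv (# 0) ⊙ # 1) ⊙ inv (# 0)) (inv (inv (# 0)) ⊙ inv (# 1)) refl))))))
    where
    le : ∀ x → ℓT (x ⁻¹) ≤ ℓT x
    le x with ℓT-word x
    ... | ts , R , q , refl = subst (ℓT (prodW ts ⁻¹) ≤_) q (go ts R)
      where
      go : ∀ ts → Reflections ts → ℓT (prodW ts ⁻¹) ≤ length ts
      go [] [] = ℕₚ.≤-reflexive (trans (cong ℓT e⁻¹) ℓT-e)
      go (t ∷ ts) (tR ∷ R) = ℕₚ.≤-trans (ℕₚ.≤-reflexive (cong ℓT (trans (⁻¹-anti t _) (cong (prodW ts ⁻¹ ·_) (refl-⁻¹ tR)))))
        (ℕₚ.≤-trans (ℓT-sub _ t) (ℕₚ.≤-trans (ℕₚ.+-mono-≤ (go ts R) (ℕₚ.≤-reflexive (ℓT-refl tR))) (ℕₚ.≤-reflexive (ℕₚ.+-comm _ 1))))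
    ℓT-⁻¹ : ∀ x → ℓT (x ⁻¹) ≡ ℓT x
    ℓT-⁻¹ x = ℕₚ.≤-antisym (le x) (subst (λ y → ℓT y ≤ ℓT (x ⁻¹)) (⁻¹-involutive x) (le (x ⁻¹)))

  -- Compatibility of two positive roots under rotation

  Commute : W → W → Set
  Commute t u = t · u ≡ u · t

  commute? : ∀ t u → Dec (Commute t u)
  commute? t u = (t · u) ≟ (u · t)

  conj-commute : ∀ {t u} → conj t u ≡ u → Commute t u
  conj-commute {t} {u} p = trans (group (t ∷ u ∷ []) [] (# 0 ⊙ # 1) (# 0 ⊙ # 1 ⊙ inv (# 0) ⊙ # 0) refl) (cong (_· t) p)

  commute-conj : ∀ {t u} → Commute t u → conj t u ≡ u
  commute-conj {t} {u} p = trans (cong (_· t ⁻¹) p) (group (t ∷ u ∷ []) [] (# 1 ⊙ # 0 ⊙ inv (# 0)) (# 1) refl)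

  commute-conj-s : ∀ r {t u} → Commute t u → Commute (conj (s r) t) (conj (s r) u)
  commute-conj-s r {t} {u} p = trans (sym (conj-homo (s r) t u)) (trans (cong (conj (s r)) p) (conj-homo (s r) u t))

  -- For t u ≼ c or u t ≼ c this is compatibility of the two positive roots.
  Fall : W → W → Set
  Fall t u = Commute t u ⊎ η u t ≡ true ⊎ η t u ≡ true

  fall-sym : ∀ {t u} → Fall t u → Fall u t
  fall-sym (inj₁ p)        = inj₁ (sym p)
  fall-sym (inj₂ (inj₁ p)) = inj₂ (inj₂ p)
  fall-sym (inj₂ (inj₂ p)) = inj₂ (inj₁ p)

  -- By `without-commute`, conjugation by `s r` moves `u` out of the parabolic subgroup, so
  -- `u · s r` does not invert `u`; dropping the last factor `u` of `conj u (s r) · u` reverses the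
  -- sign.
  η-conj-by-without : ∀ {r u} → Without r u → IsReflection u → ¬ Commute (s r) u → η (conj u (s r)) u ≡ true
  η-conj-by-without {r} {u} q uR ¬comm = trans (sym (not-involutive _)) (cong not (trans (sym (η-·t (conj u (s r)) uR))
    (trans (cong (λ x → η x u) (group (u ∷ []) (s² r ∷ []) (# 0 ⊙ ! 0 ⊙ inv (# 0) ⊙ # 0) (# 0 ⊙ ! 0) refl))
      (trans (η-· u (s r) u) (cong₂ _⊕_ (par-η-false q (λ q′ → ¬comm (conj-commute (without-commute q q′))))
        (trans (η-s r u) (≡ʷ-false (without-≢ q))))))))

  η-conj-s-self : ∀ {r u} → Without r u → ¬ Commute (s r) u → η (conj (s r) u) (s r) ≡ true
  η-conj-s-self {r} {u} q ¬comm = trans (cong (λ t → η (conj (s r) u) t) (sym rrr)) (trans (η-conj-s r u (s r))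
    (cong₂ _⊕_ (cong₂ _⊕_ (≡ʷ-false (λ p → ¬comm (sym (conj-commute p)))) (par-η-false q ¬without-s)) (≡ʷ-true refl)))
    where
    rrr : conj (s r) (s r) ≡ s r
    rrr = group [] (s² r ∷ []) (! 0 ⊙ ! 0 ⊙ inv (! 0)) (! 0) refl

  -- t = x⁻¹ r x for x in the parabolic subgroup without r.
  module Insertion {r x t} (qx : Without r x) (conj≡ : conj x t ≡ s r) where

    ¬without : ¬ Without r t
    ¬without q = ¬without-s (subst (Without r) conj≡ (par-conj qx q))

    η-x : η x t ≡ false
    η-x = par-η-false qx ¬without

    x·t : x · t ≡ s r · x
    x·t = trans (group (x ∷ t ∷ []) [] (# 0 ⊙ # 1) (# 0 ⊙ # 1 ⊙ inv (# 0) ⊙ # 0) refl) (cong (_· x) conj≡)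

    t≡ : t ≡ conj (x ⁻¹) (s r)
    t≡ = trans (sym (conj-inv x t)) (cong (conj (x ⁻¹)) conj≡)

    -- Factor `t` as `x ⁻¹ · (s r · x)`. Unless `t` and `u` commute, `s r · x` moves `u` out of the
    -- parabolic subgroup, where `x ⁻¹` inverts nothing; the sign is therefore that of `x` alone.
    η-t : ∀ {u} → Without r u → ¬ Commute t u → η t u ≡ η x u
    η-t {u} q ¬comm = trans (cong (λ y → η y u) (trans t≡ (group (x ∷ []) (s² r ∷ []) (inv (# 0) ⊙ ! 0 ⊙ inv (inv (# 0))) (inv (# 0) ⊙ (! 0 ⊙ # 0)) refl)))
      (trans (η-· (x ⁻¹) (s r · x) u) (cong₂ _⊕_ (par-η-false (par-⁻¹ qx) outside) (η-s·-without qx q)))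
      where
      y = conj x u
      outside : ¬ Without r (conj (s r · x) u)
      outside q′ = ¬comm (trans (cong (_· u) t≡) (trans
        (group (x ∷ u ∷ s r ∷ []) [] (inv (# 0) ⊙ # 2 ⊙ inv (inv (# 0)) ⊙ # 1) (inv (# 0) ⊙ (# 2 ⊙ (# 0 ⊙ # 1 ⊙ inv (# 0))) ⊙ # 0) refl)
        (trans (cong (λ z → x ⁻¹ · z · x) (conj-commute (without-commute (par-conj qx q) (subst (Without r) (conj-· (s r) x u) q′))))
          (trans (group (x ∷ u ∷ s r ∷ []) [] (inv (# 0) ⊙ (# 0 ⊙ # 1 ⊙ inv (# 0) ⊙ # 2) ⊙ # 0) (# 1 ⊙ (inv (# 0) ⊙ # 2 ⊙ inv (inv (# 0)))) refl)
            (cong (u ·_) (sym t≡))))))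

    fall-from : ∀ {u} → Without r u → η x u ≡ true → Fall t u
    fall-from {u} q p with commute? t u
    ... | yes c = inj₁ c
    ... | no ¬c = inj₂ (inj₂ (trans (η-t q ¬c) p))

    fall-to : ∀ {u} → Without r u → Fall t u → Commute t u ⊎ η x u ≡ true
    fall-to {u} q f with commute? t u
    ... | yes c = inj₁ c
    fall-to q (inj₁ c)        | no ¬c = ⊥-elim (¬c c)
    fall-to q (inj₂ (inj₁ p)) | no ¬c = case trans (sym p) (par-η-false q ¬without) of λ ()
    fall-to q (inj₂ (inj₂ p)) | no ¬c = inj₂ (trans (sym (η-t q ¬c)) p)

    fall-down : ∀ {u} → Without r u → Fall t u → η x u ≡ false → Commute t u
    fall-down q f p with fall-to q f
    ... | inj₁ c = c
    ... | inj₂ h = case trans (sym h) p of λ ()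

  Compatible : List (Fin n) → W → W → Set
  Compatible ws t u = Fall t u × (t · u ≼ prodS ws ⊎ u · t ≼ prodS ws)

  compatible-sym : ∀ {ws t u} → Compatible ws t u → Compatible ws u t
  compatible-sym (f , o) = fall-sym f , [ inj₂ , inj₁ ]′ o

  module Head′ (r : Fin n) (ws : List (Fin n)) (uniq : Unique (r ∷ ws)) where
    open Head r ws uniq public

    -- Inversion turns `c′ · s r` into a Coxeter word with head `r` followed by the reversed
    -- remaining letters, and there `Head.without⇒≼c′` applies.
    final-without⇒≼c′ : ∀ {w} → w ≼ c* → Without r w → w ≼ c′
    final-without⇒≼c′ {w} le q = subst₂ _≼_ (⁻¹-involutive w) (trans (cong _⁻¹ (prodS-reverse ws)) (⁻¹-involutive c′))
      (≼-⁻¹ (Head.without⇒≼c′ r (reverse ws) uniq-reverse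
        (subst (w ⁻¹ ≼_) (trans (cong _⁻¹ c*≡c′s) (trans (⁻¹-anti c′ (s r)) (cong₂ _·_ (s⁻¹ r) (sym (prodS-reverse ws))))) (≼-⁻¹ le)) (par-⁻¹ q)))
      where
      uniq-reverse : Unique (r ∷ reverse ws)
      uniq-reverse = AllPairs-↭ ≢-sym (↭-prep r (↭-sym (↭ₚ.↭-reverse ws))) uniq

    -- Generically the rotation keeps both signs. In the exceptional case, where one reflection
    -- conjugates the other to `s r`, the inversion changes sides: `t` inverts `u` before and `u`
    -- inverts `t` after. Hence `Fall`, which is symmetric, is stable either way.
    data Rotated (t u : W) : Set where
      both : Fall t u → Fall (conj (s r) t) (conj (s r) u) → Rotated t u
      same : η (conj (s r) u) (conj (s r) t) ≡ η u t → η (conj (s r) t) (conj (s r) u) ≡ η t u → Rotated t u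

    rotated-sym : ∀ {t u} → Rotated t u → Rotated u t
    rotated-sym (both f g) = both (fall-sym f) (fall-sym g)
    rotated-sym (same p q) = same q p

    rotated : ∀ {t u} → IsReflection t → IsReflection u → t ≢ s r → u ≢ s r → t ≢ u → u · t ≼ c → Rotated t u
    rotated {t} {u} tR uR t≢r u≢r t≢u le with commute? t u
    ... | yes p = both (inj₁ p) (inj₁ (commute-conj-s r p))
    ... | no ¬comm with conj u t ≟ s r | conj t u ≟ s r
    ...   | no p | no q = same (η-conj-s-same p t≢r) (η-conj-s-same q u≢r)
    ...   | yes p | _ = both (inj₂ (inj₂ (trans (cong (λ x → η x u) t≡) (η-conj-by-without qu uR ¬ru))))
              (inj₂ (inj₁ (trans (η-conj-s r u t) (cong₂ _⊕_ (cong₂ _⊕_ (≡ʷ-true p) (par-η-false qu ¬qt)) (≡ʷ-false t≢r)))))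
      where
      qu : Without r u
      qu = ≼c′⇒without (crossing p (additive-refl uR tR (≢-sym t≢u)) tR le)
      t≡ : t ≡ conj u (s r)
      t≡ = trans (sym (conj-inv u t)) (trans (cong (conj (u ⁻¹)) p) (cong (λ x → conj x (s r)) (refl-⁻¹ uR)))
      ¬ru : ¬ Commute (s r) u
      ¬ru h = ¬comm (subst (λ x → Commute x u) (sym (trans t≡ (commute-conj (sym h)))) h)
      ¬qt : ¬ Without r t
      ¬qt q = ¬without-s (subst (Without r) p (par-conj qu q))
    ...   | no _ | yes p = both (inj₂ (inj₂ (flip-true (trans (sym (η-conj-s r t u)) (par-η-false q₀ outside)))))
              (inj₂ (inj₁ (trans (cong (λ x → η x t₀) u₀≡) (η-conj-by-without q₀ (refl-conj (s r) tR) ¬rt₀))))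
      where
      t₀ = conj (s r) t
      t·r : u · t ≡ t · s r
      t·r = trans (trans (cong (_· t) (sym (conj-inv t u))) (cong (λ x → conj x (conj t u) · t) (refl-⁻¹ tR)))
        (trans (cong (λ x → conj t x · t) p) (group (t ∷ []) (s² r ∷ []) (# 0 ⊙ ! 0 ⊙ inv (# 0) ⊙ # 0) (# 0 ⊙ ! 0) refl))
      q₀ : Without r t₀
      q₀ = ≼c′⇒without (conj≼c′ (additive-refl tR (refl-s r) t≢r) (subst (_≼ c) t·r le))
      u≡ : u ≡ conj t (s r)
      u≡ = trans (sym (conj-inv t u)) (trans (cong (conj (t ⁻¹)) p) (cong (λ x → conj x (s r)) (refl-⁻¹ tR)))
      u₀≡ : conj (s r) u ≡ conj t₀ (s r)
      u₀≡ = trans (cong (conj (s r)) u≡) (group (t ∷ []) (s² r ∷ [])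
        (! 0 ⊙ (# 0 ⊙ ! 0 ⊙ inv (# 0)) ⊙ inv (! 0)) (! 0 ⊙ # 0 ⊙ inv (! 0) ⊙ ! 0 ⊙ inv (! 0 ⊙ # 0 ⊙ inv (! 0))) refl)
      outside : ¬ Without r (conj (s r) u)
      outside q = ¬without-s (subst (Without r) (trans (cong (conj (t₀ ⁻¹)) u₀≡) (conj-inv t₀ (s r))) (par-conj (par-⁻¹ q₀) q))
      ¬rt₀ : ¬ Commute (s r) t₀
      ¬rt₀ h = u≢r (trans u≡ (commute-conj (sym (subst₂ Commute conj-ss (conj-s² r t) (commute-conj-s r h)))))
      flip-true : ((conj t u ≡ʷ s r) ⊕ η t u) ⊕ (u ≡ʷ s r) ≡ false → η t u ≡ true
      flip-true h = lemma (trans (sym (cong₂ _⊕_ (cong (_⊕ η t u) (≡ʷ-true p)) (≡ʷ-false u≢r))) h)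
        where
        lemma : ∀ {b} → (true ⊕ b) ⊕ false ≡ false → b ≡ true
        lemma {true} _ = refl

    rotated⇒ : ∀ {t u} → Rotated t u → Fall t u → Fall (conj (s r) t) (conj (s r) u)
    rotated⇒ (both _ g) _ = g
    rotated⇒ (same p q) (inj₁ h)        = inj₁ (commute-conj-s r h)
    rotated⇒ (same p q) (inj₂ (inj₁ h)) = inj₂ (inj₁ (trans p h))
    rotated⇒ (same p q) (inj₂ (inj₂ h)) = inj₂ (inj₂ (trans q h))

    rotated⇐ : ∀ {t u} → Rotated t u → Fall (conj (s r) t) (conj (s r) u) → Fall t u
    rotated⇐ (both f _) _ = f
    rotated⇐ (same p q) (inj₁ h)        = inj₁ (subst₂ Commute (conj-s² r _) (conj-s² r _) (commute-conj-s r h))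
    rotated⇐ (same p q) (inj₂ (inj₁ h)) = inj₂ (inj₁ (trans (sym p) h))
    rotated⇐ (same p q) (inj₂ (inj₂ h)) = inj₂ (inj₂ (trans (sym q) h))

    rotated′ : ∀ {t u} → IsReflection t → IsReflection u → t ≢ s r → u ≢ s r → t ≢ u → t · u ≼ c ⊎ u · t ≼ c → Rotated t u
    rotated′ tR uR t≢r u≢r t≢u (inj₂ le) = rotated tR uR t≢r u≢r t≢u le
    rotated′ tR uR t≢r u≢r t≢u (inj₁ le) = rotated-sym (rotated uR tR u≢r t≢r (≢-sym t≢u) le)

    order-rot : ∀ {t u} → t · u ≼ c ⊎ u · t ≼ c → conj (s r) t · conj (s r) u ≼ c* ⊎ conj (s r) u · conj (s r) t ≼ c*
    order-rot {t} {u} (inj₁ le) = inj₁ (subst (_≼ c*) (conj-homo (s r) t u) (≼-rot le))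
    order-rot {t} {u} (inj₂ le) = inj₂ (subst (_≼ c*) (conj-homo (s r) u t) (≼-rot le))

    order-rot⁻ : ∀ {t u} → conj (s r) t · conj (s r) u ≼ c* ⊎ conj (s r) u · conj (s r) t ≼ c* → t · u ≼ c ⊎ u · t ≼ c
    order-rot⁻ {t} {u} (inj₁ le) = inj₁ (≼-rot⁻ (subst (_≼ c*) (sym (conj-homo (s r) t u)) le))
    order-rot⁻ {t} {u} (inj₂ le) = inj₂ (≼-rot⁻ (subst (_≼ c*) (sym (conj-homo (s r) u t)) le))

    compatible-rot : ∀ {t u} → IsReflection t → IsReflection u → t ≢ s r → u ≢ s r → t ≢ u →
                     Compatible (r ∷ ws) t u → Compatible (ws ++ r ∷ []) (conj (s r) t) (conj (s r) u)
    compatible-rot tR uR t≢r u≢r t≢u (f , o) = rotated⇒ (rotated′ tR uR t≢r u≢r t≢u o) f , order-rot o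

    compatible-rot⁻ : ∀ {t u} → IsReflection t → IsReflection u → t ≢ s r → u ≢ s r → t ≢ u →
                      Compatible (ws ++ r ∷ []) (conj (s r) t) (conj (s r) u) → Compatible (r ∷ ws) t u
    compatible-rot⁻ tR uR t≢r u≢r t≢u (f , o) = rotated⇐ (rotated′ tR uR t≢r u≢r t≢u (order-rot⁻ o)) f , order-rot⁻ o

    refl-conj≼c′ : ∀ {u} → IsReflection u → u ≼ c → Without r (conj (s r) u) → conj (s r) u ≼ c′
    refl-conj≼c′ uR le q = without⇒≼c′ (refl-par-≼ uniq (refl-conj (s r) uR)
      (par-conj (par-s (here refl)) (par-≼ le (par-word (r ∷ ws))))) q

    -- If `u · s r ≼ c`, this is `conj≼c′`. If `s r · u ≼ c`, then `u` itself avoids `r`, neither of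
    -- `s r` and `u` can invert the other, and `Fall` leaves only commutation, under which the
    -- conjugation fixes `u`.
    compatible-head⇒ : ∀ {u} → IsReflection u → u ≢ s r → Compatible (r ∷ ws) (s r) u → Without r (conj (s r) u)
    compatible-head⇒ {u} uR u≢r (f , inj₂ le) = ≼c′⇒without (conj≼c′ (additive-refl uR (refl-s r) u≢r) le)
    compatible-head⇒ {u} uR u≢r (f , inj₁ le) = by f
      where
      qu : Without r u
      qu = ≼c′⇒without (subst (_≼ c′) (group (u ∷ []) (s² r ∷ []) (! 0 ⊙ (! 0 ⊙ # 0)) (# 0) refl)
        (strip (additive-≼ (additive-refl (refl-s r) uR (≢-sym u≢r))) le))
      by : Fall (s r) u → Without r (conj (s r) u)
      by (inj₁ p)        = subst (Without r) (sym (commute-conj p)) qu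
      by (inj₂ (inj₁ p)) = case trans (sym p) (par-η-false qu ¬without-s) of λ ()
      by (inj₂ (inj₂ p)) = ⊥-elim (u≢r (≡ʷ-true⁻ (trans (sym (η-s r u)) p)))

    fall-head : ∀ {u} → Without r (conj (s r) u) → Fall (s r) u
    fall-head {u} q with commute? (s r) u
    ... | yes p = inj₁ p
    ... | no ¬p = inj₂ (inj₁ (trans (cong (λ x → η x (s r)) (sym (conj-s² r u))) (η-conj-s-self q
        (λ h → ¬p (subst (Commute (s r)) (conj-s² r u) (subst (λ x → Commute x (conj (s r) (conj (s r) u))) conj-ss (commute-conj-s r h)))))))

    compatible-head⇐ : ∀ {u} → IsReflection u → u ≼ c → Without r (conj (s r) u) → Compatible (r ∷ ws) (s r) u
    compatible-head⇐ {u} uR le q = fall-head q , inj₂ (proj₂ (·s≼c (refl-conj≼c′ uR le q)))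

  -- Paths under stripping and rotation

  steps-shift : ∀ {b r x} ts → Without r x → All (Without r) ts → Steps b x ts → Steps b (s r · x) ts
  steps-shift []       q _        _        = tt
  steps-shift {b} {r} (t ∷ ts) q (p ∷ ps) (h , hs) = trans (η-s·-without q p) h ,
    subst (λ y → Steps b y ts) (sym (assoc _ _ _)) (steps-shift ts (par-· q p) ps hs)

  steps-unshift : ∀ {b r x} ts → Without r x → All (Without r) ts → Steps b (s r · x) ts → Steps b x ts
  steps-unshift []       q _        _        = tt
  steps-unshift {b} {r} (t ∷ ts) q (p ∷ ps) (h , hs) = trans (sym (η-s·-without q p)) h ,
    steps-unshift ts (par-· q p) ps (subst (λ y → Steps b y ts) (assoc _ _ _) hs)

  -- The steps of the path whose direction survives conjugation by s r.
  NoFlip : Fin n → W → List W → Set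
  NoFlip r x []       = ⊤
  NoFlip r x (t ∷ ts) = conj x t ≢ s r × t ≢ s r × NoFlip r (x · t) ts

  steps-conj : ∀ {b r x} ts → NoFlip r x ts → Steps b x ts → Steps b (conj (s r) x) (map (conj (s r)) ts)
  steps-conj []       _            _        = tt
  steps-conj {b} {r} {x} (t ∷ ts) (p , q , nf) (h , hs) = trans (η-conj-s-same p q) h ,
    subst (λ y → Steps b y (map (conj (s r)) ts)) (conj-homo (s r) x t) (steps-conj ts nf hs)

  steps-conj⁻ : ∀ {b r x} ts → NoFlip r x ts → Steps b (conj (s r) x) (map (conj (s r)) ts) → Steps b x ts
  steps-conj⁻ []       _            _        = tt
  steps-conj⁻ {b} {r} {x} (t ∷ ts) (p , q , nf) (h , hs) = trans (sym (η-conj-s-same p q)) h ,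
    steps-conj⁻ ts nf (subst (λ y → Steps b y (map (conj (s r)) ts)) (sym (conj-homo (s r) x t)) hs)

  noFlip-without : ∀ {r x} ts → Without r x → All (Without r) ts → NoFlip r x ts
  noFlip-without []       _ _        = tt
  noFlip-without (t ∷ ts) q (p ∷ ps) = without-≢ (par-conj q p) , without-≢ p , noFlip-without ts (par-· q p) ps

  map-conj² : ∀ r ts → map (conj (s r)) (map (conj (s r)) ts) ≡ ts
  map-conj² r []       = refl
  map-conj² r (t ∷ ts) = cong₂ _∷_ (conj-s² r t) (map-conj² r ts)

  -- Between `x` and `β` no covering step is left multiplication by `s r`. This excludes one of the
  -- two ways in which a direction can change; the other, a factor `s r`, is excluded separately in
  -- `noFlip`.
  CrossFree : Fin n → W → W → Set
  CrossFree r x β = ∀ y t → x ≼ y → Additive y t → IsReflection t → y · t ≼ β → conj y t ≢ s r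

  noFlip : ∀ {r β} x ts → Reduced ts → Additive x (prodW ts) → x · prodW ts ≡ β → All (_≢ s r) ts → CrossFree r x β → NoFlip r x ts
  noFlip x [] _ _ _ _ _ = tt
  noFlip {r} {β} x (t ∷ ts) R a eq (≢r ∷ ≢rs) free with reduced-∷⁻ R
  ... | tR , R′ , b with additive-assocˡ a b
  ...   | a′ , xt = free x t ≼-refl xt tR (subst (x · t ≼_) (trans (assoc _ _ _) eq) (additive-≼ a′)) , ≢r ,
          noFlip (x · t) ts R′ a′ (trans (assoc _ _ _) eq) ≢rs (λ y u le → free y u (≼-trans (additive-≼ xt) le))

  reduced-pair-≢ : ∀ {t u} → Reduced (t ∷ u ∷ []) → t ≢ u
  reduced-pair-≢ {t} (tR ∷ _ , p) refl = case trans (sym p) (trans (cong ℓT (trans (cong (t ·_) (identityʳ t)) (refl-invol tR))) ℓT-e) of λ ()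

  pair-⊑ : ∀ {t u : W} {ts} → u ∈ ts → (t ∷ u ∷ []) ⊑ (t ∷ ts)
  pair-⊑ m = refl ∷ from∈ m

  member-step : ∀ {x ts t} → Reduced ts → Additive x (prodW ts) → t ∈ ts → Additive x t × x · t ≼ x · prodW ts
  member-step R a m = ≼-mulˡ a (factor-≼ R m)

  length-reduced : ∀ {ts} → Reflections ts → ∀ {w} → prodW ts ≡ w → ℓT w ≡ length ts → Reduced ts
  length-reduced R refl p = R , p

  down-par : ∀ {J x} ts → Par J x → Down x ts → Par J (x · prodW ts) × All (Par J) ts
  down-par {J} [] p _ = subst (Par J) (sym (identityʳ _)) p , []
  down-par {J} (t ∷ ts) p (h , hs) with par-exchange p h
  ... | pt with down-par ts (par-· p pt) hs
  ...   | q , qs = subst (Par J) (assoc _ _ _) q , pt ∷ qs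

  reduced-unique : ∀ {L} → Reduced L → Unique L
  reduced-unique {[]}    _ = []
  reduced-unique {t ∷ L} R = All.tabulate (λ m → reduced-pair-≢ (proj₁ (reduced-⊑ (pair-⊑ {t} m) R))) ∷ reduced-unique (proj₁ (proj₂ (reduced-∷⁻ R)))

  -- Every descending pair splits into a rising and a falling half

  Descends : W → W → Set
  Descends α β = ∃ λ D → Reflections D × α · prodW D ≡ β × Down α D × ℓT β ≡ ℓT α + length D

  descends-reduced : ∀ {α β} ((D , _) : Descends α β) → Reduced D × Additive α (prodW D)
  descends-reduced {α} (D , R , refl , _ , len) = (R , exact) , trans len (cong (ℓT α +_) (sym exact))
    where
    exact : ℓT (prodW D) ≡ length D
    exact = ℕₚ.≤-antisym (ℓT-≤ R refl) (ℕₚ.+-cancelˡ-≤ (ℓT α) _ _ (ℕₚ.≤-trans (ℕₚ.≤-reflexive (sym len)) (ℓT-sub α _)))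

  descends-≼ : ∀ {α β} → Descends α β → α ≼ β
  descends-≼ {α} ch@(D , _ , refl , _) = additive-≼ (proj₂ (descends-reduced ch))

  -- `inversions` strengthens the induction: when a new reflection `t` with `conj α t ≡ s r` is
  -- inserted at the turning point, `Insertion.fall-from` obtains `Fall t u` for every old factor
  -- `u` from `η α u ≡ true`.
  record Split (α β : W) : Set where
    field
      U D        : List W
      reduced    : Reduced (U ++ D)
      product-U  : prodW U ≡ α
      product    : prodW (U ++ D) ≡ β
      up         : Up e U
      down       : Down α D
      fall       : AllPairs Fall (U ++ D)
      inversions : All (λ t → η α t ≡ true) (U ++ D)

  split-facts : ∀ {α β} (S : Split α β) → let open Split S in Reduced U × Reduced D × Additive α (prodW D) × α · prodW D ≡ β
  split-facts record { U = U ; D = D ; reduced = R ; product-U = refl ; product = refl } with reduced-++⁻ U R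
  ... | RU , RD , a = RU , RD , a , sym (prodW-++ U D)

  module Cases (r : Fin n) (ws : List (Fin n)) (uniq : Unique (r ∷ ws)) where
    open Head′ r ws uniq public

    κ : W → W
    κ = conj (s r)

    κe : κ e ≡ e
    κe = conj-fix (s r) e refl

    s·s· : ∀ x → s r · (s r · x) ≡ x
    s·s· x = group (x ∷ []) (s² r ∷ []) (! 0 ⊙ (! 0 ⊙ # 0)) (# 0) refl

    crossing-≼ : ∀ {x t} → conj x t ≡ s r → Additive x t → IsReflection t → s r ≼ x · t
    crossing-≼ {x} {t} p a tR = subst (s r ≼_) (sym xt≡) (additive-≼ (trans (cong ℓT (sym xt≡))
      (trans a (trans (ℕₚ.+-comm (ℓT x) _) (cong (_+ ℓT x) (trans (ℓT-refl tR) (sym (ℓT-refl (refl-s r)))))))))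
      where
      xt≡ : x · t ≡ s r · x
      xt≡ = trans (group (x ∷ t ∷ []) [] (# 0 ⊙ # 1) (# 0 ⊙ # 1 ⊙ inv (# 0) ⊙ # 0) refl) (cong (_· x) p)

    crossFree-⋠ : ∀ {x β} → ¬ s r ≼ β → CrossFree r x β
    crossFree-⋠ ⋠ y t _ a tR le p = ⋠ (≼-trans (crossing-≼ p a tR) le)

    crossFree-outside : ∀ {x β} → ¬ Without r x → β ≼ c → CrossFree r x β
    crossFree-outside out β≼c y t x≼y a tR le p = out (par-≼ x≼y (≼c′⇒without (crossing p a tR (≼-trans le β≼c))))

    pairs-rotated : ∀ {L} → Reduced L → prodW L ≼ c → All (_≢ s r) L → AllPairs Rotated L
    pairs-rotated {[]} _ _ _ = []
    pairs-rotated {t ∷ L} R le (t≢ ∷ L≢) with reduced-∷⁻ R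
    ... | tR , R′ , a = All.tabulate one ∷ pairs-rotated R′ (≼-trans (additive-≼ʳ a) le) L≢
      where
      one : ∀ {u} → u ∈ L → Rotated t u
      one {u} m with reduced-⊑ (pair-⊑ {t} m) R
      ... | R₂ , le₂ = rotated′ tR (All.lookup (proj₁ R′) m) t≢ (All.lookup L≢ m) (reduced-pair-≢ R₂)
            (inj₁ (≼-trans (subst (_≼ prodW (t ∷ L)) (cong (t ·_) (identityʳ u)) le₂) le))

    fall-map : ∀ {L} → Reduced L → prodW L ≼ c → All (_≢ s r) L → AllPairs Fall L → AllPairs Fall (map κ L)
    fall-map R le ≢r f = AllPairsₚ.map⁺ (AllPairs.zipWith (λ (ρ , f) → rotated⇒ ρ f) (pairs-rotated R le ≢r , f))

    fall-map⁻ : ∀ {L} → Reduced L → prodW L ≼ c → All (_≢ s r) L → AllPairs Fall (map κ L) → AllPairs Fall L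
    fall-map⁻ R le ≢r f = AllPairs.zipWith (λ (ρ , f) → rotated⇐ ρ f) (pairs-rotated R le ≢r , AllPairsₚ.map⁻ f)

    reduced-without : ∀ {L} → Reduced L → prodW L ≼ c′ → All (Without r) L
    reduced-without R le = parabolic R (≼c′⇒without le)

    -- Ensures that the path from `α` to `β` keeps its directions under `κ`. The first alternative
    -- leaves no room for `s r`. In the second, a crossing step would force `α` to avoid `r`, and a
    -- factor `s r` would give `α · s r ≼ c` and so `κ α ≼ c′`.
    Turning : W → W → Set
    Turning α β = ¬ s r ≼ β ⊎ (¬ Without r α × ¬ κ α ≼ c′)

    turning-free : ∀ {α β} → β ≼ c → Turning α β → CrossFree r α β
    turning-free le (inj₁ ⋠)       = crossFree-⋠ ⋠
    turning-free le (inj₂ (out , _)) = crossFree-outside out le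

    turning-≢ : ∀ {α β D} → β ≼ c → Turning α β → Reduced D → Additive α (prodW D) → α · prodW D ≡ β → All (_≢ s r) D
    turning-≢ {α} {β} {D} le turn R a refl = All.tabulate λ m t≡ → avoid turn (subst (_∈ D) t≡ m)
      where
      avoid : Turning α β → s r ∉ D
      avoid (inj₁ ⋠) m = ⋠ (≼-trans (factor-≼ R m) (additive-≼ʳ a))
      avoid (inj₂ (_ , ⋠c′)) m with member-step R a m
      ... | a′ , le′ = ⋠c′ (conj≼c′ a′ (≼-trans le′ le))

    -- The new factor `t` is appended to the rising half. Right multiplication of `s r · α` by it is
    -- left multiplication by `s r`, which gives back `α` and does not affect the directions of the
    -- falling half.
    split-head : ∀ {α β} → s r ≼ α → α ≼ β → β ≼ c → Split (s r · α) (s r · β) → Split α β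
    split-head {α} {β} r≼α α≼β β≼c S = record
      { U = U ++ t ∷ []
      ; D = D
      ; reduced = length-reduced (↭ₚ.All-resp-↭ (↭-sym perm) (tR ∷ proj₁ reduced)) product′
          (trans ℓTβ (trans (cong suc (proj₂ reduced)) (sym (↭ₚ.↭-length perm))))
      ; product-U = product-U′
      ; product = product′
      ; up = steps-++ U up (subst (λ x → η x t ≡ false) (trans (sym product-U) (sym (identityˡ _))) I.η-x , tt)
      ; down = subst (λ x → Down x D) (s·s· α) (steps-shift D q₀ (Allₚ.++⁻ʳ U qs) down)
      ; fall = AllPairs-↭ fall-sym (↭-sym perm) (All.zipWith (λ (q , h) → I.fall-from q h) (qs , inversions) ∷ fall)
      ; inversions = ↭ₚ.All-resp-↭ (↭-sym perm)
          (trans (cong (λ x → η x t) (sym α₀t)) (η-up tR I.η-x)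
          ∷ All.zipWith (λ {u} (q , h) → trans (trans (cong (λ x → η x u) (sym (s·s· α))) (η-s·-without q₀ q)) h) (qs , inversions))
      }
      where
      open Split S
      α₀ = s r · α
      t = conj (α₀ ⁻¹) (s r)
      tR : IsReflection t
      tR = refl-conj _ (refl-s r)
      β₀≼c′ : s r · β ≼ c′
      β₀≼c′ = strip (≼-trans r≼α α≼β) β≼c
      α₀≼c′ : α₀ ≼ c′
      α₀≼c′ = strip r≼α (≼-trans α≼β β≼c)
      q₀ : Without r α₀
      q₀ = ≼c′⇒without α₀≼c′
      qs : All (Without r) (U ++ D)
      qs = reduced-without reduced (subst (_≼ c′) (sym product) β₀≼c′)
      module I = Insertion {r} {α₀} {t} q₀ (conj-inv′ α₀ (s r))
      α₀t : α₀ · t ≡ α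
      α₀t = trans I.x·t (s·s· α)
      product-U′ : prodW (U ++ t ∷ []) ≡ α
      product-U′ = trans (prodW-∷ʳ U t) (trans (cong (_· t) product-U) α₀t)
      product′ : prodW ((U ++ t ∷ []) ++ D) ≡ β
      product′ = trans (prodW-++ (U ++ t ∷ []) D) (trans (cong (_· prodW D) (trans product-U′ (sym (s·s· α))))
        (trans (assoc _ _ _) (trans (cong (s r ·_) (proj₂ (proj₂ (proj₂ (split-facts S))))) (s·s· β))))
      ℓTβ : ℓT β ≡ suc (ℓT (prodW (U ++ D)))
      ℓTβ = trans (cong ℓT (sym (s·s· β))) (trans (additive-s β₀≼c′) (trans (cong (_+ ℓT (s r · β)) (ℓT-refl (refl-s r))) (cong (suc ∘ ℓT) (sym product))))
      perm : (U ++ t ∷ []) ++ D ↭ t ∷ (U ++ D)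
      perm = subst (_↭ t ∷ (U ++ D)) (sym (Listₚ.++-assoc U (t ∷ []) D)) (↭ₚ.shift t U D)

    split-turn : ∀ {α β} → ¬ s r ≼ α → β ≼ c → Turning α β → Split (κ α) (κ β) → Split α β
    split-turn {α} {β} r⋠α β≼c turn S = record
      { U = U ; D = D
      ; reduced = RL
      ; product-U = product-U′
      ; product = product′
      ; up = steps-conj⁻ U (noFlip e U RU (trans (cong ℓT (identityˡ _)) (cong (_+ ℓT (prodW U)) (sym ℓT-e))) (trans (identityˡ _) product-U′) U≢ (crossFree-⋠ r⋠α))
          (subst₂ Up (sym κe) (sym (map-conj² r S.U)) S.up)
      ; down = steps-conj⁻ D (noFlip α D RD aD αD D≢ free) (subst (Down (κ α)) (sym (map-conj² r S.D)) S.down)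
      ; fall = fall-map⁻ RL (subst (_≼ c) (sym product′) β≼c) L≢ (subst (AllPairs Fall) (sym κL) S.fall)
      ; inversions = All.tabulate invert
      }
      where
      module S = Split S
      U D : List W
      U = map κ S.U
      D = map κ S.D
      L≡ : map κ (S.U ++ S.D) ≡ U ++ D
      L≡ = Listₚ.map-++ κ S.U S.D
      κL : map κ (U ++ D) ≡ S.U ++ S.D
      κL = trans (cong (map κ) (sym L≡)) (map-conj² r _)
      RL : Reduced (U ++ D)
      RL = subst Reduced L≡ (reduced-conj (s r) S.reduced)
      product-U′ : prodW U ≡ α
      product-U′ = trans (prodW-conj (s r) S.U) (trans (cong κ S.product-U) (conj-s² r α))
      product′ : prodW (U ++ D) ≡ β
      product′ = trans (cong prodW (sym L≡)) (trans (prodW-conj (s r) (S.U ++ S.D)) (trans (cong κ S.product) (conj-s² r β)))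
      RU : Reduced U
      RU = proj₁ (reduced-++⁻ U RL)
      RD : Reduced D
      RD = proj₁ (proj₂ (reduced-++⁻ U RL))
      aD : Additive α (prodW D)
      aD = subst (λ x → Additive x (prodW D)) product-U′ (proj₂ (proj₂ (reduced-++⁻ U RL)))
      αD : α · prodW D ≡ β
      αD = trans (cong (_· prodW D) (sym product-U′)) (trans (sym (prodW-++ U D)) product′)
      U≢ : All (_≢ s r) U
      U≢ = All.tabulate λ m t≡ → r⋠α (subst₂ _≼_ t≡ product-U′ (factor-≼ RU m))
      D≢ : All (_≢ s r) D
      D≢ = turning-≢ β≼c turn RD aD αD
      L≢ : All (_≢ s r) (U ++ D)
      L≢ = Allₚ.++⁺ U≢ D≢
      free : CrossFree r α β
      free = turning-free β≼c turn
      uncrossed : ∀ {t} → t ∈ U ++ D → conj α t ≢ s r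
      uncrossed {t} m with ∈ₚ.∈-++⁻ U m
      ... | inj₁ m′ = λ p → r⋠α (subst₂ _≼_ p (group (α ∷ []) [] (# 0 ⊙ # 0 ⊙ inv (# 0)) (# 0) refl)
              (≼-conj α (subst (t ≼_) product-U′ (factor-≼ RU m′))))
      ... | inj₂ m′ with member-step RD aD m′
      ...   | a , le = free α t ≼-refl a (All.lookup (proj₁ RD) m′) (subst (α · t ≼_) αD le)
      invert : ∀ {t} → t ∈ U ++ D → η α t ≡ true
      invert {t} m = trans (sym (η-conj-s-same (uncrossed m) (All.lookup L≢ m)))
        (All.lookup S.inversions (subst (κ t ∈_) κL (∈ₚ.∈-map⁺ κ m)))

    κ-without-outside : ∀ {α} → Without r (κ α) → ¬ Without r α → ¬ Commute (s r) (κ α)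
    κ-without-outside {α} q out comm = out (subst (Without r) (trans (sym (commute-conj comm)) (conj-s² r α)) q)

    -- After conjugating the smaller factorization by `s r`, the factor `s r` closes the falling
    -- half, since `κ β₀ · s r` equals `s r · β₀`. This last step falls because `β₀` does not
    -- commute with `s r`; otherwise `α` would avoid `r`.
    split-final : ∀ {α β} → ¬ Without r α → s r · β ≼ c′ → α ≼ β → Split (κ α) (s r · β) → Split α β
    split-final {α} {β} α∉ β₀≼c′ α≼β S = record
      { U = U ; D = D
      ; reduced = length-reduced (subst Reflections L≡ (Allₚ.++⁺ (refls-conj (s r) (proj₁ S.reduced)) (refl-s r ∷ []))) product′
          (trans ℓTβ (trans (cong suc (proj₂ S.reduced)) (sym (trans (cong length (sym L≡)) (trans (length-∷ʳ (map κ (S.U ++ S.D)) (s r)) (cong suc (Listₚ.length-map κ (S.U ++ S.D))))))))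
      ; product-U = product-U′
      ; product = product′
      ; up = subst (λ x → Up x U) κe (steps-conj S.U (noFlip-without S.U par-e (Allₚ.++⁻ˡ S.U qs)) S.up)
      ; down = subst (λ x → Down x D) (conj-s² r α) (steps-++ (map κ S.D) (steps-conj S.D (noFlip-without S.D q₀ (Allₚ.++⁻ʳ S.U qs)) S.down)
          (trans (cong (λ x → η x (s r)) end≡) (η-conj-s-self qβ₀ ¬rβ₀) , tt))
      ; fall = AllPairs-↭ fall-sym (↭-sym perm) (Allₚ.map⁺ (All.map (λ {t} q → fall-head (subst (Without r) (sym (conj-s² r t)) q)) qs)
          ∷ fall-map S.reduced (≼c′⇒≼c (subst (_≼ c′) (sym S.product) β₀≼c′)) (All.map without-≢ qs) S.fall)
      ; inversions = ↭ₚ.All-resp-↭ (↭-sym perm)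
          (trans (cong (λ x → η x (s r)) (sym (conj-s² r α))) (η-conj-s-self q₀ (κ-without-outside q₀ α∉))
          ∷ Allₚ.map⁺ (All.zipWith (λ {t} (q , h) → trans (cong (λ x → η x (κ t)) (sym (conj-s² r α)))
              (trans (η-conj-s-same (without-≢ (par-conj q₀ q)) (without-≢ q)) h)) (qs , S.inversions)))
      }
      where
      module S = Split S
      U D : List W
      U = map κ S.U
      D = map κ S.D ++ s r ∷ []
      β₀ = s r · β
      facts = split-facts S
      α₀≼β₀ : κ α ≼ β₀
      α₀≼β₀ = subst (κ α ≼_) (proj₂ (proj₂ (proj₂ facts))) (additive-≼ (proj₁ (proj₂ (proj₂ facts))))
      q₀ : Without r (κ α)
      q₀ = ≼c′⇒without (≼-trans α₀≼β₀ β₀≼c′)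
      qβ₀ : Without r β₀
      qβ₀ = ≼c′⇒without β₀≼c′
      qs : All (Without r) (S.U ++ S.D)
      qs = reduced-without S.reduced (subst (_≼ c′) (sym S.product) β₀≼c′)
      ¬rβ₀ : ¬ Commute (s r) β₀
      ¬rβ₀ comm = α∉ (par-≼ (subst₂ _≼_ (conj-s² r α) (commute-conj comm) (≼-conj (s r) α₀≼β₀)) qβ₀)
      L≡ : map κ (S.U ++ S.D) ++ s r ∷ [] ≡ U ++ D
      L≡ = trans (cong (_++ s r ∷ []) (Listₚ.map-++ κ S.U S.D)) (Listₚ.++-assoc U (map κ S.D) (s r ∷ []))
      product-U′ : prodW U ≡ α
      product-U′ = trans (prodW-conj (s r) S.U) (trans (cong κ S.product-U) (conj-s² r α))
      product′ : prodW (U ++ D) ≡ β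
      product′ = trans (cong prodW (sym L≡)) (trans (prodW-∷ʳ (map κ (S.U ++ S.D)) (s r)) (trans (cong (_· s r) (trans (prodW-conj (s r) (S.U ++ S.D)) (cong κ S.product)))
        (group (β ∷ []) (s² r ∷ []) (! 0 ⊙ (! 0 ⊙ # 0) ⊙ inv (! 0) ⊙ ! 0) (# 0) refl)))
      ℓTβ : ℓT β ≡ suc (ℓT (prodW (S.U ++ S.D)))
      ℓTβ = trans (cong ℓT (sym (s·s· β))) (trans (additive-s β₀≼c′) (trans (cong (_+ ℓT β₀) (ℓT-refl (refl-s r))) (cong (suc ∘ ℓT) (sym S.product))))
      end≡ : κ (κ α) · prodW (map κ S.D) ≡ κ β₀
      end≡ = trans (cong (κ (κ α) ·_) (prodW-conj (s r) S.D)) (trans (sym (conj-homo (s r) (κ α) _)) (cong κ (proj₂ (proj₂ (proj₂ facts)))))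
      perm : U ++ D ↭ s r ∷ map κ (S.U ++ S.D)
      perm = subst (_↭ s r ∷ map κ (S.U ++ S.D)) L≡ (↭-sym (↭ₚ.∷↭∷ʳ (s r) (map κ (S.U ++ S.D))))

    descends-head : ∀ {α β} → s r ≼ α → β ≼ c → Descends α β → Descends (s r · α) (s r · β)
    descends-head {α} {β} r≼α β≼c ch@(D , R , refl , dn , len) = D , R , assoc _ _ _ ,
        steps-unshift D q₀ (parabolic (proj₁ red) (par-cancelˡ q₀ (subst (Without r) (sym (assoc _ _ _)) qβ₀))) (subst (λ x → Down x D) (sym (s·s· α)) dn) ,
        ℕₚ.suc-injective (trans (sym (lower β₀≼c′)) (trans len (cong (_+ length D) (lower α₀≼c′))))
      where
      red = descends-reduced ch
      α₀≼c′ : s r · α ≼ c′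
      α₀≼c′ = strip r≼α (≼-trans (descends-≼ ch) β≼c)
      β₀≼c′ : s r · β ≼ c′
      β₀≼c′ = strip (≼-trans r≼α (descends-≼ ch)) β≼c
      q₀ : Without r (s r · α)
      q₀ = ≼c′⇒without α₀≼c′
      qβ₀ : Without r (s r · β)
      qβ₀ = ≼c′⇒without β₀≼c′
      lower : ∀ {x} → s r · x ≼ c′ → ℓT x ≡ suc (ℓT (s r · x))
      lower {x} le = trans (cong ℓT (sym (s·s· x))) (trans (additive-s le) (cong (_+ ℓT (s r · x)) (ℓT-refl (refl-s r))))

    descends-turn : ∀ {α β} → β ≼ c → Turning α β → Descends α β → Descends (κ α) (κ β)
    descends-turn {α} {β} β≼c turn ch@(D , R , refl , dn , len) = map κ D , refls-conj (s r) R ,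
        trans (cong (κ α ·_) (prodW-conj (s r) D)) (sym (conj-homo (s r) α _)) ,
        steps-conj D (noFlip α D RD aD refl (turning-≢ β≼c turn RD aD refl) (turning-free β≼c turn)) dn ,
        trans (ℓT-conj (s r) β) (trans len (cong₂ _+_ (sym (ℓT-conj (s r) α)) (sym (Listₚ.length-map κ D))))
      where
      RD = proj₁ (descends-reduced ch)
      aD = proj₂ (descends-reduced ch)

    lower-ℓT : ∀ {x} → s r · x ≼ c′ → ℓT x ≡ suc (ℓT (s r · x))
    lower-ℓT {x} le = trans (cong ℓT (sym (s·s· x))) (trans (additive-s le) (cong (_+ ℓT (s r · x)) (ℓT-refl (refl-s r))))

    record FinalStep (α β : W) (D : List W) : Set where
      field
        pre post       : List W
        D≡        : D ≡ pre ++ s r ∷ post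
        others-≢  : All (_≢ s r) (pre ++ post)
        without-B : All (Without r) post
        down      : Down (κ α) (map κ pre ++ post)
        product   : κ α · prodW (map κ pre ++ post) ≡ s r · β

    -- Without a factor `s r`, the conjugated path would fall inside the parabolic subgroup and end
    -- at the conjugate of `β`, although `s r · β` avoids `r`; so `s r` would avoid `r`. The factor
    -- found cuts the path: before it the path is conjugated, after it `s r` is stripped on the
    -- left.
    final-step : ∀ {α β D} → ¬ Without r α → κ α ≼ c′ → s r ≼ β → β ≼ c →
                 Reduced D → Additive α (prodW D) → α · prodW D ≡ β → Down α D → FinalStep α β D
    final-step {α} {β} {D} α∉ κα≼c′ r≼β β≼c RD aD αD dn with Any.any? (s r ≟_) D
    ... | no r∉D = ⊥-elim (¬without-s (subst (Without r) (s⁻¹ r) (par-cancelˡ qβ₀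
            (subst (Without r) κβ≡ (proj₁ (down-par (map κ D) q₀ dn′))))))
      where
      q₀ : Without r (κ α)
      q₀ = ≼c′⇒without κα≼c′
      qβ₀ : Without r (s r · β)
      qβ₀ = ≼c′⇒without (strip r≼β β≼c)
      dn′ : Down (κ α) (map κ D)
      dn′ = steps-conj D (noFlip α D RD aD αD (All.tabulate λ m t≡ → r∉D (subst (_∈ D) t≡ m)) (crossFree-outside α∉ β≼c)) dn
      κβ≡ : κ α · prodW (map κ D) ≡ s r · β · s r ⁻¹
      κβ≡ = trans (cong (κ α ·_) (prodW-conj (s r) D)) (trans (sym (conj-homo (s r) α _)) (cong κ αD))
    ... | yes r∈D with ∈ₚ.∈-∃++ r∈D
    ...   | pre , post , refl = record
      { pre = pre ; post = post ; D≡ = refl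
      ; others-≢ = unique-head (AllPairs-↭ ≢-sym (↭ₚ.shift (s r) pre post) (reduced-unique RD))
      ; without-B = qB
      ; down = steps-++ (map κ pre) dnA (subst (λ y → Down y post) (sym κx≡) (steps-unshift post qx₀ qB (subst (λ y → Down y post) xr≡ (proj₂ (proj₂ halves)))))
      ; product = trans (cong (κ α ·_) (prodW-++ (map κ pre) post)) (trans (sym (assoc _ _ _)) (trans (cong (_· prodW post) κx≡) x₀B))
      }
      where
      x = α · prodW pre
      x₀ = κ x
      halves : Down α pre × Down x (s r ∷ post)
      halves = steps-++⁻ pre dn
      parts = reduced-++⁻ pre RD
      adds = additive-assocˡ {α} {prodW pre} {prodW (s r ∷ post)} (subst (Additive α) (prodW-++ pre (s r ∷ post)) aD) (proj₂ (proj₂ parts))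
      xP : x · prodW (s r ∷ post) ≡ β
      xP = trans (assoc _ _ _) (trans (cong (α ·_) (sym (prodW-++ pre (s r ∷ post)))) αD)
      A≢ : All (_≢ s r) pre
      A≢ = Allₚ.++⁻ˡ pre (unique-head (AllPairs-↭ ≢-sym (↭ₚ.shift (s r) pre post) (reduced-unique RD)))
      dnA : Down (κ α) (map κ pre)
      dnA = steps-conj pre (noFlip α pre (proj₁ parts) (proj₂ adds) refl A≢
        (crossFree-outside α∉ (≼-trans (subst (x ≼_) xP (additive-≼ (proj₁ adds))) β≼c))) (proj₁ halves)
      κx≡ : κ α · prodW (map κ pre) ≡ x₀
      κx≡ = trans (cong (κ α ·_) (prodW-conj (s r) pre)) (sym (conj-homo (s r) α _))
      qx₀ : Without r x₀
      qx₀ = subst (Without r) κx≡ (proj₁ (down-par (map κ pre) (≼c′⇒without κα≼c′) dnA))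
      x₀B : x₀ · prodW post ≡ s r · β
      x₀B = trans (group (x ∷ prodW post ∷ []) (s² r ∷ []) (! 0 ⊙ # 0 ⊙ inv (! 0) ⊙ # 1) (! 0 ⊙ (# 0 ⊙ (! 0 ⊙ # 1))) refl) (cong (s r ·_) xP)
      qB : All (Without r) post
      qB = parabolic (proj₁ (proj₂ (reduced-∷⁻ (proj₁ (proj₂ parts))))) (par-cancelˡ qx₀ (subst (Without r) (sym x₀B) (≼c′⇒without (strip r≼β β≼c))))
      xr≡ : x · s r ≡ s r · x₀
      xr≡ = group (x ∷ []) (s² r ∷ []) (# 0 ⊙ ! 0) (! 0 ⊙ (! 0 ⊙ # 0 ⊙ inv (! 0))) refl

    descends-final : ∀ {α β} → ¬ Without r α → κ α ≼ c′ → s r ≼ β → β ≼ c → Descends α β → Descends (κ α) (s r · β)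
    descends-final {α} {β} α∉ κα≼c′ r≼β β≼c ch@(D , R , αD , dn , len) = map κ pre ++ post ,
        Allₚ.++⁺ (refls-conj (s r) (Allₚ.++⁻ˡ pre R′)) (All.tail (Allₚ.++⁻ʳ pre R′)) , product , down ,
        ℕₚ.suc-injective (trans (sym (lower-ℓT (strip r≼β β≼c))) (trans len (trans (cong (ℓT α +_) length≡)
          (trans (ℕₚ.+-suc _ _) (cong (λ k → suc (k + length (map κ pre ++ post))) (sym (ℓT-conj (s r) α)))))))
      where
      open FinalStep (final-step α∉ κα≼c′ r≼β β≼c (proj₁ (descends-reduced ch)) (proj₂ (descends-reduced ch)) αD dn)
      R′ : Reflections (pre ++ s r ∷ post)
      R′ = subst Reflections D≡ R
      length≡ : length D ≡ suc (length (map κ pre ++ post))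
      length≡ = trans (cong length D≡) (trans (Listₚ.length-++ pre) (trans (ℕₚ.+-suc _ _)
        (cong suc (trans (cong (_+ length post) (sym (Listₚ.length-map κ pre))) (sym (Listₚ.length-++ (map κ pre)))))))

    outside-α : ∀ {α β D} → s r ≼ β → Down α D → α · prodW D ≡ β → ¬ Without r α
    outside-α {D = D} r≼β dn refl q = ¬without-s (par-≼ r≼β (proj₁ (down-par D q dn)))

    data Case (α β : W) : Set where
      turning : Turning α β → Case α β
      final   : ¬ Without r α → κ α ≼ c′ → s r ≼ β → Case α β

    case-split : ∀ {α β} → (s r ≼ β → ¬ Without r α) → Case α β
    case-split {α} {β} out with ≼-dec (s r) β | ≼-dec (κ α) c′
    ... | no r⋠β  | _      = turning (inj₁ r⋠β)
    ... | yes r≼β | yes le = final (out r≼β) le r≼β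
    ... | yes r≼β | no ¬le = turning (inj₂ (out r≼β , ¬le))

    split-step : (∀ {α β} → β ≼ c′ → Descends α β → Split α β) → ∀ {α β} → β ≼ c → Descends α β →
                 (s r ≼ α ⊎ (Descends (κ α) (κ β) → Split (κ α) (κ β))) → Split α β
    split-step ih {α} {β} β≼c ch = λ { (inj₁ r≼α) → head r≼α ; (inj₂ rec) → rotated-step rec (≼-dec (s r) α) }
      where
      α≼β = descends-≼ ch
      head : s r ≼ α → Split α β
      head r≼α = split-head r≼α α≼β β≼c (ih (strip (≼-trans r≼α α≼β) β≼c) (descends-head r≼α β≼c ch))
      rotated-step : (Descends (κ α) (κ β) → Split (κ α) (κ β)) → Dec (s r ≼ α) → Split α β
      rotated-step rec (yes r≼α) = head r≼α
      rotated-step rec (no r⋠α) with case-split {α} {β} (λ r≼β → outside-α r≼β (proj₁ (proj₂ (proj₂ (proj₂ ch)))) (proj₁ (proj₂ (proj₂ ch))))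
      ... | final α∉ le r≼β = split-final α∉ (strip r≼β β≼c) α≼β (ih (strip r≼β β≼c) (descends-final α∉ le r≼β β≼c ch))
      ... | turning turn = split-turn r⋠α β≼c turn (rec (descends-turn β≼c turn ch))

  first-factor : ∀ {α} → α ≢ e → ∃ λ t → IsReflection t × t ≼ α
  first-factor {α} α≢e with reducedFactors α
  ... | [] , _ , p = ⊥-elim (α≢e (sym p))
  ... | t ∷ ts , R , refl with reduced-∷⁻ R
  ...   | tR , _ , a = t , tR , additive-≼ a

  descends-from-e : ∀ {β} → Descends e β → β ≡ e
  descends-from-e ([] , _ , p , _) = sym (trans (sym (identityʳ e)) p)
  descends-from-e (t ∷ _ , _ , _ , (h , _) , _) = case trans (sym h) (η-e t) of λ ()

  split-e : Split e e
  split-e = record { U = [] ; D = [] ; reduced = reduced-[] ; product-U = refl ; product = refl ; up = tt ; down = tt ; fall = [] ; inversions = [] }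

  SplitsBelow : List (Fin n) → Set
  SplitsBelow ws = ∀ {α β} → β ≼ prodS ws → Descends α β → Split α β

  -- The reflection `t` below `α` is rotated along with the pair. When it becomes the head letter,
  -- `s r ≼ α` holds and the pair reduces to the shorter word, so the recursion on the `Hit` is well
  -- founded.
  splitting-hit : ∀ {k} → (∀ {ws} → length ws ≡ k → Unique ws → SplitsBelow ws) →
                  ∀ {ws t} → length ws ≡ suc k → Unique ws → Hit ws t →
                  ∀ {α β} → t ≼ α → β ≼ prodS ws → Descends α β → Split α β
  splitting-hit ih {r ∷ ws} len uniq (now refl) t≼α β≼c ch =
    Cases.split-step r ws uniq (ih (ℕₚ.suc-injective len) (AllPairs.tail uniq)) β≼c ch (inj₁ t≼α)
  splitting-hit ih {r ∷ ws} len uniq (later h) t≼α β≼c ch =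
    Cases.split-step r ws uniq (ih (ℕₚ.suc-injective len) (AllPairs.tail uniq)) β≼c ch
      (inj₂ (splitting-hit ih (trans (length-∷ʳ ws r) len) (rotate uniq) h (≼-conj (s r) t≼α) (Cases.≼-rot r ws uniq β≼c)))

  splitting : ∀ k {ws} → length ws ≡ k → Unique ws → SplitsBelow ws
  splitting k {ws} len uniq {α} {β} β≼c ch with α ≟ e
  -- No step falls from `e`, so `β` is `e` as well.
  ... | yes refl = subst (Split e) (sym (descends-from-e ch)) split-e
  splitting zero {[]} len uniq β≼c ch | no α≢e = ⊥-elim (α≢e (ℓT-0 (ℕₚ.n≤0⇒n≡0
    (ℕₚ.≤-trans (ℕₚ.m≤m+n _ _) (ℕₚ.≤-reflexive (trans (sym (≼-trans (descends-≼ ch) β≼c)) ℓT-e))))))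
  splitting (suc k) {ws} len uniq β≼c ch | no α≢e with first-factor α≢e
  ... | t , tR , t≼α = splitting-hit (splitting k) len uniq (≼-hit uniq tR (≼-trans t≼α (≼-trans (descends-≼ ch) β≼c))) t≼α β≼c ch

  -- Uniqueness of the rising and the falling half

  remove-⊑ : ∀ {A : Set} (xs : List A) {y ys} → (xs ++ ys) ⊑ (xs ++ y ∷ ys)
  remove-⊑ []       = _ ∷ʳ ⊑-refl
  remove-⊑ (x ∷ xs) = refl ∷ remove-⊑ xs

  commute-prodW : ∀ {t ts} → All (Commute t) ts → Commute t (prodW ts)
  commute-prodW []       = trans (identityʳ _) (sym (identityˡ _))
  commute-prodW {t} {u ∷ ts} (p ∷ ps) = trans (sym (assoc _ _ _)) (trans (cong (_· prodW ts) p)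
    (trans (assoc _ _ _) (trans (cong (u ·_) (commute-prodW ps)) (sym (assoc _ _ _)))))

  -- Letters of a rising (falling) stretch on the far side of an inserted reflection commute with it.
  commuting-ups : ∀ {r x t} ts → Without r x → conj x t ≡ s r → All (Without r) ts → Up x ts → All (Fall t) ts → All (Commute t) ts
  commuting-ups [] _ _ _ _ _ = []
  commuting-ups {r} {x} {t} (u ∷ ts) q p (pu ∷ ps) (h , hs) (f ∷ fs) = tu ∷
    commuting-ups ts (par-· q pu) (trans (conj-· x u t) (trans (cong (conj x) (commute-conj (sym tu))) p)) ps hs fs
    where
    tu : Commute t u
    tu = Insertion.fall-down q p pu f h

  commuting-downs : ∀ {r y t} ts → Reflections ts → Without r y → conj (y · prodW ts) t ≡ s r → All (Without r) ts → Down y ts → All (Fall t) ts → All (Commute t) ts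
  commuting-downs [] _ _ _ _ _ _ = []
  commuting-downs {r} {y} {t} (u ∷ ts) (uR ∷ R) q p (pu ∷ ps) (h , hs) (f ∷ fs) =
    Insertion.fall-down (par-· q pu) yu pu f (η-down uR h) ∷ rest-commute
    where
    rest-commute : All (Commute t) ts
    rest-commute = commuting-downs ts R (par-· q pu) (trans (cong (λ z → conj z t) (assoc _ _ _)) p) ps hs fs
    yu : conj (y · u) t ≡ s r
    yu = trans (cong (conj (y · u)) (sym (commute-conj (sym (commute-prodW rest-commute)))))
      (trans (sym (conj-· (y · u) (prodW ts) t)) (trans (cong (λ z → conj z t) (assoc _ _ _)) p))

  IsUp : W → List W → Set
  IsUp α U = Reduced U × prodW U ≡ α × Up e U × AllPairs Fall U

  IsDown : W → W → List W → Set
  IsDown α β D = Reduced D × Additive α (prodW D) × α · prodW D ≡ β × Down α D × AllPairs Fall D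

  is-down-≼ : ∀ {α β D} → IsDown α β D → α ≼ β
  is-down-≼ (_ , a , refl , _) = additive-≼ a

  UpUnique : W → Set
  UpUnique α = ∀ {U U′ t} → IsUp α U → IsUp α U′ → t ∈ U → t ∈ U′

  DownUnique : W → W → Set
  DownUnique α β = ∀ {D D′ t} → IsDown α β D → IsDown α β D′ → t ∈ D → t ∈ D′

  ∈-↭ : ∀ {A : Set} {x : A} {xs ys} → xs ↭ ys → x ∈ xs → x ∈ ys
  ∈-↭ = ↭ₚ.∈-resp-↭

  map-conj-∈ : ∀ r {t ts} → conj (s r) t ∈ map (conj (s r)) ts → t ∈ ts
  map-conj-∈ r {t} {ts} m with ∈ₚ.∈-map⁻ (conj (s r)) m
  ... | u , u∈ , eq = subst (_∈ ts) (conj-injective (s r) (sym eq)) u∈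

  module Uniqueness (r : Fin n) (ws : List (Fin n)) (uniq : Unique (r ∷ ws)) where
    open Cases r ws uniq public

    -- The first factor that does not avoid `r` is the crossing. By `subword`, `x · t` is then `s r`
    -- times a word without `r`; exchange with `t` must delete this letter, as `x` avoids `r`.
    crossing-step : ∀ {α₀} x ts → Without r α₀ → Without r x → Reflections ts → Up x ts → x · prodW ts ≡ s r · α₀ →
                    ∃₂ λ pre t → ∃ λ post → ts ≡ pre ++ t ∷ post × Without r (x · prodW pre) × conj (x · prodW pre) t ≡ s r
    crossing-step {α₀} x [] qα q _ _ p = ⊥-elim (¬without-s (par-cancelʳ qα (subst (Without r) (trans (sym (identityʳ x)) p) q)))
    crossing-step {α₀} x (t ∷ ts) qα q (tR ∷ R) (h , hs) p with without? r t
    ... | yes qt with crossing-step (x · t) ts qα (par-· q qt) R hs (trans (assoc _ _ _) p)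
    ...   | pre , u , post , refl , q′ , p′ = t ∷ pre , u , post , refl ,
            subst (Without r) (assoc _ _ _) q′ , trans (cong (λ z → conj z u) (sym (assoc _ _ _))) p′
    crossing-step {α₀} x (t ∷ ts) qα@(ρ , ρ≢r , ρ≡) q (tR ∷ R) (h , hs) p | no ¬qt =
        [] , t , ts , refl , subst (Without r) (sym (identityʳ x)) q ,
        trans (cong (λ z → conj z t) (identityʳ x)) (cross (subword (x · t) (r ∷ ρ) R hs (trans (cong (s r ·_) ρ≡) (trans (sym p) (sym (assoc _ _ _))))))
      where
      x≡xtt : x ≡ x · t · t
      x≡xtt = sym (tt-cancel x tR)
      cross : (∃ λ σ → σ ⊑ (r ∷ ρ) × length (r ∷ ρ) ≡ length ts + length σ × prodS σ ≡ x · t) → conj x t ≡ s r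
      cross (σ , (_ ∷ʳ σ⊑ρ) , _ , σ≡) = ⊥-elim (¬qt (par-cancelˡ q (subst (Without r) σ≡ (without-word (⊑ₚ.All-resp-⊆ σ⊑ρ ρ≢r)))))
      cross (.r ∷ σ , (refl ∷ σ⊑ρ) , _ , σ≡) with exchangeʷ (r ∷ σ) t σ≡ (η-up tR h)
      ... | _ , drop , eq = trans (cong (_· x ⁻¹) (trans (sym σ≡) (cong (s r ·_) (sym (trans x≡xtt eq)))))
              (group (x ∷ []) (s² r ∷ []) (! 0 ⊙ # 0 ⊙ inv (# 0)) (! 0) refl)
      ... | _ ∷ vs , keep v⋖σ , eq = ⊥-elim (¬without-s (par-cancelʳ (without-word (⋖-All v⋖σ (⊑ₚ.All-resp-⊆ σ⊑ρ ρ≢r)))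
              (subst (Without r) (trans x≡xtt eq) q)))

    -- The crossing factor commutes with all factors after it, by `commuting-ups`. It can thus be
    -- moved to the end, which determines it from `α` alone, and the other factors form a rising
    -- factorization of `s r · α`.
    up-strip : ∀ {α U} → s r ≼ α → α ≼ c → IsUp α U → ∃ λ U₀ → IsUp (s r · α) U₀ × U ↭ conj ((s r · α) ⁻¹) (s r) ∷ U₀
    up-strip {α} {U} r≼α α≼c (R , refl , up , fall) with crossing-step {s r · α} e U (≼c′⇒without (strip r≼α α≼c)) par-e (proj₁ R) up
        (trans (identityˡ _) (sym (s·s· (prodW U))))
    ... | pre , t , post , refl , q , p = pre ++ post , (R₀ , prod₀ , up₀ , AllPairs.tail fall′) ,
          subst (λ u → pre ++ t ∷ post ↭ u ∷ (pre ++ post)) t≡ perm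
      where
      perm : pre ++ t ∷ post ↭ t ∷ (pre ++ post)
      perm = ↭ₚ.shift t pre post
      fall′ : AllPairs Fall (t ∷ (pre ++ post))
      fall′ = AllPairs-↭ fall-sym perm fall
      x = e · prodW pre
      x≡ : x ≡ prodW pre
      x≡ = identityˡ _
      module I = Insertion {r} {x} {t} q p
      R₀ : Reduced (pre ++ post)
      R₀ = proj₁ (reduced-⊑ (remove-⊑ pre) R)
      prod₀ : prodW (pre ++ post) ≡ s r · α
      prod₀ = trans (trans (prodW-++ pre post) (cong (_· prodW post) (sym x≡))) (sym (trans (cong (s r ·_)
          (trans (prodW-++ pre (t ∷ post)) (trans (sym (assoc _ _ _)) (cong (_· prodW post) (trans (cong (_· t) (sym x≡)) I.x·t)))))
        (group (x ∷ prodW post ∷ []) (s² r ∷ []) (! 0 ⊙ (! 0 ⊙ # 0 ⊙ # 1)) (# 0 ⊙ # 1) refl)))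
      qs : All (Without r) (pre ++ post)
      qs = reduced-without R₀ (subst (_≼ c′) (sym prod₀) (strip r≼α α≼c))
      halves = steps-++⁻ pre up
      up-post : Up x post
      up-post = steps-unshift post q (Allₚ.++⁻ʳ pre qs) (subst (λ y → Up y post) I.x·t (proj₂ (proj₂ halves)))
      up₀ : Up e (pre ++ post)
      up₀ = steps-++ pre (proj₁ halves) up-post
      commutes : All (Commute t) post
      commutes = commuting-ups post q p (Allₚ.++⁻ʳ pre qs) up-post (Allₚ.++⁻ʳ pre (AllPairs.head fall′))
      t≡ : t ≡ conj ((s r · α) ⁻¹) (s r)
      t≡ = trans (sym (conj-inv (s r · α) t)) (cong (conj ((s r · α) ⁻¹)) (trans (cong (λ y → conj y t) (trans (sym prod₀) (prodW-++ pre post)))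
        (trans (conj-· (prodW pre) (prodW post) t) (trans (cong (conj (prodW pre)) (commute-conj (sym (commute-prodW commutes)))) (trans (cong (λ y → conj y t) (sym x≡)) p)))))

    up-turn : ∀ {α U} → ¬ s r ≼ α → α ≼ c → IsUp α U → IsUp (κ α) (map κ U)
    up-turn {α} {U} r⋠α α≼c (R , refl , up , fall) = reduced-conj (s r) R , prodW-conj (s r) U ,
        subst (λ y → Up y (map κ U)) κe (steps-conj U (noFlip e U R (trans (cong ℓT (identityˡ _)) (cong (_+ ℓT (prodW U)) (sym ℓT-e))) (identityˡ _) U≢ (crossFree-⋠ r⋠α)) up) ,
        fall-map R α≼c U≢ fall
      where
      U≢ : All (_≢ s r) U
      U≢ = All.tabulate λ m t≡ → r⋠α (subst (_≼ prodW U) t≡ (factor-≼ R m))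

    up-unique-step : (∀ {α} → α ≼ c′ → UpUnique α) → ∀ {α} → α ≼ c → (s r ≼ α ⊎ UpUnique (κ α)) → UpUnique α
    up-unique-step ih {α} α≼c = λ { (inj₁ r≼α) → head r≼α ; (inj₂ rec) → turn rec (≼-dec (s r) α) }
      where
      head : s r ≼ α → UpUnique α
      head r≼α p p′ m with up-strip r≼α α≼c p | up-strip r≼α α≼c p′
      ... | U₀ , i , perm | U₀′ , i′ , perm′ with ∈-↭ perm m
      ...   | here eq  = ∈-↭ (↭-sym perm′) (here eq)
      ...   | there m₀ = ∈-↭ (↭-sym perm′) (there (ih (strip r≼α α≼c) i i′ m₀))
      turn : UpUnique (κ α) → Dec (s r ≼ α) → UpUnique α
      turn rec (yes r≼α) = head r≼α
      turn rec (no r⋠α) p p′ m = map-conj-∈ r (rec (up-turn r⋠α α≼c p) (up-turn r⋠α α≼c p′) (∈ₚ.∈-map⁺ κ m))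

    down-strip : ∀ {α β D} → s r ≼ α → β ≼ c → IsDown α β D → IsDown (s r · α) (s r · β) D
    down-strip {α} {β} {D} r≼α β≼c (R , a , refl , dn , fall) = R , a₀ , assoc _ _ _ ,
        steps-unshift D q₀ (parabolic R (par-cancelˡ q₀ (subst (Without r) (sym (assoc _ _ _)) (≼c′⇒without β₀≼c′)))) (subst (λ x → Down x D) (sym (s·s· α)) dn) , fall
      where
      α≼β = additive-≼ a
      α₀≼c′ : s r · α ≼ c′
      α₀≼c′ = strip r≼α (≼-trans α≼β β≼c)
      β₀≼c′ : s r · β ≼ c′
      β₀≼c′ = strip (≼-trans r≼α α≼β) β≼c
      q₀ : Without r (s r · α)
      q₀ = ≼c′⇒without α₀≼c′
      a₀ : Additive (s r · α) (prodW D)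
      a₀ = trans (cong ℓT (assoc _ _ _)) (ℕₚ.suc-injective (trans (sym (lower-ℓT β₀≼c′)) (trans a (cong (_+ ℓT (prodW D)) (lower-ℓT α₀≼c′)))))

    down-turn : ∀ {α β D} → β ≼ c → Turning α β → IsDown α β D → IsDown (κ α) (κ β) (map κ D)
    down-turn {α} {β} {D} β≼c turn (R , a , refl , dn , fall) = reduced-conj (s r) R ,
        subst (Additive (κ α)) (sym (prodW-conj (s r) D)) (additive-conj (s r) a) ,
        trans (cong (κ α ·_) (prodW-conj (s r) D)) (sym (conj-homo (s r) α _)) ,
        steps-conj D (noFlip α D R a refl D≢ (turning-free β≼c turn)) dn ,
        fall-map R (≼-trans (additive-≼ʳ a) β≼c) D≢ fall
      where
      D≢ : All (_≢ s r) D
      D≢ = turning-≢ β≼c turn R a refl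

    -- The factors after `s r` avoid `r`, so `Fall` with `s r` can only mean commutation and `κ`
    -- fixes them. The list supplied by `final-step` is therefore the image under `κ` of `D` without
    -- `s r`, and `D` is recovered from it.
    down-final : ∀ {α β D} → ¬ Without r α → κ α ≼ c′ → s r ≼ β → β ≼ c → IsDown α β D →
                 ∃ λ E → IsDown (κ α) (s r · β) (map κ E) × D ↭ s r ∷ E
    down-final {α} {β} {D} α∉ κα≼c′ r≼β β≼c (R , a , αD , dn , fall) = pre ++ post ,
        (proj₁ red , proj₂ red , trans (cong (λ z → κ α · prodW z) (sym list≡)) product , subst (Down (κ α)) list≡ down , fallE) ,
        subst (_↭ s r ∷ (pre ++ post)) (sym D≡) perm
      where
      open FinalStep (final-step α∉ κα≼c′ r≼β β≼c R a αD dn)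
      perm : pre ++ s r ∷ post ↭ s r ∷ (pre ++ post)
      perm = ↭ₚ.shift (s r) pre post
      R′ : Reduced (pre ++ s r ∷ post)
      R′ = subst Reduced D≡ R
      fall′ : AllPairs Fall (s r ∷ (pre ++ post))
      fall′ = AllPairs-↭ fall-sym perm (subst (AllPairs Fall) D≡ fall)
      fixed : ∀ {t} → Without r t → t ≢ s r → Fall (s r) t → κ t ≡ t
      fixed q ≢r (inj₁ p)        = commute-conj p
      fixed q ≢r (inj₂ (inj₁ p)) = case trans (sym p) (par-η-false q ¬without-s) of λ ()
      fixed q ≢r (inj₂ (inj₂ p)) = ⊥-elim (≢r (≡ʷ-true⁻ (trans (sym (η-s r _)) p)))
      map-fixed : ∀ {ts} → All (Without r) ts → All (_≢ s r) ts → All (Fall (s r)) ts → map κ ts ≡ ts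
      map-fixed []       []       []       = refl
      map-fixed (q ∷ qs) (p ∷ ps) (f ∷ fs) = cong₂ _∷_ (fixed q p f) (map-fixed qs ps fs)
      list≡ : map κ pre ++ post ≡ map κ (pre ++ post)
      list≡ = trans (cong (map κ pre ++_) (sym (map-fixed without-B (Allₚ.++⁻ʳ pre others-≢) (Allₚ.++⁻ʳ pre (AllPairs.head fall′)))))
        (sym (Listₚ.map-++ κ pre post))
      RE : Reduced (pre ++ post)
      RE = proj₁ (reduced-⊑ (remove-⊑ pre) R′)
      red : Reduced (map κ (pre ++ post)) × Additive (κ α) (prodW (map κ (pre ++ post)))
      red = reduced-conj (s r) RE , trans (cong ℓT (trans (cong (λ z → κ α · prodW z) (sym list≡)) product))
        (ℕₚ.suc-injective (trans (sym (lower-ℓT (strip r≼β β≼c))) (trans (sym (cong ℓT αD)) (trans a (trans (cong (ℓT α +_) lengths)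
          (trans (ℕₚ.+-suc _ _) (cong (λ k → suc (k + ℓT (prodW (map κ (pre ++ post))))) (sym (ℓT-conj (s r) α)))))))))
        where
        lengths : ℓT (prodW D) ≡ suc (ℓT (prodW (map κ (pre ++ post))))
        lengths = trans (proj₂ R) (trans (trans (cong length D≡) (↭ₚ.↭-length perm)) (cong suc (trans (sym (proj₂ RE))
          (trans (sym (ℓT-conj (s r) _)) (cong ℓT (sym (prodW-conj (s r) (pre ++ post))))))))
      fallE : AllPairs Fall (map κ (pre ++ post))
      fallE = fall-map RE (≼-trans (proj₂ (reduced-⊑ (remove-⊑ pre) R′)) (≼-trans (subst (λ z → prodW z ≼ β) D≡ (subst (prodW D ≼_) αD (additive-≼ʳ a))) β≼c))
        others-≢ (AllPairs.tail fall′)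

    down-unique-step : (∀ {α β} → β ≼ c′ → DownUnique α β) → ∀ {α β} → β ≼ c → (s r ≼ α ⊎ DownUnique (κ α) (κ β)) → DownUnique α β
    down-unique-step ih {α} {β} β≼c = λ { (inj₁ r≼α) → head r≼α ; (inj₂ rec) → step rec (≼-dec (s r) α) }
      where
      head : s r ≼ α → DownUnique α β
      head r≼α p p′ = ih (strip (≼-trans r≼α (is-down-≼ p)) β≼c) (down-strip r≼α β≼c p) (down-strip r≼α β≼c p′)
      step : DownUnique (κ α) (κ β) → Dec (s r ≼ α) → DownUnique α β
      step rec (yes r≼α) = head r≼α
      step rec (no r⋠α) p@(_ , _ , αD , dn , _) p′ m with case-split {α} {β} (λ r≼β → outside-α r≼β dn αD)
      ... | turning turn = map-conj-∈ r (rec (down-turn β≼c turn p) (down-turn β≼c turn p′) (∈ₚ.∈-map⁺ κ m))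
      ... | final α∉ le r≼β with down-final α∉ le r≼β β≼c p | down-final α∉ le r≼β β≼c p′
      ...   | E , i , perm | E′ , i′ , perm′ with ∈-↭ perm m
      ...     | here eq  = ∈-↭ (↭-sym perm′) (here eq)
      ...     | there m₀ = ∈-↭ (↭-sym perm′) (there (map-conj-∈ r (ih (strip r≼β β≼c) i i′ (∈ₚ.∈-map⁺ κ m₀))))

  up-unique-e : UpUnique e
  up-unique-e {[]} _ _ ()
  up-unique-e {t ∷ U} (R , p , _) _ _ = case trans (sym (proj₂ R)) (trans (cong ℓT p) ℓT-e) of λ ()

  down-unique-e : ∀ {β} → DownUnique e β
  down-unique-e {β} {[]} _ _ ()
  down-unique-e {β} {t ∷ D} (_ , _ , _ , (h , _) , _) = case trans (sym h) (η-e t) of λ ()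

  up-unique-hit : ∀ {k} → (∀ {ws} → length ws ≡ k → Unique ws → ∀ {α} → α ≼ prodS ws → UpUnique α) →
                  ∀ {ws t} → length ws ≡ suc k → Unique ws → Hit ws t → ∀ {α} → t ≼ α → α ≼ prodS ws → UpUnique α
  up-unique-hit ih {r ∷ ws} len uniq (now refl) t≼α α≼c =
    Uniqueness.up-unique-step r ws uniq (ih (ℕₚ.suc-injective len) (AllPairs.tail uniq)) α≼c (inj₁ t≼α)
  up-unique-hit ih {r ∷ ws} len uniq (later h) t≼α α≼c =
    Uniqueness.up-unique-step r ws uniq (ih (ℕₚ.suc-injective len) (AllPairs.tail uniq)) α≼c
      (inj₂ (up-unique-hit ih (trans (length-∷ʳ ws r) len) (rotate uniq) h (≼-conj (s r) t≼α) (Head.≼-rot r ws uniq α≼c)))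

  ≼e : ∀ {α} → α ≼ e → α ≡ e
  ≼e le = ℓT-0 (ℕₚ.n≤0⇒n≡0 (ℕₚ.≤-trans (ℕₚ.m≤m+n _ _) (ℕₚ.≤-reflexive (trans (sym le) ℓT-e))))

  up-unique : ∀ k {ws} → length ws ≡ k → Unique ws → ∀ {α} → α ≼ prodS ws → UpUnique α
  up-unique k len uniq {α} α≼c with α ≟ e
  ... | yes refl = up-unique-e
  up-unique zero {[]} len uniq α≼c | no α≢e = ⊥-elim (α≢e (≼e α≼c))
  up-unique (suc k) len uniq α≼c | no α≢e with first-factor α≢e
  ... | t , tR , t≼α = up-unique-hit (up-unique k) len uniq (≼-hit uniq tR (≼-trans t≼α α≼c)) t≼α α≼c

  down-unique-hit : ∀ {k} → (∀ {ws} → length ws ≡ k → Unique ws → ∀ {α β} → β ≼ prodS ws → DownUnique α β) →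
                    ∀ {ws t} → length ws ≡ suc k → Unique ws → Hit ws t → ∀ {α β} → t ≼ α → β ≼ prodS ws → DownUnique α β
  down-unique-hit ih {r ∷ ws} len uniq (now refl) t≼α β≼c =
    Uniqueness.down-unique-step r ws uniq (ih (ℕₚ.suc-injective len) (AllPairs.tail uniq)) β≼c (inj₁ t≼α)
  down-unique-hit ih {r ∷ ws} len uniq (later h) t≼α β≼c =
    Uniqueness.down-unique-step r ws uniq (ih (ℕₚ.suc-injective len) (AllPairs.tail uniq)) β≼c
      (inj₂ (down-unique-hit ih (trans (length-∷ʳ ws r) len) (rotate uniq) h (≼-conj (s r) t≼α) (Head.≼-rot r ws uniq β≼c)))

  down-unique : ∀ k {ws} → length ws ≡ k → Unique ws → ∀ {α β} → β ≼ prodS ws → DownUnique α β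
  down-unique k len uniq {α} {β} β≼c with α ≟ e
  ... | yes refl = down-unique-e
  down-unique zero {[]} len uniq β≼c | no α≢e = λ p _ _ → ⊥-elim (α≢e (≼e (≼-trans (is-down-≼ p) β≼c)))
  down-unique (suc k) len uniq β≼c | no α≢e with first-factor α≢e
  ... | t , tR , t≼α = λ p → down-unique-hit (down-unique k) len uniq (≼-hit uniq tR (≼-trans t≼α (≼-trans (is-down-≼ p) β≼c))) t≼α β≼c p

  -- Bitone orderings of faces

  record Face (ws : List (Fin n)) (P : List W) : Set where
    field
      reflections : Reflections P
      below       : All (_≼ prodS ws) P
      distinct    : Unique P
      compatible  : AllPairs (Compatible ws) P

  face-↭ : ∀ {ws P P′} → P ↭ P′ → Face ws P → Face ws P′
  face-↭ {ws} p F = record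
    { reflections = ↭ₚ.All-resp-↭ p reflections ; below = ↭ₚ.All-resp-↭ p below
    ; distinct = AllPairs-↭ ≢-sym p distinct ; compatible = AllPairs-↭ (compatible-sym {ws}) p compatible }
    where open Face F

  record Bitone (ws : List (Fin n)) (P : List W) : Set where
    field
      U D     : List W
      perm    : U ++ D ↭ P
      reduced : Reduced (U ++ D)
      bound   : prodW (U ++ D) ≼ prodS ws
      up      : Up e U
      down    : Down (prodW U) D

  AllPairs-All : ∀ {A : Set} {R : A → A → Set} {Q : A → Set} {xs} → All Q xs → AllPairs R xs → AllPairs (λ x y → R x y × Q x × Q y) xs
  AllPairs-All []       []       = []
  AllPairs-All (q ∷ qs) (h ∷ hs) = All.zipWith (λ (a , b) → a , q , b) (h , qs) ∷ AllPairs-All qs hs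

  module Faces (r : Fin n) (ws : List (Fin n)) (uniq : Unique (r ∷ ws)) where
    open Cases r ws uniq public

    face-turn : ∀ {P} → s r ∉ P → Face (r ∷ ws) P → Face (ws ++ r ∷ []) (map κ P)
    face-turn {P} r∉ F = record
      { reflections = refls-conj (s r) reflections
      ; below = Allₚ.map⁺ (All.map ≼-rot below)
      ; distinct = Uniqueₚ.map⁺ (conj-injective (s r)) distinct
      ; compatible = AllPairsₚ.map⁺ (AllPairs.zipWith (λ ((f , (tR , t≢) , (uR , u≢)) , t≢u) → compatible-rot tR uR t≢ u≢ t≢u f)
          (AllPairs-All (All.zip (reflections , All.tabulate λ m t≡ → r∉ (subst (_∈ P) t≡ m))) compatible , distinct)) }
      where open Face F

    -- The link of the head root. Compatibility with `s r` says that the conjugates avoid `r`, and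
    -- for such elements being below `c*` means being below `c′`.
    face-link : ∀ {P} → Face (r ∷ ws) (s r ∷ P) → Face ws (map κ P)
    face-link {P} F = record
      { reflections = refls-conj (s r) R
      ; below = Allₚ.map⁺ (All.map (λ (uR , _ , le , q) → refl-conj≼c′ uR le q) facts′)
      ; distinct = Uniqueₚ.map⁺ (conj-injective (s r)) (AllPairs.tail distinct)
      ; compatible = AllPairsₚ.map⁺ (AllPairs.zipWith (λ ((f , a , b) , t≢u) → link f a b t≢u) (AllPairs-All facts′ (AllPairs.tail compatible) , AllPairs.tail distinct)) }
      where
      open Face F
      R : Reflections P
      R = All.tail reflections
      Fact : W → Set
      Fact u = IsReflection u × u ≢ s r × u ≼ c × Without r (κ u)
      facts′ : All Fact P
      facts′ = All.tabulate λ {u} m → let uR = All.lookup R m ; u≢ = All.lookup (unique-head distinct) m in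
        uR , u≢ , All.lookup (All.tail below) m , compatible-head⇒ uR u≢ (All.lookup (AllPairs.head compatible) m)
      link : ∀ {t u} → Compatible (r ∷ ws) t u → Fact t → Fact u → t ≢ u → Compatible ws (κ t) (κ u)
      link f (tR , t≢ , _ , qt) (uR , u≢ , _ , qu) t≢u with compatible-rot tR uR t≢ u≢ t≢u f
      ... | f′ , inj₁ le = f′ , inj₁ (final-without⇒≼c′ le (par-· qt qu))
      ... | f′ , inj₂ le = f′ , inj₂ (final-without⇒≼c′ le (par-· qu qt))

    module Link {P : List W} (B : Bitone ws (map κ P)) where
      module B = Bitone B
      L : List W
      L = B.U ++ B.D
      β₀ = prodW L
      qβ₀ : Without r β₀
      qβ₀ = ≼c′⇒without B.bound
      qs : All (Without r) L
      qs = parabolic B.reduced qβ₀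
      ℓT-sβ₀ : ℓT (s r · β₀) ≡ suc (length L)
      ℓT-sβ₀ = trans (additive-s B.bound) (cong₂ _+_ (ℓT-refl (refl-s r)) (proj₂ B.reduced))
      perm′ : map κ L ↭ P
      perm′ = subst (map κ L ↭_) (map-conj² r P) (↭ₚ.map⁺ κ B.perm)

      -- The head letter goes to the very end: `κ β₀ · s r` equals `s r · β₀`, and the step falls by
      -- `η-conj-s-self`.
      apart : ¬ Commute (s r) β₀ → Bitone (r ∷ ws) (s r ∷ P)
      apart ¬comm = record
        { U = map κ B.U ; D = map κ B.D ++ s r ∷ []
        ; perm = subst (_↭ s r ∷ P) L≡ (↭-trans (↭-sym (↭ₚ.∷↭∷ʳ (s r) (map κ L))) (↭-prep (s r) perm′))
        ; reduced = length-reduced (subst Reflections L≡ (Allₚ.++⁺ (refls-conj (s r) (proj₁ B.reduced)) (refl-s r ∷ []))) product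
            (trans ℓT-sβ₀ (sym (trans (cong length (sym L≡)) (trans (length-∷ʳ (map κ L) (s r)) (cong suc (Listₚ.length-map κ L))))))
        ; bound = subst (_≼ c) (sym product) (s·≼c B.bound)
        ; up = subst (λ x → Up x (map κ B.U)) κe (steps-conj B.U (noFlip-without B.U par-e (Allₚ.++⁻ˡ B.U qs)) B.up)
        ; down = subst (λ x → Down x (map κ B.D ++ s r ∷ [])) (sym (prodW-conj (s r) B.U))
            (steps-++ (map κ B.D) (steps-conj B.D (noFlip-without B.D (par-prodW (Allₚ.++⁻ˡ B.U qs)) (Allₚ.++⁻ʳ B.U qs)) B.down)
              (trans (cong (λ x → η x (s r)) end≡) (η-conj-s-self qβ₀ ¬comm) , tt))
        }
        where
        L≡ : map κ L ++ s r ∷ [] ≡ map κ B.U ++ (map κ B.D ++ s r ∷ [])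
        L≡ = trans (cong (_++ s r ∷ []) (Listₚ.map-++ κ B.U B.D)) (Listₚ.++-assoc (map κ B.U) (map κ B.D) (s r ∷ []))
        product : prodW (map κ B.U ++ (map κ B.D ++ s r ∷ [])) ≡ s r · β₀
        product = trans (cong prodW (sym L≡)) (trans (prodW-∷ʳ (map κ L) (s r)) (trans (cong (_· s r) (prodW-conj (s r) L))
          (group (β₀ ∷ []) (s² r ∷ []) (! 0 ⊙ # 0 ⊙ inv (! 0) ⊙ ! 0) (! 0 ⊙ # 0) refl)))
        end≡ : κ (prodW B.U) · prodW (map κ B.D) ≡ κ β₀
        end≡ = trans (cong (κ (prodW B.U) ·_) (prodW-conj (s r) B.D)) (trans (sym (conj-homo (s r) _ _)) (cong κ (sym (prodW-++ B.U B.D))))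

      -- Here `s r` commutes with everything below `β₀`, so `κ` changes nothing. At the end the step
      -- would rise, and therefore `s r` is placed at the turning point.
      together : Commute (s r) β₀ → Bitone (r ∷ ws) (s r ∷ P)
      together comm = record
        { U = B.U ++ s r ∷ [] ; D = B.D
        ; perm = ↭-trans perm (↭-prep (s r) (subst (_↭ P) (map-fixed qs (All.tabulate (λ m → m))) perm′))
        ; reduced = length-reduced (↭ₚ.All-resp-↭ (↭-sym perm) (refl-s r ∷ proj₁ B.reduced)) product
            (trans ℓT-sβ₀ (sym (↭ₚ.↭-length perm)))
        ; bound = subst (_≼ c) (sym product) (s·≼c B.bound)
        ; up = steps-++ B.U B.up (subst (λ x → η x (s r) ≡ false) (sym (identityˡ _)) (par-η-false qα₀ ¬without-s) , tt)
        ; down = subst (λ x → Down x B.D) (sym product-U) (steps-shift B.D qα₀ (Allₚ.++⁻ʳ B.U qs) B.down)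
        }
        where
        qα₀ : Without r (prodW B.U)
        qα₀ = par-prodW (Allₚ.++⁻ˡ B.U qs)
        perm : (B.U ++ s r ∷ []) ++ B.D ↭ s r ∷ L
        perm = subst (_↭ s r ∷ L) (sym (Listₚ.++-assoc B.U (s r ∷ []) B.D)) (↭ₚ.shift (s r) B.U B.D)
        fixed : ∀ {x} → x ≼ β₀ → κ x ≡ x
        fixed {x} le = without-commute (par-≼ le qβ₀) (par-≼ (subst (κ x ≼_) (commute-conj comm) (≼-conj (s r) le)) qβ₀)
        map-fixed : ∀ {ts} → All (Without r) ts → All (_∈ L) ts → map κ ts ≡ ts
        map-fixed []       []       = refl
        map-fixed (_ ∷ qs) (m ∷ ms) = cong₂ _∷_ (fixed (factor-≼ B.reduced m)) (map-fixed qs ms)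
        α₀≼β₀ : prodW B.U ≼ β₀
        α₀≼β₀ = subst (prodW B.U ≼_) (sym (prodW-++ B.U B.D)) (additive-≼ (proj₂ (proj₂ (reduced-++⁻ B.U B.reduced))))
        product-U : prodW (B.U ++ s r ∷ []) ≡ s r · prodW B.U
        product-U = trans (prodW-∷ʳ B.U (s r)) (sym (conj-commute (fixed α₀≼β₀)))
        product : prodW ((B.U ++ s r ∷ []) ++ B.D) ≡ s r · β₀
        product = trans (prodW-++ (B.U ++ s r ∷ []) B.D) (trans (cong (_· prodW B.D) product-U)
          (trans (assoc _ _ _) (cong (s r ·_) (sym (prodW-++ B.U B.D)))))

      bitone : Bitone (r ∷ ws) (s r ∷ P)
      bitone with commute? (s r) β₀
      ... | yes comm = together comm
      ... | no ¬comm = apart ¬comm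

    flip-search : ∀ x ts → All (_≢ s r) ts →
      NoFlip r x ts ⊎ (∃₂ λ pre t → ∃ λ post → ts ≡ pre ++ t ∷ post × NoFlip r x pre × conj (x · prodW pre) t ≡ s r)
    flip-search x [] _ = inj₁ tt
    flip-search x (t ∷ ts) (t≢ ∷ ps) with conj x t ≟ s r
    ... | yes p = inj₂ ([] , t , ts , refl , tt , trans (cong (λ y → conj y t) (identityʳ x)) p)
    ... | no ¬p with flip-search (x · t) ts ps
    ...   | inj₁ nf = inj₁ (¬p , t≢ , nf)
    ...   | inj₂ (pre , u , post , refl , nf , p) = inj₂ (t ∷ pre , u , post , refl , (¬p , t≢ , nf) , trans (cong (λ y → conj y u) (sym (assoc _ _ _))) p)

    crossing-prefix : ∀ pre {t post} → Reduced (pre ++ t ∷ post) → prodW (pre ++ t ∷ post) ≼ c → conj (prodW pre) t ≡ s r → prodW pre ≼ c′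
    crossing-prefix pre {t} {post} R le p with reduced-++⁻ pre R
    ... | _ , R′ , a with reduced-∷⁻ R′
    ...   | tR , _ , b with additive-assocˡ a b
    ...     | a′ , pt = crossing p pt tR (≼-trans (subst (prodW pre · t ≼_) (trans (assoc _ _ _) (sym (prodW-++ pre (t ∷ post)))) (additive-≼ a′)) le)

    -- Before the rotation a crossing step rises, as `y · prodW pre` avoids `r` and `t` does not;
    -- exactly one of the two corrections in `η-conj-s` applies, so the rotated step falls.
    flip-sign : ∀ {b} y pre {t post} → Steps b (κ y) (map κ (pre ++ t ∷ post)) → conj (y · prodW pre) t ≡ s r →
                Without r (y · prodW pre) → t ≢ s r → b ≡ true
    flip-sign {b} y pre {t} {post} st p q t≢ = trans (sym (proj₁ (proj₂ (steps-++⁻ (map κ pre) (subst (Steps b (κ y)) (Listₚ.map-++ κ pre (t ∷ post)) st)))))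
      (trans (cong (λ x → η x (κ t)) (trans (cong (κ y ·_) (prodW-conj (s r) pre)) (sym (conj-homo (s r) y _))))
        (trans (η-conj-s r _ t) (cong₂ _⊕_ (cong₂ _⊕_ (≡ʷ-true p) (Insertion.η-x q p)) (≡ʷ-false t≢))))

    -- Rotating back keeps all directions except at a crossing step, which by `flip-sign` can only
    -- sit in the falling half and rises after rotating back. `flipped` moves it to the end of the
    -- rising half.
    bitone-turn : ∀ {P} → s r ∉ P → Face (r ∷ ws) P → Bitone (ws ++ r ∷ []) (map κ P) → Bitone (r ∷ ws) P
    bitone-turn {P} r∉ F B = go (flip-search e U U≢)
      where
      module B = Bitone B
      U D : List W
      U = map κ B.U
      D = map κ B.D
      L≡ : map κ (B.U ++ B.D) ≡ U ++ D
      L≡ = Listₚ.map-++ κ B.U B.D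
      perm : U ++ D ↭ P
      perm = subst₂ _↭_ L≡ (map-conj² r P) (↭ₚ.map⁺ κ B.perm)
      R : Reduced (U ++ D)
      R = subst Reduced L≡ (reduced-conj (s r) B.reduced)
      bound : prodW (U ++ D) ≼ c
      bound = ≼-rot⁻ (subst (_≼ c*) (trans (sym (conj-s² r _)) (cong κ (trans (sym (prodW-conj (s r) (B.U ++ B.D))) (cong prodW L≡)))) B.bound)
      L≢ : All (_≢ s r) (U ++ D)
      L≢ = ↭ₚ.All-resp-↭ (↭-sym perm) (All.tabulate λ m t≡ → r∉ (subst (_∈ P) t≡ m))
      U≢ = Allₚ.++⁻ˡ U L≢
      D≢ = Allₚ.++⁻ʳ U L≢
      fall : AllPairs Fall (U ++ D)
      fall = AllPairs-↭ fall-sym (↭-sym perm) (AllPairs.map proj₁ (Face.compatible F))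
      up* : Up (κ e) (map κ U)
      up* = subst₂ Up (sym κe) (sym (map-conj² r B.U)) B.up
      down* : Down (κ (prodW U)) (map κ D)
      down* = subst₂ Down (trans (sym (conj-s² r _)) (cong κ (sym (prodW-conj (s r) B.U)))) (sym (map-conj² r B.D)) B.down
      -- The crossing factor `t` commutes with the falling factors `D₁` before it. Moving it in
      -- front of them shifts their path by `s r` on the left, which preserves directions; after the
      -- crossing the path has left the parabolic subgroup and cannot cross again.
      flipped : ∀ {D₁ t D₂} → Up e U → D ≡ D₁ ++ t ∷ D₂ → NoFlip r (prodW U) D₁ → conj (prodW U · prodW D₁) t ≡ s r → Bitone (r ∷ ws) P
      flipped {D₁} {t} {D₂} up D≡ nf p = record
        { U = U ++ t ∷ [] ; D = D₁ ++ D₂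
        ; perm = ↭-trans perm₁ (↭-trans (↭-sym perm₂) perm)
        ; reduced = reduced-cong (↭ₚ.All-resp-↭ (↭-sym perm₁) (↭ₚ.All-resp-↭ perm₂ (proj₁ R))) (sym product)
            (↭ₚ.↭-length (↭-trans perm₂ (↭-sym perm₁))) R
        ; bound = subst (_≼ c) (sym product) bound
        ; up = steps-++ U up (subst (λ y → η y t ≡ false) (sym (identityˡ _)) I₁.η-x , tt)
        ; down = subst (λ y → Down y (D₁ ++ D₂)) (trans (sym I₁.x·t) (sym (prodW-∷ʳ U t)))
            (steps-++ D₁ (steps-shift D₁ qU qD₁ down₁) (subst (λ y → Down y D₂) start₂ down₂))
        }
        where
        x = prodW U · prodW D₁
        x≡ : prodW (U ++ D₁) ≡ x
        x≡ = prodW-++ U D₁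
        L≡′ : U ++ D ≡ (U ++ D₁) ++ t ∷ D₂
        L≡′ = trans (cong (U ++_) D≡) (sym (Listₚ.++-assoc U D₁ (t ∷ D₂)))
        R′ : Reduced ((U ++ D₁) ++ t ∷ D₂)
        R′ = subst Reduced L≡′ R
        bound′ : prodW ((U ++ D₁) ++ t ∷ D₂) ≼ c
        bound′ = subst (λ l → prodW l ≼ c) L≡′ bound
        x≼c′ : prodW (U ++ D₁) ≼ c′
        x≼c′ = crossing-prefix (U ++ D₁) R′ bound′ (trans (cong (λ y → conj y t) x≡) p)
        qUD₁ : All (Without r) (U ++ D₁)
        qUD₁ = reduced-without (proj₁ (reduced-++⁻ (U ++ D₁) R′)) x≼c′
        qD₁ = Allₚ.++⁻ʳ U qUD₁
        qU : Without r (prodW U)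
        qU = par-prodW (Allₚ.++⁻ˡ U qUD₁)
        qx : Without r x
        qx = subst (Without r) x≡ (≼c′⇒without x≼c′)
        tR : IsReflection t
        tR = All.head (Allₚ.++⁻ʳ (U ++ D₁) (proj₁ R′))
        module I = Insertion {r} {x} {t} qx p
        down*′ : Down (κ (prodW U)) (map κ D₁ ++ map κ (t ∷ D₂))
        down*′ = subst (Down (κ (prodW U))) (trans (cong (map κ) D≡) (Listₚ.map-++ κ D₁ (t ∷ D₂))) down*
        halves = steps-++⁻ (map κ D₁) down*′
        down₁ : Down (prodW U) D₁
        down₁ = steps-conj⁻ D₁ nf (proj₁ halves)
        fall-t : All (Fall t) ((U ++ D₁) ++ D₂)
        fall-t = AllPairs.head (AllPairs-↭ fall-sym (↭ₚ.shift t (U ++ D₁) D₂) (subst (AllPairs Fall) L≡′ fall))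
        commutes : All (Commute t) D₁
        commutes = commuting-downs D₁ (Allₚ.++⁻ʳ U (proj₁ (proj₁ (reduced-++⁻ (U ++ D₁) R′)))) qU p qD₁ down₁ (Allₚ.++⁻ʳ U (Allₚ.++⁻ˡ (U ++ D₁) fall-t))
        t-D₁ : Commute t (prodW D₁)
        t-D₁ = commute-prodW commutes
        p₁ : conj (prodW U) t ≡ s r
        p₁ = trans (cong (conj (prodW U)) (sym (commute-conj (sym t-D₁)))) (trans (sym (conj-· (prodW U) (prodW D₁) t)) p)
        module I₁ = Insertion {r} {prodW U} {t} qU p₁
        R₂ = reduced-∷⁻ (proj₁ (proj₂ (reduced-++⁻ (U ++ D₁) R′)))
        add₂ : Additive (x · t) (prodW D₂)
        add₂ = subst (λ y → Additive (y · t) (prodW D₂)) x≡ (proj₁ (additive-assocˡ (proj₂ (proj₂ (reduced-++⁻ (U ++ D₁) R′))) (proj₂ (proj₂ R₂))))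
        end₂ : x · t · prodW D₂ ≡ prodW ((U ++ D₁) ++ t ∷ D₂)
        end₂ = trans (assoc _ _ _) (trans (cong (_· (t · prodW D₂)) (sym x≡)) (sym (prodW-++ (U ++ D₁) (t ∷ D₂))))
        outside : ¬ Without r (x · t)
        outside q = I.¬without (par-cancelˡ qx q)
        down₂ : Down (x · t) D₂
        down₂ = steps-conj⁻ D₂ (noFlip (x · t) D₂ (proj₁ (proj₂ R₂)) add₂ end₂ (All.tail (Allₚ.++⁻ʳ (U ++ D₁) (subst (All (_≢ s r)) L≡′ L≢))) (crossFree-outside outside bound′))
          (subst (λ y → Down y (map κ D₂)) (trans (cong (λ z → κ (prodW U) · z · κ t) (prodW-conj (s r) D₁))
            (trans (cong (_· κ t) (sym (conj-homo (s r) _ _))) (sym (conj-homo (s r) x t)))) (proj₂ (proj₂ halves)))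
        start₂ : x · t ≡ s r · prodW U · prodW D₁
        start₂ = trans (assoc _ _ _) (trans (cong (prodW U ·_) (sym t-D₁)) (trans (sym (assoc _ _ _)) (cong (_· prodW D₁) I₁.x·t)))
        product : prodW ((U ++ t ∷ []) ++ (D₁ ++ D₂)) ≡ prodW (U ++ D)
        product = trans (prodW-++ (U ++ t ∷ []) (D₁ ++ D₂)) (trans (cong₂ _·_ (prodW-∷ʳ U t) (prodW-++ D₁ D₂))
          (trans (group (prodW U ∷ t ∷ prodW D₁ ∷ prodW D₂ ∷ []) [] (# 0 ⊙ # 1 ⊙ (# 2 ⊙ # 3)) (# 0 ⊙ (# 1 ⊙ # 2) ⊙ # 3) refl)
            (trans (cong (λ z → prodW U · z · prodW D₂) t-D₁) (trans (trans (cong (_· prodW D₂) (sym (assoc _ _ _))) end₂) (cong prodW (sym L≡′))))))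
        perm₁ : (U ++ t ∷ []) ++ (D₁ ++ D₂) ↭ t ∷ ((U ++ D₁) ++ D₂)
        perm₁ = subst₂ (λ l m → l ↭ t ∷ m) (sym (Listₚ.++-assoc U (t ∷ []) (D₁ ++ D₂))) (sym (Listₚ.++-assoc U D₁ D₂)) (↭ₚ.shift t U (D₁ ++ D₂))
        perm₂ : U ++ D ↭ t ∷ ((U ++ D₁) ++ D₂)
        perm₂ = subst (_↭ t ∷ ((U ++ D₁) ++ D₂)) (sym L≡′) (↭ₚ.shift t (U ++ D₁) D₂)
      below-D : Up e U → Bitone (r ∷ ws) P
      below-D up with flip-search (prodW U) D D≢
      ... | inj₁ nf = record { U = U ; D = D ; perm = perm ; reduced = R ; bound = bound ; up = up ; down = steps-conj⁻ D nf down* }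
      ... | inj₂ (_ , _ , _ , D≡ , nf , p) = flipped up D≡ nf p
      go : NoFlip r e U ⊎ (∃₂ λ pre t → ∃ λ post → U ≡ pre ++ t ∷ post × NoFlip r e pre × conj (e · prodW pre) t ≡ s r) → Bitone (r ∷ ws) P
      go (inj₁ nf) = below-D (steps-conj⁻ U nf up*)
      go (inj₂ (pre , t , post , U≡ , _ , p)) = case flip-sign e pre (subst (λ l → Up (κ e) (map κ l)) U≡ up*) p
          (subst (Without r) (sym (identityˡ _)) (≼c′⇒without (crossing-prefix pre (subst Reduced L≡″ R) (subst (λ l → prodW l ≼ c) L≡″ bound) (trans (cong (λ y → conj y t) (sym (identityˡ _))) p))))
          (All.head (Allₚ.++⁻ʳ pre (subst (All (_≢ s r)) U≡ U≢))) of λ ()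
        where
        L≡″ : U ++ D ≡ pre ++ t ∷ (post ++ D)
        L≡″ = trans (cong (_++ D) U≡) (Listₚ.++-assoc pre (t ∷ post) D)

    bitone-step : (∀ {P} → Face ws P → Bitone ws P) → ∀ {P} → Face (r ∷ ws) P →
                  (s r ∈ P ⊎ (Face (ws ++ r ∷ []) (map κ P) → Bitone (ws ++ r ∷ []) (map κ P))) → Bitone (r ∷ ws) P
    bitone-step ih {P} F = λ { (inj₁ m) → linked-case m ; (inj₂ rec) → turned rec (Any.any? (s r ≟_) P) }
      where
      linked-case : s r ∈ P → Bitone (r ∷ ws) P
      linked-case m with ∈ₚ.∈-∃++ m
      ... | pre , post , refl = record { U = U ; D = D ; perm = ↭-trans perm (↭-sym sh) ; reduced = reduced ; bound = bound ; up = up ; down = down }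
        where
        sh : pre ++ s r ∷ post ↭ s r ∷ (pre ++ post)
        sh = ↭ₚ.shift (s r) pre post
        open Bitone (Link.bitone (ih (face-link (face-↭ sh F))))
      turned : (Face (ws ++ r ∷ []) (map κ P) → Bitone (ws ++ r ∷ []) (map κ P)) → Dec (s r ∈ P) → Bitone (r ∷ ws) P
      turned rec (yes m)  = linked-case m
      turned rec (no r∉) = bitone-turn r∉ F (rec (face-turn r∉ F))

  bitone-hit : ∀ {k} → (∀ {ws} → length ws ≡ k → Unique ws → ∀ {P} → Face ws P → Bitone ws P) →
               ∀ {ws t} → length ws ≡ suc k → Unique ws → Hit ws t → ∀ {P} → t ∈ P → Face ws P → Bitone ws P
  bitone-hit ih {r ∷ ws} len uniq (now refl) m F =
    Faces.bitone-step r ws uniq (ih (ℕₚ.suc-injective len) (AllPairs.tail uniq)) F (inj₁ m)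
  bitone-hit ih {r ∷ ws} len uniq (later h) m F =
    Faces.bitone-step r ws uniq (ih (ℕₚ.suc-injective len) (AllPairs.tail uniq)) F
      (inj₂ (bitone-hit ih (trans (length-∷ʳ ws r) len) (rotate uniq) h (∈ₚ.∈-map⁺ (conj (s r)) m)))

  bitone : ∀ k {ws} → length ws ≡ k → Unique ws → ∀ {P} → Face ws P → Bitone ws P
  bitone k len uniq {[]} F = record { U = [] ; D = [] ; perm = ↭-refl ; reduced = reduced-[] ; bound = e≼ _ ; up = tt ; down = tt }
  bitone zero {[]} len uniq {t ∷ P} F = ⊥-elim (refl≢e (All.head (Face.reflections F)) (≼e (All.head (Face.below F))))
  bitone (suc k) len uniq {t ∷ P} F = bitone-hit (bitone k) len uniq (≼-hit uniq (All.head (Face.reflections F)) (All.head (Face.below F))) (here refl) F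

  -- Admissible orderings of a face

  reduced-insert : ∀ {r} us vs → All (Without r) us → All (Without r) vs → Reflections (us ++ s r ∷ vs) → Reduced (us ++ vs) → Reduced (us ++ s r ∷ vs)
  reduced-insert {r} us vs qu qv R (_ , len) with par-prodW qu | par-prodW qv
  ... | ρ , ρ≢ , ρ≡ | τ , τ≢ , τ≡ = R , ℕₚ.≤-antisym (ℓT-≤ R refl) (begin
    length (us ++ s r ∷ vs)             ≡⟨ trans (Listₚ.length-++-sucʳ us (s r) vs) (cong suc (sym len)) ⟩
    suc (ℓT (prodW (us ++ vs)))         ≡⟨ cong (suc ∘ ℓT) (trans (prodW-++ us vs) (trans (sym (cong₂ _·_ ρ≡ τ≡)) (sym (prodS-++ ρ τ)))) ⟩
    suc (ℓT (prodS (ρ ++ τ)))           ≤⟨ ℓT-single ρ≢ τ≢ ⟩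
    ℓT (prodS (ρ ++ r ∷ τ))             ≡⟨ cong ℓT (trans (prodS-++ ρ (r ∷ τ)) (trans (cong₂ _·_ ρ≡ (cong (s r ·_) τ≡)) (sym (prodW-++ us (s r ∷ vs))))) ⟩
    ℓT (prodW (us ++ s r ∷ vs))         ∎)
    where open ℕₚ.≤-Reasoning

  reduced-conj⁻ : ∀ r {ts} → Reduced (map (conj (s r)) ts) → Reduced ts
  reduced-conj⁻ r {ts} R = subst Reduced (map-conj² r ts) (reduced-conj (s r) R)

  -- If `s r` is in the face, the conjugates of the other members avoid `r`, and `ℓT-single` shows
  -- that `s r` adds one to the absolute length wherever it is inserted.
  reduced-step : ∀ r ws (uniq : Unique (r ∷ ws)) → (∀ {P} → Face ws P → Reduced P) →
                 ∀ {P} → Face (r ∷ ws) P → (s r ∈ P ⊎ (Face (ws ++ r ∷ []) (map (conj (s r)) P) → Reduced (map (conj (s r)) P))) → Reduced P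
  reduced-step r ws uniq ih {P} F = λ { (inj₁ m) → linked-case m ; (inj₂ rec) → turned rec (Any.any? (s r ≟_) P) }
    where
    open Faces r ws uniq
    linked-case : s r ∈ P → Reduced P
    linked-case m with ∈ₚ.∈-∃++ m
    ... | pre , post , refl = reduced-conj⁻ r (subst Reduced (sym split) (reduced-insert (map κ pre) (map κ post) (Allₚ.++⁻ˡ (map κ pre) qs) (Allₚ.++⁻ʳ (map κ pre) qs)
          (subst Reflections split (refls-conj (s r) (Face.reflections F))) (subst Reduced (Listₚ.map-++ κ pre post) (ih G))))
      where
      G : Face ws (map κ (pre ++ post))
      G = face-link (face-↭ (↭ₚ.shift (s r) pre post) F)
      qs : All (Without r) (map κ pre ++ map κ post)
      qs = subst (All (Without r)) (Listₚ.map-++ κ pre post) (All.map ≼c′⇒without (Face.below G))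
      split : map κ (pre ++ s r ∷ post) ≡ map κ pre ++ s r ∷ map κ post
      split = trans (Listₚ.map-++ κ pre (s r ∷ post)) (cong (λ t → map κ pre ++ t ∷ map κ post) conj-ss)
    turned : (Face (ws ++ r ∷ []) (map κ P) → Reduced (map κ P)) → Dec (s r ∈ P) → Reduced P
    turned rec (yes m) = linked-case m
    turned rec (no r∉) = reduced-conj⁻ r (rec (face-turn r∉ F))

  face-reduced-hit : ∀ {k} → (∀ {ws} → length ws ≡ k → Unique ws → ∀ {P} → Face ws P → Reduced P) →
                     ∀ {ws t} → length ws ≡ suc k → Unique ws → Hit ws t → ∀ {P} → t ∈ P → Face ws P → Reduced P
  face-reduced-hit ih {r ∷ ws} len uniq (now refl) m F =
    reduced-step r ws uniq (ih (ℕₚ.suc-injective len) (AllPairs.tail uniq)) F (inj₁ m)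
  face-reduced-hit ih {r ∷ ws} len uniq (later h) m F =
    reduced-step r ws uniq (ih (ℕₚ.suc-injective len) (AllPairs.tail uniq)) F
      (inj₂ (face-reduced-hit ih (trans (length-∷ʳ ws r) len) (rotate uniq) h (∈ₚ.∈-map⁺ (conj (s r)) m)))

  -- This holds for every ordering of the face, so whichever ordering the search in `sqr` accepts is
  -- a shortest factorization of its product.
  face-reduced : ∀ k {ws} → length ws ≡ k → Unique ws → ∀ {P} → Face ws P → Reduced P
  face-reduced k len uniq {[]} F = reduced-[]
  face-reduced zero {[]} len uniq {t ∷ P} F = ⊥-elim (refl≢e (All.head (Face.reflections F)) (≼e (All.head (Face.below F))))
  face-reduced (suc k) len uniq {t ∷ P} F = face-reduced-hit (face-reduced k) len uniq (≼-hit uniq (All.head (Face.reflections F)) (All.head (Face.below F))) (here refl) F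

  -- Rotate until `t` is the head letter `s r`. One order then shows that `u` avoids `r`, the other
  -- that its conjugate does, and `without-commute` applies.
  both-orders : ∀ {ws t u} → Unique ws → Hit ws t → IsReflection t → IsReflection u → t ≢ u → t · u ≼ prodS ws → u · t ≼ prodS ws → Commute t u
  both-orders {r ∷ ws} {_} {u} uniq (now refl) tR uR t≢u tu ut = sym (trans (sym (⁻¹-involutive _)) (trans (cong _⁻¹ (⁻¹-anti u (s r)))
      (trans (cong₂ (λ x y → (x · y) ⁻¹) (s⁻¹ r) (refl-⁻¹ uR)) (trans (cong _⁻¹ ru≡) (trans (⁻¹-anti u (s r)) (cong₂ _·_ (s⁻¹ r) (refl-⁻¹ uR)))))))
    where
    open Head r ws uniq
    q : Without r u
    q = ≼c′⇒without (subst (_≼ c′) (group (u ∷ []) (s² r ∷ []) (! 0 ⊙ (! 0 ⊙ # 0)) (# 0) refl) (strip (additive-≼ (additive-refl tR uR t≢u)) tu))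
    q′ : Without r (conj (s r) u)
    q′ = ≼c′⇒without (conj≼c′ (additive-refl uR tR (≢-sym t≢u)) ut)
    ru≡ : s r · u ≡ u · s r
    ru≡ = conj-commute (without-commute q q′)
  both-orders {r ∷ ws} {t} {u} uniq (later h) tR uR t≢u tu ut = subst₂ Commute (conj-s² r t) (conj-s² r u) (commute-conj-s r
      (both-orders (rotate uniq) h (refl-conj (s r) tR) (refl-conj (s r) uR) (t≢u ∘ conj-injective (s r))
        (subst (_≼ c*) (conj-homo (s r) t u) (≼-rot tu)) (subst (_≼ c*) (conj-homo (s r) u t) (≼-rot ut))))
    where open Head r ws uniq

  -- With `t = w · s i · w ⁻¹`, commutation means that `s i` fixes the conjugate `u′`; the signs of
  -- `w ⁻¹` and `w` then cancel, and `s i` does not invert `u′` because `u′` differs from it.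
  η-commuting : ∀ {t u} → IsReflection t → IsReflection u → Commute t u → t ≢ u → η t u ≡ false
  η-commuting {_} {u} (w , i , refl) uR comm t≢u = trans (cong (λ x → η x u) refl) (trans (η-· (w · s i) (w ⁻¹) u)
      (trans (cong (_⊕ η (w ⁻¹) u) (trans (η-· w (s i) (conj (w ⁻¹) u)) (cong₂ _⊕_ (cong (η w) fixed)
          (trans (η-s i _) (≡ʷ-false (λ p → t≢u (trans (cong (conj w) (sym p)) (conj-inv′ w u))))))))
        (trans (cong ((η w u′ ⊕ false) ⊕_) (trans (cong (η (w ⁻¹)) (sym (conj-inv′ w u))) (η-⁻¹ w u′))) (cancel (η w u′)))))
    where
    u′ = conj (w ⁻¹) u
    cancel : ∀ b → (b ⊕ false) ⊕ b ≡ false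
    cancel false = refl
    cancel true  = refl
    fixed : conj (s i) u′ ≡ u′
    fixed = trans (group (w ∷ u ∷ []) (s² i ∷ []) (! 0 ⊙ (inv (# 0) ⊙ # 1 ⊙ inv (inv (# 0))) ⊙ inv (! 0))
        (inv (# 0) ⊙ ((# 0 ⊙ ! 0 ⊙ inv (# 0)) ⊙ # 1 ⊙ inv (# 0 ⊙ ! 0 ⊙ inv (# 0))) ⊙ inv (inv (# 0))) refl)
      (cong (conj (w ⁻¹)) (commute-conj comm))

  η-ignore : ∀ x {t u} → IsReflection t → IsReflection u → Commute t u → t ≢ u → η (x · t) u ≡ η x u
  η-ignore x {t} {u} tR uR comm t≢u = trans (η-· x t u) (trans (cong₂ _⊕_ (cong (η x) (commute-conj comm)) (η-commuting tR uR comm t≢u)) (xor-identityʳ _))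

  ups : W → List W → ℕ
  ups x []       = 0
  ups x (t ∷ ts) = (if η x t then 0 else 1) + ups (x · t) ts

  ups-swap : ∀ {t u} → IsReflection t → IsReflection u → Commute t u → t ≢ u → ∀ x ts → ups x (t ∷ u ∷ ts) ≡ ups x (u ∷ t ∷ ts)
  ups-swap {t} {u} tR uR comm t≢u x ts = begin
    count (η x t) + (count (η (x · t) u) + ups (x · t · u) ts) ≡⟨ cong₂ (λ b y → count (η x t) + (count b + ups y ts)) (η-ignore x tR uR comm t≢u) xtu ⟩
    count (η x t) + (count (η x u) + ups (x · u · t) ts)       ≡⟨ sym (ℕₚ.+-assoc (count (η x t)) _ _) ⟩
    (count (η x t) + count (η x u)) + ups (x · u · t) ts       ≡⟨ cong (_+ ups (x · u · t) ts) (ℕₚ.+-comm (count (η x t)) _) ⟩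
    (count (η x u) + count (η x t)) + ups (x · u · t) ts       ≡⟨ ℕₚ.+-assoc (count (η x u)) _ _ ⟩
    count (η x u) + (count (η x t) + ups (x · u · t) ts)       ≡⟨ cong (λ b → count (η x u) + (count b + ups (x · u · t) ts)) (sym (η-ignore x uR tR (sym comm) (≢-sym t≢u))) ⟩
    count (η x u) + (count (η (x · u) t) + ups (x · u · t) ts) ∎
    where
    open ≡-Reasoning
    count : Bool → ℕ
    count b = if b then 0 else 1
    xtu : x · t · u ≡ x · u · t
    xtu = trans (assoc _ _ _) (trans (cong (x ·_) comm) (sym (assoc _ _ _)))

  -- On a bitone ordering starting at `e` this is the product of the rising half. Being stable under
  -- commutations, it recovers `α` from any admissible ordering.
  upProduct : W → List W → W
  upProduct x []       = e
  upProduct x (t ∷ ts) = (if η x t then e else t) · upProduct (x · t) ts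

  upProduct-swap : ∀ {t u} → IsReflection t → IsReflection u → Commute t u → t ≢ u → ∀ x ts → upProduct x (t ∷ u ∷ ts) ≡ upProduct x (u ∷ t ∷ ts)
  upProduct-swap {t} {u} tR uR comm t≢u x ts
    rewrite η-ignore x tR uR comm t≢u | η-ignore x uR tR (sym comm) (≢-sym t≢u) =
    trans (sym (assoc _ _ _)) (trans (cong₂ _·_ (swap (η x t) (η x u)) (cong (λ y → upProduct y ts)
      (trans (assoc _ _ _) (trans (cong (x ·_) comm) (sym (assoc _ _ _)))))) (assoc _ _ _))
    where
    swap : ∀ a b → (if a then e else t) · (if b then e else u) ≡ (if b then e else u) · (if a then e else t)
    swap true  true  = refl
    swap true  false = trans (identityˡ _) (sym (identityʳ _))
    swap false true  = trans (identityʳ _) (sym (identityˡ _))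
    swap false false = comm

  SameUps : W → List W → List W → Set
  SameUps x ts ts′ = ups x ts ≡ ups x ts′ × upProduct x ts ≡ upProduct x ts′ × prodW ts ≡ prodW ts′

  move-front : ∀ {t} pre {post} → IsReflection t → Reflections pre → All (λ p → Commute p t × p ≢ t) pre → ∀ x →
               SameUps x (pre ++ t ∷ post) (t ∷ (pre ++ post))
  move-front [] _ _ _ x = refl , refl , refl
  move-front {t} (p ∷ pre) {post} tR (pR ∷ R) ((pt , p≢t) ∷ cs) x with move-front pre {post} tR R cs (x · p)
  ... | u≡ , v≡ , w≡ = trans (cong ((if η x p then 0 else 1) +_) u≡) (ups-swap pR tR pt p≢t x (pre ++ post)) ,
        trans (cong ((if η x p then e else p) ·_) v≡) (upProduct-swap pR tR pt p≢t x (pre ++ post)) ,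
        trans (cong (p ·_) w≡) (trans (sym (assoc _ _ _)) (trans (cong (_· prodW (pre ++ post)) pt) (assoc _ _ _)))

  Ordered : List (Fin n) → List W → Set
  Ordered ws = AllPairs (λ t u → t · u ≼ prodS ws)

  reduced-ordered : ∀ {ws L} → Reduced L → prodW L ≼ prodS ws → Ordered ws L
  reduced-ordered {ws} {[]} _ _ = []
  reduced-ordered {ws} {t ∷ L} R le with reduced-∷⁻ R
  ... | tR , R′ , a = All.tabulate (λ {u} m → ≼-trans (subst (_≼ prodW (t ∷ L)) (cong (t ·_) (identityʳ u)) (proj₂ (reduced-⊑ (pair-⊑ m) R))) le)
        ∷ reduced-ordered {ws} R′ (≼-trans (additive-≼ʳ a) le)

  -- Two admissible orderings of the same reflections differ by commutations.
  reorder : ∀ {ws} → Unique ws → ∀ ts {ts′} → ts ↭ ts′ → Reflections ts → All (_≼ prodS ws) ts → Unique ts → Ordered ws ts → Ordered ws ts′ →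
            ∀ x → SameUps x ts ts′
  reorder uniq [] p _ _ _ _ _ x with ↭ₚ.↭-empty-inv (↭-sym p)
  ... | refl = refl , refl , refl
  reorder {ws} uniq (t ∷ ts) {ts′} p (tR ∷ R) (t≼ ∷ bs) (t∉ ∷ u) (o ∷ os) o′ x with ∈ₚ.∈-∃++ (∈-↭ p (here refl))
  ... | pre , post , refl = trans (cong ((if η x t then 0 else 1) +_) (proj₁ rec)) (sym (proj₁ moved)) ,
        trans (cong ((if η x t then e else t) ·_) (proj₁ (proj₂ rec))) (sym (proj₁ (proj₂ moved))) ,
        trans (cong (t ·_) (proj₂ (proj₂ rec))) (sym (proj₂ (proj₂ moved)))
    where
    p′ : ts ↭ pre ++ post
    p′ = ↭ₚ.drop-mid [] pre p
    in-ts : ∀ {q} → q ∈ pre → q ∈ ts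
    in-ts m = ∈-↭ (↭-sym p′) (∈ₚ.∈-++⁺ˡ m)
    before : ∀ {l} (pre : List W) {post} → Ordered ws (pre ++ t ∷ post) → l ∈ pre → l · t ≼ prodS ws
    before (_ ∷ pre) (h ∷ _) (here refl) = All.head (Allₚ.++⁻ʳ pre h)
    before (_ ∷ pre) (_ ∷ h) (there m)   = before pre h m
    drop-t : ∀ (pre : List W) {post} → Ordered ws (pre ++ t ∷ post) → Ordered ws (pre ++ post)
    drop-t []        (_ ∷ h) = h
    drop-t (_ ∷ pre) (a ∷ h) = Allₚ.++⁺ (Allₚ.++⁻ˡ pre a) (All.tail (Allₚ.++⁻ʳ pre a)) ∷ drop-t pre h
    commutes : All (λ q → Commute q t × q ≢ t) pre
    commutes = All.tabulate λ m → let q∈ = in-ts m ; qR = All.lookup R q∈ ; t≢q = All.lookup t∉ q∈ in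
      sym (both-orders uniq (≼-hit uniq tR t≼) tR qR t≢q (All.lookup o q∈) (before pre o′ m)) , ≢-sym t≢q
    moved = move-front pre {post} tR (All.tabulate (λ m → All.lookup R (in-ts m))) commutes x
    rec = reorder uniq ts p′ R bs u os (drop-t pre o′) (x · t)

  -- Boolean tests, sublists, orderings and finite sums

  ⌊⌋-true : ∀ {P : Set} (d : Dec P) → P → ⌊ d ⌋ ≡ true
  ⌊⌋-true (yes _) _ = refl
  ⌊⌋-true (no ¬p) p = ⊥-elim (¬p p)

  ⌊⌋-true⁻ : ∀ {P : Set} (d : Dec P) → ⌊ d ⌋ ≡ true → P
  ⌊⌋-true⁻ (yes p) _ = p

  bool-≡ : ∀ {a b : Bool} → (a ≡ true → b ≡ true) → (b ≡ true → a ≡ true) → a ≡ b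
  bool-≡ {true}  {b}     f g = sym (f refl)
  bool-≡ {false} {true}  f g = g refl
  bool-≡ {false} {false} f g = refl

  ∧-true : ∀ {a b} → a ≡ true → b ≡ true → a ∧ b ≡ true
  ∧-true refl refl = refl

  ∧-true⁻ : ∀ {a b} → a ∧ b ≡ true → a ≡ true × b ≡ true
  ∧-true⁻ {true} {true} _ = refl , refl

  module _ {A : Set} where

    filterᵇ-⊑ : ∀ (p : A → Bool) xs → filterᵇ p xs ⊑ xs
    filterᵇ-⊑ p [] = []
    filterᵇ-⊑ p (x ∷ xs) with p x
    ... | true  = refl ∷ filterᵇ-⊑ p xs
    ... | false = x ∷ʳ filterᵇ-⊑ p xs

    ∈-filterᵇ⁺ : ∀ (p : A → Bool) {x xs} → x ∈ xs → p x ≡ true → x ∈ filterᵇ p xs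
    ∈-filterᵇ⁺ p {x} {y ∷ xs} (here refl) h with p x
    ∈-filterᵇ⁺ p (here refl) refl | true = here refl
    ∈-filterᵇ⁺ p {x} {y ∷ xs} (there m) h with p y
    ... | true  = there (∈-filterᵇ⁺ p m h)
    ... | false = ∈-filterᵇ⁺ p m h

    ∈-filterᵇ⁻ : ∀ (p : A → Bool) {x xs} → x ∈ filterᵇ p xs → x ∈ xs × p x ≡ true
    ∈-filterᵇ⁻ p {x} {y ∷ xs} m with p y in eq
    ∈-filterᵇ⁻ p {x} {y ∷ xs} (here refl) | true = here refl , eq
    ∈-filterᵇ⁻ p {x} {y ∷ xs} (there m)   | true with ∈-filterᵇ⁻ p m
    ... | m′ , h = there m′ , h
    ∈-filterᵇ⁻ p {x} {y ∷ xs} m | false with ∈-filterᵇ⁻ p m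
    ... | m′ , h = there m′ , h

    filterᵇ-cong : ∀ {p q : A → Bool} → (∀ x → p x ≡ q x) → ∀ xs → filterᵇ p xs ≡ filterᵇ q xs
    filterᵇ-cong h [] = refl
    filterᵇ-cong {p} {q} h (x ∷ xs) with p x | q x | h x
    ... | true  | .true  | refl = cong (x ∷_) (filterᵇ-cong h xs)
    ... | false | .false | refl = filterᵇ-cong h xs

    allᵇ⁺ : ∀ {p : A → Bool} {xs} → All (λ x → p x ≡ true) xs → allᵇ p xs ≡ true
    allᵇ⁺ []       = refl
    allᵇ⁺ (h ∷ hs) = ∧-true h (allᵇ⁺ hs)

    allᵇ⁻ : ∀ {p : A → Bool} {xs} → allᵇ p xs ≡ true → All (λ x → p x ≡ true) xs
    allᵇ⁻ {xs = []}     _ = []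
    allᵇ⁻ {xs = x ∷ xs} h with ∧-true⁻ h
    ... | a , b = a ∷ allᵇ⁻ b

    sublists-⊑ : ∀ {xs ys : List A} → xs ∈ sublists ys → xs ⊑ ys
    sublists-⊑ {ys = []} (here refl) = []
    sublists-⊑ {ys = y ∷ ys} m with ∈ₚ.∈-++⁻ (map (y ∷_) (sublists ys)) m
    ... | inj₂ m′ = y ∷ʳ sublists-⊑ m′
    ... | inj₁ m′ with ∈ₚ.∈-map⁻ (y ∷_) m′
    ...   | zs , m″ , refl = refl ∷ sublists-⊑ m″

    ⊑-sublists : ∀ {xs ys : List A} → xs ⊑ ys → xs ∈ sublists ys
    ⊑-sublists [] = here refl
    ⊑-sublists {ys = y ∷ ys} (.y ∷ʳ p) = ∈ₚ.∈-++⁺ʳ (map (y ∷_) (sublists ys)) (⊑-sublists p)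
    ⊑-sublists (refl ∷ p) = ∈ₚ.∈-++⁺ˡ (∈ₚ.∈-map⁺ (_ ∷_) (⊑-sublists p))

    ⊑-∈ : ∀ {xs ys : List A} {x} → xs ⊑ ys → x ∈ xs → x ∈ ys
    ⊑-∈ (y ∷ʳ p)   m           = there (⊑-∈ p m)
    ⊑-∈ (refl ∷ p) (here refl) = here refl
    ⊑-∈ (refl ∷ p) (there m)   = there (⊑-∈ p m)

    sublists-unique : ∀ {ys : List A} → Unique ys → Unique (sublists ys)
    sublists-unique [] = [] ∷ []
    sublists-unique {y ∷ ys} (y∉ ∷ u) = Uniqueₚ.++⁺ (Uniqueₚ.map⁺ Listₚ.∷-injectiveʳ (sublists-unique u)) (sublists-unique u) disjoint
      where
      disjoint : ∀ {zs} → ¬ (zs ∈ map (y ∷_) (sublists ys) × zs ∈ sublists ys)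
      disjoint (m , m′) with ∈ₚ.∈-map⁻ (y ∷_) m
      ... | _ , _ , refl = All.lookup y∉ (⊑-∈ (sublists-⊑ m′) (here refl)) refl

    ⊑-ext : ∀ {xs ys zs : List A} → Unique zs → xs ⊑ zs → ys ⊑ zs → (∀ {x} → x ∈ xs → x ∈ ys) → (∀ {x} → x ∈ ys → x ∈ xs) → xs ≡ ys
    ⊑-ext _ [] [] _ _ = refl
    ⊑-ext (_ ∷ u) (_ ∷ʳ p) (_ ∷ʳ q) f g = ⊑-ext u p q f g
    ⊑-ext (z∉ ∷ _) (_ ∷ʳ p) (refl ∷ q) f g = ⊥-elim (All.lookup z∉ (⊑-∈ p (g (here refl))) refl)
    ⊑-ext (z∉ ∷ _) (refl ∷ p) (_ ∷ʳ q) f g = ⊥-elim (All.lookup z∉ (⊑-∈ q (f (here refl))) refl)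
    ⊑-ext {z ∷ xs} {.z ∷ ys} (z∉ ∷ u) (refl ∷ p) (refl ∷ q) f g = cong (z ∷_) (⊑-ext u p q (restrict p f) (restrict q g))
      where
      restrict : ∀ {xs ys x} → xs ⊑ _ → (∀ {x} → x ∈ z ∷ xs → x ∈ z ∷ ys) → x ∈ xs → x ∈ ys
      restrict p f m with f (there m)
      ... | there m′  = m′
      ... | here refl = ⊥-elim (All.lookup z∉ (⊑-∈ p m) refl)

    unique-↭ : ∀ {xs ys : List A} → Unique xs → Unique ys → (∀ {x} → x ∈ xs → x ∈ ys) → (∀ {x} → x ∈ ys → x ∈ xs) → xs ↭ ys
    unique-↭ u v f g = ∼bag⇒↭ (unique∧set⇒bag u v (mk⇔ f g))

    insertEverywhere-∈ : ∀ {x : A} xs {ys} → (xs ++ x ∷ ys) ∈ insertEverywhere x (xs ++ ys)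
    insertEverywhere-∈ [] {[]}    = here refl
    insertEverywhere-∈ [] {_ ∷ _} = here refl
    insertEverywhere-∈ (z ∷ xs)   = there (∈ₚ.∈-map⁺ (z ∷_) (insertEverywhere-∈ xs))

    insertEverywhere-↭ : ∀ {x : A} ys {zs} → zs ∈ insertEverywhere x ys → zs ↭ x ∷ ys
    insertEverywhere-↭ [] (here refl) = ↭-refl
    insertEverywhere-↭ (y ∷ ys) (here refl) = ↭-refl
    insertEverywhere-↭ {x} (y ∷ ys) (there m) with ∈ₚ.∈-map⁻ (y ∷_) m
    ... | zs , m′ , refl = ↭-trans (↭-prep y (insertEverywhere-↭ ys m′)) (Perm.swap y x ↭-refl)

    orderings-∈ : ∀ xs {ys : List A} → ys ↭ xs → ys ∈ orderings xs
    orderings-∈ [] p with ↭ₚ.↭-empty-inv p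
    ... | refl = here refl
    orderings-∈ (x ∷ xs) p with ∈ₚ.∈-∃++ (↭ₚ.∈-resp-↭ (↭-sym p) (here refl))
    ... | pre , post , refl = ∈ₚ.∈-concatMap⁺ (insertEverywhere x)
      (Any.map (λ { refl → insertEverywhere-∈ pre }) (orderings-∈ xs (↭ₚ.drop-mid pre [] p)))

    orderings-↭ : ∀ xs {ys : List A} → ys ∈ orderings xs → ys ↭ xs
    orderings-↭ [] (here refl) = ↭-refl
    orderings-↭ (x ∷ xs) m with ∈.find (∈ₚ.∈-concatMap⁻ (insertEverywhere x) m)
    ... | zs , zs∈ , m′ = ↭-trans (insertEverywhere-↭ zs m′) (↭-prep x (orderings-↭ xs zs∈))

    findᵇ-just : ∀ (p : A → Bool) {x xs} → x ∈ xs → p x ≡ true → ∃ λ y → findᵇ p xs ≡ just y × y ∈ xs × p y ≡ true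
    findᵇ-just p {x} {z ∷ xs} m h with p z in eq
    ... | true = z , refl , here refl , eq
    findᵇ-just p {x} {z ∷ xs} (here refl) h | false = case trans (sym h) eq of λ ()
    findᵇ-just p {x} {z ∷ xs} (there m) h | false with findᵇ-just p m h
    ... | y , e₁ , m′ , h′ = y , e₁ , there m′ , h′

  map-toList : ∀ {A : Set} {Q : A → Set} {xs} (qs : All Q xs) → map proj₁ (All.toList qs) ≡ xs
  map-toList []       = refl
  map-toList (_ ∷ qs) = cong (_ ∷_) (map-toList qs)

  toList-∈ : ∀ {A : Set} {Q : A → Set} {xs x} (qs : All Q xs) → x ∈ xs → ∃ λ q → (x , q) ∈ All.toList qs
  toList-∈ (q ∷ qs) (here refl) = q , here refl
  toList-∈ (q ∷ qs) (there m) with toList-∈ qs m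
  ... | q′ , m′ = q′ , there m′

  Unique-map : ∀ {A B : Set} {f : A → B} {C : Set} {g : A → C} {xs} → (∀ x y → f x ≡ f y → g x ≡ g y) → Unique (map g xs) → Unique (map f xs)
  Unique-map h u = AllPairsₚ.map⁺ (AllPairs.map (λ g≢ f≡ → g≢ (h _ _ f≡)) (AllPairsₚ.map⁻ u))

  sublists-map : ∀ {A B : Set} (f : A → B) xs → sublists (map f xs) ≡ map (map f) (sublists xs)
  sublists-map f [] = refl
  sublists-map f (x ∷ xs) rewrite sublists-map f xs = trans
    (cong (_++ map (map f) (sublists xs)) (trans (sym (Listₚ.map-∘ (sublists xs))) (Listₚ.map-∘ (sublists xs))))
    (sym (Listₚ.map-++ (map f) (map (x ∷_) (sublists xs)) (sublists xs)))

  pairsFrom : ∀ {A B : Set} → (A → List B) → List A → List (A × B)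
  pairsFrom ys = concatMap (λ x → map (x ,_) (ys x))

  ∈-pairsFrom⁺ : ∀ {A B : Set} (ys : A → List B) {xs x y} → x ∈ xs → y ∈ ys x → (x , y) ∈ pairsFrom ys xs
  ∈-pairsFrom⁺ ys {x = x} m m′ = ∈ₚ.∈-concatMap⁺ (λ x → map (x ,_) (ys x)) (Any.map (λ { refl → ∈ₚ.∈-map⁺ (x ,_) m′ }) m)

  ∈-pairsFrom⁻ : ∀ {A B : Set} (ys : A → List B) {xs x y} → (x , y) ∈ pairsFrom ys xs → x ∈ xs × y ∈ ys x
  ∈-pairsFrom⁻ ys m with ∈.find (∈ₚ.∈-concatMap⁻ (λ x → map (x ,_) (ys x)) m)
  ... | x , x∈ , m′ with ∈ₚ.∈-map⁻ (x ,_) m′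
  ...   | y , y∈ , refl = x∈ , y∈

  pairsFrom-unique : ∀ {A B : Set} {ys : A → List B} {xs} → Unique xs → (∀ x → Unique (ys x)) → Unique (pairsFrom ys xs)
  pairsFrom-unique [] _ = []
  pairsFrom-unique {ys = ys} {x ∷ xs} (x∉ ∷ u) v = Uniqueₚ.++⁺ (Uniqueₚ.map⁺ (cong proj₂) (v x)) (pairsFrom-unique u v) disjoint
    where
    disjoint : ∀ {p} → ¬ (p ∈ map (x ,_) (ys x) × p ∈ pairsFrom ys xs)
    disjoint (m , m′) with ∈ₚ.∈-map⁻ (x ,_) m
    ... | _ , _ , refl = All.lookup x∉ (proj₁ (∈-pairsFrom⁻ ys m′)) refl

  module Sums (R : CommutativeRing 0ℓ 0ℓ) where
    module R = CommutativeRing R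
    open R using (Carrier; 0#; 1#; _≈_) renaming (_+_ to _+R_; _*_ to _*R_)

    ∑ : {X : Set} → (X → Carrier) → List X → Carrier
    ∑ f = foldr (λ a acc → f a +R acc) 0#

    ∏ : {X : Set} → (X → Carrier) → List X → Carrier
    ∏ f = foldr (λ a acc → f a *R acc) 1#

    private variable X Y : Set

    ∑-cong∈ : ∀ {f g : X → Carrier} xs → (∀ {x} → x ∈ xs → f x ≈ g x) → ∑ f xs ≈ ∑ g xs
    ∑-cong∈ [] h = R.refl
    ∑-cong∈ (x ∷ xs) h = R.+-cong (h (here refl)) (∑-cong∈ xs (h ∘ there))

    ∑-cong : ∀ {f g : X → Carrier} xs → (∀ x → f x ≈ g x) → ∑ f xs ≈ ∑ g xs
    ∑-cong xs h = ∑-cong∈ xs (λ {x} _ → h x)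

    ∑-++ : ∀ (f : X → Carrier) xs ys → ∑ f (xs ++ ys) ≈ ∑ f xs +R ∑ f ys
    ∑-++ f [] ys = R.sym (R.+-identityˡ _)
    ∑-++ f (x ∷ xs) ys = R.trans (R.+-congˡ (∑-++ f xs ys)) (R.sym (R.+-assoc _ _ _))

    ∑-map : ∀ (f : Y → Carrier) (g : X → Y) xs → ∑ f (map g xs) ≡ ∑ (f ∘ g) xs
    ∑-map f g [] = refl
    ∑-map f g (x ∷ xs) = cong (f (g x) +R_) (∑-map f g xs)

    ∑-filter : ∀ (p : X → Bool) (f : X → Carrier) xs → ∑ f (filterᵇ p xs) ≈ ∑ (λ x → if p x then f x else 0#) xs
    ∑-filter p f [] = R.refl
    ∑-filter p f (x ∷ xs) with p x
    ... | true  = R.+-congˡ (∑-filter p f xs)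
    ... | false = R.trans (∑-filter p f xs) (R.sym (R.+-identityˡ _))

    +-exchange : ∀ a b c d → (a +R b) +R (c +R d) ≈ (a +R c) +R (b +R d)
    +-exchange a b c d = R.trans (R.+-assoc a b _) (R.trans (R.+-congˡ (R.trans (R.sym (R.+-assoc b c d))
      (R.trans (R.+-congʳ (R.+-comm b c)) (R.+-assoc c b d)))) (R.sym (R.+-assoc a c _)))

    ∑-+ : ∀ (f g : X → Carrier) xs → ∑ (λ x → f x +R g x) xs ≈ ∑ f xs +R ∑ g xs
    ∑-+ f g [] = R.sym (R.+-identityˡ _)
    ∑-+ f g (x ∷ xs) = R.trans (R.+-congˡ (∑-+ f g xs)) (+-exchange _ _ _ _)

    ∑-0 : ∀ (xs : List X) → ∑ (λ _ → 0#) xs ≈ 0#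
    ∑-0 [] = R.refl
    ∑-0 (x ∷ xs) = R.trans (R.+-identityˡ _) (∑-0 xs)

    ∑-swap : ∀ (f : X → Y → Carrier) xs ys → ∑ (λ x → ∑ (f x) ys) xs ≈ ∑ (λ y → ∑ (λ x → f x y) xs) ys
    ∑-swap f [] ys = R.sym (∑-0 ys)
    ∑-swap f (x ∷ xs) ys = R.trans (R.+-congˡ (∑-swap f xs ys)) (R.sym (∑-+ (f x) _ ys))

    ∑-*ʳ : ∀ (f : X → Carrier) k xs → ∑ (λ x → f x *R k) xs ≈ ∑ f xs *R k
    ∑-*ʳ f k [] = R.sym (R.zeroˡ k)
    ∑-*ʳ f k (x ∷ xs) = R.trans (R.+-congˡ (∑-*ʳ f k xs)) (R.sym (R.distribʳ k _ _))

    ∑-*ˡ : ∀ k (f : X → Carrier) xs → ∑ (λ x → k *R f x) xs ≈ k *R ∑ f xs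
    ∑-*ˡ k f xs = R.trans (∑-cong xs (λ x → R.*-comm k (f x))) (R.trans (∑-*ʳ f k xs) (R.*-comm _ k))

    ∑-↭ : ∀ (f : X → Carrier) {xs ys} → xs ↭ ys → ∑ f xs ≈ ∑ f ys
    ∑-↭ f Perm.refl = R.refl
    ∑-↭ f (Perm.prep x p) = R.+-congˡ (∑-↭ f p)
    ∑-↭ f (Perm.swap x y p) = R.trans (R.sym (R.+-assoc _ _ _)) (R.trans (R.+-cong (R.+-comm _ _) (∑-↭ f p)) (R.+-assoc _ _ _))
    ∑-↭ f (Perm.trans p q) = R.trans (∑-↭ f p) (∑-↭ f q)

    ∑-pairsFrom : ∀ (f : X × Y → Carrier) (ys : X → List Y) xs → ∑ f (pairsFrom ys xs) ≈ ∑ (λ x → ∑ (λ y → f (x , y)) (ys x)) xs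
    ∑-pairsFrom f ys [] = R.refl
    ∑-pairsFrom f ys (x ∷ xs) = R.trans (∑-++ f (map (x ,_) (ys x)) _)
      (R.+-cong (R.reflexive (∑-map f (x ,_) (ys x))) (∑-pairsFrom f ys xs))

    ∑-sublists-++ : ∀ (f : List X → Carrier) xs ys → ∑ f (sublists (xs ++ ys)) ≈ ∑ (λ M → ∑ (λ P → f (M ++ P)) (sublists ys)) (sublists xs)
    ∑-sublists-++ f [] ys = R.sym (R.+-identityʳ _)
    ∑-sublists-++ f (x ∷ xs) ys = R.trans (∑-++ f (map (x ∷_) (sublists (xs ++ ys))) _) (R.trans
      (R.+-cong (R.trans (R.reflexive (∑-map f (x ∷_) (sublists (xs ++ ys)))) (R.trans (∑-sublists-++ (f ∘ (x ∷_)) xs ys)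
          (R.reflexive (sym (∑-map (λ M → ∑ (λ P → f (M ++ P)) (sublists ys)) (x ∷_) (sublists xs))))))
        (∑-sublists-++ f xs ys))
      (R.sym (∑-++ _ (map (x ∷_) (sublists xs)) (sublists xs))))

    ∏-expand : ∀ (p : X → Bool) (x : X → Carrier) xs →
               ∑ (λ M → if allᵇ p M then ∏ x M else 0#) (sublists xs) ≈ ∏ (λ i → x i +R 1#) (filterᵇ p xs)
    ∏-expand p x [] = R.+-identityʳ _
    ∏-expand p x (i ∷ is) = R.trans (∑-++ _ (map (i ∷_) (sublists is)) (sublists is))
      (R.trans (R.+-cong (R.reflexive (∑-map _ (i ∷_) (sublists is))) (∏-expand p x is)) head)
      where
      head : ∑ (λ M → if p i ∧ allᵇ p M then x i *R ∏ x M else 0#) (sublists is) +R ∏ (λ i → x i +R 1#) (filterᵇ p is) ≈ ∏ (λ i → x i +R 1#) (filterᵇ p (i ∷ is))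
      head with p i
      ... | false = R.trans (R.+-congʳ (∑-0 (sublists is))) (R.+-identityˡ _)
      ... | true  = R.trans (R.+-cong (R.trans (∑-cong (sublists is) factor) (R.trans (∑-*ˡ (x i) _ (sublists is)) (R.*-congˡ (∏-expand p x is)))) (R.sym (R.*-identityˡ _)))
              (R.sym (R.distribʳ _ _ _))
        where
        factor : ∀ M → (if allᵇ p M then x i *R ∏ x M else 0#) ≈ x i *R (if allᵇ p M then ∏ x M else 0#)
        factor M with allᵇ p M
        ... | true  = R.refl
        ... | false = R.sym (R.zeroʳ _)

  -- Covers, descending chains and support

  absLe-≼ : ∀ {v w} → absLe v w ≡ true → v ≼ w
  absLe-≼ {v} {w} = ⌊⌋-true⁻ (≼-dec v w)

  ≼-absLe : ∀ {v w} → v ≼ w → absLe v w ≡ true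
  ≼-absLe {v} {w} = ⌊⌋-true (≼-dec v w)

  ℓT-1 : ∀ {w} → ℓT w ≡ 1 → IsReflection w
  ℓT-1 {w} p with ℓT-word w
  ... | [] , _ , q , _ with () ← trans q p
  ... | t ∷ [] , tR ∷ [] , _ , refl = subst IsReflection (sym (identityʳ t)) tR
  ... | _ ∷ _ ∷ _ , _ , q , _ with () ← trans q p

  cov⇒ : ∀ {v w} → cov v w ≡ true → IsReflection (v ⁻¹ · w) × ℓT w ≡ suc (ℓT v)
  cov⇒ {v} {w} h with ∧-true⁻ h
  ... | h₁ , h₂ = ℓT-1 (ℕₚ.+-cancelˡ-≡ (ℓT v) _ _ (trans (sym (absLe-≼ h₁)) (trans w≡ (ℕₚ.+-comm 1 _)))) , w≡
    where
    w≡ : ℓT w ≡ suc (ℓT v)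
    w≡ = ⌊⌋-true⁻ (ℓT w ≟ℕ suc (ℓT v)) h₂

  ⇒cov : ∀ {v t} → IsReflection t → Additive v t → cov v (v · t) ≡ true
  ⇒cov {v} {t} tR a = ∧-true (≼-absLe (additive-≼ a))
    (⌊⌋-true (_ ≟ℕ _) (trans a (trans (cong (ℓT v +_) (ℓT-refl tR)) (ℕₚ.+-comm _ 1))))

  ≪⇒descends : ∀ {α β} → α ≪ β → Descends α β
  ≪⇒descends {α} ε = [] , [] , identityʳ α , tt , sym (ℕₚ.+-identityʳ _)
  ≪⇒descends {α} {β} (_◅_ {j = γ} (h , lt) rest) with ≪⇒descends rest | cov⇒ h
  ... | D , R , p , down , len | tR , γ≡ = t ∷ D , tR ∷ R , trans (sym (assoc _ _ _)) (trans (cong (_· prodW D) αt≡) p) ,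
        (ℓ⇒η-true tR (subst (λ x → ℓ x < ℓ α) (sym αt≡) lt) , subst (λ x → Down x D) (sym αt≡) down) ,
        trans len (trans (cong (_+ length D) γ≡) (sym (ℕₚ.+-suc _ _)))
    where
    t = α ⁻¹ · γ
    αt≡ : α · t ≡ γ
    αt≡ = cancelˡ′ α γ

  descends⇒≪ : ∀ {α} D → Reduced D → Additive α (prodW D) → Down α D → α ≪ (α · prodW D)
  descends⇒≪ {α} [] _ _ _ = subst (α ≪_) (sym (identityʳ α)) ε
  descends⇒≪ {α} (t ∷ D) R a (h , down) with reduced-∷⁻ R
  ... | tR , R′ , b with additive-assocˡ a b
  ...   | a′ , αt = (⇒cov tR αt , η-true⇒ℓ h) ◅ subst ((α · t) ≪_) (assoc _ _ _) (descends⇒≪ D R′ a′ down)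

  -- Deleting the head letter of a reduced word is right multiplication by an inversion. That
  -- inversion lies in the parabolic subgroup, hence so does the rest of the word, and the head
  -- letter is the quotient.
  reduced-letters : ∀ {J} us → length us ≡ ℓ (prodS us) → Par J (prodS us) → All J us
  reduced-letters [] _ _ = []
  reduced-letters {J} (i ∷ us) len p = par-s⁻ (par-cancelʳ pv p) ∷ reduced-letters us len-v pv
    where
    v = prodS us
    t = conj (v ⁻¹) (s i)
    wt≡v : s i · v · t ≡ v
    wt≡v = group (v ∷ []) (s² i ∷ []) (! 0 ⊙ # 0 ⊙ (inv (# 0) ⊙ ! 0 ⊙ inv (inv (# 0)))) (# 0) refl
    len-v : length us ≡ ℓ v
    len-v with reducedWord v
    ... | vs , vlen , q = ℕₚ.≤-antisym (ℕₚ.≤-pred (ℕₚ.≤-trans (ℕₚ.≤-reflexive len)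
            (ℕₚ.≤-trans (ℓ-≤ (i ∷ vs) (cong (s i ·_) q)) (ℕₚ.≤-reflexive (cong suc vlen))))) (ℓ-≤ us refl)
    pt : Par J t
    pt = par-exchange p (ℓ⇒η-true (refl-conj _ (refl-s i))
      (subst₂ _<_ (trans len-v (cong ℓ (sym wt≡v))) len ℕₚ.≤-refl))
    pv : Par J v
    pv = subst (Par J) wt≡v (par-· p pt)

  without⇒¬supp : ∀ {i w} → Without i w → ¬ InSupp w i
  without⇒¬supp p (us , len , refl , m) = All.lookup (reduced-letters us len p) m refl

  ¬supp⇒without : ∀ {i w} → ¬ InSupp w i → Without i w
  ¬supp⇒without {i} {w} h with reducedWord w
  ... | us , len , p = us , All.tabulate (λ m eq → h (us , len , p , subst (_∈ us) eq m)) , p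

  prodW-s : ∀ us → prodW (map s us) ≡ prodS us
  prodW-s []       = refl
  prodW-s (i ∷ us) = cong (s i ·_) (prodW-s us)

  ℓT≤ℓ : ∀ w → ℓT w ≤ ℓ w
  ℓT≤ℓ w with reducedWord w
  ... | us , len , p = subst (ℓT w ≤_) (trans (Listₚ.length-map s us) len)
    (ℓT-≤ (Allₚ.map⁺ (All.universal refl-s us)) (trans (prodW-s us) p))

  coxeter-word-unique : ∀ {ws} → ws ↭ allFin n → Unique ws
  coxeter-word-unique p = AllPairs-↭ ≢-sym (↭-sym p) (Uniqueₚ.allFin⁺ n)

  full-support : ∀ {ws} → ws ↭ allFin n → ∀ w → Par (_∈ ws) w
  full-support p w = proj₁ (generated w) , All.universal (λ i → ∈-↭ (↭-sym p) (∈ₚ.∈-allFin i)) _ , proj₂ (generated w)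

  -- Reading's compatibility relations

  σ-pos : ∀ {r t} → t ≢ s r → σ r (pos t) ≡ pos (conj (s r) t)
  σ-pos {r} {t} t≢ with t ≟ s r
  ... | yes p = ⊥-elim (t≢ p)
  ... | no _  = cong (λ x → pos (s r · t · x)) (sym (s⁻¹ r))

  σ-head : ∀ r → σ r (pos (s r)) ≡ neg r
  σ-head r with s r ≟ s r
  ... | yes _ = refl
  ... | no ¬p = ⊥-elim (¬p refl)

  module Clusters (Tl : List W) (Tl-spec : ∀ t → t ∈ Tl ⇔ IsReflection t)
                  (compat : W → Root → Root → Bool) (family : IsClusterFamily Tl compat) where
    open IsClusterFamily family

    Tl⁺ : ∀ {t} → IsReflection t → t ∈ Tl
    Tl⁺ = Equivalence.from (Tl-spec _)

    Tl⁻ : ∀ {t} → t ∈ Tl → IsReflection t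
    Tl⁻ = Equivalence.to (Tl-spec _)

    pos∈ : ∀ {t} → IsReflection t → pos t ∈ Φ≥-1 Tl
    pos∈ tR = ∈ₚ.∈-++⁺ʳ (map neg (allFin n)) (∈ₚ.∈-map⁺ pos (Tl⁺ tR))

    compat-rot : ∀ {r ws t u} → r ∷ ws ↭ allFin n → IsReflection t → IsReflection u →
                 compat (prodS (r ∷ ws)) (pos t) (pos u) ≡ compat (prodS (ws ++ r ∷ [])) (σ r (pos t)) (σ r (pos u))
    compat-rot {r} {ws} perm tR uR = trans (rot _ (_ , perm , refl) r shorter _ _ (pos∈ tR) (pos∈ uR))
      (cong (λ x → compat x _ _) (sym (trans c*≡ (cong (s r · c ·_) (s⁻¹ r)))))
      where
      uniq = coxeter-word-unique perm
      open Head r ws uniq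
      shorter : ℓ (s r · c) < ℓ c
      shorter = ℕₚ.≤-trans (s≤s (ℓ-≤ ws (sym s·c))) (ℕₚ.≤-trans (ℕₚ.≤-reflexive (sym (ℓT-prodS uniq))) (ℓT≤ℓ c))

    rotate-perm : ∀ {r ws} → r ∷ ws ↭ allFin n → ws ++ r ∷ [] ↭ allFin n
    rotate-perm {r} {ws} perm = ↭-trans (↭ₚ.++-comm ws (r ∷ [])) perm

    -- One rotation sends the head root to the negative simple root, where compatibility is a
    -- support condition on the conjugate of `u`; `compatible-head⇒` and `compatible-head⇐`
    -- translate it.
    compat-head : ∀ {r ws u} → r ∷ ws ↭ allFin n → IsReflection u → u ≢ s r →
                  compat (prodS (r ∷ ws)) (pos (s r)) (pos u) ≡ true ⇔ Compatible (r ∷ ws) (s r) u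
    compat-head {r} {ws} {u} perm uR u≢ = mk⇔
      (λ h → compatible-head⇐ uR (refl-par-≼ uniq uR (full-support perm u)) (¬supp⇒without (to (trans (sym eq) h))))
      (λ h → trans eq (from (without⇒¬supp (compatible-head⇒ uR u≢ h))))
      where
      uniq = coxeter-word-unique perm
      open Head′ r ws uniq
      eq : compat (prodS (r ∷ ws)) (pos (s r)) (pos u) ≡ compat (prodS (ws ++ r ∷ [])) (neg r) (pos (conj (s r) u))
      eq = trans (compat-rot perm (refl-s r) uR) (cong₂ (compat _) (σ-head r) (σ-pos u≢))
      open Equivalence (negpos _ (_ , rotate-perm perm , refl) r _ (Tl⁺ (refl-conj (s r) uR)))

    -- Both sides are invariant under rotation as long as neither reflection is the head letter. The
    -- `Hit` of `t` ends the recursion; if `u` becomes the head letter first, the symmetry of both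
    -- relations is used.
    compat-spec : ∀ {ws t u} → ws ↭ allFin n → Hit ws t → IsReflection t → IsReflection u → t ≢ u →
                  compat (prodS ws) (pos t) (pos u) ≡ true ⇔ Compatible ws t u
    compat-spec perm (now refl) tR uR t≢u = compat-head perm uR (≢-sym t≢u)
    compat-spec {r ∷ ws} {t} {u} perm (later h) tR uR t≢u with t ≟ s r | u ≟ s r
    ... | yes refl | _ = compat-head perm uR (≢-sym t≢u)
    ... | no t≢ | yes refl = mk⇔ (λ p → compatible-sym {r ∷ ws} (to (trans sym-compat p))) (λ p → trans (sym sym-compat) (from (compatible-sym {r ∷ ws} p)))
      where
      open Equivalence (compat-head perm tR t≢u)
      sym-compat = symm _ (_ , perm , refl) (pos (s r)) (pos t) (pos∈ uR) (pos∈ tR)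
    ... | no t≢ | no u≢ = mk⇔ (λ p → compatible-rot⁻ tR uR t≢ u≢ t≢u (to (trans (sym eq) p))) (λ p → trans eq (from (compatible-rot tR uR t≢ u≢ t≢u p)))
      where
      open Head′ r ws (coxeter-word-unique perm)
      eq : compat (prodS (r ∷ ws)) (pos t) (pos u) ≡ compat (prodS (ws ++ r ∷ [])) (pos (conj (s r) t)) (pos (conj (s r) u))
      eq = trans (compat-rot perm tR uR) (cong₂ (compat _) (σ-pos t≢) (σ-pos u≢))
      open Equivalence (compat-spec (rotate-perm perm) h (refl-conj (s r) tR) (refl-conj (s r) uR) (t≢u ∘ conj-injective (s r)))

  -- Positive faces correspond to descending pairs

  not-⌊⌋ : ∀ {P : Set} (d : Dec P) → not ⌊ d ⌋ ≡ ⌊ ¬? d ⌋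
  not-⌊⌋ (yes _) = refl
  not-⌊⌋ (no _)  = refl

  ups-up : ∀ {x} us {ds} → Up x us → ups x (us ++ ds) ≡ length us + ups (x · prodW us) ds
  ups-up {x} [] {ds} _ = cong (λ y → ups y ds) (sym (identityʳ x))
  ups-up {x} (u ∷ us) {ds} (h , up) rewrite h =
    cong suc (trans (ups-up us up) (cong (λ y → length us + ups y ds) (assoc _ _ _)))

  ups-down : ∀ {x} ds → Down x ds → ups x ds ≡ 0
  ups-down []       _          = refl
  ups-down (d ∷ ds) (h , down) rewrite h = ups-down ds down

  upProduct-up : ∀ {x} us {ds} → Up x us → upProduct x (us ++ ds) ≡ prodW us · upProduct (x · prodW us) ds
  upProduct-up {x} [] {ds} _ = trans (cong (λ y → upProduct y ds) (sym (identityʳ x))) (sym (identityˡ _))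
  upProduct-up {x} (u ∷ us) {ds} (h , up) rewrite h =
    trans (cong (u ·_) (trans (upProduct-up us up) (cong (λ y → prodW us · upProduct y ds) (assoc _ _ _)))) (sym (assoc _ _ _))

  upProduct-down : ∀ {x} ds → Down x ds → upProduct x ds ≡ e
  upProduct-down []       _          = refl
  upProduct-down (d ∷ ds) (h , down) rewrite h = trans (identityˡ _) (upProduct-down ds down)

  module Bitonic {U D : List W} (up : Up e U) (down : Down (prodW U) D) where

    down-from : Down (e · prodW U) D
    down-from = subst (λ x → Down x D) (sym (identityˡ _)) down

    ups-bitone : ups e (U ++ D) ≡ length U
    ups-bitone = trans (ups-up U up) (trans (cong (length U +_) (ups-down D down-from)) (ℕₚ.+-identityʳ _))

    upProduct-bitone : upProduct e (U ++ D) ≡ prodW U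
    upProduct-bitone = trans (upProduct-up U up) (trans (cong (prodW U ·_) (upProduct-down D down-from)) (identityʳ _))

    bitone-parts : Reduced (U ++ D) → AllPairs Fall (U ++ D) → IsUp (prodW U) U × IsDown (prodW U) (prodW (U ++ D)) D
    bitone-parts R f with reduced-++⁻ U R
    ... | RU , RD , a = (RU , refl , up , AllPairs-⊑ (⊑ₚ.++⁺ʳ D ⊑-refl) f) ,
                        (RD , a , sym (prodW-++ U D) , down , AllPairs-⊑ (⊑ₚ.++⁺ˡ U ⊑-refl) f)

  module Counting (Tl : List W) (Tl-unique : Unique Tl) (Tl-spec : ∀ t → t ∈ Tl ⇔ IsReflection t)
                  (compat : W → Root → Root → Bool) (family : IsClusterFamily Tl compat)
                  (supp? : ∀ w i → Dec (InSupp w i)) (≪? : ∀ α β → Dec (α ≪ β))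
                  (ws : List (Fin n)) (perm : ws ↭ allFin n) where

    open Clusters Tl Tl-spec compat family
    open IsClusterFamily family using (negneg; negpos)
    open Complex Tl compat (prodS ws)

    isCox : IsStdCoxeter (prodS ws)
    isCox = ws , perm , refl

    uniq : Unique ws
    uniq = coxeter-word-unique perm

    refl-≼ : ∀ {t} → IsReflection t → t ≼ prodS ws
    refl-≼ tR = refl-par-≼ uniq tR (full-support perm _)

    compat-pos : ∀ {t u} → IsReflection t → IsReflection u → t ≢ u → compat (prodS ws) (pos t) (pos u) ≡ true ⇔ Compatible ws t u
    compat-pos tR uR = compat-spec perm (hit uniq tR (full-support perm _)) tR uR

    pairwise⁻ : ∀ F → pairwise F ≡ true → AllPairs (λ a b → compat (prodS ws) a b ≡ true) F
    pairwise⁻ []      _ = []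
    pairwise⁻ (a ∷ F) h with ∧-true⁻ h
    ... | p , q = allᵇ⁻ p ∷ pairwise⁻ F q

    pairwise⁺ : ∀ {F} → AllPairs (λ a b → compat (prodS ws) a b ≡ true) F → pairwise F ≡ true
    pairwise⁺ []       = refl
    pairwise⁺ (p ∷ ps) = ∧-true (allᵇ⁺ p) (pairwise⁺ ps)

    pairwise⇒face : ∀ {P} → P ⊑ Tl → pairwise (map pos P) ≡ true → Face ws P
    pairwise⇒face {P} p h = record
      { reflections = refls
      ; below = All.map refl-≼ refls
      ; distinct = distinct
      ; compatible = AllPairs.map (λ ((h , t≢u) , tR , uR) → Equivalence.to (compat-pos tR uR t≢u) h)
          (AllPairs-All refls (AllPairs.zip (AllPairsₚ.map⁻ (pairwise⁻ (map pos P) h) , distinct))) }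
      where
      refls    = All.tabulate (λ m → Tl⁻ (⊑-∈ p m))
      distinct = AllPairs-⊑ p Tl-unique

    face⇒pairwise : ∀ {P} → Face ws P → pairwise (map pos P) ≡ true
    face⇒pairwise F = pairwise⁺ (AllPairsₚ.map⁺ (AllPairs.map (λ ((h , t≢u) , tR , uR) → Equivalence.from (compat-pos tR uR t≢u) h)
      (AllPairs-All reflections (AllPairs.zip (compatible , distinct)))))
      where open Face F

    PosFace : List W → Set
    PosFace P = P ⊑ Tl × Face ws P

    posFaces : List (List W)
    posFaces = filterᵇ (pairwise ∘ map pos) (sublists Tl)

    posFaces-good : All PosFace posFaces
    posFaces-good = All.tabulate λ m → let m′ , h = ∈-filterᵇ⁻ (pairwise ∘ map pos) {xs = sublists Tl} m ; p = sublists-⊑ m′ in p , pairwise⇒face p h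

    faceList : List (Σ (List W) PosFace)
    faceList = All.toList posFaces-good

    map-faceList : map proj₁ faceList ≡ posFaces
    map-faceList = map-toList posFaces-good

    faceList-∈ : ∀ {P} → P ∈ posFaces → ∃ λ q → (P , q) ∈ faceList
    faceList-∈ = toList-∈ posFaces-good

    above : W → List W
    above α = filterᵇ (λ β → ⌊ ≪? α β ⌋) (NC (prodS ws))

    pairs : List (W × W)
    pairs = pairsFrom above (NC (prodS ws))

    ∈NC : ∀ {w} → w ≼ prodS ws → w ∈ NC (prodS ws)
    ∈NC le = ∈-filterᵇ⁺ (λ w → absLe w (prodS ws)) (elems-complete _) (≼-absLe le)

    ∈pairs⁺ : ∀ {α β} → α ≪ β → β ≼ prodS ws → (α , β) ∈ pairs
    ∈pairs⁺ {α} {β} h le = ∈-pairsFrom⁺ above (∈NC (≼-trans (descends-≼ (≪⇒descends h)) le))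
      (∈-filterᵇ⁺ (λ β → ⌊ ≪? α β ⌋) (∈NC le) (⌊⌋-true (≪? α β) h))

    ∈pairs⁻ : ∀ {α β} → (α , β) ∈ pairs → α ≪ β × β ≼ prodS ws
    ∈pairs⁻ {α} {β} m with ∈-filterᵇ⁻ (λ β → ⌊ ≪? α β ⌋) {xs = NC (prodS ws)} (proj₂ (∈-pairsFrom⁻ above {xs = NC (prodS ws)} m))
    ... | m′ , h = ⌊⌋-true⁻ (≪? α β) h , absLe-≼ (proj₂ (∈-filterᵇ⁻ (λ w → absLe w (prodS ws)) {xs = elems} m′))

    NC-unique : Unique (NC (prodS ws))
    NC-unique = AllPairs-⊑ (filterᵇ-⊑ _ elems) elems-unique

    pairs-unique : Unique pairs
    pairs-unique = pairsFrom-unique {ys = above} NC-unique (λ α → AllPairs-⊑ (filterᵇ-⊑ _ (NC (prodS ws))) NC-unique)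

    bitone-of : ∀ {P} → Face ws P → Bitone ws P
    bitone-of = bitone (length ws) refl uniq

    split-of : ∀ {α β} → β ≼ prodS ws → Descends α β → Split α β
    split-of = splitting (length ws) refl uniq

    module Ψ-of {P : List W} (p : P ⊑ Tl) (F : Face ws P) where
      open Bitone (bitone-of F) public renaming (perm to ordering)
      open Bitonic up down public

      α β : W
      α = prodW U
      β = prodW (U ++ D)

      parts : IsUp α U × IsDown α β D
      parts = bitone-parts reduced (AllPairs.map proj₁ (Face.compatible (face-↭ (↭-sym ordering) F)))

      α≪β : α ≪ β
      α≪β with proj₂ parts
      ... | RD , a , q , dn , _ = subst (α ≪_) q (descends⇒≪ D RD a dn)

      α≼c : α ≼ prodS ws
      α≼c = ≼-trans (is-down-≼ (proj₂ parts)) bound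

    -- The pair consists of the element at the turning point and the endpoint of a bitone ordering.
    -- The proof of being a face travels with the list because the ordering is computed from it.
    Ψ : Σ (List W) PosFace → W × W
    Ψ (_ , p , F) = Ψ-of.α p F , Ψ-of.β p F

    Ψ-pairs : ∀ q → Ψ q ∈ pairs
    Ψ-pairs (_ , p , F) = ∈pairs⁺ (Ψ-of.α≪β p F) (Ψ-of.bound p F)

    Ψ-⊆ : ∀ q q′ → Ψ q ≡ Ψ q′ → ∀ {t} → t ∈ proj₁ q → t ∈ proj₁ q′
    Ψ-⊆ (_ , p , F) (_ , p′ , F′) eq {t} m = ∈-↭ B′.ordering (go (∈ₚ.∈-++⁻ B.U (∈-↭ (↭-sym B.ordering) m)))
      where
      module B  = Ψ-of p F
      module B′ = Ψ-of p′ F′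
      go : t ∈ B.U ⊎ t ∈ B.D → t ∈ B′.U ++ B′.D
      go (inj₁ m) = ∈ₚ.∈-++⁺ˡ (up-unique (length ws) refl uniq B.α≼c (proj₁ B.parts)
        (subst (λ α → IsUp α B′.U) (sym (cong proj₁ eq)) (proj₁ B′.parts)) m)
      go (inj₂ m) = ∈ₚ.∈-++⁺ʳ B′.U (down-unique (length ws) refl uniq B.bound (proj₂ B.parts)
        (subst (λ (α , β) → IsDown α β B′.D) (sym eq) (proj₂ B′.parts)) m)

    Ψ-injective : ∀ q q′ → Ψ q ≡ Ψ q′ → proj₁ q ≡ proj₁ q′
    Ψ-injective q@(_ , p , _) q′@(_ , p′ , _) eq = ⊑-ext Tl-unique p p′ (Ψ-⊆ q q′ eq) (Ψ-⊆ q′ q (sym eq))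

    Ψ-unique : Unique (map Ψ faceList)
    Ψ-unique = Unique-map Ψ-injective (subst Unique (sym map-faceList)
      (AllPairs-⊑ (filterᵇ-⊑ _ (sublists Tl)) (sublists-unique Tl-unique)))

    module OfPair {α β : W} (m : (α , β) ∈ pairs) where

      below-c : β ≼ prodS ws
      below-c = proj₂ (∈pairs⁻ m)

      open Split (split-of below-c (≪⇒descends (proj₁ (∈pairs⁻ m))))

      L : List W
      L = U ++ D

      member? : ∀ t → Dec (t ∈ L)
      member? t = Any.any? (t ≟_) L

      P : List W
      -- Faces are sublists of `Tl`, so the factors of the split are listed in the order of `Tl`.
      P = filterᵇ (λ t → ⌊ member? t ⌋) Tl

      P⊑ : P ⊑ Tl
      P⊑ = filterᵇ-⊑ _ Tl

      distinct : Unique L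
      distinct = reduced-unique reduced

      L↭P : L ↭ P
      L↭P = unique-↭ distinct (AllPairs-⊑ P⊑ Tl-unique)
        (λ {t} m → ∈-filterᵇ⁺ (λ t → ⌊ member? t ⌋) (Tl⁺ (All.lookup (proj₁ reduced) m)) (⌊⌋-true (member? t) m))
        (λ {t} m → ⌊⌋-true⁻ (member? t) (proj₂ (∈-filterᵇ⁻ (λ t → ⌊ member? t ⌋) {xs = Tl} m)))

      ordered : Ordered ws L
      ordered = reduced-ordered {ws} reduced (subst (_≼ prodS ws) (sym product) below-c)

      face : Face ws P
      face = face-↭ L↭P record
        { reflections = proj₁ reduced ; below = All.map refl-≼ (proj₁ reduced) ; distinct = distinct
        ; compatible = AllPairs.zipWith (λ (f , o) → f , inj₁ o) (fall , ordered) }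

      upProduct-L : upProduct e L ≡ prodW U
      upProduct-L = Bitonic.upProduct-bitone up (subst (λ x → Down x D) (sym product-U) down)

      -- The split and the bitone ordering computed for the face are both admissible orderings of
      -- the same reflections, so by `reorder` they have the same product and the same rising
      -- product.
      Ψ-face : ∀ {Q} (p : Q ⊑ Tl) (F : Face ws Q) → L ↭ Q → Ψ (Q , p , F) ≡ (α , β)
      Ψ-face {Q} p F L↭Q = conclude (reorder uniq L (↭-trans L↭Q (↭-sym ordering)) (proj₁ reduced) (All.map refl-≼ (proj₁ reduced)) distinct
                                      ordered (reduced-ordered {ws} Ψ.reduced bound) e)
        where
        module Ψ = Ψ-of p F
        open Ψ using (ordering; bound; upProduct-bitone)
        conclude : SameUps e L (Ψ.U ++ Ψ.D) → (Ψ.α , Ψ.β) ≡ (α , β)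
        conclude (_ , α≡ , β≡) = cong₂ _,_ (trans (sym upProduct-bitone) (trans (sym α≡) (trans upProduct-L product-U))) (trans (sym β≡) product)

      pair∈ : (α , β) ∈ map Ψ faceList
      pair∈ = let (p , F) , q∈ = faceList-∈ (∈-filterᵇ⁺ (pairwise ∘ map pos) (⊑-sublists P⊑) (face⇒pairwise face)) in
        subst (_∈ map Ψ faceList) (Ψ-face p F L↭P) (∈ₚ.∈-map⁺ Ψ q∈)

    faces↭pairs : map Ψ faceList ↭ pairs
    faces↭pairs = unique-↭ Ψ-unique pairs-unique image OfPair.pair∈
      where
      image : ∀ {v} → v ∈ map Ψ faceList → v ∈ pairs
      image m with ∈ₚ.∈-map⁻ Ψ m
      ... | q , _ , refl = Ψ-pairs q

    -- Along a shortest factorization every step is a cover, so the test in `countSq` comes down to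
    -- the direction of the step.
    countSq-ups : ∀ {x} ts → Reduced ts → Additive x (prodW ts) → countSq x ts ≡ ups x ts
    countSq-ups [] _ _ = refl
    countSq-ups {x} (t ∷ ts) R a with reduced-∷⁻ R
    ... | tR , R′ , b with additive-assocˡ a b
    ...   | a′ , xt = cong₂ _+_ first (countSq-ups ts R′ a′)
      where
      first : (if sqcov x (x · t) then 1 else 0) ≡ (if η x t then 0 else 1)
      first rewrite ⇒cov tR xt with ℓ x <?ℕ ℓ (x · t) | η x t in h
      ... | yes _  | false = refl
      ... | no _   | true  = refl
      ... | yes lt | true  = ⊥-elim (ℕₚ.<-asym lt (η-true⇒ℓ h))
      ... | no ¬lt | false = ⊥-elim (¬lt (η-false⇒ℓ tR h))

    countFound : Maybe (List W) → ℕ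
    countFound (just ts) = countSq e ts
    countFound nothing   = 0

    sqr-found : ∀ F → sqr F ≡ countFound (findᵇ (λ ts → absLe (prodW ts) (prodS ws)) (orderings (posPart F)))
    sqr-found F with findᵇ (λ ts → absLe (prodW ts) (prodS ws)) (orderings (posPart F))
    ... | just _  = refl
    ... | nothing = refl

    sqr-cong : ∀ F G → posPart F ≡ posPart G → sqr F ≡ sqr G
    sqr-cong F G h = trans (sqr-found F) (trans
      (cong (λ P → countFound (findᵇ (λ ts → absLe (prodW ts) (prodS ws)) (orderings P))) h) (sym (sqr-found G)))

    posPart-mixed : ∀ M P → posPart (map neg M ++ map pos P) ≡ P
    posPart-mixed (_ ∷ M) P       = posPart-mixed M P
    posPart-mixed []      []      = refl
    posPart-mixed []      (t ∷ P) = cong (t ∷_) (posPart-mixed [] P)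

    negPart-mixed : ∀ M P → negPart (map neg M ++ map pos P) ≡ M
    negPart-mixed (i ∷ M) P       = cong (i ∷_) (negPart-mixed M P)
    negPart-mixed []      []      = refl
    negPart-mixed []      (_ ∷ P) = negPart-mixed [] P

    module Values {P : List W} (p : P ⊑ Tl) (F : Face ws P) where
      open Ψ-of p F

      rank-α : ℓT α ≡ length U
      rank-α = proj₂ (proj₁ (proj₁ parts))

      rank-β : ℓT β ≡ length P
      rank-β = trans (proj₂ reduced) (↭ₚ.↭-length ordering)

      -- The bitone ordering guarantees that the search succeeds, `face-reduced` makes the ordering
      -- found a shortest factorization, and `reorder` gives it as many rising steps as the bitone
      -- one.
      sqr-α : sqr (map pos P) ≡ ℓT α
      sqr-α with findᵇ-just (λ ts → absLe (prodW ts) (prodS ws)) (orderings-∈ P ordering) (≼-absLe bound)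
      ... | ts , found , ts∈ , h = begin
        sqr (map pos P)  ≡⟨ sqr-found (map pos P) ⟩
        countFound (findᵇ _ (orderings (posPart (map pos P)))) ≡⟨ cong (λ P → countFound (findᵇ (λ ts → absLe (prodW ts) (prodS ws)) (orderings P))) (posPart-mixed [] P) ⟩
        countFound (findᵇ _ (orderings P)) ≡⟨ cong countFound found ⟩
        countSq e ts     ≡⟨ countSq-ups ts R (trans (cong ℓT (identityˡ _)) (cong (_+ ℓT (prodW ts)) (sym ℓT-e))) ⟩
        ups e ts         ≡⟨ proj₁ (reorder uniq ts (↭-trans (orderings-↭ P ts∈) (↭-sym ordering)) (proj₁ R) (All.map refl-≼ (proj₁ R))
                              (reduced-unique R) (reduced-ordered {ws} R (absLe-≼ h)) (reduced-ordered {ws} reduced bound) e) ⟩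
        ups e (U ++ D)   ≡⟨ ups-bitone ⟩
        length U         ≡⟨ sym rank-α ⟩
        ℓT α             ∎
        where
        open ≡-Reasoning
        R : Reduced ts
        R = face-reduced (length ws) refl uniq (face-↭ (↭-sym (orderings-↭ P ts∈)) F)

      -- If all factors avoid `i`, so does their product; conversely `parabolic` passes from the
      -- product `β` to the factors of a shortest factorization.
      free-β : ∀ i → allᵇ (λ t → compat (prodS ws) (neg i) (pos t)) P ≡ not ⌊ supp? β i ⌋
      free-β i = trans (bool-≡ to-β from-β) (sym (not-⌊⌋ (supp? β i)))
        where
        spec : ∀ {t} → t ∈ P → compat (prodS ws) (neg i) (pos t) ≡ true ⇔ (¬ InSupp t i)
        spec m = negpos (prodS ws) isCox i _ (⊑-∈ p m)
        to-β : allᵇ (λ t → compat (prodS ws) (neg i) (pos t)) P ≡ true → ⌊ ¬? (supp? β i) ⌋ ≡ true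
        to-β h = ⌊⌋-true (¬? (supp? β i)) (without⇒¬supp (par-prodW (↭ₚ.All-resp-↭ (↭-sym ordering)
          (All.tabulate λ m → ¬supp⇒without (Equivalence.to (spec m) (All.lookup (allᵇ⁻ h) m))))))
        from-β : ⌊ ¬? (supp? β i) ⌋ ≡ true → allᵇ (λ t → compat (prodS ws) (neg i) (pos t)) P ≡ true
        from-β h = allᵇ⁺ (All.tabulate λ m → Equivalence.from (spec m) (without⇒¬supp (All.lookup
          (parabolic reduced (¬supp⇒without (⌊⌋-true⁻ (¬? (supp? β i)) h))) (∈-↭ (↭-sym ordering) m))))

    free : List W → Fin n → Bool
    free P i = allᵇ (λ t → compat (prodS ws) (neg i) (pos t)) P

    allᵇ-map-pos : ∀ f P → allᵇ f (map pos P) ≡ allᵇ (f ∘ pos) P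
    allᵇ-map-pos f []      = refl
    allᵇ-map-pos f (t ∷ P) = cong (f (pos t) ∧_) (allᵇ-map-pos f P)

    allᵇ-mixed : ∀ i M P → allᵇ (compat (prodS ws) (neg i)) (map neg M ++ map pos P) ≡ free P i
    allᵇ-mixed i []      P = allᵇ-map-pos _ P
    allᵇ-mixed i (j ∷ M) P rewrite negneg (prodS ws) isCox i j = allᵇ-mixed i M P

    pairwise-mixed : ∀ M P → pairwise (map neg M ++ map pos P) ≡ allᵇ (free P) M ∧ pairwise (map pos P)
    pairwise-mixed []      P = refl
    pairwise-mixed (i ∷ M) P = trans (cong₂ _∧_ (allᵇ-mixed i M P) (pairwise-mixed M P)) (sym (∧-assoc (free P i) _ _))

    -- Comparison of the generating functions

    module Identity (R : CommutativeRing 0ℓ 0ℓ) (x : Fin n → CommutativeRing.Carrier R) (y z : CommutativeRing.Carrier R) where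
      open Sums R
      open R using (Carrier; 0#; 1#; _≈_) renaming (_+_ to _+R_; _*_ to _*R_)
      open Poly R

      x+1 : Fin n → Carrier
      x+1 i = x i +R 1#

      F-term : List Root → Carrier
      F-term F = ∏ x (negPart F) *R pow y (sqr F) *R pow z (length (posPart F) ∸ sqr F)

      I-term : W × W → Carrier
      I-term (α , β) = ∏ x+1 (filterᵇ (λ i → not ⌊ supp? β i ⌋) (allFin n)) *R pow y (ℓT α) *R pow z (ℓT β ∸ ℓT α)

      weight : List W → Carrier
      weight P = pow y (sqr (map pos P)) *R pow z (length P ∸ sqr (map pos P))

      -- Extension by zero to all sets of roots, so that the sums over negative and positive parts
      -- become independent and can be exchanged.
      on-faces : List Root → Carrier
      on-faces F = if pairwise F then F-term F else 0#

      fibre : List W → Carrier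
      fibre P = ∏ x+1 (filterᵇ (free P) (allFin n)) *R weight P

      negative : List W → List (Fin n) → Carrier
      negative P M = if allᵇ (free P) M then ∏ x M else 0#

      F-term-mixed : ∀ M P → F-term (map neg M ++ map pos P) ≈ ∏ x M *R weight P
      F-term-mixed M P = R.trans (R.reflexive (cong₂ (λ (N , k) l → ∏ x N *R pow y k *R pow z (l ∸ k))
        (cong₂ _,_ (negPart-mixed M P) (sqr-cong (map neg M ++ map pos P) (map pos P) (trans (posPart-mixed M P) (sym (posPart-mixed [] P)))))
        (cong length (posPart-mixed M P)))) (R.*-assoc _ _ _)

      on-faces-mixed : ∀ M P → on-faces (map neg M ++ map pos P) ≈ (if pairwise (map pos P) then negative P M *R weight P else 0#)
      on-faces-mixed M P rewrite pairwise-mixed M P with allᵇ (free P) M | pairwise (map pos P)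
      ... | true  | true  = F-term-mixed M P
      ... | true  | false = R.refl
      ... | false | true  = R.sym (R.zeroˡ _)
      ... | false | false = R.refl

      -- Negative simple roots are pairwise compatible, so those that may join a positive face are
      -- chosen independently; the sum over the choices is a product of factors `x i` plus 1.
      ∑-negative : ∀ P → ∑ (λ M → on-faces (map neg M ++ map pos P)) (sublists (allFin n)) ≈ (if pairwise (map pos P) then fibre P else 0#)
      ∑-negative P = R.trans (∑-cong (sublists (allFin n)) (λ M → on-faces-mixed M P)) (go (pairwise (map pos P)))
        where
        go : ∀ b → ∑ (λ M → if b then negative P M *R weight P else 0#) (sublists (allFin n)) ≈ (if b then fibre P else 0#)
        go false = ∑-0 (sublists (allFin n))
        go true  = R.trans (∑-*ʳ (negative P) (weight P) (sublists (allFin n))) (R.*-congʳ (∏-expand (free P) x (allFin n)))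

      fibre-Ψ : ∀ q → fibre (proj₁ q) ≈ I-term (Ψ q)
      fibre-Ψ (P , p , F) = R.trans (R.sym (R.*-assoc _ _ _)) (R.reflexive (cong₂ (λ (N , k) l → ∏ x+1 N *R pow y k *R pow z (l ∸ k))
        (cong₂ _,_ (filterᵇ-cong (Values.free-β p F) (allFin n)) (Values.sqr-α p F)) (sym (Values.rank-β p F))))

      identity : Fpoly x y z ≈ Ipoly supp? ≪? x+1 y z
      identity = begin
        ∑ F-term (filterᵇ pairwise (sublists (Φ≥-1 Tl)))
          ≈⟨ ∑-filter pairwise F-term (sublists (Φ≥-1 Tl)) ⟩
        ∑ on-faces (sublists (map neg (allFin n) ++ map pos Tl))
          ≈⟨ ∑-sublists-++ on-faces (map neg (allFin n)) (map pos Tl) ⟩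
        ∑ (λ M → ∑ (λ P → on-faces (M ++ P)) (sublists (map pos Tl))) (sublists (map neg (allFin n)))
          ≡⟨ cong₂ (λ Ms Ps → ∑ (λ M → ∑ (λ P → on-faces (M ++ P)) Ps) Ms) (sublists-map neg (allFin n)) (sublists-map pos Tl) ⟩
        ∑ (λ M → ∑ (λ P → on-faces (M ++ P)) (map (map pos) (sublists Tl))) (map (map neg) (sublists (allFin n)))
          ≡⟨ ∑-map _ (map neg) (sublists (allFin n)) ⟩
        ∑ (λ M → ∑ (λ P → on-faces (map neg M ++ P)) (map (map pos) (sublists Tl))) (sublists (allFin n))
          ≈⟨ ∑-cong (sublists (allFin n)) (λ M → R.reflexive (∑-map _ (map pos) (sublists Tl))) ⟩
        ∑ (λ M → ∑ (λ P → on-faces (map neg M ++ map pos P)) (sublists Tl)) (sublists (allFin n))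
          ≈⟨ ∑-swap (λ M P → on-faces (map neg M ++ map pos P)) (sublists (allFin n)) (sublists Tl) ⟩
        ∑ (λ P → ∑ (λ M → on-faces (map neg M ++ map pos P)) (sublists (allFin n))) (sublists Tl)
          ≈⟨ ∑-cong (sublists Tl) ∑-negative ⟩
        ∑ (λ P → if pairwise (map pos P) then fibre P else 0#) (sublists Tl)
          ≈⟨ ∑-filter (pairwise ∘ map pos) fibre (sublists Tl) ⟨
        ∑ fibre posFaces
          ≡⟨ cong (∑ fibre) map-faceList ⟨
        ∑ fibre (map proj₁ faceList)
          ≡⟨ ∑-map fibre proj₁ faceList ⟩
        ∑ (fibre ∘ proj₁) faceList
          ≈⟨ ∑-cong faceList fibre-Ψ ⟩
        ∑ (I-term ∘ Ψ) faceList
          ≡⟨ ∑-map I-term Ψ faceList ⟨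
        ∑ I-term (map Ψ faceList)
          ≈⟨ ∑-↭ I-term faces↭pairs ⟩
        ∑ I-term pairs
          ≈⟨ ∑-pairsFrom I-term above (NC (prodS ws)) ⟩
        ∑ (λ α → ∑ (λ β → I-term (α , β)) (above α)) (NC (prodS ws)) ∎
        where open SetoidReasoning R.setoid

theorem9p1 :
  (C : FiniteCoxeterSystem) → let open Cox C in
  (ℓ : W → ℕ) → (∀ w → IsLength w (ℓ w)) →
  (ℓT : W → ℕ) → (∀ w → IsAbsLength w (ℓT w)) →
  let open WithLengths ℓ ℓT in
  (Tl : List W) → Unique Tl → (∀ t → t ∈ Tl ⇔ IsReflection t) →
  (compat : W → Root → Root → Bool) → IsClusterFamily Tl compat →
  (supp? : ∀ w i → Dec (InSupp w i)) →
  (≪? : ∀ α β → Dec (α ≪ β)) →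
  (c : W) → IsStdCoxeter c →
  let open Complex Tl compat c in
  (R : CommutativeRing 0ℓ 0ℓ) → let open Poly R in
  (x : Fin n → CommutativeRing.Carrier R) → (y z : CommutativeRing.Carrier R) →
  CommutativeRing._≈_ R
    (Fpoly x y z)
    (Ipoly supp? ≪? (λ i → CommutativeRing._+_ R (x i) (CommutativeRing.1# R)) y z)
theorem9p1 C ℓ ℓ-spec ℓT ℓT-spec Tl Tl-unique Tl-spec compat family supp? ≪? _ (ws , perm , refl) R x y z =
  Theory.Counting.Identity.identity C ℓ ℓ-spec ℓT ℓT-spec Tl Tl-unique Tl-spec compat family supp? ≪? ws perm R x y z
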